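{- Let $G$ be a finite group which is neither cyclic nor isomorphic to a dihedral group of order $2n$ with $n$ odd. Then $$\mathsf D(G)\leq \frac34|G|.$$
   Context: A sequence over a finite group $G$ is a finite unordered list of elements of $G$ with repetition allowed; its length is its number of terms with multiplicity. It is product-one if its terms can be ordered so that their product is the identity. A minimal product-one sequence is a nonempty product-one sequence that cannot be partitioned into two nonempty product-one subsequences. $\mathsf D(G)$ (the large Davenport constant) is the maximal length of a minimal product-one sequence over $G$. -}

module Defs where

open import Level using (0ℓ)
open import Data.Nat using (ℕ; zero; suc; _+_; _∸_; NonZero)
open import Data.Nat.DivMod using (_mod_)
open import Data.Fin using (Fin; toℕ)
open import Data.Bool using (Bool; true; false; not)
open import Data.Product using (_×_; _,_; ∃; ∃-syntax)
open import Data.List using (List; []; _∷_; _++_; foldr)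
open import Data.List.Relation.Binary.Permutation.Propositional using (_↭_)
open import Relation.Binary.PropositionalEquality using (_≡_)
open import Relation.Nullary using (¬_)
open import Algebra.Structures using (IsGroup)
open import Function.Definitions using (Bijective)

-- A finite group: (up to isomorphism) a group whose carrier is Fin n,
-- with propositional equality.  Its order |G| is n.
record FinGroup : Set where
  field
    order : ℕ
    _∙_   : Fin order → Fin order → Fin order
    ε     : Fin order
    _⁻¹   : Fin order → Fin order
    isGroup : IsGroup _≡_ _∙_ ε _⁻¹

module _ (G : FinGroup) where
  open FinGroup G

  Elt : Set
  Elt = Fin order

  pow : Elt → ℕ → Elt
  pow g zero    = ε
  pow g (suc k) = g ∙ pow g k

  IsCyclic : Set
  IsCyclic = ∃[ g ] (∀ (x : Elt) → ∃[ k ] pow g k ≡ x)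

  prod : List Elt → Elt
  prod = foldr _∙_ ε

  -- Sequences are lists considered up to permutation (all notions below
  -- are invariant under _↭_).  Product-one: some ordering has product ε.
  ProductOne : List Elt → Set
  ProductOne S = ∃[ T ] (T ↭ S × prod T ≡ ε)

  NonEmpty : List Elt → Set
  NonEmpty S = ¬ (S ≡ [])

  MinimalProductOne : List Elt → Set
  MinimalProductOne S =
    NonEmpty S × ProductOne S ×
    ¬ (∃[ U ] ∃[ V ] (S ↭ U ++ V × NonEmpty U × NonEmpty V
                      × ProductOne U × ProductOne V))

-- The dihedral group of order 2m, m = suc k ≥ 1:
-- elements (a , b) meaning r^a s^b, with s r s⁻¹ = r⁻¹.
module _ (m : ℕ) .{{_ : NonZero m}} where
  Dih : Set
  Dih = Fin m × Bool

  dihMul : Dih → Dih → Dih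
  dihMul (a , false) (b , t) = ((toℕ a + toℕ b) mod m , t)
  dihMul (a , true)  (b , t) = ((toℕ a + (m ∸ toℕ b)) mod m , not t)

IsoDihedral : (G : FinGroup) (m : ℕ) .{{_ : NonZero m}} → Set
IsoDihedral G m = ∃[ φ ] (Bijective _≡_ _≡_ φ ×
    (∀ x y → φ (x ∙ y) ≡ dihMul m (φ x) (φ y)))
  where open FinGroup G

{-# OPTIONS --safe #-}
module Submission where

-- Induction on |G|.  Let T be an ordering, with product one, of a minimal product-one sequence S over G.
-- Cutting a suitable rotation of T wherever its partial products return to a subgroup H yields a minimal
-- product-one sequence over H of length at least |S| / [G : H].  So the bound passes from H to G, and in a
-- minimal counterexample every proper subgroup is cyclic or dihedral of order 2n with n odd.  Then the
-- centralisers of noncentral elements are cyclic, commuting is an equivalence relation on these elements,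
-- and by counting conjugates one of the centralisers is normal.  It follows that G is C_p × C_p, or Q_8, or
-- has a normal subgroup A of prime order q with G / A abelian, M = C(A) = A × Z, Z = Z(G) of order z and
-- |G| = e z q.
--
-- In the last case, if the orderings of some terms J of S realise a whole coset of A, then no product-one
-- subsequence can be split off from the remaining terms, which bounds their number.  Noncommuting pairs,
-- triples, and terms of M placed on either side of a term outside M enlarge the set of products of J step by
-- step (Cauchy–Davenport), so J can be taken short.  If there are too few noncommuting pairs, almost all
-- terms commute with each other; then central products collected from the runs of commuting terms in T
-- split S.

open import Defs
open import Data.Bool using (Bool; true; false; not; T; _∧_; _∨_; _xor_)
import Data.Bool
open import Data.Bool.Properties using (T?)
open import Data.Empty using (⊥; ⊥-elim)
open import Data.Fin using (Fin; zero; suc; toℕ; fromℕ<)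
open import Data.Fin.Properties using (pigeonhole; _≟_; any?; all?; toℕ<n; toℕ-fromℕ<; toℕ-injective; suc-injective)
open import Data.List using (List; []; _∷_; _++_; length; map; concat; applyUpTo)
open import Data.List.Properties using (∷-injectiveˡ; ∷-injectiveʳ; length-++; ++-assoc; ++-identityʳ; length-map; length-applyUpTo; concat-++; map-++; map-∘; map-cong; map-id)
open import Data.List.Relation.Unary.All using (All; []; _∷_)
open import Data.List.Relation.Unary.AllPairs using (AllPairs; []; _∷_)
import Data.List.Relation.Unary.AllPairs.Properties as AllPairsₚ
import Data.List.Relation.Unary.AllPairs as AllPairs
open import Data.List.Relation.Unary.Any using (Any; here; there)
import Data.List.Relation.Unary.Any as Any
import Data.List.Relation.Unary.Any.Properties as Anyₚ
import Data.List.Relation.Unary.All as All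
import Data.List.Relation.Unary.All.Properties as Allₚ
open import Data.List.Relation.Binary.Permutation.Propositional using (_↭_; refl; prep; swap; ↭-refl; ↭-sym; ↭-trans; ↭-reflexive)
import Data.List.Relation.Binary.Permutation.Propositional as ↭
open import Data.List.Relation.Binary.Permutation.Propositional.Properties using (↭-length; All-resp-↭; Any-resp-↭; ↭-map-inv; ↭-empty-inv; ++⁺; ++⁺ˡ; ++⁺ʳ; shift; shifts; ++-comm; ++-commutativeMonoid; map⁺)
open import Data.Nat using (ℕ; zero; suc; pred; _+_; _*_; _∸_; _≤_; _<_; z≤n; s≤s; NonZero; >-nonZero; _≤?_; _<?_)
open import Data.Nat.Properties hiding (_≟_; suc-injective)
open import Data.Nat.Properties using () renaming (_≟_ to _≟ℕ_)
open import Data.Nat.Divisibility using (hasNonTrivialDivisor; _∣_; divides; _∣?_; ∣-trans; ∣-refl; m∣m*n; n∣m*n; ∣⇒≤; ∣m+n∣m⇒∣n)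
open import Data.Nat.DivMod using (_%_; _/_; _mod_; m≡m%n+[m/n]*n; m%n<n; m*n%n≡0; n%n≡0; %-distribˡ-+; m%n%n≡m%n)
open import Data.Nat.Induction using (<-rec; <-wellFounded)
open import Induction.WellFounded using (Acc; acc)
open import Data.Nat.Primality using (Prime; prime?; ¬prime⇒composite; prime⇒nonTrivial; prime⇒irreducible; prime[2])
open import Data.Nat.GCD using (module Bézout)
open import Data.Nat.Coprimality using (Coprime; coprime⇒GCD≡1)
open import Data.Nat.Base using (n>1⇒nonTrivial; nonTrivial⇒n>1)
open import Data.Nat.Tactic.RingSolver using (solve-∀)
open import Data.Product using (Σ; _×_; _,_; ∃; ∃-syntax; proj₁; proj₂)
open import Data.Sum using (_⊎_; inj₁; inj₂; [_,_]′)
open import Data.Unit using (tt)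
open import Data.Vec using (Vec; []; _∷_; lookup)
open import Algebra.Properties.CommutativeMonoid.Sum +-0-commutativeMonoid using (sum; ∑-comm; sum-cong-≗; ∑-distrib-+)
open import Algebra.Structures using (IsGroup)
open import Function using (_∘_; id; case_of_)
open import Relation.Binary.PropositionalEquality using (isEquivalence; _≡_; _≢_; refl; sym; trans; cong; cong₂; subst; subst₂; module ≡-Reasoning)
open import Relation.Nullary using (¬_; Dec; yes; no; ¬?; _×-dec_; _⊎-dec_; _→-dec_)
open import Relation.Nullary.Decidable using (⌊_⌋; toWitness; fromWitness; ¬¬-excluded-middle; decidable-stable)

-- The excluded groups really violate the bound: n copies of a generator of a cyclic group of order
-- n > 1 form a minimal product-one sequence of length n. So the induction says nothing about proper
-- subgroups of the two excluded kinds, and groups having only such proper subgroups must be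
-- determined and treated directly.
--
-- The constant 3/4 leaves no room in the smallest of them: the three involutions of C_2 × C_2 form
-- a minimal product-one sequence of length 3. Small parameters therefore need arguments of their
-- own. For e = 3 and z = 1, a term of A has to contribute two new products instead of one. For e =
-- 2, the general bound on product-one free sequences is too weak after removing noncommuting pairs,
-- and terms outside M are counted separately.
--
-- Whether a subgroup is cyclic or dihedral is never decided. The final inequality between natural
-- numbers is stable, so these case distinctions are made under the double negation `DN`.

DN : Set → Set
DN P = ¬ ¬ P

em : (P : Set) → DN (Dec P)
em P = ¬¬-excluded-middle

-- Finitely many instances of excluded middle remain jointly irrefutable. This turns a predicate on
-- group elements that has no decision procedure into a `BSet`.
decide-all : ∀ {n} (P : Fin n → Set) → DN (∀ i → Dec (P i))
decide-all {zero}  P k = k λ ()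
decide-all {suc n} P k = em (P zero) λ d → decide-all (P ∘ suc) λ f →
  k λ { zero → d ; (suc i) → f i }

≤-absurd : ∀ {a b} r → a ≤ b → a ≡ suc (b + r) → ⊥
≤-absurd {a} {b} r a≤b eq =
  <-irrefl refl (≤-trans (s≤s (m≤m+n b r)) (≤-trans (≤-reflexive (sym eq)) a≤b))

≤-slack : ∀ {a b} r → b ≡ a + r → a ≤ b
≤-slack {a} r eq = ≤-trans (m≤m+n a r) (≤-reflexive (sym eq))

-- Finite sets

BSet : ℕ → Set
BSet n = Fin n → Bool

infix 4 _∈_ _∉_ _∈?_

-- A record and not a synonym of `T (X i)`, which would reduce: in this form `i` and `X` can be
-- recovered by unification.
record _∈_ {n} (i : Fin n) (X : BSet n) : Set where
  constructor mem
  field holds : T (X i)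

_∉_ : ∀ {n} → Fin n → BSet n → Set
i ∉ X = ¬ i ∈ X

_∈?_ : ∀ {n} (i : Fin n) (X : BSet n) → Dec (i ∈ X)
i ∈? X with T? (X i)
... | yes t = yes (mem t)
... | no ¬t = no λ { (mem t) → ¬t t }

set : ∀ {n} {P : Fin n → Set} → (∀ i → Dec (P i)) → BSet n
set P? i = ⌊ P? i ⌋

∈⁺ : ∀ {n} {P : Fin n → Set} (P? : ∀ i → Dec (P i)) {i} → P i → i ∈ set P?
∈⁺ P? {i} p = mem (fromWitness {a? = P? i} p)

∈⁻ : ∀ {n} {P : Fin n → Set} (P? : ∀ i → Dec (P i)) {i} → i ∈ set P? → P i
∈⁻ P? {i} (mem t) = toWitness {a? = P? i} t

full : ∀ {n} → BSet n
full _ = true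

∈-full : ∀ {n} {i : Fin n} → i ∈ full
∈-full = mem tt

indicator : Bool → ℕ
indicator true  = 1
indicator false = 0

sum-mono : ∀ {n} {f g : Fin n → ℕ} → (∀ i → f i ≤ g i) → sum f ≤ sum g
sum-mono {zero}  h = z≤n
sum-mono {suc n} h = +-mono-≤ (h zero) (sum-mono (h ∘ suc))

sum-scale : ∀ {n} k (f : Fin n → ℕ) → sum (λ i → k * f i) ≡ k * sum f
sum-scale {zero}  k f = sym (*-zeroʳ k)
sum-scale {suc n} k f = trans (cong (k * f zero +_) (sum-scale k (f ∘ suc)))
  (sym (*-distribˡ-+ k (f zero) (sum (f ∘ suc))))

T-∧⁺ : ∀ {a b} → T a → T b → T (a ∧ b)
T-∧⁺ {true} _ t = t

T-∧⁻ : ∀ {a b} → T (a ∧ b) → T a × T b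
T-∧⁻ {true} t = tt , t

∧⁺ : ∀ {n} {X Y : BSet n} {i} → i ∈ X → i ∈ Y → i ∈ (λ i → X i ∧ Y i)
∧⁺ (mem s) (mem t) = mem (T-∧⁺ s t)

∧⁻ : ∀ {n} {X Y : BSet n} {i} → i ∈ (λ i → X i ∧ Y i) → i ∈ X × i ∈ Y
∧⁻ (mem t) = mem (proj₁ (T-∧⁻ t)) , mem (proj₂ (T-∧⁻ t))

_∪_ _∩_ _∖_ : ∀ {n} → BSet n → BSet n → BSet n
(X ∪ Y) i = X i ∨ Y i
(X ∩ Y) i = X i ∧ Y i
X ∖ Y = set (λ i → (i ∈? X) ×-dec ¬? (i ∈? Y))

T-∨⁺ : ∀ {a b} → T a ⊎ T b → T (a ∨ b)
T-∨⁺ {true}  _        = tt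
T-∨⁺ {false} (inj₂ t) = t

T-∨⁻ : ∀ {a b} → T (a ∨ b) → T a ⊎ T b
T-∨⁻ {true}  _ = inj₁ tt
T-∨⁻ {false} t = inj₂ t

module _ {n} {X Y : BSet n} {i : Fin n} where
  ∪⁺ : i ∈ X ⊎ i ∈ Y → i ∈ X ∪ Y
  ∪⁺ (inj₁ (mem s)) = mem (T-∨⁺ (inj₁ s))
  ∪⁺ (inj₂ (mem t)) = mem (T-∨⁺ {X i} (inj₂ t))
  ∪⁻ : i ∈ X ∪ Y → i ∈ X ⊎ i ∈ Y
  ∪⁻ (mem t) = [ (λ s → inj₁ (mem s)) , (λ s → inj₂ (mem s)) ]′ (T-∨⁻ t)
  ∩⁻ : i ∈ X ∩ Y → i ∈ X × i ∈ Y
  ∩⁻ = ∧⁻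
  ∖⁺ : i ∈ X × i ∉ Y → i ∈ X ∖ Y
  ∖⁺ = ∈⁺ (λ i → (i ∈? X) ×-dec ¬? (i ∈? Y))
  ∖⁻ : i ∈ X ∖ Y → i ∈ X × i ∉ Y
  ∖⁻ = ∈⁻ (λ i → (i ∈? X) ×-dec ¬? (i ∈? Y))

abstract
  # : ∀ {n} → BSet n → ℕ
  # X = sum (indicator ∘ X)

  -- Both sides estimate the number of related pairs `(i , j)` with `i` in `X` and `j` in `Y`. The
  -- bounds for fibres and injections, and through them for cosets and conjugates, come from this
  -- count.
  double-count : ∀ {n m} (X : BSet n) (Y : BSet m) (R : Fin n → BSet m) k l →
    (∀ i → i ∈ X → k ≤ # (λ j → Y j ∧ R i j)) →
    (∀ j → j ∈ Y → # (λ i → X i ∧ R i j) ≤ l) →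
    k * # X ≤ l * # Y
  double-count {n} {m} X Y R k l lower upper = begin
    k * # X                                ≡⟨ sum-scale k (indicator ∘ X) ⟨
    sum (λ i → k * indicator (X i))        ≤⟨ sum-mono rows ⟩
    sum (λ i → sum (λ j → entry i j))      ≡⟨ ∑-comm entry ⟩
    sum (λ j → sum (λ i → entry i j))      ≤⟨ sum-mono columns ⟩
    sum (λ j → l * indicator (Y j))        ≡⟨ sum-scale l (indicator ∘ Y) ⟩
    l * # Y                                ∎
    where
    open ≤-Reasoning
    entry : Fin n → Fin m → ℕ
    entry i j = indicator (X i ∧ (Y j ∧ R i j))
    rows : ∀ i → k * indicator (X i) ≤ sum (λ j → entry i j)
    rows i with X i in eq
    ... | true  = ≤-trans (≤-reflexive (*-identityʳ k)) (lower i (mem (subst T (sym eq) tt)))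
    ... | false = ≤-trans (≤-reflexive (*-zeroʳ k)) z≤n
    zeros : ∀ {n} → sum {n} (λ _ → 0) ≡ 0
    zeros {zero}  = refl
    zeros {suc n} = zeros {n}
    ∧-drop : ∀ x → indicator (x ∧ false) ≡ 0
    ∧-drop true  = refl
    ∧-drop false = refl
    columns : ∀ j → sum (λ i → entry i j) ≤ l * indicator (Y j)
    columns j with Y j in eq
    ... | true  = ≤-trans (upper j (mem (subst T (sym eq) tt))) (≤-reflexive (sym (*-identityʳ l)))
    ... | false = ≤-trans (≤-reflexive (trans (sum-cong-≗ {_} {λ i → indicator (X i ∧ false)} {λ _ → 0} (λ i → ∧-drop (X i))) (zeros {n}))) z≤n

  -- Cardinalities are abstract, so that sums do not unfold during type checking; this equation is
  -- the way back where the sum itself is needed.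
  #-sum : ∀ {n} (X : BSet n) → # X ≡ sum (indicator ∘ X)
  #-sum X = refl

  #-mono : ∀ {n} {X Y : BSet n} → (∀ i → i ∈ X → i ∈ Y) → # X ≤ # Y
  #-mono {X = X} {Y} h = sum-mono λ i → go i (h i)
    where
    go : ∀ i → (i ∈ X → i ∈ Y) → indicator (X i) ≤ indicator (Y i)
    go i h with X i | Y i | (λ t → _∈_.holds (h (mem t)))
    ... | false | _     | _  = z≤n
    ... | true  | true  | _  = ≤-refl
    ... | true  | false | h′ = ⊥-elim (h′ tt)

  #-full : ∀ {n} → # (full {n}) ≡ n
  #-full {zero}  = refl
  #-full {suc n} = cong suc #-full

  1≤# : ∀ {n} {X : BSet n} {i} → i ∈ X → 1 ≤ # X
  1≤# {X = X} {zero}  (mem t) with X zero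
  ... | true = s≤s z≤n
  1≤# {X = X} {suc i} (mem t) = ≤-trans (1≤# {X = X ∘ suc} (mem t)) (m≤n+m _ (indicator (X zero)))

  #≤0 : ∀ {n} {X : BSet n} → (∀ i → i ∉ X) → # X ≤ 0
  #≤0 {zero}  h = z≤n
  #≤0 {suc n} {X} h with X zero in eq
  ... | true  = ⊥-elim (h zero (mem (subst T (sym eq) tt)))
  ... | false = #≤0 {X = X ∘ suc} λ { i (mem t) → h (suc i) (mem t) }

  #≤1 : ∀ {n} {X : BSet n} → (∀ i j → i ∈ X → j ∈ X → i ≡ j) → # X ≤ 1
  #≤1 {zero}  h = z≤n
  #≤1 {suc n} {X} h with X zero in eq
  ... | true  = s≤s (#≤0 {X = X ∘ suc} λ { i (mem t) →
                  case h zero (suc i) (mem (subst T (sym eq) tt)) (mem t) of λ () })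
  ... | false = #≤1 {X = X ∘ suc} λ { i j (mem s) (mem t) → suc-injective (h (suc i) (suc j) (mem s) (mem t)) }

  #-∪-∩ : ∀ {n} (X Y : BSet n) → # (X ∪ Y) + # (X ∩ Y) ≡ # X + # Y
  #-∪-∩ X Y = trans (sym (∑-distrib-+ (indicator ∘ (X ∪ Y)) (indicator ∘ (X ∩ Y))))
    (trans (sum-cong-≗ pointwise) (∑-distrib-+ (indicator ∘ X) (indicator ∘ Y)))
    where
    pointwise : ∀ i → indicator ((X ∪ Y) i) + indicator ((X ∩ Y) i) ≡ indicator (X i) + indicator (Y i)
    pointwise i with X i | Y i
    ... | true  | true  = refl
    ... | true  | false = refl
    ... | false | true  = refl
    ... | false | false = refl

  -- Identifies a subset with `Fin (# X)`, which is how a subgroup becomes a `FinGroup` again.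
  enumerate : ∀ {n} (X : BSet n) → Σ (Fin (# X) → Fin n) λ f →
    (∀ k → f k ∈ X) × (∀ i → i ∈ X → ∃[ k ] f k ≡ i) × (∀ k l → f k ≡ f l → k ≡ l)
  enumerate {zero}  X = (λ ()) , (λ ()) , (λ ()) , (λ ())
  enumerate {suc n} X with enumerate (X ∘ suc) | X zero in eq
  ... | f , in-X , onto , inj | true = f′
      , (λ { zero → mem (subst T (sym eq) tt) ; (suc k) → mem (_∈_.holds (in-X k)) })
      , (λ { zero _ → zero , refl
           ; (suc i) (mem t) → suc (proj₁ (onto i (mem t))) , cong suc (proj₂ (onto i (mem t))) })
      , λ { zero zero _ → refl ; zero (suc l) () ; (suc k) zero ()
          ; (suc k) (suc l) e → cong suc (inj k l (suc-injective e)) }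
    where
    f′ : Fin (suc (# (X ∘ suc))) → Fin (suc n)
    f′ zero    = zero
    f′ (suc k) = suc (f k)
  ... | f , in-X , onto , inj | false = (λ k → suc (f k))
      , (λ k → mem (_∈_.holds (in-X k)))
      , (λ { zero (mem t) → ⊥-elim (subst T eq t)
           ; (suc i) (mem t) → proj₁ (onto i (mem t)) , cong suc (proj₂ (onto i (mem t))) })
      , λ k l e → inj k l (suc-injective e)

#≤n : ∀ {n} (X : BSet n) → # X ≤ n
#≤n X = subst (# X ≤_) #-full (#-mono (λ _ _ → ∈-full))

fibres-≤ : ∀ {n m} {X : BSet n} {Y : BSet m} (f : Fin n → Fin m) k →
  (∀ i → i ∈ X → f i ∈ Y) →
  (∀ j → j ∈ Y → # (λ i → X i ∧ ⌊ f i ≟ j ⌋) ≤ k) →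
  # X ≤ k * # Y
fibres-≤ {X = X} {Y} f k maps fibre = subst (_≤ k * # Y) (*-identityˡ (# X))
  (double-count X Y (λ i j → ⌊ f i ≟ j ⌋) 1 k
    (λ i i∈X → 1≤# {i = f i} (∧⁺ (maps i i∈X) (∈⁺ (f i ≟_) refl))) fibre)

injection-≤ : ∀ {n m} {X : BSet n} {Y : BSet m} (f : Fin n → Fin m) →
  (∀ i → i ∈ X → f i ∈ Y) →
  (∀ i j → i ∈ X → j ∈ X → f i ≡ f j → i ≡ j) →
  # X ≤ # Y
injection-≤ {X = X} {Y} f maps inj = subst (# X ≤_) (*-identityˡ (# Y))
  (fibres-≤ {X = X} {Y} f 1 maps λ k _ → #≤1 λ i j i∈ j∈ →
    let (iX , fi) = ∧⁻ i∈ ; (jX , fj) = ∧⁻ j∈ in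
    inj i j iX jX (trans (∈⁻ (λ i → f i ≟ k) fi) (sym (∈⁻ (λ i → f i ≟ k) fj))))

⊈-witness : ∀ {n} {X Y : BSet n} → # X < # Y → ∃[ i ] (i ∈ Y × i ∉ X)
⊈-witness {X = X} {Y} lt with any? (λ i → (i ∈? Y) ×-dec ¬? (i ∈? X))
... | yes p = p
... | no ¬p = ⊥-elim (<⇒≱ lt (#-mono λ i i∈Y → decidable-stable (i ∈? X) λ i∉X → ¬p (i , i∈Y , i∉X)))

#-disjoint : ∀ {n} (X Y : BSet n) → (∀ i → i ∈ X → i ∉ Y) → # (X ∪ Y) ≡ # X + # Y
#-disjoint X Y h = trans (sym (trans (cong (# (X ∪ Y) +_) empty) (+-identityʳ _))) (#-∪-∩ X Y)
  where
  empty : # (X ∩ Y) ≡ 0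
  empty = n≤0⇒n≡0 (#≤0 λ i i∈ → let (a , b) = ∩⁻ {X = X} {Y} i∈ in h i a b)

disjoint-≤ : ∀ {n} {X Y W : BSet n} → (∀ i → i ∈ X → i ∉ Y) →
  (∀ i → i ∈ X → i ∈ W) → (∀ i → i ∈ Y → i ∈ W) → # X + # Y ≤ # W
disjoint-≤ {X = X} {Y} {W} dis f g = subst (_≤ # W) (#-disjoint X Y dis)
  (#-mono λ i i∈ → [ f i , g i ]′ (∪⁻ {X = X} {Y} i∈))

cover-≤ : ∀ {n} {X Y W : BSet n} → (∀ i → i ∈ W → i ∈ X ⊎ i ∈ Y) → # W ≤ # X + # Y
cover-≤ {X = X} {Y} {W} h = ≤-trans (#-mono {Y = X ∪ Y} λ i i∈ → ∪⁺ {X = X} {Y} (h i i∈))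
  (≤-trans (m≤m+n _ _) (≤-reflexive (#-∪-∩ X Y)))

#-mono-< : ∀ {n} {X Y : BSet n} {i} → (∀ i → i ∈ X → i ∈ Y) → i ∈ Y → i ∉ X → # X < # Y
#-mono-< {X = X} {Y} {i} sub i∈Y i∉X = subst (_≤ # Y) (+-comm (# X) 1)
  (≤-trans (+-monoʳ-≤ (# X) (1≤# {X = set (_≟ i)} (∈⁺ (_≟ i) refl)))
    (disjoint-≤ {X = X} {set (_≟ i)} (λ j j∈X j≡i → i∉X (subst (_∈ X) (∈⁻ (_≟ i) j≡i) j∈X)) sub
      (λ j j≡i → subst (_∈ Y) (sym (∈⁻ (_≟ i) j≡i)) i∈Y)))

-- Lists up to permutation

concat-↭ : ∀ {A : Set} {Bs Bs′ : List (List A)} → Bs ↭ Bs′ → concat Bs ↭ concat Bs′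
concat-↭ refl = ↭-refl
concat-↭ (prep B p) = ++⁺ˡ B (concat-↭ p)
concat-↭ (swap {xs = Bs} {ys = Cs} B C p) = ↭-trans (↭-reflexive (sym (++-assoc B C (concat Bs))))
  (↭-trans (++⁺ (++-comm B C) (concat-↭ p)) (↭-reflexive (++-assoc C B (concat Cs))))
concat-↭ (↭.trans p q) = ↭-trans (concat-↭ p) (concat-↭ q)

extract : ∀ {A : Set} {P : A → Set} {xs} → Any P xs → ∃[ x ] ∃[ ys ] (P x × xs ↭ x ∷ ys)
extract {xs = x ∷ xs} (here p) = x , xs , p , ↭-refl
extract {xs = x ∷ xs} (there i) with extract i
... | y , ys , p , perm = y , x ∷ ys , p , ↭-trans (prep x perm) (swap x y ↭-refl)

count : ∀ {A : Set} {P : A → Set} → (∀ x → Dec (P x)) → List A → ℕ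
count P? []       = 0
count P? (x ∷ xs) = indicator ⌊ P? x ⌋ + count P? xs

module _ {A : Set} {P : A → Set} (P? : ∀ x → Dec (P x)) where

  count-↭ : ∀ {xs ys} → xs ↭ ys → count P? xs ≡ count P? ys
  count-↭ refl = refl
  count-↭ (prep x p) = cong (indicator ⌊ P? x ⌋ +_) (count-↭ p)
  count-↭ (swap x y p) = trans (cong (λ k → indicator ⌊ P? x ⌋ + (indicator ⌊ P? y ⌋ + k)) (count-↭ p))
    (+-exchange (indicator ⌊ P? x ⌋) (indicator ⌊ P? y ⌋) _)
    where
    +-exchange : ∀ a b c → a + (b + c) ≡ b + (a + c)
    +-exchange = solve-∀
  count-↭ (↭.trans p r) = trans (count-↭ p) (count-↭ r)

  count-++ : ∀ xs ys → count P? (xs ++ ys) ≡ count P? xs + count P? ys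
  count-++ []       ys = refl
  count-++ (x ∷ xs) ys = trans (cong (indicator ⌊ P? x ⌋ +_) (count-++ xs ys)) (sym (+-assoc (indicator ⌊ P? x ⌋) _ _))

  count-all : ∀ {xs} → All P xs → count P? xs ≡ length xs
  count-all [] = refl
  count-all {x ∷ xs} (p ∷ ps) with P? x
  ... | yes _ = cong suc (count-all ps)
  ... | no ¬p = ⊥-elim (¬p p)

  count-none : ∀ {xs} → All (λ x → ¬ P x) xs → count P? xs ≡ 0
  count-none [] = refl
  count-none {x ∷ xs} (¬p ∷ ps) with P? x
  ... | yes p = ⊥-elim (¬p p)
  ... | no _  = count-none ps

  separate : ∀ xs → ∃[ ys ] ∃[ zs ] (xs ↭ ys ++ zs × All P ys × All (λ x → ¬ P x) zs × length ys ≡ count P? xs)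
  separate [] = [] , [] , refl , [] , [] , refl
  separate (x ∷ xs) with P? x | separate xs
  ... | yes p | ys , zs , perm , py , nz , e = x ∷ ys , zs , prep x perm , p ∷ py , nz , cong suc e
  ... | no ¬p | ys , zs , perm , py , nz , e = ys , x ∷ zs , ↭-trans (prep x perm) (↭-sym (shift x ys zs)) , py , ¬p ∷ nz , e

  count-≤ : ∀ xs → count P? xs ≤ length xs
  count-≤ [] = z≤n
  count-≤ (x ∷ xs) with P? x
  ... | yes _ = s≤s (count-≤ xs)
  ... | no _  = m≤n⇒m≤1+n (count-≤ xs)

split-at : ∀ {A : Set} k (xs : List A) → k ≤ length xs → ∃[ ys ] ∃[ zs ] (xs ≡ ys ++ zs × length ys ≡ k)
split-at zero    xs       _       = [] , xs , refl , refl
split-at (suc k) (x ∷ xs) (s≤s h) with split-at k xs h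
... | ys , zs , refl , e = x ∷ ys , zs , refl , cong suc e

nonempty-length : ∀ {A : Set} {xs : List A} → 0 < length xs → ¬ xs ≡ []
nonempty-length () refl

map-split : ∀ {A B : Set} (f : A → B) xs U V → map f xs ≡ U ++ V →
  ∃[ xs₁ ] ∃[ xs₂ ] (xs ≡ xs₁ ++ xs₂ × map f xs₁ ≡ U × map f xs₂ ≡ V)
map-split f xs [] V eq = [] , xs , refl , refl , eq
map-split f (x ∷ xs) (u ∷ U) V eq with map-split f xs U V (∷-injectiveʳ eq)
... | xs₁ , xs₂ , refl , e₁ , e₂ = x ∷ xs₁ , xs₂ , refl , cong₂ _∷_ (∷-injectiveˡ eq) e₁ , e₂

-- Elementary number theory

least : ∀ {P : ℕ → Set} → (∀ k → Dec (P k)) → ∀ k → P k → ∃[ m ] (P m × ∀ j → P j → m ≤ j)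
least P? zero    p = zero , p , λ _ _ → z≤n
least P? (suc k) p with P? zero
... | yes p₀ = zero , p₀ , λ _ _ → z≤n
... | no ¬p₀ with least (P? ∘ suc) k p
...   | m , pm , min = suc m , pm , λ { zero p₀ → ⊥-elim (¬p₀ p₀) ; (suc j) pj → s≤s (min j pj) }

abstract
  prime-divisor : ∀ n → 2 ≤ n → ∃[ p ] (Prime p × p ∣ n)
  prime-divisor = <-rec _ step
    where
    step : ∀ n → (∀ {m} → m < n → 2 ≤ m → ∃[ p ] (Prime p × p ∣ m)) → 2 ≤ n → ∃[ p ] (Prime p × p ∣ n)
    step n rec 2≤n with prime? n
    ... | yes pr = n , pr , ∣-refl
    ... | no ¬pr with ¬prime⇒composite {{n>1⇒nonTrivial 2≤n}} ¬pr
    ...   | hasNonTrivialDivisor {d} {{nt}} d<n d∣n =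
            let (p , pr , p∣d) = rec d<n (nonTrivial⇒n>1 d {{nt}}) in p , pr , ∣-trans p∣d d∣n

prime-≥2 : ∀ {p} → Prime p → 2 ≤ p
prime-≥2 {p} pr = nonTrivial⇒n>1 p {{prime⇒nonTrivial pr}}

abstract
  -- Bézout without subtraction, because exponents of group elements are natural numbers:
  -- `(x ^ t) ^ u` equals `x · (x ^ p) ^ v`.
  prime-coprime : ∀ {p t} → Prime p → ¬ p ∣ t → ∃[ u ] ∃[ v ] t * u ≡ 1 + p * v
  prime-coprime {p} {t} pr p∤t with Bézout.identity (coprime⇒GCD≡1 (prime⇒coprime-∤ pr p∤t))
    where
    prime⇒coprime-∤ : ∀ {p t} → Prime p → ¬ p ∣ t → Coprime t p
    prime⇒coprime-∤ pr p∤t {d} (d∣t , d∣p) with prime⇒irreducible pr d∣p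
    ... | inj₁ d≡1 = d≡1
    ... | inj₂ refl = ⊥-elim (p∤t d∣t)
  ... | Bézout.+- x y eq = x , y , trans (*-comm t x) (trans (sym eq) (cong suc (*-comm y p)))
  ... | Bézout.-+ x zero eq = ⊥-elim (1+n≢0 eq)
  ... | Bézout.-+ x (suc y) eq = x * (p ∸ 1) , suc y * (p ∸ 1) ∸ 1 , go (prime-≥2 pr) eq
    where
    -- 1 + x t = y p, so t (x (p − 1)) ≡ −(p − 1) ≡ 1 modulo p.
    go : ∀ {p} → 2 ≤ p → 1 + x * t ≡ suc y * p → t * (x * (p ∸ 1)) ≡ 1 + p * (suc y * (p ∸ 1) ∸ 1)
    go (s≤s {n = suc r} (s≤s z≤n)) eq = +-cancelˡ-≡ (suc r) _ _ (begin
      suc r + t * (x * suc r)                                  ≡⟨ l₁ r t x ⟩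
      (1 + x * t) * suc r                                      ≡⟨ cong (_* suc r) eq ⟩
      (suc y * suc (suc r)) * suc r                           ≡⟨ l₂ r y ⟩
      suc r + (1 + suc (suc r) * (r + y * suc r))             ∎)
      where
      open ≡-Reasoning
      l₁ : ∀ r t x → suc r + t * (x * suc r) ≡ (1 + x * t) * suc r
      l₁ = solve-∀
      l₂ : ∀ r y → (suc y * suc (suc r)) * suc r ≡ suc r + (1 + suc (suc r) * (r + y * suc r))
      l₂ = solve-∀

prime-∣-prime : ∀ {p q} → Prime p → Prime q → p ∣ q → p ≡ q
prime-∣-prime pr qr p∣q with prime⇒irreducible qr p∣q
... | inj₁ p≡1 = ⊥-elim (<⇒≱ (prime-≥2 pr) (≤-reflexive p≡1))
... | inj₂ p≡q = p≡q

parity : ∀ n → ∃[ k ] (n ≡ k + k ⊎ n ≡ suc (k + k))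
parity zero = 0 , inj₁ refl
parity (suc n) with parity n
... | k , inj₁ e = k , inj₂ (cong suc e)
... | k , inj₂ e = suc k , inj₁ (cong suc (trans e (sym (+-suc k k))))

-- Finite groups

module Group (G : FinGroup) where

  open FinGroup G public using (order; ε) renaming (_∙_ to mul; _⁻¹ to inv)
  open IsGroup (FinGroup.isGroup G) using (assoc; identityˡ; identityʳ; inverseˡ; inverseʳ)

  E : Set
  E = Elt G

  infixl 7 _·_
  infix 9 _⁻
  infixl 8 _^_

  _·_ : E → E → E
  _·_ = mul

  _⁻ : E → E
  _⁻ = inv

  _^_ : E → ℕ → E
  _^_ = pow G

  ∏ : List E → E
  ∏ = prod G

  infixl 7 _•_
  infix 9 _ⁱ

  data Word (k : ℕ) : Set where
    var  : Fin k → Word k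
    𝟙    : Word k
    _•_  : Word k → Word k → Word k
    _ⁱ   : Word k → Word k

  pattern v0 = var zero
  pattern v1 = var (suc zero)
  pattern v2 = var (suc (suc zero))
  pattern v3 = var (suc (suc (suc zero)))
  pattern v4 = var (suc (suc (suc (suc zero))))
  pattern v5 = var (suc (suc (suc (suc (suc zero)))))

  private
    module _ {k : ℕ} (ρ : Vec E k) where
      ⟦_⟧ : Word k → E
      ⟦ var i ⟧ = lookup ρ i
      ⟦ 𝟙 ⟧     = ε
      ⟦ a • b ⟧ = ⟦ a ⟧ · ⟦ b ⟧
      ⟦ a ⁱ ⟧   = ⟦ a ⟧ ⁻

      letter : Bool × Fin k → E
      letter (true  , i) = lookup ρ i
      letter (false , i) = lookup ρ i ⁻

      letters : List (Bool × Fin k) → E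
      letters []      = ε
      letters (l ∷ w) = letter l · letters w

    push : ∀ {k} → Bool × Fin k → List (Bool × Fin k) → List (Bool × Fin k)
    push l [] = l ∷ []
    push (true , i) ((false , j) ∷ w) with i ≟ j
    ... | yes _ = w
    ... | no  _ = (true , i) ∷ (false , j) ∷ w
    push (false , i) ((true , j) ∷ w) with i ≟ j
    ... | yes _ = w
    ... | no  _ = (false , i) ∷ (true , j) ∷ w
    push l w = l ∷ w

    -- The second argument is the part to the right, already reduced. `reduceⁱ` prepends the inverse
    -- of the word, so that inverses travel down to the letters.
    reduce reduceⁱ : ∀ {k} → Word k → List (Bool × Fin k) → List (Bool × Fin k)
    reduce (var i) w = push (true , i) w
    reduce 𝟙       w = w
    reduce (a • b) w = reduce a (reduce b w)
    reduce (a ⁱ)   w = reduceⁱ a w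
    reduceⁱ (var i) w = push (false , i) w
    reduceⁱ 𝟙       w = w
    reduceⁱ (a • b) w = reduceⁱ b (reduceⁱ a w)
    reduceⁱ (a ⁱ)   w = reduce a w

    unique-⁻ : ∀ x y → x · y ≡ ε → y ≡ x ⁻
    unique-⁻ x y e = trans (sym (identityˡ y)) (trans (cong (_· y) (sym (inverseˡ x)))
      (trans (assoc _ _ _) (trans (cong (x ⁻ ·_) e) (identityʳ _))))

    cancel : ∀ x y w → x · y ≡ ε → w ≡ x · (y · w)
    cancel x y w e = trans (sym (identityˡ w)) (trans (cong (_· w) (sym e)) (assoc x y w))

    module _ {k : ℕ} (ρ : Vec E k) where
      push-sound : ∀ l w → letters ρ (push l w) ≡ letter ρ l · letters ρ w
      push-sound l [] = refl
      push-sound (true , i) ((false , j) ∷ w) with i ≟ j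
      ... | yes refl = cancel _ _ _ (inverseʳ _)
      ... | no  _    = refl
      push-sound (false , i) ((true , j) ∷ w) with i ≟ j
      ... | yes refl = cancel _ _ _ (inverseˡ _)
      ... | no  _    = refl
      push-sound (true , i) ((true , j) ∷ w) = refl
      push-sound (false , i) ((false , j) ∷ w) = refl

      anti : ∀ x y → y ⁻ · x ⁻ ≡ (x · y) ⁻
      anti x y = unique-⁻ (x · y) (y ⁻ · x ⁻) (trans (assoc x y _)
        (trans (cong (x ·_) (sym (cancel y (y ⁻) (x ⁻) (inverseʳ y)))) (inverseʳ x)))

      reduce-sound  : ∀ a w → letters ρ (reduce a w) ≡ ⟦ ρ ⟧ a · letters ρ w
      reduceⁱ-sound : ∀ a w → letters ρ (reduceⁱ a w) ≡ (⟦ ρ ⟧ a) ⁻ · letters ρ w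
      reduce-sound (var i) w = push-sound (true , i) w
      reduce-sound 𝟙 w       = sym (identityˡ _)
      reduce-sound (a • b) w = trans (reduce-sound a (reduce b w))
        (trans (cong (⟦ ρ ⟧ a ·_) (reduce-sound b w)) (sym (assoc _ _ _)))
      reduce-sound (a ⁱ) w   = reduceⁱ-sound a w
      reduceⁱ-sound (var i) w = push-sound (false , i) w
      reduceⁱ-sound 𝟙 w       = trans (sym (identityˡ _)) (cong (_· letters ρ w) (unique-⁻ ε ε (identityˡ ε)))
      reduceⁱ-sound (a • b) w = trans (reduceⁱ-sound b (reduceⁱ a w))
        (trans (cong (⟦ ρ ⟧ b ⁻ ·_) (reduceⁱ-sound a w))
          (trans (sym (assoc _ _ _)) (cong (_· letters ρ w) (anti (⟦ ρ ⟧ a) (⟦ ρ ⟧ b)))))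
      reduceⁱ-sound (a ⁱ) w   = trans (reduce-sound a w)
        (cong (_· letters ρ w) (unique-⁻ (⟦ ρ ⟧ a ⁻) (⟦ ρ ⟧ a) (inverseˡ _)))

  -- Proves identities that hold in every group, by free reduction.
  word : ∀ {k} (ρ : Vec E k) (a b : Word k) → reduce a [] ≡ reduce b [] → ⟦_⟧ ρ a ≡ ⟦_⟧ ρ b
  word ρ a b e = trans (sym (trans (reduce-sound ρ a []) (identityʳ _)))
    (trans (cong (letters ρ) e) (trans (reduce-sound ρ b []) (identityʳ _)))

  ·-assoc : ∀ x y z → (x · y) · z ≡ x · (y · z)
  ·-assoc = assoc

  ε-left : ∀ x → ε · x ≡ x
  ε-left = identityˡ

  ε-right : ∀ x → x · ε ≡ x
  ε-right = identityʳ

  ⁻-left : ∀ x → x ⁻ · x ≡ ε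
  ⁻-left = inverseˡ

  ⁻-right : ∀ x → x · x ⁻ ≡ ε
  ⁻-right = inverseʳ

  ε⁻ : ε ⁻ ≡ ε
  ε⁻ = word [] (𝟙 ⁱ) 𝟙 refl

  cancelˡ : ∀ x {y z} → x · y ≡ x · z → y ≡ z
  cancelˡ x {y} {z} e = trans (word (x ∷ y ∷ []) v1 (v0 ⁱ • (v0 • v1)) refl)
    (trans (cong (x ⁻ ·_) e) (word (x ∷ z ∷ []) (v0 ⁱ • (v0 • v1)) v1 refl))

  cancelʳ : ∀ x {y z} → y · x ≡ z · x → y ≡ z
  cancelʳ x {y} {z} e = trans (word (x ∷ y ∷ []) v1 (v1 • v0 • v0 ⁱ) refl)
    (trans (cong (_· x ⁻) e) (word (x ∷ z ∷ []) (v1 • v0 • v0 ⁱ) v1 refl))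

  Comm : E → E → Set
  Comm x y = x · y ≡ y · x

  comm? : ∀ x y → Dec (Comm x y)
  comm? x y = x · y ≟ y · x

  comm-· : ∀ {x y z} → Comm x y → Comm x z → Comm x (y · z)
  comm-· {x} {y} {z} p q = trans (sym (assoc x y z)) (trans (cong (_· z) p)
    (trans (assoc y x z) (trans (cong (y ·_) q) (sym (assoc y z x)))))

  comm-⁻ : ∀ {x y} → Comm x y → Comm x (y ⁻)
  comm-⁻ {x} {y} p = trans (word (x ∷ y ∷ []) (v0 • v1 ⁱ) (v1 ⁱ • (v1 • v0) • v1 ⁱ) refl)
    (trans (cong (λ w → y ⁻ · w · y ⁻) (sym p)) (word (x ∷ y ∷ []) (v1 ⁱ • (v0 • v1) • v1 ⁱ) (v1 ⁱ • v0) refl))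

  comm-ε : ∀ {x} → Comm x ε
  comm-ε {x} = trans (identityʳ x) (sym (identityˡ x))

  comm-^ : ∀ {x y} → Comm x y → ∀ k → Comm x (y ^ k)
  comm-^ p zero    = comm-ε
  comm-^ p (suc k) = comm-· p (comm-^ p k)

  comm-^^ : ∀ {x y} → Comm x y → ∀ i j → Comm (x ^ i) (y ^ j)
  comm-^^ p i j = comm-^ (sym (comm-^ (sym p) i)) j

  ^-+ : ∀ x i j → x ^ (i + j) ≡ x ^ i · x ^ j
  ^-+ x zero    j = sym (identityˡ _)
  ^-+ x (suc i) j = trans (cong (x ·_) (^-+ x i j)) (sym (assoc _ _ _))

  ^-1 : ∀ x → x ^ 1 ≡ x
  ^-1 = identityʳ

  ^-2 : ∀ x → x ^ 2 ≡ x · x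
  ^-2 x = cong (x ·_) (identityʳ x)

  ^-* : ∀ x i j → x ^ (i * j) ≡ (x ^ i) ^ j
  ^-* x i zero    = cong (x ^_) (*-zeroʳ i)
  ^-* x i (suc j) = trans (cong (x ^_) (*-suc i j)) (trans (^-+ x i (i * j)) (cong (x ^ i ·_) (^-* x i j)))

  ^-swap : ∀ x i j → (x ^ i) ^ j ≡ (x ^ j) ^ i
  ^-swap x i j = trans (sym (^-* x i j)) (trans (cong (x ^_) (*-comm i j)) (^-* x j i))

  ε-^ : ∀ k → ε ^ k ≡ ε
  ε-^ zero    = refl
  ε-^ (suc k) = trans (identityˡ _) (ε-^ k)

  ^-· : ∀ {x y} → Comm x y → ∀ k → (x · y) ^ k ≡ x ^ k · y ^ k
  ^-· p zero    = sym (identityˡ ε)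
  ^-· {x} {y} p (suc k) = trans (cong (x · y ·_) (^-· p k))
    (trans (word (x ∷ y ∷ x ^ k ∷ y ^ k ∷ []) (v0 • v1 • (v2 • v3)) (v0 • (v1 • v2) • v3) refl)
      (trans (cong (λ w → x · w · y ^ k) (comm-^ (sym p) k))
        (word (x ∷ y ∷ x ^ k ∷ y ^ k ∷ []) (v0 • (v2 • v1) • v3) (v0 • v2 • (v1 • v3)) refl)))

  conj : E → E → E
  conj g x = g · x · g ⁻

  conj-^ : ∀ g x k → conj g (x ^ k) ≡ conj g x ^ k
  conj-^ g x zero    = word (g ∷ []) (v0 • 𝟙 • v0 ⁱ) 𝟙 refl
  conj-^ g x (suc k) = trans (word (g ∷ x ∷ x ^ k ∷ []) (v0 • (v1 • v2) • v0 ⁱ) (v0 • v1 • v0 ⁱ • (v0 • v2 • v0 ⁱ)) refl)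
    (cong (conj g x ·_) (conj-^ g x k))

  conj-comm : ∀ {g x} → Comm g x → conj g x ≡ x
  conj-comm {g} {x} p = trans (cong (_· g ⁻) p) (word (x ∷ g ∷ []) (v0 • v1 • v1 ⁱ) v0 refl)

  comm-conj : ∀ {g x} → conj g x ≡ x → Comm g x
  comm-conj {g} {x} e = trans (word (g ∷ x ∷ []) (v0 • v1) (v0 • v1 • v0 ⁱ • v0) refl) (cong (_· g) e)

  ^-diff : ∀ x i k → x ^ (i + k) ≡ x ^ i → x ^ k ≡ ε
  ^-diff x i k e = cancelˡ (x ^ i) (trans (sym (^-+ x i k)) (trans e (sym (identityʳ _))))

  abstract
    finite-order : ∀ x → ∃[ k ] x ^ suc k ≡ ε
    finite-order x with pigeonhole (n<1+n order) (λ i → x ^ toℕ i)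
    ... | i , j , i<j , e with m≤n⇒∃[o]m+o≡n i<j
    ...   | k , i+k≡j = k , ^-diff x (toℕ i) (suc k) (trans (cong (x ^_) (trans (+-suc (toℕ i) k) i+k≡j)) (sym e))

  record HasOrder (x : E) (N : ℕ) : Set where
    field
      positive : 0 < N
      kills    : x ^ N ≡ ε
      divides′ : ∀ i → x ^ i ≡ ε → N ∣ i

    ^-∣ : ∀ {i} → N ∣ i → x ^ i ≡ ε
    ^-∣ (divides k refl) = trans (cong (x ^_) (*-comm k N)) (trans (^-* x N k) (trans (cong (_^ k) kills) (ε-^ k)))

    ^-% : .{{_ : NonZero N}} → ∀ i → x ^ i ≡ x ^ (i % N)
    ^-% i = trans (cong (x ^_) (m≡m%n+[m/n]*n i N)) (trans (^-+ x (i % N) (i / N * N))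
      (trans (cong (x ^ (i % N) ·_) (^-∣ (divides (i / N) refl))) (identityʳ _)))

    private
      injective-≤ : ∀ i j → j < N → i ≤ j → x ^ i ≡ x ^ j → i ≡ j
      injective-≤ i j j<N i≤j e with m≤n⇒∃[o]m+o≡n i≤j
      ... | zero , refl = sym (+-identityʳ i)
      ... | suc k , refl = ⊥-elim (<⇒≱ (≤-<-trans (m≤n+m (suc k) i) j<N)
                             (∣⇒≤ (divides′ (suc k) (^-diff x i (suc k) (sym e)))))

    injective : ∀ i j → i < N → j < N → x ^ i ≡ x ^ j → i ≡ j
    injective i j i<N j<N e with ≤-total i j
    ... | inj₁ i≤j = injective-≤ i j j<N i≤j e
    ... | inj₂ j≤i = sym (injective-≤ j i i<N j≤i (sym e))

  abstract
    has-order : ∀ x → ∃[ N ] HasOrder x N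
    has-order x with finite-order x
    ... | k , e with least (λ k → x ^ suc k ≟ ε) k e
    ...   | m , kills , minimal = suc m , record { positive = s≤s z≤n ; kills = kills ; divides′ = div }
      where
      div : ∀ i → x ^ i ≡ ε → suc m ∣ i
      div i e with i % suc m in eq | m≡m%n+[m/n]*n i (suc m)
      ... | zero  | d = divides (i / suc m) d
      ... | suc r | d = ⊥-elim (<⇒≱ (subst (_< suc m) eq (m%n<n i (suc m)))
        (≤-trans (s≤s (minimal r (trans (sym (trans (cong (x ^_) d) (trans (^-+ x (suc r) (i / suc m * suc m))
          (trans (cong (x ^ suc r ·_) (trans (cong (x ^_) (*-comm (i / suc m) (suc m)))
            (trans (^-* x (suc m) (i / suc m)) (trans (cong (_^ (i / suc m)) kills) (ε-^ (i / suc m))))))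
            (identityʳ _))))) e))) ≤-refl))

-- Subgroups, cosets and blocks of a sequence

module Subgroups (G : FinGroup) where

  open Group G public

  record IsSub (H : BSet order) : Set where
    field
      ε∈ : ε ∈ H
      ·∈ : ∀ {x y} → x ∈ H → y ∈ H → x · y ∈ H

    ^∈ : ∀ {x} → x ∈ H → ∀ k → x ^ k ∈ H
    ^∈ x∈ zero    = ε∈
    ^∈ x∈ (suc k) = ·∈ x∈ (^∈ x∈ k)

    -- By finiteness the inverse is a power: `x ^ suc k` is `ε` for some `k`, and then `x ^ k` is
    -- the inverse.
    ⁻∈ : ∀ {x} → x ∈ H → x ⁻ ∈ H
    ⁻∈ {x} x∈ with finite-order x
    ... | k , e = subst (_∈ H) (cancelˡ x (trans e (sym (⁻-right x)))) (^∈ x∈ k)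

    ∏∈ : ∀ {L} → All (_∈ H) L → ∏ L ∈ H
    ∏∈ []       = ε∈
    ∏∈ (x ∷ xs) = ·∈ x (∏∈ xs)

    conj∈ : ∀ {g x} → g ∈ H → x ∈ H → conj g x ∈ H
    conj∈ g∈ x∈ = ·∈ (·∈ g∈ x∈) (⁻∈ g∈)

    cancelˡ∈ : ∀ {x y} → x ∈ H → x · y ∈ H → y ∈ H
    cancelˡ∈ {x} {y} x∈ xy∈ = subst (_∈ H) (word (x ∷ y ∷ []) (v0 ⁱ • (v0 • v1)) v1 refl) (·∈ (⁻∈ x∈) xy∈)

    cancelʳ∈ : ∀ {x y} → y ∈ H → x · y ∈ H → x ∈ H
    cancelʳ∈ {x} {y} y∈ xy∈ = subst (_∈ H) (word (x ∷ y ∷ []) (v0 • v1 • v1 ⁱ) v0 refl) (·∈ xy∈ (⁻∈ y∈))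

    1≤#H : 1 ≤ # H
    1≤#H = 1≤# ε∈

  open IsSub public

  trivial : BSet order
  trivial = set (_≟ ε)

  trivial-sub : IsSub trivial
  trivial-sub = record
    { ε∈ = ∈⁺ (_≟ ε) refl
    ; ·∈ = λ x∈ y∈ → ∈⁺ (_≟ ε) (trans (cong₂ _·_ (∈⁻ (_≟ ε) x∈) (∈⁻ (_≟ ε) y∈)) (ε-left ε)) }

  #-trivial : # trivial ≡ 1
  #-trivial = ≤-antisym (#≤1 λ i j p q → trans (∈⁻ (_≟ ε) p) (sym (∈⁻ (_≟ ε) q))) (1≤#H trivial-sub)

  full-sub : IsSub full
  full-sub = record { ε∈ = ∈-full ; ·∈ = λ _ _ → ∈-full }

  -- For a subgroup `H`: distinct left cosets.
  Apart : BSet order → E → E → Set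
  Apart H x y = x ⁻ · y ∉ H

  #-translate : ∀ (H : BSet order) x → # H ≤ # (set (λ g → (x ⁻ · g) ∈? H))
  #-translate H x = injection-≤ (x ·_)
    (λ h h∈ → ∈⁺ (λ g → (x ⁻ · g) ∈? H) (subst (_∈ H) (word (x ∷ h ∷ []) v1 (v0 ⁱ • (v0 • v1)) refl) h∈))
    (λ i j _ _ e → cancelˡ x e)

  -- The coset of the head is removed from `K` before the recursive call, so the induction is over
  -- arbitrary sets `K` that contain the listed cosets. For trivial `H` this counts distinct
  -- elements; for `K` the whole group it bounds the index.
  cosets-≤ : ∀ {H} → IsSub H → (K : BSet order) → ∀ L → AllPairs (Apart H) L →
    All (λ x → ∀ h → h ∈ H → x · h ∈ K) L → length L * # H ≤ # K
  cosets-≤ sub K [] [] [] = z≤n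
  cosets-≤ {H} sub K (x ∷ L) (apart ∷ aparts) (in-K ∷ ins-K) =
    ≤-trans (+-mono-≤ (#-translate H x) (cosets-≤ sub (K ∖ xH) L aparts
        (All.zipWith (λ {y} (yx , y-in) h h∈ → ∖⁺ {X = K} {xH} (y-in h h∈ , λ yh∈xH → yx
          (cancelʳ∈ sub h∈ (subst (_∈ H) (sym (·-assoc (x ⁻) y h)) (∈⁻ xH? yh∈xH))))) (apart , ins-K))))
      (disjoint-≤ {X = xH} {K ∖ xH} (λ i i∈ i∈′ → proj₂ (∖⁻ {X = K} {xH} i∈′) i∈)
        (λ i i∈ → subst (_∈ K) (word (x ∷ i ∷ []) (v0 • (v0 ⁱ • v1)) v1 refl) (in-K _ (∈⁻ xH? i∈)))
        (λ i i∈ → proj₁ (∖⁻ {X = K} {xH} i∈)))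
    where
    xH? : ∀ g → Dec (x ⁻ · g ∈ H)
    xH? g = (x ⁻ · g) ∈? H
    xH : BSet order
    xH = set xH?

  ∏-++ : ∀ xs ys → ∏ (xs ++ ys) ≡ ∏ xs · ∏ ys
  ∏-++ []       ys = sym (ε-left _)
  ∏-++ (x ∷ xs) ys = trans (cong (x ·_) (∏-++ xs ys)) (sym (·-assoc _ _ _))

  prefixes properPrefixes : List E → List E
  prefixes []      = ε ∷ []
  prefixes (x ∷ L) = ε ∷ map (x ·_) (prefixes L)
  properPrefixes []      = []
  properPrefixes (x ∷ L) = ε ∷ map (x ·_) (properPrefixes L)

  length-prefixes : ∀ L → length (prefixes L) ≡ suc (length L)
  length-prefixes []      = refl
  length-prefixes (x ∷ L) = cong suc (trans (length-map (x ·_) (prefixes L)) (length-prefixes L))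

  length-properPrefixes : ∀ L → length (properPrefixes L) ≡ length L
  length-properPrefixes []      = refl
  length-properPrefixes (x ∷ L) = cong suc (trans (length-map (x ·_) (properPrefixes L)) (length-properPrefixes L))

  prefixes-++ : ∀ L L′ → prefixes (L ++ L′) ≡ properPrefixes L ++ map (∏ L ·_) (prefixes L′)
  prefixes-++ [] L′ = sym (trans (map-cong (λ y → ε-left y) (prefixes L′)) (map-id (prefixes L′)))
  prefixes-++ (x ∷ L) L′ = cong (ε ∷_) (trans (cong (map (x ·_)) (prefixes-++ L L′))
    (trans (map-++ (x ·_) (properPrefixes L) (map (∏ L ·_) (prefixes L′)))
      (cong (map (x ·_) (properPrefixes L) ++_) (trans (sym (map-∘ (prefixes L′)))
        (map-cong (λ y → sym (·-assoc x (∏ L) y)) (prefixes L′))))))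

  module _ {H : BSet order} (sub : IsSub H) where

    -- A segment after which the walk of partial products returns to its coset for the first time.
    -- `tight` says that no coset repeats before that; it bounds the length of the segment by the
    -- index, and later it bounds the number of conjugates of its product from below.
    record Block (R : List E) : Set where
      field
        pre body post : List E
        split    : R ≡ pre ++ body ++ post
        nonempty : 0 < length body
        product  : ∏ body ∈ H
        tight    : AllPairs (Apart H) (properPrefixes body)

    private
      first-prefix : ∀ x R → All (λ u → x · u ∉ H) (prefixes R) ⊎
        (∃[ B ] ∃[ post ] (R ≡ B ++ post × x · ∏ B ∈ H × All (λ u → x · u ∉ H) (properPrefixes B)))
      first-prefix x [] with (x · ε) ∈? H
      ... | yes p = inj₂ ([] , [] , refl , p , [])
      ... | no ¬p = inj₁ (¬p ∷ [])
      first-prefix x (y ∷ R) with (x · ε) ∈? H | first-prefix (x · y) R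
      ... | yes p | _ = inj₂ ([] , y ∷ R , refl , p , [])
      ... | no ¬p | inj₁ none = inj₁ (¬p ∷ Allₚ.map⁺ (All.map (λ {u} n p → n (subst (_∈ H) (sym (·-assoc x y u)) p)) none))
      ... | no ¬p | inj₂ (B , post , eq , p , none) = inj₂ (y ∷ B , post , cong (y ∷_) eq , subst (_∈ H) (·-assoc x y (∏ B)) p
            , ¬p ∷ Allₚ.map⁺ (All.map (λ {u} n p → n (subst (_∈ H) (sym (·-assoc x y u)) p)) none))

      shift-apart : ∀ x {L} → AllPairs (Apart H) L → AllPairs (Apart H) (map (x ·_) L)
      shift-apart x ap = AllPairsₚ.map⁺ (AllPairs.map (λ {u} {v} a p → a (subst (_∈ H)
        (word (x ∷ u ∷ v ∷ []) ((v0 • v1) ⁱ • (v0 • v2)) (v1 ⁱ • v2) refl) p)) ap)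

      from-ε : ∀ x {L} → All (λ u → x · u ∉ H) L → All (Apart H ε) (map (x ·_) L)
      from-ε x none = Allₚ.map⁺ (All.map (λ {u} n p → n (subst (_∈ H) (word (x ∷ u ∷ []) (𝟙 ⁱ • (v0 • v1)) (v0 • v1) refl) p)) none)

      AllPairs-++ˡ : ∀ xs {ys} → AllPairs (Apart H) (xs ++ ys) → AllPairs (Apart H) xs
      AllPairs-++ˡ []       _        = []
      AllPairs-++ˡ (x ∷ xs) (a ∷ as) = Allₚ.++⁻ˡ xs a ∷ AllPairs-++ˡ xs as

    -- The search starts from the right end. If the prefix products of the tail are apart, the only
    -- coset that the new head can make repeat is that of `ε`; cutting at the first such repetition
    -- keeps the body tight.
    find-block : ∀ R → AllPairs (Apart H) (prefixes R) ⊎ Block R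
    find-block [] = inj₁ ([] ∷ [])
    find-block (x ∷ R) with find-block R
    ... | inj₂ b = inj₂ record { Block b ; pre = x ∷ Block.pre b ; split = cong (x ∷_) (Block.split b) }
    ... | inj₁ free with first-prefix x R
    ...   | inj₁ none = inj₁ (from-ε x none ∷ shift-apart x free)
    ...   | inj₂ (B , post , refl , p , none) = inj₂ record
            { pre = [] ; body = x ∷ B ; post = post ; split = refl ; nonempty = s≤s z≤n ; product = p
            ; tight = from-ε x none ∷ shift-apart x (AllPairs-++ˡ (properPrefixes B)
                        (subst (AllPairs (Apart H)) (prefixes-++ B post) free)) }

    module _ {K : BSet order} (subK : IsSub K) (H⊆K : ∀ h → h ∈ H → h ∈ K) where

      private
        in-K : ∀ {L} → All (_∈ K) L → All (λ x → ∀ h → h ∈ H → x · h ∈ K) L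
        in-K = All.map (λ x∈ h h∈ → ·∈ subK x∈ (H⊆K h h∈))

      prefixes∈ : ∀ {L} → All (_∈ K) L → All (_∈ K) (prefixes L)
      prefixes∈ []       = ε∈ subK ∷ []
      prefixes∈ (x ∷ xs) = ε∈ subK ∷ Allₚ.map⁺ (All.map (·∈ subK x) (prefixes∈ xs))

      properPrefixes∈ : ∀ {L} → All (_∈ K) L → All (_∈ K) (properPrefixes L)
      properPrefixes∈ []       = []
      properPrefixes∈ (x ∷ xs) = ε∈ subK ∷ Allₚ.map⁺ (All.map (·∈ subK x) (properPrefixes∈ xs))

      -- Pigeonhole: `n` terms have `n + 1` prefix products, so a length equal to the index is
      -- already enough.
      block-exists : ∀ {R} → All (_∈ K) R → # K ≤ length R * # H → Block R
      block-exists {R} R⊆K long with find-block R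
      ... | inj₂ b = b
      ... | inj₁ free = ⊥-elim (<⇒≱ (≤-trans (≤-trans (s≤s long) (+-monoˡ-≤ (length R * # H) (1≤#H sub)))
              (≤-reflexive (cong (_* # H) (sym (length-prefixes R)))))
              (cosets-≤ sub K (prefixes R) free (in-K (prefixes∈ R⊆K))))

      block-length : ∀ {R} → All (_∈ K) R → (b : Block R) → length (Block.body b) * # H ≤ # K
      block-length R⊆K b = subst (λ l → l * # H ≤ # K) (length-properPrefixes (Block.body b))
        (cosets-≤ sub K (properPrefixes (Block.body b)) (Block.tight b) (in-K (properPrefixes∈
          (Allₚ.++⁻ˡ (Block.body b) (Allₚ.++⁻ʳ (Block.pre b) (subst (All (_∈ K)) (Block.split b) R⊆K))))))

  proper-≤ : ∀ {H K} → IsSub H → IsSub K → (∀ h → h ∈ H → h ∈ K) → ∀ {g} → g ∈ K → g ∉ H → 2 * # H ≤ # K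
  proper-≤ {H} {K} subH subK H⊆K {g} g∈ g∉ = cosets-≤ subH K (ε ∷ g ∷ [])
    (((λ p → g∉ (subst (_∈ H) (word (g ∷ []) (𝟙 ⁱ • v0) v0 refl) p)) ∷ []) ∷ [] ∷ [])
    ((λ h h∈ → subst (_∈ K) (sym (ε-left h)) (H⊆K h h∈)) ∷ (λ h h∈ → ·∈ subK g∈ (H⊆K h h∈)) ∷ [])

  -- Primes are stripped from an exponent that leads into `H` until the power leaves `H`; the last
  -- prime stripped is the one wanted.
  prime-power-into : ∀ {H} → IsSub H → ∀ {g} → g ∉ H → ∃[ k ] ∃[ p ] (Prime p × g ^ k ∉ H × (g ^ k) ^ p ∈ H)
  prime-power-into {H} sub {g} g∉ with finite-order g
  ... | k , e = go (suc k) (<-wellFounded (suc k)) (s≤s z≤n) (subst (_∈ H) (sym e) (ε∈ sub))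
    where
    go : ∀ k → Acc _<_ k → 0 < k → g ^ k ∈ H → ∃[ k ] ∃[ p ] (Prime p × g ^ k ∉ H × (g ^ k) ^ p ∈ H)
    go (suc zero) _ _ g∈ = ⊥-elim (g∉ (subst (_∈ H) (^-1 g) g∈))
    go k@(suc (suc _)) (acc rec) _ g∈ with prime-divisor k (s≤s (s≤s z≤n))
    ... | p , pr , divides m eq with (g ^ m) ∈? H
    ...   | no g∉′ = m , p , pr , g∉′ , subst (_∈ H) (trans (cong (g ^_) eq) (^-* g m p)) g∈
    ...   | yes g∈′ with m
    ...     | zero  = case eq of λ ()
    ...     | suc m′ = go (suc m′) (rec (subst (suc m′ <_) (sym eq) (m<m*n (suc m′) p (prime-≥2 pr)))) (s≤s z≤n) g∈′

  ∏-concat : ∀ Bs → ∏ (concat Bs) ≡ ∏ (map ∏ Bs)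
  ∏-concat []       = refl
  ∏-concat (B ∷ Bs) = trans (∏-++ B (concat Bs)) (cong (∏ B ·_) (∏-concat Bs))

  commuting-∏ : ∀ {Q : E → Set} → (∀ {x y} → Q x → Q y → Comm x y) → ∀ {T L} → All Q T → T ↭ L → ∏ T ≡ ∏ L
  commuting-∏ com cs refl = refl
  commuting-∏ com (c ∷ cs) (prep y p) = cong (y ·_) (commuting-∏ com cs p)
  commuting-∏ com (c ∷ c′ ∷ cs) (swap {xs = T} y y′ p) = trans (sym (·-assoc y y′ (∏ T)))
    (trans (cong₂ _·_ (com c c′) (commuting-∏ com cs p)) (·-assoc y′ y _))
  commuting-∏ com cs (↭.trans p r) = trans (commuting-∏ com cs p) (commuting-∏ com (All-resp-↭ p cs) r)

  -- One term `s` is set aside. If `# K` terms remained, they would contain a segment with product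
  -- `ε`, and `s` guarantees that its complement is nonempty.
  commuting-bound : ∀ {S K} → MinimalProductOne G S → IsSub K → (∀ {x y} → x ∈ K → y ∈ K → Comm x y) →
    All (_∈ K) S → length S ≤ # K
  commuting-bound {[]} (ne , _) _ _ _ = ⊥-elim (ne refl)
  commuting-bound {s ∷ R} {K} (_ , (T , T↭ , e) , minimal) subK com S⊆K@(_ ∷ R⊆K) with # K ≤? length R
  ... | no ≰ = ≰⇒> ≰
  ... | yes long with block-exists trivial-sub subK (λ h h∈ → subst (_∈ K) (sym (∈⁻ (_≟ ε) h∈)) (ε∈ subK)) {R} R⊆K
                  (≤-trans long (≤-reflexive (sym (trans (cong (length R *_) #-trivial) (*-identityʳ _)))))
  ...   | record { pre = pre ; body = body ; post = post ; split = refl ; nonempty = ne ; product = p } =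
          ⊥-elim (minimal (body , s ∷ (pre ++ post) , perm , nonempty-length ne , (λ ()) , (body , ↭-refl , body-ε)
            , (s ∷ (pre ++ post) , ↭-refl , (begin
                ∏ (s ∷ (pre ++ post))            ≡⟨ ε-left _ ⟨
                ε · ∏ (s ∷ (pre ++ post))        ≡⟨ cong (_· ∏ (s ∷ (pre ++ post))) body-ε ⟨
                ∏ body · ∏ (s ∷ (pre ++ post))   ≡⟨ ∏-++ body (s ∷ (pre ++ post)) ⟨
                ∏ (body ++ s ∷ (pre ++ post))    ≡⟨ commuting-∏ com S⊆K perm ⟨
                ∏ (s ∷ (pre ++ body ++ post))    ≡⟨ commuting-∏ com S⊆K (↭-sym T↭) ⟩
                ∏ T                              ≡⟨ e ⟩
                ε                                ∎))))
    where
    open ≡-Reasoning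
    perm : s ∷ (pre ++ body ++ post) ↭ body ++ s ∷ (pre ++ post)
    perm = ↭-trans (prep s (shifts pre body)) (↭-sym (shift s body (pre ++ post)))
    body-ε : ∏ body ≡ ε
    body-ε = ∈⁻ (_≟ ε) p

  distinct-≤ : ∀ {X : BSet order} L → AllPairs _≢_ L → All (_∈ X) L → length L ≤ # X
  distinct-≤ {X} L ne in-X = subst (_≤ # X) (trans (cong (length L *_) #-trivial) (*-identityʳ _))
    (cosets-≤ trivial-sub X L (AllPairs.map (λ {x} {y} x≢y p → x≢y (sym (cancelˡ (x ⁻) (trans (∈⁻ (_≟ ε) p) (sym (⁻-left x)))))) ne)
      (All.map (λ x∈ h h∈ → subst (_∈ X) (sym (trans (cong (_ ·_) (∈⁻ (_≟ ε) h∈)) (ε-right _))) x∈) in-X))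

-- Passing from a group to a subgroup

module Relabelling (G : FinGroup) {H : BSet (FinGroup.order G)} (sub : Subgroups.IsSub G H) where

  open Subgroups G

  private
    lift : Fin (# H) → E
    lift = proj₁ (enumerate H)

    lift∈ : ∀ i → lift i ∈ H
    lift∈ = proj₁ (proj₂ (enumerate H))

    lift-injective : ∀ i j → lift i ≡ lift j → i ≡ j
    lift-injective = proj₂ (proj₂ (proj₂ (enumerate H)))

  -- Junk outside H: the index of the identity.
  index : E → Fin (# H)
  index x with x ∈? H
  ... | yes x∈ = proj₁ (proj₁ (proj₂ (proj₂ (enumerate H))) x x∈)
  ... | no  _  = proj₁ (proj₁ (proj₂ (proj₂ (enumerate H))) ε (ε∈ sub))

  private
    lift-index : ∀ {x} → x ∈ H → lift (index x) ≡ x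
    lift-index {x} x∈ with x ∈? H
    ... | yes x∈′ = proj₂ (proj₁ (proj₂ (proj₂ (enumerate H))) x x∈′)
    ... | no  x∉  = ⊥-elim (x∉ x∈)

  index-injective : ∀ {x y} → x ∈ H → y ∈ H → index x ≡ index y → x ≡ y
  index-injective x∈ y∈ e = trans (sym (lift-index x∈)) (trans (cong lift e) (lift-index y∈))

  private
    from-lift : ∀ {i x} → x ∈ H → lift i ≡ x → i ≡ index x
    from-lift {i} x∈ e = lift-injective i _ (trans e (sym (lift-index x∈)))

    op : Fin (# H) → Fin (# H) → Fin (# H)
    op i j = index (lift i · lift j)

    lift-op : ∀ i j → lift (op i j) ≡ lift i · lift j
    lift-op i j = lift-index (·∈ sub (lift∈ i) (lift∈ j))

  relabel : FinGroup
  relabel = record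
    { order = # H ; _∙_ = op ; ε = index ε ; _⁻¹ = λ i → index (lift i ⁻)
    ; isGroup = record
      { isMonoid = record
        { isSemigroup = record
          { isMagma = record { isEquivalence = isEquivalence ; ∙-cong = cong₂ op }
          ; assoc = λ i j k → lift-injective _ _ (trans (lift-op (op i j) k)
              (trans (cong (_· lift k) (lift-op i j)) (trans (·-assoc _ _ _)
                (trans (cong (lift i ·_) (sym (lift-op j k))) (sym (lift-op i (op j k))))))) }
        ; identity = (λ i → lift-injective _ _ (trans (lift-op (index ε) i)
                       (trans (cong (_· lift i) (lift-index (ε∈ sub))) (ε-left _))))
                   , (λ i → lift-injective _ _ (trans (lift-op i (index ε))
                       (trans (cong (lift i ·_) (lift-index (ε∈ sub))) (ε-right _)))) }
      ; inverse = (λ i → cong index (trans (cong (_· lift i) (lift-index (⁻∈ sub (lift∈ i)))) (⁻-left _)))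
                , (λ i → cong index (trans (cong (lift i ·_) (lift-index (⁻∈ sub (lift∈ i)))) (⁻-right _)))
      ; ⁻¹-cong = cong (λ i → index (lift i ⁻)) } }

  index-· : ∀ {x y} → x ∈ H → y ∈ H → index (x · y) ≡ FinGroup._∙_ relabel (index x) (index y)
  index-· x∈ y∈ = cong index (cong₂ _·_ (sym (lift-index x∈)) (sym (lift-index y∈)))

  index-^ : ∀ {x} → x ∈ H → ∀ k → index (x ^ k) ≡ pow relabel (index x) k
  index-^ x∈ zero    = refl
  index-^ x∈ (suc k) = trans (index-· x∈ (^∈ sub x∈ k)) (cong (FinGroup._∙_ relabel (index _)) (index-^ x∈ k))

  index-onto : ∀ i → ∃[ x ] (x ∈ H × index x ≡ i)
  index-onto i = lift i , lift∈ i , sym (from-lift (lift∈ i) refl)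

  index-∏ : ∀ {L} → All (_∈ H) L → index (∏ L) ≡ prod relabel (map index L)
  index-∏ [] = refl
  index-∏ (x∈ ∷ xs) = trans (index-· x∈ (∏∈ sub xs)) (cong (FinGroup._∙_ relabel (index _)) (index-∏ xs))

  -- Visits of the walk with steps T, started at g, to H; the end point is not counted.
  private
    visit : E → ℕ
    visit g = indicator (H g)

    visits : E → List E → ℕ
    visits g []      = 0
    visits g (p ∷ P) = visit (g · p) + visits g P

    visited : E → List E → ℕ
    visited g T = visits g (properPrefixes T)

    visits-cong : ∀ {g g′} → (∀ p → visit (g · p) ≡ visit (g′ · p)) → ∀ P → visits g P ≡ visits g′ P
    visits-cong e []      = refl
    visits-cong e (p ∷ P) = cong₂ _+_ (e p) (visits-cong e P)

    visits-map : ∀ g x P → visits g (map (x ·_) P) ≡ visits (g · x) P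
    visits-map g x []      = refl
    visits-map g x (p ∷ P) = cong₂ _+_ (cong visit (sym (·-assoc g x p))) (visits-map g x P)

    visited-∷ : ∀ g x T → visited g (x ∷ T) ≡ visit g + visited (g · x) T
    visited-∷ g x T = cong₂ _+_ (cong visit (ε-right g)) (visits-map g x (properPrefixes T))

    visit-shift : ∀ {h} → h ∈ H → ∀ p → visit (h · p) ≡ visit p
    visit-shift {h} h∈ p = cong indicator (⇔→≡ (cancelˡ∈ sub h∈) (·∈ sub h∈))
      where
      ⇔→≡ : ∀ {x y} → (x ∈ H → y ∈ H) → (y ∈ H → x ∈ H) → H x ≡ H y
      ⇔→≡ {x} {y} f g with H x | H y | (λ t → _∈_.holds (f (mem t))) | (λ t → _∈_.holds (g (mem t)))
      ... | true  | true  | _ | _ = refl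
      ... | false | false | _ | _ = refl
      ... | true  | false | f | _ = ⊥-elim (f tt)
      ... | false | true  | _ | g = ⊥-elim (g tt)

    -- A prefix product `p` leads into `H` from the starting points `h · p ⁻` with `h` in `H`.
    visits-total : ∀ P → length P * # H ≤ sum (λ g → visits g P)
    visits-total [] = z≤n
    visits-total (p ∷ P) = subst (length (p ∷ P) * # H ≤_)
      (sym (∑-distrib-+ (λ g → visit (g · p)) (λ g → visits g P)))
      (+-mono-≤ (≤-trans (injection-≤ (_· p ⁻)
          (λ h h∈ → mem (_∈_.holds (subst (_∈ H) (word (h ∷ p ∷ []) v0 (v0 • v1 ⁱ • v1) refl) h∈)))
          (λ i j _ _ → cancelʳ (p ⁻))) (≤-reflexive (#-sum (λ g → H (g · p))))) (visits-total P))

    -- Some starting point does at least as well as the average. If all fell short, the strict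
    -- inequalities, summed over all starting points, would contradict `visits-total`.
    max-visits : ∀ T → ∃[ g ] (length T * # H ≤ visited g T * order)
    max-visits T with any? (λ g → length T * # H ≤? visited g T * order)
    ... | yes p = p
    ... | no ¬p = ⊥-elim (absurd order refl)
      where
      small : ∀ g → suc (visited g T * order) ≤ length T * # H
      small g = ≰⇒> λ le → ¬p (g , le)
      sum-suc : ∀ {n} (f : Fin n → ℕ) m B → (∀ i → suc (f i * m) ≤ B) → n + sum f * m ≤ n * B
      sum-suc {zero}  f m B h = z≤n
      sum-suc {suc n} f m B h = ≤-trans (≤-reflexive (l n (f zero) (sum (f ∘ suc)) m))
        (+-mono-≤ (h zero) (sum-suc (f ∘ suc) m B (h ∘ suc)))
        where
        l : ∀ n a b m → suc n + (a + b) * m ≡ suc (a * m) + (n + b * m)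
        l = solve-∀
      absurd : ∀ m → m ≡ order → ⊥
      absurd zero e = case subst Fin (sym e) ε of λ ()
      absurd (suc m) e = <⇒≱ (≤-trans (s≤s (≤-trans (≤-reflexive (*-comm order _)) (*-monoˡ-≤ order
          (≤-trans (≤-reflexive (cong (_* # H) (sym (length-properPrefixes T)))) (visits-total (properPrefixes T))))))
          (≤-trans (+-monoˡ-≤ _ (subst (1 ≤_) e (s≤s z≤n))) ≤-refl))
        (sum-suc (λ g → visited g T) order (length T * # H) small)

    visited-++ : ∀ g T T′ → visited g (T ++ T′) ≡ visited g T + visited (g · ∏ T) T′
    visited-++ g [] T′ = cong (λ x → visited x T′) (sym (ε-right g))
    visited-++ g (x ∷ T) T′ = trans (visited-∷ g x (T ++ T′)) (trans (cong (visit g +_) (visited-++ (g · x) T T′))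
      (trans (sym (+-assoc (visit g) _ _)) (cong₂ _+_ (sym (visited-∷ g x T)) (cong (λ y → visited y T′) (·-assoc g x (∏ T))))))

    first-visit : ∀ g T → 0 < visited g T →
      ∃[ T₁ ] ∃[ T₂ ] (T ≡ T₁ ++ T₂ × g · ∏ T₁ ∈ H × visited g T ≤ visited (g · ∏ T₁) T₂)
    first-visit g (x ∷ T) pos with H g in eq
    ... | true  = [] , x ∷ T , refl , subst (_∈ H) (sym (ε-right g)) (mem (subst T′ (sym eq) tt))
                , ≤-reflexive (cong (λ y → visited y (x ∷ T)) (sym (ε-right g)))
      where T′ = Data.Bool.T
    ... | false with first-visit (g · x) T (subst (0 <_) (trans (visited-∷ g x T) (cong (λ b → indicator b + visited (g · x) T) eq)) pos)
    ...   | T₁ , T₂ , e , u∈ , le = x ∷ T₁ , T₂ , cong (x ∷_) e , subst (_∈ H) (·-assoc g x (∏ T₁)) u∈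
            , ≤-trans (≤-reflexive (trans (visited-∷ g x T) (cong (λ b → indicator b + visited (g · x) T) eq)))
                (subst (λ y → visited (g · x) T ≤ visited y T₂) (·-assoc g x (∏ T₁)) le)

    -- `c ∷ cs` is the block in progress, kept nonempty by its form so that no empty block is ever
    -- cut off. The last block ends at the end point of the walk, which `visited` leaves out; hence
    -- the `suc`.
    chop : ∀ c cs T → ∏ ((c ∷ cs) ++ T) ∈ H → ∃[ Bs ] (concat Bs ≡ (c ∷ cs) ++ T
      × All (λ B → ∏ B ∈ H × 0 < length B) Bs × suc (visited (∏ (c ∷ cs)) T) ≤ length Bs)
    chop c cs [] p = ((c ∷ cs) ∷ []) , refl , ((subst (λ l → ∏ l ∈ H) (++-identityʳ (c ∷ cs)) p , s≤s z≤n) ∷ []) , s≤s z≤n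
    chop c cs (x ∷ T) p with H (∏ (c ∷ cs)) in eq
    ... | true with chop x [] T (cancelˡ∈ sub (mem (subst Data.Bool.T (sym eq) tt)) (subst (_∈ H) (∏-++ (c ∷ cs) (x ∷ T)) p))
    ...   | Bs , con , all , len = (c ∷ cs) ∷ Bs , cong ((c ∷ cs) ++_) con
            , (mem (subst Data.Bool.T (sym eq) tt) , s≤s z≤n) ∷ all
            , s≤s (≤-trans (≤-reflexive (trans (visited-∷ (∏ (c ∷ cs)) x T) (cong₂ _+_ (cong indicator eq)
                (visits-cong (λ q → trans (cong visit (·-assoc _ _ _)) (trans (visit-shift (mem (subst Data.Bool.T (sym eq) tt)) (x · q))
                  (cong (λ y → visit (y · q)) (sym (ε-right x))))) (properPrefixes T))))) len)
    chop c cs (x ∷ T) p | false with chop c (cs ++ x ∷ []) T (subst (λ l → ∏ l ∈ H) (cong (c ∷_) (sym (++-assoc cs (x ∷ []) T))) p)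
    ...   | Bs , con , all , len = Bs , trans con (cong (c ∷_) (++-assoc cs (x ∷ []) T)) , all
            , ≤-trans (s≤s (≤-reflexive (trans (visited-∷ (∏ (c ∷ cs)) x T) (trans (cong (λ b → indicator b + visited (∏ (c ∷ cs) · x) T) eq)
                (cong (λ y → visited y T) (trans (cong (∏ (c ∷ cs) ·_) (sym (ε-right x))) (sym (∏-++ (c ∷ cs) (x ∷ [])))))))) ) len

    value : List E → Fin (# H)
    value B = index (∏ B)

    value-∏ : ∀ {Bs} → All (λ B → ∏ B ∈ H × 0 < length B) Bs → index (∏ (concat Bs)) ≡ prod relabel (map value Bs)
    value-∏ {Bs} all = trans (cong index (∏-concat Bs)) (trans (index-∏ (Allₚ.map⁺ (All.map proj₁ all)))
      (cong (prod relabel) (sym (map-∘ Bs))))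

    -- A reordering of the block products lifts to a reordering of the blocks and thus of the terms.
    -- In this way a splitting over `H` becomes a splitting over the whole group.
    product-one : ∀ {Bs U} → All (λ B → ∏ B ∈ H × 0 < length B) Bs → map value Bs ≡ U →
      ProductOne relabel U → ProductOne G (concat Bs)
    product-one {Bs} all refl (T , T↭ , e) with ↭-map-inv value (↭-sym T↭)
    ... | Bs′ , refl , Bs↭ = concat Bs′ , ↭-sym (concat-↭ Bs↭)
        , index-injective (subst (_∈ H) (sym (∏-concat Bs′)) (∏∈ sub (Allₚ.map⁺ (All.map proj₁ all′)))) (ε∈ sub)
            (trans (value-∏ all′) e)
      where
      all′ : All (λ B → ∏ B ∈ H × 0 < length B) Bs′
      all′ = All-resp-↭ Bs↭ all

    nonempty : ∀ {Bs U} → All (λ B → ∏ B ∈ H × 0 < length B) Bs → map value Bs ≡ U →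
      NonEmpty relabel U → NonEmpty G (concat Bs)
    nonempty [] refl ne = λ _ → ne refl
    nonempty {(_ ∷ _) ∷ Bs} (_ ∷ _) refl ne ()
    nonempty {[] ∷ Bs} ((_ , ()) ∷ _) refl ne

    rotate : ∀ T₁ T₂ → ∏ (T₁ ++ T₂) ≡ ε → ∏ (T₂ ++ T₁) ≡ ε
    rotate T₁ T₂ e = trans (∏-++ T₂ T₁) (cancelˡ (∏ T₁) (trans (sym (·-assoc _ _ _))
      (trans (cong (_· ∏ T₁) (trans (sym (∏-++ T₁ T₂)) e)) (trans (ε-left _) (sym (ε-right _))))))

  descend : ∀ {S} → MinimalProductOne G S →
    ∃[ S′ ] (MinimalProductOne relabel S′ × length S * # H ≤ length S′ * order)
  descend {S} (ne , (T , T↭S , e) , minimal) with max-visits T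
  ... | g , many with visited g T in eq
  ...   | zero  = ⊥-elim (ne (length-0 S (n≤0⇒n≡0 (≤-trans (≤-trans (≤-reflexive (sym (*-identityʳ _)))
                    (*-monoʳ-≤ (length S) (1≤#H sub))) (subst (λ l → l * # H ≤ 0) (↭-length T↭S) many)))))
    where
    length-0 : ∀ (S : List E) → length S ≡ 0 → S ≡ []
    length-0 [] _ = refl
  ...   | suc k with first-visit g T (subst (0 <_) (sym eq) (s≤s z≤n))
  -- `T` has product `ε`, so it may be rotated to begin at its first visit to `H`.
  ...     | T₁ , T₂ , refl , u∈ , le with T₂ ++ T₁ in eq′
  ...       | [] = ⊥-elim (ne (empty S (↭-trans (↭-sym T↭S) (↭-trans (++-comm T₁ T₂) (↭-reflexive eq′)))))
    where
    empty : ∀ S → S ↭ [] → S ≡ []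
    empty S p = ↭-empty-inv p
  ...       | x ∷ T′ with chop x [] T′ (subst (λ l → ∏ l ∈ H) eq′ (subst (_∈ H) (sym (rotate T₁ T₂ e)) (ε∈ sub)))
  ...         | Bs , con , all , len = map value Bs , (ne′ , po , min′) , bound
    where
    S↭Bs : S ↭ concat Bs
    S↭Bs = ↭-trans (↭-sym T↭S) (↭-trans (++-comm T₁ T₂) (↭-reflexive (trans eq′ (sym con))))
    ne′ : NonEmpty relabel (map value Bs)
    ne′ = none Bs con
      where
      none : ∀ Bs → concat Bs ≡ x ∷ T′ → NonEmpty relabel (map value Bs)
      none [] ()
      none (_ ∷ _) _ ()
    po : ProductOne relabel (map value Bs)
    po = map value Bs , ↭-refl , trans (sym (value-∏ all)) (cong index (trans (cong ∏ (trans con (sym eq′))) (rotate T₁ T₂ e)))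
    min′ : ¬ (∃[ U ] ∃[ V ] (map value Bs ↭ U ++ V × NonEmpty relabel U × NonEmpty relabel V
                      × ProductOne relabel U × ProductOne relabel V))
    min′ (U , V , perm , neU , neV , poU , poV) with ↭-map-inv value perm
    ... | Bs′ , e₁ , Bs↭ with map-split value Bs′ U V (sym e₁) | All-resp-↭ Bs↭ all
    ...   | B₁ , B₂ , refl , eU , eV | all′ = minimal (concat B₁ , concat B₂
            , ↭-trans S↭Bs (↭-trans (concat-↭ Bs↭) (↭-reflexive (sym (concat-++ B₁ B₂))))
            , nonempty (Allₚ.++⁻ˡ B₁ all′) eU neU , nonempty (Allₚ.++⁻ʳ B₁ all′) eV neV
            , product-one (Allₚ.++⁻ˡ B₁ all′) eU poU , product-one (Allₚ.++⁻ʳ B₁ all′) eV poV)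
    -- The starting point counts for at most one visit, and it pays for the block that `chop`
    -- returns beyond the later visits.
    bound : length S * # H ≤ length (map value Bs) * order
    bound = subst (λ l → l * # H ≤ length (map value Bs) * order) (↭-length T↭S)
      (≤-trans many (*-monoˡ-≤ order (≤-trans (≤-trans (≤-reflexive (sym eq)) le)
        (≤-trans (≤-reflexive (visits-cong (λ p → trans (visit-shift u∈ p) (cong visit (sym (ε-left p)))) (properPrefixes T₂)))
        (≤-trans (m≤m+n _ _) (≤-trans (≤-reflexive (trans (sym (visited-++ ε T₂ T₁)) (trans (cong (visited ε) eq′) (visited-∷ ε x T′))))
          (≤-trans (+-mono-≤ {x = visit ε} {1} visit≤1 (≤-reflexive (cong (λ y → visited y T′) (trans (ε-left x) (sym (ε-right x))))))
            (≤-trans len (≤-reflexive (sym (length-map value Bs)))))))))))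
      where
      visit≤1 : visit ε ≤ 1
      visit≤1 with H ε
      ... | true  = ≤-refl
      ... | false = z≤n

-- Cyclic and odd dihedral subgroups

module Shapes (G : FinGroup) where

  open Subgroups G

  record Cyc (H : BSet order) : Set where
    field
      gen   : E
      gen∈  : gen ∈ H
      power : ∀ {x} → x ∈ H → ∃[ k ] gen ^ k ≡ x

    commutes : ∀ {x y} → x ∈ H → y ∈ H → Comm x y
    commutes x∈ y∈ with power x∈ | power y∈
    ... | i , refl | j , refl = comm-^^ refl i j

  -- An odd dihedral subgroup, described by the multiplication rules of rotations and reflections
  -- instead of an isomorphism. The values of `rot` off `H` are junk, so every rule asks for
  -- membership in `H`; the rotations have the odd exponent `suc (half + half)`.
  record ODih (H : BSet order) : Set where
    field
      rot   : BSet order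
      s     : E
      s∈    : s ∈ H
      s∉    : s ∉ rot
      rr    : ∀ {x y} → x ∈ H → y ∈ H → x ∈ rot → y ∈ rot → x · y ∈ rot
      rs    : ∀ {x y} → x ∈ H → y ∈ H → x ∈ rot → y ∉ rot → x · y ∉ rot
      sr    : ∀ {x y} → x ∈ H → y ∈ H → x ∉ rot → y ∈ rot → x · y ∉ rot
      ss    : ∀ {x y} → x ∈ H → y ∈ H → x ∉ rot → y ∉ rot → x · y ∈ rot
      flip  : ∀ {x} → x ∈ H → x ∉ rot → x · x ≡ ε
      comm  : ∀ {x y} → x ∈ H → y ∈ H → x ∈ rot → y ∈ rot → Comm x y
      half  : ℕ
      odd   : ∀ {x} → x ∈ H → x ∈ rot → x ^ suc (half + half) ≡ ε

  module _ {H : BSet order} (sub : IsSub H) where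

    open Relabelling G sub

    Cyc-intro : IsCyclic relabel → Cyc H
    Cyc-intro (i , onto) with index-onto i
    ... | g , g∈ , refl = record { gen = g ; gen∈ = g∈ ; power = λ x∈ →
      let (k , e) = onto (index _) in k , index-injective (^∈ sub g∈ k) x∈ (trans (index-^ g∈ k) e) }

    ODih-intro : ∀ k → IsoDihedral relabel (suc (k + k)) → ODih H
    ODih-intro k (φ , (φ-inj , φ-onto) , φ-hom) = record
      { rot = rotation ; s = s ; s∈ = s∈
      ; s∉ = λ { (mem t) → subst Data.Bool.T (cong not (cong proj₂ ψs)) t }
      ; rr = λ x∈ y∈ (mem p) (mem q) → mem (rrᵇ (sign _) (sign _) (sign-· x∈ y∈) p q)
      ; rs = λ x∈ y∈ (mem p) q (mem r) → q (mem (rsᵇ (sign _) (sign _) (sign-· x∈ y∈) p r))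
      ; sr = λ x∈ y∈ p (mem q) (mem r) → p (mem (srᵇ (sign _) (sign _) (sign-· x∈ y∈) q r))
      ; ss = λ x∈ y∈ p q → mem (ssᵇ (sign _) (sign _) (sign-· x∈ y∈) (λ t → p (mem t)) (λ t → q (mem t)))
      ; flip = λ x∈ p → ψ-inj (·∈ sub x∈ x∈) (ε∈ sub) (trans (ψ-· x∈ x∈) (trans (square (ψ _) (λ t → p (mem t))) (sym ψε)))
      ; comm = λ x∈ y∈ (mem p) (mem q) → ψ-inj (·∈ sub x∈ y∈) (·∈ sub y∈ x∈)
          (trans (ψ-· x∈ y∈) (trans (commute (ψ _) (ψ _) p q) (sym (ψ-· y∈ x∈))))
      ; half = k
      ; odd = λ {x} x∈ (mem p) → ψ-inj (^∈ sub x∈ m) (ε∈ sub) (trans (ψ-^ x∈ (ψ x) refl p m)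
          (trans (cong (_, false) (toℕ-injective (trans (toℕ-mod (m * toℕ (proj₁ (ψ x)))) (trans (cong (_% m) (*-comm m (toℕ (proj₁ (ψ x))))) (m*n%n≡0 (toℕ (proj₁ (ψ x))) m))))) (sym ψε))) }
      where
      m = suc (k + k)
      ψ : E → Dih m
      ψ x = φ (index x)
      ψ-inj : ∀ {x y} → x ∈ H → y ∈ H → ψ x ≡ ψ y → x ≡ y
      ψ-inj x∈ y∈ e = index-injective x∈ y∈ (φ-inj e)
      ψ-· : ∀ {x y} → x ∈ H → y ∈ H → ψ (x · y) ≡ dihMul m (ψ x) (ψ y)
      ψ-· x∈ y∈ = trans (cong φ (index-· x∈ y∈)) (φ-hom _ _)
      ψ-onto : ∀ d → ∃[ x ] (x ∈ H × ψ x ≡ d)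
      ψ-onto d with φ-onto d
      ... | i , onto with index-onto i
      ...   | x , x∈ , refl = x , x∈ , onto refl
      toℕ-mod : ∀ a → toℕ (a mod m) ≡ a % m
      toℕ-mod a = toℕ-fromℕ< (m%n<n a m)
      rotation : BSet order
      rotation x = not (proj₂ (ψ x))
      s  = proj₁ (ψ-onto (zero , true))
      s∈ = proj₁ (proj₂ (ψ-onto (zero , true)))
      ψs = proj₂ (proj₂ (ψ-onto (zero , true)))
      ψε : ψ ε ≡ (zero , false)
      ψε with ψ-onto (zero , false)
      ... | e , e∈ , ψe = trans (cong ψ (sym e≡ε)) ψe
        where
        e≡ε : e ≡ ε
        e≡ε = cancelˡ e (trans (ψ-inj (·∈ sub e∈ e∈) e∈ (trans (ψ-· e∈ e∈) (trans (cong₂ (dihMul m) ψe ψe) (sym ψe)))) (sym (ε-right e)))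
      sign : E → Bool
      sign x = proj₂ (ψ x)
      sign-mul : ∀ (a b : Dih m) → proj₂ (dihMul m a b) ≡ proj₂ a xor proj₂ b
      sign-mul (a , false) (b , t) = refl
      sign-mul (a , true)  (b , t) = refl
      sign-· : ∀ {x y} → x ∈ H → y ∈ H → sign (x · y) ≡ sign x xor sign y
      sign-· x∈ y∈ = trans (cong proj₂ (ψ-· x∈ y∈)) (sign-mul (ψ _) (ψ _))
      rrᵇ : ∀ a b {c} → c ≡ a xor b → Data.Bool.T (not a) → Data.Bool.T (not b) → Data.Bool.T (not c)
      rrᵇ false false refl _ _ = tt
      rsᵇ : ∀ a b {c} → c ≡ a xor b → Data.Bool.T (not a) → Data.Bool.T (not c) → Data.Bool.T (not b)
      rsᵇ false false refl _ _ = tt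
      srᵇ : ∀ a b {c} → c ≡ a xor b → Data.Bool.T (not b) → Data.Bool.T (not c) → Data.Bool.T (not a)
      srᵇ false false refl _ _ = tt
      ssᵇ : ∀ a b {c} → c ≡ a xor b → ¬ Data.Bool.T (not a) → ¬ Data.Bool.T (not b) → Data.Bool.T (not c)
      ssᵇ true  true  refl _ _ = tt
      ssᵇ false _     refl n _ = ⊥-elim (n tt)
      ssᵇ true  false refl _ n = ⊥-elim (n tt)
      square : ∀ (d : Dih m) → ¬ Data.Bool.T (not (proj₂ d)) → dihMul m d d ≡ (zero , false)
      square (a , false) n = ⊥-elim (n tt)
      square (a , true)  _ = cong (_, false) (toℕ-injective (trans (toℕ-mod (toℕ a + (m ∸ toℕ a)))
        (trans (cong (_% m) (m+[n∸m]≡n (<⇒≤ (toℕ<n a)))) (n%n≡0 m))))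
      commute : ∀ (d d′ : Dih m) → Data.Bool.T (not (proj₂ d)) → Data.Bool.T (not (proj₂ d′)) → dihMul m d d′ ≡ dihMul m d′ d
      commute (a , false) (b , false) _ _ = cong (λ c → c mod m , false) (+-comm (toℕ a) (toℕ b))
      ψ-^ : ∀ {x} → x ∈ H → ∀ d → ψ x ≡ d → Data.Bool.T (not (proj₂ d)) → ∀ j → ψ (x ^ j) ≡ ((j * toℕ (proj₁ d)) mod m , false)
      ψ-^ x∈ d e p zero = ψε
      ψ-^ x∈ d@(a , false) e p (suc j) = trans (ψ-· x∈ (^∈ sub x∈ j)) (trans (cong₂ (dihMul m) e (ψ-^ x∈ d e p j))
        (cong (_, false) (toℕ-injective (trans (toℕ-mod (toℕ a + toℕ ((j * toℕ a) mod m))) (trans (cong (λ c → (toℕ a + c) % m) (toℕ-mod (j * toℕ a)))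
          (trans (%-distribˡ-+ (toℕ a) (j * toℕ a % m) m) (trans (cong (λ c → (toℕ a % m + c) % m) (m%n%n≡m%n (j * toℕ a) m))
            (trans (sym (%-distribˡ-+ (toℕ a) (j * toℕ a) m)) (sym (toℕ-mod (toℕ a + j * toℕ a)))))))))))

    -- A rotation that commutes with a reflection is its own inverse and so is trivial, having odd
    -- order. A nontrivial central element is therefore a reflection, all rotations commute with it
    -- and are trivial, and `H` has order two.
    central⇒Cyc : ODih H → ∀ {x} → x ∈ H → x ≢ ε → (∀ {y} → y ∈ H → Comm x y) → Cyc H
    central⇒Cyc D {x} x∈ x≢ε central = record { gen = x ; gen∈ = x∈ ; power = power }
      where
      open ODih D
      invert : ∀ {r t} → r ∈ H → t ∈ H → r ∈ rot → t ∉ rot → Comm r t → r · r ≡ ε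
      invert {r} {t} r∈ t∈ rr∈ t∉ c = trans (word (r ∷ t ∷ []) (v0 • v0) (v0 • v1 • (v1 ⁱ • v0)) refl)
        (trans (cong (λ w → r · t · (w · r)) (sym (cancelˡ t (trans (flip t∈ t∉) (sym (⁻-right t))))))
          (trans (cong (r · t ·_) (sym c)) (flip (·∈ sub r∈ t∈) (rs r∈ t∈ rr∈ t∉))))
      trivial-rot : ∀ {r} → r ∈ H → r ∈ rot → r · r ≡ ε → r ≡ ε
      trivial-rot {r} r∈ rr∈ e = trans (sym (ε-right r)) (trans (cong (r ·_) (sym (trans (^-+ r half half)
        (trans (sym (^-· refl half)) (trans (cong (_^ half) e) (ε-^ half)))))) (odd r∈ rr∈))
      x∉ : x ∉ rot
      x∉ x∈rot = x≢ε (trivial-rot x∈ x∈rot (invert x∈ s∈ x∈rot s∉ (central s∈)))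
      rot⇒ε : ∀ {r} → r ∈ H → r ∈ rot → r ≡ ε
      rot⇒ε r∈ rr∈ = trivial-rot r∈ rr∈ (invert r∈ x∈ rr∈ x∉ (sym (central r∈)))
      power : ∀ {y} → y ∈ H → ∃[ k ] x ^ k ≡ y
      power {y} y∈ with y ∈? rot
      ... | yes r = 0 , sym (rot⇒ε y∈ r)
      ... | no ¬r = 1 , trans (^-1 x) (cancelˡ x (trans (flip x∈ x∉) (sym (rot⇒ε (·∈ sub x∈ y∈) (ss x∈ y∈ x∉ ¬r)))))

    -- An element with nontrivial square is a rotation, and whatever does not commute with a
    -- rotation is a reflection.
    noncommuting⇒inverts : ODih H → ∀ {x y} → x ∈ H → y ∈ H → ¬ Comm x y → x · x ≢ ε →
      y · y ≡ ε × conj y x ≡ x ⁻ × ∃[ j ] x ^ suc (j + j) ≡ ε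
    noncommuting⇒inverts D {x} {y} x∈ y∈ nc x²≢ε with x ∈? ODih.rot D | y ∈? ODih.rot D
    ... | no x∉  | _      = ⊥-elim (x²≢ε (ODih.flip D x∈ x∉))
    ... | yes xr | yes yr = ⊥-elim (nc (ODih.comm D x∈ y∈ xr yr))
    ... | yes xr | no y∉  = y² , inverted , ODih.half D , ODih.odd D x∈ xr
      where
      y² = ODih.flip D y∈ y∉
      inverted : conj y x ≡ x ⁻
      inverted = cancelʳ x (trans (trans (cong (λ w → y · x · w · x) (sym (cancelˡ y (trans y² (sym (⁻-right y))))))
        (trans (word (x ∷ y ∷ []) (v1 • v0 • v1 • v0) (v1 • v0 • (v1 • v0)) refl) (ODih.flip D (·∈ sub y∈ x∈) (ODih.sr D y∈ x∈ y∉ xr))))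
        (sym (⁻-left x)))

  ⁻-^ : ∀ x k → (x ⁻) ^ k ≡ (x ^ k) ⁻
  ⁻-^ x k = cancelˡ (x ^ k) (trans (sym (^-· (⁻-comm x) k)) (trans (cong (_^ k) (⁻-right x)) (trans (ε-^ k) (sym (⁻-right (x ^ k))))))
    where
    ⁻-comm : ∀ x → Comm x (x ⁻)
    ⁻-comm x = trans (⁻-right x) (sym (⁻-left x))

  module _ {a b : E} {N : ℕ} .{{_ : NonZero N}} (order-a : HasOrder a N) (b² : b · b ≡ ε) (inverts : conj b a ≡ a ⁻)
           (b∉ : ∀ i → a ^ i ≢ b) (cover : ∀ g → (∃[ i ] a ^ i ≡ g) ⊎ (∃[ i ] a ^ i · b ≡ g)) where
    open HasOrder order-a
    private
      ι : Dih N → E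
      ι (i , false) = a ^ toℕ i
      ι (i , true)  = a ^ toℕ i · b

      φ : E → Dih N
      φ g with cover g
      ... | inj₁ (i , _) = i mod N , false
      ... | inj₂ (i , _) = i mod N , true

      ^-mod : ∀ i → a ^ toℕ (i mod N) ≡ a ^ i
      ^-mod i = trans (cong (a ^_) (toℕ-fromℕ< (m%n<n i N))) (sym (^-% i))

      ιφ : ∀ g → ι (φ g) ≡ g
      ιφ g with cover g
      ... | inj₁ (i , e) = trans (^-mod i) e
      ... | inj₂ (i , e) = trans (cong (_· b) (^-mod i)) e

      a^-⁻ : ∀ {j} → j ≤ N → a ^ (N ∸ j) ≡ (a ^ j) ⁻
      a^-⁻ {j} j≤N = cancelʳ (a ^ j) (trans (sym (^-+ a (N ∸ j) j)) (trans (cong (a ^_) (m∸n+n≡m j≤N)) (trans kills (sym (⁻-left _)))))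

      not-reflection : ∀ i j → a ^ i ≢ a ^ j · b
      not-reflection i j e = b∉ (N ∸ j % N + i) (trans (^-+ a (proj₁ inverse) i) (trans (cong (_· a ^ i) (proj₂ inverse))
        (trans (cong ((a ^ j) ⁻ ·_) e) (word (a ^ j ∷ b ∷ []) (v0 ⁱ • (v0 • v1)) v1 refl))))
        where
        inverse : ∃[ k ] a ^ k ≡ (a ^ j) ⁻
        inverse = N ∸ j % N , trans (a^-⁻ (<⇒≤ (m%n<n j N))) (cong _⁻ (sym (^-% j)))

      ι-inj : ∀ d d′ → ι d ≡ ι d′ → d ≡ d′
      ι-inj (i , false) (j , false) e = cong (_, false) (toℕ-injective (injective _ _ (toℕ<n i) (toℕ<n j) e))
      ι-inj (i , true)  (j , true)  e = cong (_, true) (toℕ-injective (injective _ _ (toℕ<n i) (toℕ<n j) (cancelʳ b e)))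
      ι-inj (i , false) (j , true)  e = ⊥-elim (not-reflection (toℕ i) (toℕ j) e)
      ι-inj (i , true)  (j , false) e = ⊥-elim (not-reflection (toℕ j) (toℕ i) (sym e))

      move : ∀ j → b · a ^ j ≡ (a ^ j) ⁻ · b
      move j = trans (word (b ∷ a ^ j ∷ []) (v0 • v1) (v0 • v1 • v0 ⁱ • v0) refl) (cong (_· b) (trans (conj-^ b a j) (trans (cong (_^ j) inverts) (⁻-^ a j))))

      ι-rot : ∀ i j → a ^ toℕ ((toℕ i + toℕ {N} j) mod N) ≡ a ^ toℕ {N} i · a ^ toℕ j
      ι-rot i j = trans (^-mod (toℕ i + toℕ j)) (^-+ a (toℕ i) (toℕ j))

      ι-flip : ∀ i j → a ^ toℕ ((toℕ i + (N ∸ toℕ {N} j)) mod N) ≡ a ^ toℕ {N} i · (a ^ toℕ j) ⁻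
      ι-flip i j = trans (^-mod (toℕ i + (N ∸ toℕ j))) (trans (^-+ a (toℕ i) (N ∸ toℕ j)) (cong (a ^ toℕ i ·_) (a^-⁻ (<⇒≤ (toℕ<n j)))))

      ι-hom : ∀ d d′ → ι (dihMul N d d′) ≡ ι d · ι d′
      ι-hom (i , false) (j , false) = ι-rot i j
      ι-hom (i , false) (j , true)  = trans (cong (_· b) (ι-rot i j)) (·-assoc _ _ _)
      ι-hom (i , true)  (j , false) = trans (cong (_· b) (ι-flip i j)) (trans (·-assoc _ _ _)
        (trans (cong (a ^ toℕ i ·_) (sym (move (toℕ j)))) (sym (·-assoc _ _ _))))
      ι-hom (i , true)  (j , true)  = trans (ι-flip i j) (trans (sym (ε-right _)) (trans (cong (a ^ toℕ i · (a ^ toℕ j) ⁻ ·_) (sym b²))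
        (trans (word (a ^ toℕ i ∷ (a ^ toℕ j) ⁻ ∷ b ∷ []) (v0 • v1 • (v2 • v2)) (v0 • (v1 • v2) • v2) refl)
          (trans (cong (λ w → a ^ toℕ i · w · b) (sym (move (toℕ j)))) (word (a ^ toℕ i ∷ a ^ toℕ j ∷ b ∷ []) (v0 • (v2 • v1) • v2) (v0 • v2 • (v1 • v2)) refl)))))

    -- Only `ι`, from the dihedral group to `G`, is given by a formula. `φ` picks some exponent
    -- supplied by `cover`; since `ι` is an injective homomorphism, the properties of `φ` follow
    -- from those of `ι`.
    dihedral-iso : IsoDihedral G N
    dihedral-iso = φ , ((λ {x} {y} e → trans (sym (ιφ x)) (trans (cong ι e) (ιφ y)))
        , (λ d → ι d , λ { refl → ι-inj _ _ (ιφ (ι d)) }))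
      , λ x y → ι-inj _ _ (trans (ιφ (x · y)) (trans (cong₂ _·_ (sym (ιφ x)) (sym (ιφ y))) (sym (ι-hom (φ x) (φ y)))))

-- Groups with a normal subgroup A of prime order containing all commutators

module Centralisers (G : FinGroup) where

  open Subgroups G public

  abstract
    centre : BSet order
    centre = set (λ x → all? (λ y → comm? x y))

    centralises? : (A : BSet order) (x : E) → Dec (∀ y → y ∈ A → Comm x y)
    centralises? A x = all? (λ y → (y ∈? A) →-dec comm? x y)

    centraliser : BSet order → BSet order
    centraliser A = set (centralises? A)

    centre⁺ : ∀ {x} → (∀ y → Comm x y) → x ∈ centre
    centre⁺ = ∈⁺ (λ x → all? (λ y → comm? x y))

    centre⁻ : ∀ {x} → x ∈ centre → ∀ y → Comm x y
    centre⁻ = ∈⁻ (λ x → all? (λ y → comm? x y))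

    centraliser⁺ : ∀ {A x} → (∀ y → y ∈ A → Comm x y) → x ∈ centraliser A
    centraliser⁺ {A} = ∈⁺ (centralises? A)

    centraliser⁻ : ∀ {A x} → x ∈ centraliser A → ∀ y → y ∈ A → Comm x y
    centraliser⁻ {A} = ∈⁻ (centralises? A)

  centre-sub : IsSub centre
  centre-sub = record { ε∈ = centre⁺ (λ y → sym comm-ε)
                      ; ·∈ = λ x∈ y∈ → centre⁺ λ w → sym (comm-· (sym (centre⁻ x∈ w)) (sym (centre⁻ y∈ w))) }

  centraliser-sub : ∀ A → IsSub (centraliser A)
  centraliser-sub A = record { ε∈ = centraliser⁺ (λ y _ → sym comm-ε)
    ; ·∈ = λ x∈ y∈ → centraliser⁺ λ w w∈ → sym (comm-· (sym (centraliser⁻ x∈ w w∈)) (sym (centraliser⁻ y∈ w w∈))) }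

  Reach : List E → E → Set
  Reach L g = ∃[ T ] (T ↭ L × ∏ T ≡ g)

  reach-++ : ∀ {L L′ g g′} → Reach L g → Reach L′ g′ → Reach (L ++ L′) (g · g′)
  reach-++ (T , p , refl) (T′ , p′ , refl) = T ++ T′ , ++⁺ p p′ , ∏-++ T T′

  reach-↭ : ∀ {L L′ g} → L ↭ L′ → Reach L g → Reach L′ g
  reach-↭ p (T , p′ , e) = T , ↭-trans p′ p , e

  -- Product-one free sequences, whose maximal length is the small Davenport constant.
  Free : List E → Set
  Free R = ∀ U W → R ↭ U ++ W → NonEmpty G U → ¬ Reach U ε

  module ModuloCommutators {A : BSet order} (A-sub : IsSub A) (commutator : ∀ x y → x · y · (y · x) ⁻ ∈ A) where

    -- `conj g a` is the commutator of `g` and `a` times `a`, so a subgroup containing all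
    -- commutators is normal.
    conj-A : ∀ g {a} → a ∈ A → conj g a ∈ A
    conj-A g {a} a∈ = subst (_∈ A) (word (g ∷ a ∷ []) (v0 • v1 • (v1 • v0) ⁱ • v1) (v0 • v1 • v0 ⁱ) refl)
      (·∈ A-sub (commutator g a) a∈)

    ∏-↭-mod : ∀ {T L} → T ↭ L → ∏ T · (∏ L) ⁻ ∈ A
    ∏-↭-mod {T} refl = subst (_∈ A) (sym (⁻-right (∏ T))) (ε∈ A-sub)
    ∏-↭-mod (prep {xs = T} {ys = L} x p) = subst (_∈ A)
      (word (x ∷ ∏ T ∷ ∏ L ∷ []) (v0 • (v1 • v2 ⁱ) • v0 ⁱ) (v0 • v1 • (v0 • v2) ⁱ) refl) (conj-A x (∏-↭-mod p))
    ∏-↭-mod (swap {xs = T} {ys = L} x y p) = subst (_∈ A)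
      (word (x ∷ y ∷ ∏ T ∷ ∏ L ∷ []) (v0 • v1 • (v1 • v0) ⁱ • (v1 • v0 • (v2 • v3 ⁱ) • (v1 • v0) ⁱ)) (v0 • (v1 • v2) • (v1 • (v0 • v3)) ⁱ) refl)
      (·∈ A-sub (commutator x y) (conj-A (y · x) (∏-↭-mod p)))
    ∏-↭-mod (↭.trans {xs = T} {ys = L} {zs = K} p r) = subst (_∈ A)
      (word (∏ T ∷ ∏ L ∷ ∏ K ∷ []) (v0 • v1 ⁱ • (v1 • v2 ⁱ)) (v0 • v2 ⁱ) refl) (·∈ A-sub (∏-↭-mod p) (∏-↭-mod r))

    reach-mod : ∀ {L g} → Reach L g → g · (∏ L) ⁻ ∈ A
    reach-mod (T , p , refl) = ∏-↭-mod p

-- `A-gen` encodes that `A` has prime order: each nontrivial element generates it. Modulo the centre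
-- such a group consists of affine maps x ↦ u x + v over the field with q elements, and `e` is the
-- number of multipliers u that occur.
record AffineData (G : FinGroup) : Set where
  open Centralisers G
  field
    A          : BSet order
    A-sub      : IsSub A
    A-gen      : ∀ {c} → c ∈ A → c ≢ ε → ∀ {a} → a ∈ A → ∃[ k ] c ^ k ≡ a
    commutator : ∀ x y → x · y · (y · x) ⁻ ∈ A
    b          : E
    b∉         : b ∉ centraliser A
    decompose  : ∀ {m} → m ∈ centraliser A → ∃[ a ] ∃[ ζ ] (a ∈ A × ζ ∈ centre × m ≡ a · ζ)
    e          : ℕ
    index-e    : order ≡ e * # (centraliser A)

module Affine (G : FinGroup) (data′ : AffineData G) where

  open Centralisers G public
  open AffineData data′ public

  M Z : BSet order
  M = centraliser A
  Z = centre

  M-sub : IsSub M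
  M-sub = centraliser-sub A

  q z : ℕ
  q = # A
  z = # Z

  1≤q : 1 ≤ q
  1≤q = 1≤#H A-sub

  1≤z : 1 ≤ z
  1≤z = 1≤#H centre-sub

  A-comm : ∀ {x y} → x ∈ A → y ∈ A → Comm x y
  A-comm {x} {y} x∈ y∈ with x ≟ ε
  ... | yes refl = sym comm-ε
  ... | no x≢ε with A-gen x∈ x≢ε y∈
  ...   | k , refl = comm-^ refl k

  open ModuloCommutators A-sub commutator public

  commutes-A : ∀ {a g} → a ∈ A → a ≢ ε → Comm g a → g ∈ M
  commutes-A a∈ a≢ε c = centraliser⁺ λ y y∈ → case A-gen a∈ a≢ε y∈ of λ { (k , refl) → comm-^ c k }

  A⊆M : ∀ {a} → a ∈ A → a ∈ M
  A⊆M a∈ = centraliser⁺ λ y y∈ → A-comm a∈ y∈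

  Z⊆M : ∀ {a} → a ∈ Z → a ∈ M
  Z⊆M a∈ = centraliser⁺ λ y _ → centre⁻ a∈ y

  -- A nontrivial `a` generates `A`, so commuting with it would put `x` into `M`.
  A∩C : ∀ {a x} → a ∈ A → x ∉ M → Comm x a → a ≡ ε
  A∩C {a} a∈ x∉ c with a ≟ ε
  ... | yes e = e
  ... | no ne = ⊥-elim (x∉ (commutes-A a∈ ne c))

  A∩Z : ∀ {a} → a ∈ A → a ∈ Z → a ≡ ε
  A∩Z a∈ a∈Z = A∩C a∈ b∉ (sym (centre⁻ a∈Z b))

  M-comm : ∀ {x y} → x ∈ M → y ∈ M → Comm x y
  M-comm x∈ y∈ with decompose y∈
  ... | a , ζ , a∈ , ζ∈ , refl = comm-· (centraliser⁻ x∈ a a∈) (sym (centre⁻ ζ∈ _))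

  M∩C⊆Z : ∀ {m x} → m ∈ M → x ∉ M → Comm x m → m ∈ Z
  M∩C⊆Z {m} {x} m∈ x∉ c with decompose m∈
  ... | a , ζ , a∈ , ζ∈ , refl = subst (_∈ Z) (trans (sym (ε-left ζ)) (cong (_· ζ) (sym (A∩C a∈ x∉ comm-a)))) ζ∈
    where
    comm-a : Comm x a
    comm-a = subst (Comm x) (word (a ∷ ζ ∷ []) (v0 • v1 • v1 ⁱ) v0 refl) (comm-· c (comm-⁻ (sym (centre⁻ ζ∈ x))))

  -- The commutator of `u` and `v` lies in `A` and commutes with `x`, so it is trivial by `A∩C`:
  -- centralisers of elements outside `M` are abelian.
  commutator-comm : ∀ {x u v} → x ∉ M → Comm x u → Comm x v → Comm u v
  commutator-comm {x} {u} {v} x∉ cu cv = trans (word (u ∷ v ∷ []) (v0 • v1) (v0 • v1 • (v1 • v0) ⁱ • (v1 • v0)) refl)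
    (trans (cong (_· (v · u)) (A∩C (commutator u v) x∉ (comm-· (comm-· cu cv) (comm-⁻ (comm-· cv cu))))) (ε-left _))

  -- For `y` outside `M` its centraliser is abelian. For a noncentral `y = a · ζ` in `M` the factor
  -- `a` is nontrivial, and the centraliser of `y` lies in the abelian group `M`.
  comm-trans : ∀ {x y w} → y ∉ Z → Comm x y → Comm y w → Comm x w
  comm-trans {x} {y} {w} y∉Z c c′ with y ∈? M
  ... | no y∉M = commutator-comm y∉M (sym c) c′
  ... | yes y∈M with decompose y∈M
  ...   | a , ζ , a∈ , ζ∈ , refl = M-comm (in-M (sym c)) (in-M c′)
    where
    in-M : ∀ {g} → Comm (a · ζ) g → g ∈ M
    in-M {g} cg = commutes-A a∈ (λ { refl → y∉Z (subst (_∈ Z) (sym (ε-left ζ)) ζ∈) })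
      (subst (Comm g) (word (a ∷ ζ ∷ []) (v0 • v1 • v1 ⁱ) v0 refl) (comm-· (sym cg) (comm-⁻ (sym (centre⁻ ζ∈ g)))))

  #M : # M ≡ z * q
  #M = ≤-antisym
    (≤-trans (≤-reflexive (sym (*-identityˡ (# M)))) (≤-trans (double-count M Z (λ m ζ → A (ζ ⁻ · m)) 1 q
      (λ m m∈ → case decompose m∈ of λ { (a , ζ , a∈ , ζ∈ , refl) → 1≤# {i = ζ} (∧⁺ ζ∈ (mem (_∈_.holds (subst (_∈ A) (strip a ζ (centre⁻ ζ∈ a)) a∈)))) })
      (λ ζ ζ∈ → injection-≤ (λ m → ζ ⁻ · m) (λ m m∈ → mem (_∈_.holds (proj₂ (∧⁻ {X = M} {λ m → A (ζ ⁻ · m)} m∈)))) (λ i j _ _ → cancelˡ (ζ ⁻))))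
      (≤-reflexive (*-comm q z))))
    (≤-trans (≤-reflexive (*-comm z q)) (≤-trans (double-count Z M (λ ζ m → A (ζ ⁻ · m)) q 1
      (λ ζ ζ∈ → injection-≤ (ζ ·_) (λ a a∈ → ∧⁺ (·∈ M-sub (Z⊆M ζ∈) (A⊆M a∈))
          (mem (_∈_.holds (subst (_∈ A) (word (ζ ∷ a ∷ []) v1 (v0 ⁱ • (v0 • v1)) refl) a∈)))) (λ i j _ _ → cancelˡ ζ))
      (λ m m∈ → #≤1 λ ζ ζ′ p p′ → let (a , mem r) = ∧⁻ {X = Z} {λ ζ → A (ζ ⁻ · m)} p ; (a′ , mem r′) = ∧⁻ {X = Z} {λ ζ → A (ζ ⁻ · m)} p′ in same m a a′ (mem r) (mem r′)))
      (≤-reflexive (*-identityˡ (# M)))))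
    where
    strip : ∀ a ζ → Comm ζ a → a ≡ ζ ⁻ · (a · ζ)
    strip a ζ c = trans (word (a ∷ ζ ∷ []) v0 (v1 ⁱ • (v1 • v0)) refl) (cong (ζ ⁻ ·_) c)
    same : ∀ m {ζ ζ′} → ζ ∈ Z → ζ′ ∈ Z → ζ ⁻ · m ∈ A → ζ′ ⁻ · m ∈ A → ζ ≡ ζ′
    same m {ζ} {ζ′} ζ∈ ζ′∈ p p′ = trans (word (ζ ∷ ζ′ ∷ []) v0 (v1 • (v1 ⁱ • v0)) refl) (trans (cong (ζ′ ·_)
      (A∩Z (subst (_∈ A) (word (ζ ∷ ζ′ ∷ m ∷ []) (v1 ⁱ • v2 • (v0 ⁱ • v2) ⁱ) (v1 ⁱ • v0) refl) (·∈ A-sub p′ (⁻∈ A-sub p)))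
        (·∈ centre-sub (⁻∈ centre-sub ζ′∈) ζ∈))) (ε-right ζ′))

  order-≡ : order ≡ e * (z * q)
  order-≡ = trans index-e (cong (e *_) #M)

  -- Cauchy–Davenport; the induction is on Y, via Dyson's e-transform.
  cauchy-davenport : ∀ {X Y W} → (∀ x → x ∈ X → x ∈ A) → (∀ y → y ∈ Y → y ∈ A) →
    ∃ (_∈ X) → ∃ (_∈ Y) → (∀ {x y} → x ∈ X → y ∈ Y → x · y ∈ W) → # X + # Y ≤ suc (# W) ⊎ q ≤ # W
  cauchy-davenport {X} {Y} {W} = go (# Y) X Y ≤-refl
    where
    go : ∀ k X Y → # Y ≤ k → (∀ x → x ∈ X → x ∈ A) → (∀ y → y ∈ Y → y ∈ A) →
      ∃ (_∈ X) → ∃ (_∈ Y) → (∀ {x y} → x ∈ X → y ∈ Y → x · y ∈ W) → # X + # Y ≤ suc (# W) ⊎ q ≤ # W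
    go zero X Y Y≤k X⊆A Y⊆A (x₀ , x₀∈) (y₀ , y₀∈) XY⊆W = ⊥-elim (<⇒≱ (1≤# y₀∈) Y≤k)
    go (suc k) X Y Y≤k X⊆A Y⊆A (x₀ , x₀∈) (y₀ , y₀∈) XY⊆W with any? (λ y → (y ∈? Y) ×-dec ¬? (y ≟ y₀))
    ... | no ¬p = inj₁ (≤-trans (≤-reflexive (+-comm (# X) (# Y))) (+-mono-≤
            (#≤1 λ i j i∈ j∈ → trans (only i i∈) (sym (only j j∈))) X≤W))
      where
      only : ∀ i → i ∈ Y → i ≡ y₀
      only i i∈ = decidable-stable (i ≟ y₀) λ ne → ¬p (i , i∈ , ne)
      X≤W : # X ≤ # W
      X≤W = injection-≤ (_· y₀) (λ x x∈ → XY⊆W x∈ y₀∈) (λ i j _ _ → cancelʳ y₀)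
    -- If no such `x` exists, `X` is closed under multiplication by `y₀ ⁻ · y₁`, a generator of `A`,
    -- and so is all of `A`.
    ... | yes (y₁ , y₁∈ , y₁≢y₀) with any? (λ x → (x ∈? X) ×-dec ¬? ((x · (y₀ ⁻ · y₁)) ∈? X))
    ...   | no ¬p = inj₂ (≤-trans (#-mono all-X) (injection-≤ (_· y₀) (λ x x∈ → XY⊆W x∈ y₀∈) (λ i j _ _ → cancelʳ y₀)))
      where
      c = y₀ ⁻ · y₁
      c∈ : c ∈ A
      c∈ = ·∈ A-sub (⁻∈ A-sub (Y⊆A y₀ y₀∈)) (Y⊆A y₁ y₁∈)
      c≢ε : c ≢ ε
      c≢ε e = y₁≢y₀ (cancelˡ (y₀ ⁻) (trans e (sym (⁻-left y₀))))
      closed : ∀ k → x₀ · c ^ k ∈ X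
      closed zero    = subst (_∈ X) (sym (ε-right x₀)) x₀∈
      closed (suc k) = subst (_∈ X) (trans (·-assoc x₀ (c ^ k) c) (cong (x₀ ·_) (sym (comm-^ refl k))))
        (decidable-stable ((x₀ · c ^ k · c) ∈? X) λ n → ¬p (x₀ · c ^ k , closed k , n))
      all-X : ∀ a → a ∈ A → a ∈ X
      all-X a a∈ with A-gen c∈ c≢ε (·∈ A-sub (⁻∈ A-sub (X⊆A x₀ x₀∈)) a∈)
      ... | k , e = subst (_∈ X) (trans (cong (x₀ ·_) e) (word (x₀ ∷ a ∷ []) (v0 • (v0 ⁱ • v1)) v1 refl)) (closed k)
    -- With `u = x · y₀ ⁻` the pair is replaced by the union of `X` with u Y and the part of `Y`
    -- that `u` carries into `X`. The sum of the sizes does not drop, while the second set keeps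
    -- `y₀` and loses `y₁`.
    ...   | yes (x , x∈ , xc∉) with go k X′ Y′ (≤-pred (≤-trans Y′<Y Y≤k)) X′⊆A (λ y y∈ → Y⊆A y (proj₁ (∧⁻ {X = Y} {λ y → X (x · y₀ ⁻ · y)} y∈)))
                (x , ∪⁺ {X = X} (inj₁ x∈)) (y₀ , y₀∈Y′) X′Y′⊆W
      where
      u = x · y₀ ⁻
      uY Y′ X′ : BSet order
      uY g = Y (u ⁻ · g)
      X′ = X ∪ uY
      Y′ = Y ∩ (λ y → X (u · y))
      uy₀ : u · y₀ ≡ x
      uy₀ = word (x ∷ y₀ ∷ []) (v0 • v1 ⁱ • v1) v0 refl
      y₀∈Y′ : y₀ ∈ Y′
      y₀∈Y′ = ∧⁺ y₀∈ (mem (_∈_.holds (subst (_∈ X) (sym uy₀) x∈)))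
      Y′<Y : # Y′ < # Y
      Y′<Y = #-mono-< {i = y₁} (λ i i∈ → proj₁ (∧⁻ {X = Y} {λ y → X (u · y)} i∈)) y₁∈ λ p → xc∉ (subst (_∈ X)
        (word (x ∷ y₀ ∷ y₁ ∷ []) (v0 • v1 ⁱ • v2) (v0 • (v1 ⁱ • v2)) refl) (mem (_∈_.holds (proj₂ (∧⁻ {X = Y} {λ y → X (u · y)} p)))))
      u∈ : u ∈ A
      u∈ = ·∈ A-sub (X⊆A x x∈) (⁻∈ A-sub (Y⊆A y₀ y₀∈))
      X′⊆A : ∀ g → g ∈ X′ → g ∈ A
      X′⊆A g g∈ with ∪⁻ {X = X} {uY} g∈
      ... | inj₁ p = X⊆A g p
      ... | inj₂ (mem p) = cancelˡ∈ A-sub (⁻∈ A-sub u∈) (Y⊆A _ (mem p))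
      X′Y′⊆W : ∀ {g y} → g ∈ X′ → y ∈ Y′ → g · y ∈ W
      X′Y′⊆W {g} {y} g∈ y∈ with ∪⁻ {X = X} {uY} g∈ | ∧⁻ {X = Y} y∈
      ... | inj₁ p | yY , _ = XY⊆W p yY
      ... | inj₂ (mem p) | yY , mem uy = subst (_∈ W)
              (trans (cong (u · y ·_) refl) (trans (word (u ∷ y ∷ g ∷ []) (v0 • v1 • (v0 ⁱ • v2)) (v0 • (v1 • (v0 ⁱ • v2))) refl)
                (trans (cong (u ·_) (A-comm (Y⊆A y yY) (Y⊆A _ (mem p)))) (word (u ∷ y ∷ g ∷ []) (v0 • (v0 ⁱ • v2 • v1)) (v2 • v1) refl))))
              (XY⊆W (mem uy) (mem p))
    ...     | inj₂ full = inj₂ full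
    ...     | inj₁ sum  = inj₁ (≤-trans transform sum)
      where
      u = x · y₀ ⁻
      uY Y′ X′ : BSet order
      uY g = Y (u ⁻ · g)
      X′ = X ∪ uY
      Y′ = Y ∩ (λ y → X (u · y))
      transform : # X + # Y ≤ # X′ + # Y′
      transform = ≤-trans (+-monoʳ-≤ (# X) (injection-≤ (u ·_)
            (λ y y∈ → mem (_∈_.holds (subst (_∈ Y) (word (u ∷ y ∷ []) v1 (v0 ⁱ • (v0 • v1)) refl) y∈))) (λ i j _ _ → cancelˡ u)))
        (≤-trans (≤-reflexive (sym (#-∪-∩ X uY))) (+-monoʳ-≤ (# X′) (injection-≤ {X = X ∩ uY} (u ⁻ ·_)
          (λ g g∈ → let (gX , guY) = ∧⁻ {X = X} {uY} g∈ in ∧⁺ {X = Y} {λ y → X (u · y)} (mem (_∈_.holds guY))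
            (mem (_∈_.holds (subst (_∈ X) (word (u ∷ g ∷ []) v1 (v0 • (v0 ⁱ • v1)) refl) gX))))
          (λ i j _ _ → cancelˡ (u ⁻)))))

-- Products of the orderings of a subsequence

module Gains (G : FinGroup) (data′ : AffineData G) where

  open Affine G data′ public

  -- The orderings of L have at least s + 1 products (or the whole coset X v of A).
  record Gain (L : List E) (s : ℕ) : Set where
    field
      X     : BSet order
      v     : E
      X⊆A   : ∀ x → x ∈ X → x ∈ A
      reach : ∀ {x} → x ∈ X → Reach L (x · v)
      big   : suc s ≤ # X ⊎ q ≤ # X

  inhabited : ∀ {X : BSet order} → 1 ≤ # X → ∃ (_∈ X)
  inhabited {X} pos with ⊈-witness {X = λ _ → false} {X} (≤-trans (s≤s (#≤0 (λ { i (mem ()) }))) pos)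
  ... | i , i∈ , _ = i , i∈

  big⇒pos : ∀ {s n} → suc s ≤ n ⊎ q ≤ n → 1 ≤ n
  big⇒pos (inj₁ p) = ≤-trans (s≤s z≤n) p
  big⇒pos (inj₂ p) = ≤-trans 1≤q p

  gain-↭ : ∀ {L L′ s} → L ↭ L′ → Gain L s → Gain L′ s
  gain-↭ p g = record { Gain g ; reach = λ x∈ → reach-↭ p (Gain.reach g x∈) }

  private
    ProductSet? : ∀ (X Y : BSet order) g → Dec (∃[ x ] (x ∈ X × x ⁻ · g ∈ Y))
    ProductSet? X Y g = any? (λ x → (x ∈? X) ×-dec ((x ⁻ · g) ∈? Y))

  product-set : ∀ {X Y} → (∀ x → x ∈ X → x ∈ A) → (∀ y → y ∈ Y → y ∈ A) → ∃ (_∈ X) → ∃ (_∈ Y) →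
    ∃[ W ] ((∀ w → w ∈ W → ∃[ x ] ∃[ y ] (x ∈ X × y ∈ Y × w ≡ x · y)) × (# X + # Y ≤ suc (# W) ⊎ q ≤ # W))
  product-set {X} {Y} X⊆A Y⊆A nX nY = set (ProductSet? X Y)
    , (λ w w∈ → case ∈⁻ (ProductSet? X Y) w∈ of λ { (x , x∈ , y∈) →
        x , x ⁻ · w , x∈ , y∈ , word (x ∷ w ∷ []) v1 (v0 • (v0 ⁱ • v1)) refl })
    , cauchy-davenport X⊆A Y⊆A nX nY (λ {x} {y} x∈ y∈ → ∈⁺ (ProductSet? X Y)
        (x , x∈ , subst (_∈ Y) (word (x ∷ y ∷ []) v1 (v0 ⁱ • (v0 • v1)) refl) y∈))

  big-+ : ∀ {s t x y w} → suc s ≤ x ⊎ q ≤ x → suc t ≤ y ⊎ q ≤ y → x + y ≤ suc w ⊎ q ≤ w → suc (s + t) ≤ w ⊎ q ≤ w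
  big-+ _ _ (inj₂ p) = inj₂ p
  big-+ {s} {t} (inj₁ p) (inj₁ p′) (inj₁ r) = inj₁ (≤-pred (≤-trans (≤-reflexive (cong suc (sym (+-suc s t)))) (≤-trans (+-mono-≤ p p′) r)))
  big-+ {y = y} (inj₂ p) b (inj₁ r) = inj₂ (≤-trans p (≤-pred (≤-trans (+-monoˡ-≤ _ (big⇒pos b)) (≤-trans (≤-reflexive (+-comm y _)) r))))
  big-+ {x = x} {y} b@(inj₁ _) (inj₂ p) (inj₁ r) = inj₂ (≤-trans p (≤-pred (≤-trans (+-monoˡ-≤ y (big⇒pos b)) r)))

  gain-++ : ∀ {L L′ s t} → Gain L s → Gain L′ t → Gain (L ++ L′) (s + t)
  gain-++ {L} {L′} {s} {t} g g′ = record
    { X = proj₁ prod-set ; v = v · v′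
    ; X⊆A = λ w w∈ → case proj₁ (proj₂ prod-set) w w∈ of λ { (x , y , x∈ , y∈ , refl) → ·∈ A-sub (X⊆A x x∈) (Y⊆A y y∈) }
    ; reach = λ {w} w∈ → case proj₁ (proj₂ prod-set) w w∈ of λ { (x , y , x∈ , mem y∈ , refl) →
        subst (Reach (L ++ L′)) (word (x ∷ y ∷ v ∷ v′ ∷ []) (v0 • v2 • (v2 ⁱ • v1 • v2 ⁱ ⁱ • v3)) (v0 • v1 • (v2 • v3)) refl)
          (reach-++ (reach x∈) (reach′ (mem y∈))) }
    ; big = big-+ big ([ (λ p → inj₁ (≤-trans p X′≤Y)) , (λ p → inj₂ (≤-trans p X′≤Y)) ]′ big′) (proj₂ (proj₂ prod-set)) }
    where
    open Gain g
    open Gain g′ renaming (X to X′; v to v′; X⊆A to X′⊆A; reach to reach′; big to big′)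
    -- A product (x v)(x′ v′) equals x · conj v x′ · (v v′), so the second set enters conjugated by
    -- `v`.
    Y : BSet order
    Y y = X′ (conj (v ⁻) y)
    X′≤Y : # X′ ≤ # Y
    X′≤Y = injection-≤ (conj v) (λ x x∈ → mem (_∈_.holds (subst (_∈ X′) (word (v ∷ x ∷ []) v1 (v0 ⁱ • (v0 • v1 • v0 ⁱ) • v0 ⁱ ⁱ) refl) x∈)))
      (λ i j _ _ e → cancelˡ v (cancelʳ (v ⁻) e))
    Y⊆A : ∀ y → y ∈ Y → y ∈ A
    Y⊆A y (mem y∈) = subst (_∈ A) (word (v ∷ y ∷ []) (v0 • (v0 ⁱ • v1 • v0 ⁱ ⁱ) • v0 ⁱ) v1 refl) (conj-A v (X′⊆A _ (mem y∈)))
    prod-set = product-set X⊆A Y⊆A (inhabited (big⇒pos big)) (inhabited (≤-trans (big⇒pos big′) X′≤Y))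

  gain-distinct : ∀ {L} g gs → AllPairs _≢_ (g ∷ gs) → All (Reach L) (g ∷ gs) → Gain L (length gs)
  gain-distinct {L} g gs ne rs = record
    { X = set X? ; v = v
    ; X⊆A = λ x x∈ → All.lookupWith (λ r e → subst (_∈ A) (trans (cong (_· v ⁻) (sym e)) (word (x ∷ v ∷ []) (v0 • v1 • v1 ⁱ) v0 refl)) (reach-mod r)) rs (∈⁻ X? x∈)
    ; reach = λ {x} x∈ → All.lookupWith (λ r e → subst (Reach L) (sym e) r) rs (∈⁻ X? x∈)
    ; big = inj₁ (subst (_≤ # (set X?)) (length-map (_· v ⁻) (g ∷ gs)) (distinct-≤ (map (_· v ⁻) (g ∷ gs))
        (AllPairsₚ.map⁺ (AllPairs.map (λ n e → n (cancelʳ (v ⁻) e)) ne))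
        (Allₚ.map⁺ (All.tabulate (λ {x} x∈ → ∈⁺ X? (Any.map (λ { refl → word (x ∷ v ∷ []) (v0 • v1 ⁱ • v1) v0 refl }) x∈)))))) }
    where
    v = ∏ L
    X? : ∀ x → Dec (Any (λ g → x · v ≡ g) (g ∷ gs))
    X? x = Any.any? (λ g → x · v ≟ g) (g ∷ gs)

  gain-0 : ∀ L → Gain L 0
  gain-0 L = gain-distinct (∏ L) [] ([] ∷ []) ((L , ↭-refl , refl) ∷ [])

  gain-pair : ∀ {x y} → ¬ Comm x y → Gain (x ∷ y ∷ []) 1
  gain-pair {x} {y} nc = gain-distinct (x · y) (y · x ∷ []) ((nc ∷ []) ∷ [] ∷ [])
    ((x ∷ y ∷ [] , ↭-refl , cong (x ·_) (ε-right y)) ∷ (y ∷ x ∷ [] , swap y x ↭-refl , cong (y ·_) (ε-right x)) ∷ [])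

  private
    triple : ∀ a b c → ∏ (a ∷ b ∷ c ∷ []) ≡ a · b · c
    triple a b c = word (a ∷ b ∷ c ∷ []) (v0 • (v1 • (v2 • 𝟙))) (v0 • v1 • v2) refl

  -- If `x · x′` does not commute with `y`, then `y` can stand after, between or before the two.
  -- Otherwise `x · x′` is central, and the three products are y x x′, x y x′ and x′ y x; the last
  -- two would agree only if `x · x` commuted with `y`.
  gain-triple : ∀ {x x′ y} → ¬ Comm x y → ¬ Comm x′ y → Comm x x′ → x · x ∉ Z → Gain (y ∷ x ∷ x′ ∷ []) 2
  gain-triple {x} {x′} {y} nc nc′ c x²∉Z with comm? (x · x′) y
  ... | no nc″ = gain-distinct (x · x′ · y) (x · y · x′ ∷ y · x · x′ ∷ [])
      (((λ e → nc′ (cancelˡ x (trans (sym (·-assoc x x′ y)) (trans e (·-assoc x y x′))))) ∷ (λ e → nc″ (trans e (·-assoc y x x′))) ∷ [])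
       ∷ ((λ e → nc (cancelʳ x′ e)) ∷ []) ∷ [] ∷ [])
      ((x ∷ x′ ∷ y ∷ [] , ++-comm (x ∷ x′ ∷ []) (y ∷ []) , triple x x′ y) ∷ (x ∷ y ∷ x′ ∷ [] , swap x y ↭-refl , triple x y x′) ∷ (y ∷ x ∷ x′ ∷ [] , ↭-refl , triple y x x′) ∷ [])
  ... | yes c″ = gain-distinct (y · x · x′) (x · y · x′ ∷ x′ · y · x ∷ [])
      (((λ e → nc (sym (cancelʳ x′ e))) ∷ (λ e → nc′ (sym (cancelʳ x (trans (·-assoc y x′ x) (trans (cong (y ·_) (sym c)) (trans (sym (·-assoc y x x′)) e)))))) ∷ [])
       ∷ (distinct ∷ []) ∷ [] ∷ [])
      ((y ∷ x ∷ x′ ∷ [] , ↭-refl , triple y x x′) ∷ (x ∷ y ∷ x′ ∷ [] , swap x y ↭-refl , triple x y x′) ∷ (x′ ∷ y ∷ x ∷ [] , ↭-trans (swap x′ y ↭-refl) (prep y (swap x′ x ↭-refl)) , triple x′ y x) ∷ [])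
    where
    xx′∈Z : x · x′ ∈ Z
    xx′∈Z = decidable-stable ((x · x′) ∈? Z) λ n → nc (comm-trans n (comm-· refl c) c″)
    distinct : x · y · x′ ≢ x′ · y · x
    distinct e = nc (comm-trans x²∉Z (comm-· refl refl) (trans (·-assoc x x y) (trans (cong (x ·_) (cancelʳ x′ (begin
      x · y · x′                       ≡⟨ e ⟩
      x′ · y · x                       ≡⟨ word (x ∷ x′ ∷ y ∷ []) (v1 • v2 • v0) (v0 ⁱ • (v0 • v1 • (v2 • v0))) refl ⟩
      x ⁻ · (x · x′ · (y · x))         ≡⟨ cong (x ⁻ ·_) (centre⁻ xx′∈Z (y · x)) ⟩
      x ⁻ · (y · x · (x · x′))         ≡⟨ word (x ∷ x′ ∷ y ∷ []) (v0 ⁱ • (v2 • v0 • (v0 • v1))) (v0 ⁱ • (v2 • (v0 • v0)) • v1) refl ⟩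
      x ⁻ · (y · (x · x)) · x′         ∎))) (word (x ∷ y ∷ []) (v0 • (v0 ⁱ • (v1 • (v0 • v0)))) (v1 • (v0 • v0)) refl))))
      where open ≡-Reasoning

  nontrivial-commutator : ∀ {v a} → ¬ Comm v a → v · a · (a · v) ⁻ ≢ ε
  nontrivial-commutator {v} {a} nc e = nc (cancelʳ ((a · v) ⁻) (trans e (sym (⁻-right (a · v)))))

  -- All products collected lie outside `M`. A further noncentral term of `M` commutes with none of
  -- them, so placing it before or after gives different results.
  record HostGain (L : List E) (s : ℕ) : Set where
    field
      gain : Gain L s
      v∉   : Gain.v gain ∉ M

  host : ∀ {x} → x ∉ M → HostGain (x ∷ []) 0
  host {x} x∉ = record { gain = gain-0 (x ∷ []) ; v∉ = λ p → x∉ (subst (_∈ M) (ε-right x) p) }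

  noncommuting : ∀ {v a} → v ∉ M → a ∈ M → a ∉ Z → ¬ Comm v a
  noncommuting v∉ a∈ a∉ c = a∉ (M∩C⊆Z a∈ v∉ c)

  -- The new term a may be put on either end.
  host-∷ : ∀ {L s a} → HostGain L s → a ∈ M → a ∉ Z → HostGain (a ∷ L) (suc s)
  host-∷ {L} {s} {a} h a∈ a∉ = record
    { gain = record
      { X = proj₁ prod-set ; v = a · v
      ; X⊆A = λ w w∈ → case proj₁ (proj₂ prod-set) w w∈ of λ { (x , y , x∈ , y∈ , refl) → ·∈ A-sub (X⊆A x x∈) (D⊆A y y∈) }
      ; reach = λ {w} w∈ → case proj₁ (proj₂ prod-set) w w∈ of λ { (x , y , x∈ , y∈ , refl) → reach′ x y x∈ (∈⁻ D? y∈) }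
      ; big = subst (λ t → suc t ≤ # (proj₁ prod-set) ⊎ q ≤ # (proj₁ prod-set)) (+-comm s 1)
                (big-+ big (inj₁ (distinct-≤ (ε ∷ c ∷ []) (((λ e → c≢ε (sym e)) ∷ []) ∷ [] ∷ []) (∈⁺ D? (inj₁ refl) ∷ ∈⁺ D? (inj₂ refl) ∷ []))) (proj₂ (proj₂ prod-set))) }
    ; v∉ = λ p → v∉ (cancelˡ∈ M-sub a∈ p) }
    where
    open HostGain h
    open Gain gain
    c = v · a · (a · v) ⁻
    c≢ε : c ≢ ε
    c≢ε = nontrivial-commutator (noncommuting v∉ a∈ a∉)
    D? : ∀ y → Dec (y ≡ ε ⊎ y ≡ c)
    D? y = (y ≟ ε) ⊎-dec (y ≟ c)
    D⊆A : ∀ y → y ∈ set D? → y ∈ A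
    D⊆A y y∈ with ∈⁻ D? y∈
    ... | inj₁ refl = ε∈ A-sub
    ... | inj₂ refl = commutator v a
    prod-set = product-set X⊆A D⊆A (inhabited (big⇒pos big)) (ε , ∈⁺ D? (inj₁ refl))
    reach′ : ∀ x y → x ∈ X → y ≡ ε ⊎ y ≡ c → Reach (a ∷ L) (x · y · (a · v))
    reach′ x y x∈ (inj₁ refl) = subst (Reach (a ∷ L)) (trans (cong (_· (x · v)) (ε-right a)) (trans (sym (·-assoc a x v)) (trans (cong (_· v) (centraliser⁻ a∈ x (X⊆A x x∈)))
        (word (x ∷ a ∷ v ∷ []) (v0 • v1 • v2) (v0 • 𝟙 • (v1 • v2)) refl)))) (reach-++ (a ∷ [] , ↭-refl , refl) (reach x∈))
    reach′ x y x∈ (inj₂ refl) = reach-↭ (++-comm L (a ∷ [])) (subst (Reach (L ++ a ∷ []))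
        (word (x ∷ a ∷ v ∷ []) (v0 • v2 • (v1 • 𝟙)) (v0 • (v2 • v1 • (v1 • v2) ⁱ) • (v1 • v2)) refl) (reach-++ (reach x∈) (a ∷ [] , ↭-refl , refl)))

  host-all : ∀ {L s as} → HostGain L s → All (λ a → a ∈ M × a ∉ Z) as → HostGain (as ++ L) (length as + s)
  host-all h [] = h
  host-all h ((a∈ , a∉) ∷ as) = host-∷ (host-all h as) a∈ a∉

  -- Modulo `A` the order of the terms is irrelevant, and both `S` and `U` have product `ε` there.
  -- So the inverse of `∏ W` lies in the coset of `A` realised by `J`, and `J ++ W` can be ordered
  -- to have product `ε` as well.
  saturated : ∀ {S J R s} → MinimalProductOne G S → S ↭ J ++ R → 0 < length J → Gain J s → q ≤ suc s → Free R
  saturated {S} {J} {R} (_ , (T , T↭S , e) , minimal) S↭ J≠[] g q≤ U W R↭ U≠[] (U′ , U′↭ , eU) =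
    minimal (U , J ++ W , S↭U , U≠[] , (λ { eq → <⇒≱ J≠[] (≤-trans (m≤m+n (length J) (length W)) (≤-reflexive (trans (sym (length-++ J)) (cong length eq)))) })
            , (U′ , U′↭ , eU) , subst (Reach (J ++ W)) final (reach-++ (reach w⁻v⁻∈) (W , ↭-refl , refl)))
    where
    open Gain g
    S↭U : S ↭ U ++ (J ++ W)
    S↭U = ↭-trans S↭ (↭-trans (++⁺ˡ J R↭) (↭-trans (↭-reflexive (sym (++-assoc J U W))) (↭-trans (++⁺ʳ W (++-comm J U)) (↭-reflexive (++-assoc U J W)))))
    w = ∏ W
    x₀ = proj₁ (inhabited (big⇒pos big))
    x₀∈ = proj₂ (inhabited (big⇒pos big))
    x₀vw : ε · (ε · (x₀ · v · w)) ⁻ ∈ A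
    x₀vw with reach x₀∈
    ... | J′ , J′↭ , eJ = subst (_∈ A) (cong₂ (λ a b → a · b ⁻) e (trans (∏-++ U′ (J′ ++ W)) (cong₂ _·_ eU (trans (∏-++ J′ W) (cong (_· w) eJ)))))
            (∏-↭-mod (↭-trans T↭S (↭-trans S↭U (↭-sym (++⁺ U′↭ (++⁺ʳ W J′↭))))))
    w⁻v⁻∈A : w ⁻ · v ⁻ ∈ A
    w⁻v⁻∈A = subst (_∈ A) (word (x₀ ∷ v ∷ w ∷ []) (𝟙 • (𝟙 • (v0 • v1 • v2)) ⁱ • v0) (v2 ⁱ • v1 ⁱ) refl) (·∈ A-sub x₀vw (X⊆A x₀ x₀∈))
    w⁻v⁻∈ : w ⁻ · v ⁻ ∈ X
    w⁻v⁻∈ = decidable-stable ((w ⁻ · v ⁻) ∈? X) λ n →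
      <⇒≱ (#-mono-< X⊆A w⁻v⁻∈A n) ([ ≤-trans q≤ , id ]′ big)
    final : w ⁻ · v ⁻ · v · w ≡ ε
    final = word (v ∷ w ∷ []) (v1 ⁱ • v0 ⁱ • v0 • v1) 𝟙 refl

-- Length of product-one free sequences

module FreeBound (G : FinGroup) (data′ : AffineData G) where

  open Gains G data′ public

  free-↭ : ∀ {R R′} → R ↭ R′ → Free R → Free R′
  free-↭ p f U W R′↭ = f U W (↭-trans p R′↭)

  -- Blocks cut from a free sequence move to `B`; the size of `X` measures how much of `A` the
  -- products of subsequences of `B` already fill.
  record Spread (B : List E) (X : BSet order) : Set where
    field
      X≠∅ : ∃ (_∈ X)
      X⊆A : ∀ x → x ∈ X → x ∈ A
      sub : ∀ {x} → x ∈ X → ∃[ U ] ∃[ W ] (B ↭ U ++ W × Reach U x)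

  private
    prefix-split : ∀ L → All (λ p → ∃[ u ] ∃[ w ] (L ≡ u ++ w × ∏ u ≡ p)) (properPrefixes L)
    prefix-split []      = []
    prefix-split (x ∷ L) = ([] , x ∷ L , refl , refl)
      ∷ Allₚ.map⁺ (All.map (λ { (u , w , refl , refl) → x ∷ u , w , refl , refl }) (prefix-split L))

    rearrange : ∀ {B : List E} U W pre body post → B ↭ U ++ W → B ++ (pre ++ body ++ post) ↭ (U ++ body) ++ (W ++ (pre ++ post))
    rearrange {B} U W pre body post p = begin
      B ++ (pre ++ body ++ post)          ↭⟨ ++⁺ p (shifts pre body) ⟩
      (U ++ W) ++ (body ++ (pre ++ post)) ≡⟨ ++-assoc U W _ ⟩
      U ++ (W ++ (body ++ (pre ++ post))) ↭⟨ ++⁺ˡ U (shifts W body) ⟩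
      U ++ (body ++ (W ++ (pre ++ post))) ≡⟨ ++-assoc U body _ ⟨
      (U ++ body) ++ (W ++ (pre ++ post)) ∎
      where open ↭.PermutationReasoning

  module _ {a : E} (a∈ : a ∈ A) (a≢ε : a ≢ ε) where

    private
      turn : E → E
      turn g = conj (g ⁻) a

      same-turn : ∀ {g g₀} → turn g ≡ turn g₀ → g · g₀ ⁻ ∈ M
      same-turn {g} {g₀} eq = commutes-A a∈ a≢ε (comm-conj (trans (word (g ∷ g₀ ∷ a ∷ [])
        (v0 • v1 ⁱ • v2 • (v0 • v1 ⁱ) ⁱ) (v0 • (v1 ⁱ • v2 • v1 ⁱ ⁱ) • v0 ⁱ) refl) (trans (cong (λ w → g · w · g ⁻) (sym eq))
          (word (g ∷ a ∷ []) (v0 • (v0 ⁱ • v1 • v0 ⁱ ⁱ) • v0 ⁱ) v1 refl))))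

    turn-fibre : ∀ (K : BSet order) j → # (λ g → K g ∧ ⌊ turn g ≟ j ⌋) ≤ # M
    turn-fibre K j with any? (λ g → turn g ≟ j)
    ... | no ¬p = ≤-trans (#≤0 λ g g∈ → ¬p (g , ∈⁻ (λ g → turn g ≟ j) (proj₂ (∧⁻ {X = K} {λ g → ⌊ turn g ≟ j ⌋} g∈)))) z≤n
    ... | yes (g₀ , e₀) = injection-≤ (_· g₀ ⁻) (λ g g∈ → same-turn (trans (∈⁻ (λ g → turn g ≟ j)
            (proj₂ (∧⁻ {X = K} {λ g → ⌊ turn g ≟ j ⌋} g∈))) (sym e₀))) (λ i j _ _ → cancelʳ (g₀ ⁻))

    -- All elements of the coset of `A` through `p` conjugate `a` in the same way, since `A` is
    -- abelian, and at most `# M`, that is z q, elements of the group give the same conjugate.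
    conjugates-≥ : ∀ (D : BSet order) L → AllPairs (Apart A) L → All (λ p → conj (p ⁻) a ∈ D) L → length L ≤ z * # D
    conjugates-≥ D L apart in-D = *-cancelʳ-≤ (length L) (z * # D) q {{>-nonZero 1≤q}} (begin
      length L * q      ≤⟨ cosets-≤ A-sub K L apart (All.map (λ {p} p∈ h h∈ → ∈⁺ K? (subst (_∈ D) (sym (absorb p h h∈)) p∈)) in-D) ⟩
      # K               ≤⟨ fibres-≤ {X = K} {D} turn (# M) (λ g g∈ → ∈⁻ K? g∈) (λ j _ → turn-fibre K j) ⟩
      # M * # D         ≡⟨ cong (_* # D) #M ⟩
      z * q * # D       ≡⟨ exchange z q (# D) ⟩
      z * # D * q       ∎)
      where
      open ≤-Reasoning
      exchange : ∀ a b c → a * b * c ≡ a * c * b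
      exchange = solve-∀
      K? : ∀ g → Dec (turn g ∈ D)
      K? g = turn g ∈? D
      K : BSet order
      K = set K?
      absorb : ∀ p h → h ∈ A → turn (p · h) ≡ turn p
      absorb p h h∈ = trans (word (p ∷ h ∷ a ∷ []) ((v0 • v1) ⁱ • v2 • (v0 • v1) ⁱ ⁱ) (v1 ⁱ • (v0 ⁱ • v2 • v0 ⁱ ⁱ) • v1 ⁱ ⁱ) refl)
        (conj-comm (A-comm (⁻∈ A-sub h∈) (conj-A (p ⁻) a∈)))

    -- The conjugates of `a` are among the q - 1 nontrivial elements of `A`, and each arises from at
    -- most `# M` conjugating elements.
    e<q : e < q
    e<q = *-cancelʳ-< (# M) e q (≤-<-trans (≤-reflexive (sym index-e)) (≤-<-trans
      (≤-trans (≤-reflexive (sym #-full)) (fibres-≤ {X = full} {D} turn (# M) (λ g _ → ∈⁺ D? (conj-A (g ⁻) a∈ , λ eq → a≢ε (trans (word (g ∷ a ∷ []) v1 (v0 • (v0 ⁱ • v1 • v0 ⁱ ⁱ) • v0 ⁱ) refl)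
        (trans (cong (λ w → g · w · g ⁻) eq) (word (g ∷ []) (v0 • 𝟙 • v0 ⁱ) 𝟙 refl))))) (λ j _ → turn-fibre full j)))
      (≤-trans (≤-reflexive (cong suc (*-comm (# M) (# D)))) (*-monoˡ-< (# M) {{>-nonZero (1≤#H M-sub)}} D<A))))
      where
      D? : ∀ x → Dec (x ∈ A × x ≢ ε)
      D? x = (x ∈? A) ×-dec ¬? (x ≟ ε)
      D : BSet order
      D = set D?
      D<A : # D < q
      D<A = #-mono-< {i = ε} (λ x x∈ → proj₁ (∈⁻ D? x∈)) (ε∈ A-sub) λ p → proj₂ (∈⁻ D? p) refl

  spread-∅ : Spread [] trivial
  spread-∅ = record { X≠∅ = ε , ε∈ trivial-sub ; X⊆A = λ x x∈ → subst (_∈ A) (sym (∈⁻ (_≟ ε) x∈)) (ε∈ A-sub)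
                    ; sub = λ x∈ → [] , [] , refl , ([] , refl , sym (∈⁻ (_≟ ε) x∈)) }

  -- `X` is multiplied by `D` together with `ε`. Freeness keeps `ε` out of `D`, so Cauchy-Davenport
  -- yields `# D` further elements.
  spread-∷ : ∀ {B X body D pre post} → Spread B X → Free (B ++ (pre ++ body ++ post)) → 0 < length body →
    (∀ d → d ∈ D → d ∈ A) → (∀ {d} → d ∈ D → Reach body d) →
    ∃[ W ] (Spread (B ++ body) W × # X + # D ≤ # W)
  spread-∷ {B} {X} {body} {D} {pre} {post} spread free body≠[] D⊆A reachD =
      W , record { X≠∅ = inhabited (≤-trans (≤-trans (1≤# (proj₂ X≠∅)) (m≤m+n _ _)) large)
                 ; X⊆A = λ w w∈ → case W-elim w w∈ of λ { (x , y , x∈ , y∈ , refl) → ·∈ A-sub (X⊆A x x∈) (D₁⊆A y y∈) }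
                 ; sub = λ {w} w∈ → case W-elim w w∈ of λ { (x , y , x∈ , y∈ , refl) → sub′ x y x∈ (∪⁻ {X = trivial} {D} y∈) } }
        , large
    where
    open Spread spread
    ε∉D : ∀ i → i ∈ trivial → i ∉ D
    ε∉D i i≡ε i∈D = free body (B ++ (pre ++ post)) (rearrange [] B pre body post ↭-refl)
      (nonempty-length body≠[]) (subst (Reach body) (∈⁻ (_≟ ε) i≡ε) (reachD i∈D))
    -- This covers the case that the product set is all of `A`: an element of `X` inverse to one of
    -- `D` would give a product-one subsequence, so `X` is disjoint from the inverses of `D`.
    disjoint : # X + # D ≤ q
    disjoint = ≤-trans (+-monoʳ-≤ (# X) (injection-≤ {Y = λ y → D (y ⁻)} _⁻ (λ d d∈ → mem (_∈_.holds (subst (_∈ D) (word (d ∷ []) v0 (v0 ⁱ ⁱ) refl) d∈)))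
        (λ i j _ _ eq → trans (word (i ∷ []) v0 (v0 ⁱ ⁱ) refl) (trans (cong _⁻ eq) (word (j ∷ []) (v0 ⁱ ⁱ) v0 refl)))))
      (disjoint-≤ {X = X} {λ y → D (y ⁻)} (λ { i i∈X (mem i∈D) → case sub i∈X of λ { (U , W , B↭ , r) →
          free (U ++ body) (W ++ (pre ++ post)) (rearrange U W pre body post B↭)
            (nonempty-length (≤-trans body≠[] (≤-trans (m≤n+m _ (length U)) (≤-reflexive (sym (length-++ U))))))
            (subst (Reach (U ++ body)) (⁻-right i) (reach-++ r (reachD (mem i∈D)))) } })
        X⊆A (λ { i (mem i∈) → subst (_∈ A) (word (i ∷ []) (v0 ⁱ ⁱ) v0 refl) (⁻∈ A-sub (D⊆A _ (mem i∈))) }))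
    D₁ = trivial ∪ D
    D₁⊆A : ∀ y → y ∈ D₁ → y ∈ A
    D₁⊆A y y∈ with ∪⁻ {X = trivial} {D} y∈
    ... | inj₁ p = subst (_∈ A) (sym (∈⁻ (_≟ ε) p)) (ε∈ A-sub)
    ... | inj₂ p = D⊆A y p
    prod-set = product-set X⊆A D₁⊆A X≠∅ (ε , ∪⁺ {X = trivial} {D} (inj₁ (ε∈ trivial-sub)))
    W = proj₁ prod-set
    W-elim = proj₁ (proj₂ prod-set)
    #D₁ : # D₁ ≡ suc (# D)
    #D₁ = trans (#-disjoint trivial D ε∉D) (cong (_+ # D) #-trivial)
    large : # X + # D ≤ # W
    large = [ (λ p → ≤-pred (≤-trans (≤-reflexive (trans (sym (+-suc (# X) (# D))) (cong (# X +_) (sym #D₁)))) p)) , ≤-trans disjoint ]′ (proj₂ (proj₂ prod-set))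
    sub′ : ∀ x y → x ∈ X → y ∈ trivial ⊎ y ∈ D → ∃[ U ] ∃[ V ] (B ++ body ↭ U ++ V × Reach U (x · y))
    sub′ x y x∈ (inj₁ p) with sub x∈
    ... | U , V , B↭ , r = U , V ++ body , ↭-trans (++⁺ʳ body B↭) (↭-reflexive (++-assoc U V body))
        , subst (Reach U) (sym (trans (cong (x ·_) (∈⁻ (_≟ ε) p)) (ε-right x))) r
    sub′ x y x∈ (inj₂ p) with sub x∈
    ... | U , V , B↭ , r = U ++ body , V , ↭-trans (++⁺ʳ body B↭) (↭-trans (↭-reflexive (++-assoc U V body))
            (↭-trans (++⁺ˡ U (++-comm V body)) (↭-reflexive (sym (++-assoc U body V))))) , reach-++ r (reachD p)

  -- As long as `R` has e z terms, the index of `A`, it contains a block with product in `A`. A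
  -- block of k terms has at least k / z conjugates of its product and enlarges `X` by as many; but
  -- `X` stays inside `A`, and in the end fewer than e z terms are left.
  free-bound : ∀ R {B X} → Spread B X → Free (B ++ R) → length R + z * # X + 1 ≤ z * q + e * z
  free-bound R = go R (<-wellFounded (length R))
    where
    go : ∀ R → Acc _<_ (length R) → ∀ {B X} → Spread B X → Free (B ++ R) → length R + z * # X + 1 ≤ z * q + e * z
    go R (acc rec) {B} {X} spread free with e * z ≤? length R
    ... | no small = ≤-trans (≤-reflexive (l (length R) (z * # X))) (+-mono-≤ (*-monoʳ-≤ z (#-mono (Spread.X⊆A spread))) (≰⇒> small))
      where
      l : ∀ r x → r + x + 1 ≡ x + suc r
      l = solve-∀
    ... | yes long with block-exists A-sub full-sub (λ _ _ → ∈-full) {R} (All.tabulate (λ _ → ∈-full))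
                 (≤-trans (≤-reflexive (trans #-full (trans order-≡ (sym (*-assoc e z q))))) (*-monoˡ-≤ q long))
    ...   | record { pre = pre ; body = body ; post = post ; split = refl ; nonempty = ne ; product = a∈ ; tight = tight } =
        conclude (spread-∷ {D = D} {pre} {post} spread free ne D⊆A reachD)
      where
      a = ∏ body
      a≢ε : a ≢ ε
      a≢ε eq = free body (B ++ (pre ++ post)) (rearrange [] B pre body post ↭-refl) (nonempty-length ne) (body , ↭-refl , eq)
      D? : ∀ d → Dec (Any (λ p → conj (p ⁻) a ≡ d) (properPrefixes body))
      D? d = Any.any? (λ p → conj (p ⁻) a ≟ d) (properPrefixes body)
      D : BSet order
      D = set D?
      D⊆A : ∀ d → d ∈ D → d ∈ A
      D⊆A d d∈ with Any.satisfied (∈⁻ D? d∈)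
      ... | p , refl = conj-A (p ⁻) a∈
      -- Rotating the body conjugates its product by one of its prefix products.
      reachD : ∀ {d} → d ∈ D → Reach body d
      reachD {d} d∈ = All.lookupWith rotate (prefix-split body) (∈⁻ D? d∈)
        where
        rotate : ∀ {p} → ∃[ u ] ∃[ w ] (body ≡ u ++ w × ∏ u ≡ p) → conj (p ⁻) a ≡ d → Reach body d
        rotate (u , w , eq , refl) refl = w ++ u , ↭-trans (++-comm w u) (↭-reflexive (sym eq))
          , trans (∏-++ w u) (trans (word (∏ u ∷ ∏ w ∷ []) (v1 • v0) (v0 ⁱ • (v0 • v1) • v0 ⁱ ⁱ) refl)
              (cong (λ x → (∏ u) ⁻ · x · (∏ u) ⁻ ⁻) (trans (sym (∏-++ u w)) (cong ∏ (sym eq)))))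
      k≤ : length body ≤ z * # D
      k≤ = subst (_≤ z * # D) (length-properPrefixes body) (conjugates-≥ a∈ a≢ε D (properPrefixes body) tight
        (All.tabulate (λ p∈ → ∈⁺ D? (Any.map (cong (λ p → conj (p ⁻) a) ∘ sym) p∈))))
      lengths : length (pre ++ body ++ post) ≡ length body + length (pre ++ post)
      lengths = trans (↭-length (shifts pre body {post})) (length-++ body)
      conclude : ∃[ W ] (Spread (B ++ body) W × # X + # D ≤ # W) → length (pre ++ body ++ post) + z * # X + 1 ≤ z * q + e * z
      conclude (W , spread′ , large) = ≤-trans (begin
        length (pre ++ body ++ post) + z * # X + 1        ≡⟨ cong (λ l → l + z * # X + 1) lengths ⟩
        length body + length (pre ++ post) + z * # X + 1  ≤⟨ +-monoˡ-≤ 1 (+-monoˡ-≤ (z * # X) (+-monoˡ-≤ (length (pre ++ post)) k≤)) ⟩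
        z * # D + length (pre ++ post) + z * # X + 1      ≡⟨ l z (# D) (length (pre ++ post)) (# X) ⟩
        length (pre ++ post) + z * (# X + # D) + 1        ≤⟨ +-monoˡ-≤ 1 (+-monoʳ-≤ (length (pre ++ post)) (*-monoʳ-≤ z large)) ⟩
        length (pre ++ post) + z * # W + 1                ∎)
        (go (pre ++ post) (rec (≤-trans (+-monoˡ-≤ (length (pre ++ post)) ne) (≤-reflexive (sym lengths)))) spread′
          (free-↭ (↭-trans (++⁺ˡ B (shifts pre body)) (↭-reflexive (sym (++-assoc B body (pre ++ post))))) free))
        where
        open ≤-Reasoning
        l : ∀ z d r x → z * d + r + z * x + 1 ≡ r + z * (x + d) + 1
        l = solve-∀

-- Noncommuting pairs and runs of commuting terms

module Sequences (G : FinGroup) (data′ : AffineData G) where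

  open FreeBound G data′ public

  flat : List (E × E) → List E
  flat ps = concat (map (λ (x , y) → x ∷ y ∷ []) ps)

  flat-↭ : ∀ {ps ps′} → ps ↭ ps′ → flat ps ↭ flat ps′
  flat-↭ p = concat-↭ (map⁺ (λ (x , y) → x ∷ y ∷ []) p)

  length-flat : ∀ ps → length (flat ps) ≡ 2 * length ps
  length-flat []       = refl
  length-flat (p ∷ ps) = trans (cong (2 +_) (length-flat ps)) (sym (*-suc 2 (length ps)))

  Pairs : ℕ → List E → Set
  Pairs t L = ∃[ ps ] ∃[ R ] (length ps ≡ t × All (λ (x , y) → ¬ Comm x y) ps × L ↭ flat ps ++ R)

  outside? : ∀ x y → Dec (¬ Comm x y)
  outside? x y = ¬? (comm? x y)

  others : E → List E → ℕ
  others x = count (outside? x)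

  gain-flat : ∀ {ps} → All (λ (x , y) → ¬ Comm x y) ps → Gain (flat ps) (length ps)
  gain-flat []         = gain-0 []
  gain-flat (nc ∷ ncs) = gain-++ (gain-pair nc) (gain-flat ncs)

  private
    free-pairs : ∀ x ps → All (λ (u , v) → ¬ (¬ Comm x u × ¬ Comm x v)) ps → others x (flat ps) ≤ length ps
    free-pairs x [] [] = z≤n
    free-pairs x ((u , v) ∷ ps) (n ∷ ns) with comm? x u | comm? x v
    ... | yes _ | yes _ = m≤n⇒m≤1+n (free-pairs x ps ns)
    ... | yes _ | no _  = s≤s (free-pairs x ps ns)
    ... | no _  | yes _ = s≤s (free-pairs x ps ns)
    ... | no nu | no nv = ⊥-elim (n (nu , nv))

  -- If no larger matching is found, the unmatched terms all commute, and each matched pair has a term commuting with them.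
  matching : ∀ t L → All (_∉ Z) L → 2 * t ≤ length L → Pairs t L ⊎ ∃[ x ] ∃[ L′ ] (L ↭ x ∷ L′ × others x L < t)
  matching zero L noncentral long = inj₁ ([] , L , refl , [] , ↭-refl)
  matching (suc t) L noncentral long with matching t L noncentral (≤-trans (*-monoʳ-≤ 2 (n≤1+n t)) long)
  ... | inj₂ (x , L′ , perm , lt) = inj₂ (x , L′ , perm , m≤n⇒m≤1+n lt)
  ... | inj₁ (ps , R , refl , ncs , perm) = step R perm (+-cancelˡ-≤ (length (flat ps)) 2 (length R)
          (≤-trans (≤-reflexive (trans (cong (_+ 2) (length-flat ps)) (trans (+-comm _ 2) (sym (*-suc 2 (length ps))))))
            (≤-trans long (≤-reflexive (trans (↭-length perm) (length-++ (flat ps)))))))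
    where
    step : ∀ R → L ↭ flat ps ++ R → 2 ≤ length R → Pairs (suc (length ps)) L ⊎ ∃[ x ] ∃[ L′ ] (L ↭ x ∷ L′ × others x L < suc (length ps))
    step (r ∷ R) perm (s≤s R≠[]) with Any.any? (outside? r) R
    ... | yes found with extract found
    ...   | r′ , R′ , nc , R↭ = inj₁ ((r , r′) ∷ ps , R′ , refl , nc ∷ ncs
            , ↭-trans perm (↭-trans (++⁺ˡ (flat ps) (prep r R↭)) (shifts (flat ps) (r ∷ r′ ∷ []))))
    step (r ∷ R) perm (s≤s R≠[]) | no none with Any.any? (λ (u , v) → outside? r u ×-dec outside? r v) ps
    ... | no none′ = inj₂ (r , flat ps ++ R , ↭-trans perm (shift r (flat ps) R)
          , s≤s (≤-trans (≤-reflexive (trans (count-↭ (outside? r) perm) (trans (count-++ (outside? r) (flat ps) (r ∷ R))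
              (trans (cong (others r (flat ps) +_) (count-none (outside? r) ((λ n → n refl) ∷ Allₚ.¬Any⇒All¬ R none))) (+-identityʳ _)))))
              (free-pairs r ps (Allₚ.¬Any⇒All¬ ps none′))))
    -- Two unmatched terms `r` and `r′` break up a pair `(u , v)` whose members both fail to commute
    -- with `r`. As `r` and `r′` commute, `v` does not commute with `r′` either.
    step (r ∷ r′ ∷ R) perm (s≤s (s≤s z≤n)) | no none | yes found with extract found
    ... | (u , v) , ps′ , (nu , nv) , ps↭ = inj₁ ((u , r) ∷ (v , r′) ∷ ps′ , R
          , cong suc (sym (↭-length ps↭))
          , (λ c → nu (sym c)) ∷ nv′ ∷ All.tail (All-resp-↭ ps↭ ncs)
          , ↭-trans perm (↭-trans (++⁺ʳ (r ∷ r′ ∷ R) (flat-↭ ps↭)) mix))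
      where
      r′~r : Comm r r′
      r′~r = decidable-stable (comm? r r′) λ n → none (here n)
      r′∉Z : r′ ∉ Z
      r′∉Z = All.head (All.tail (Allₚ.++⁻ʳ (flat ps) (All-resp-↭ perm noncentral)))
      nv′ : ¬ Comm v r′
      nv′ c = nv (comm-trans r′∉Z r′~r (sym c))
      mix : u ∷ v ∷ (flat ps′ ++ r ∷ r′ ∷ R) ↭ u ∷ r ∷ v ∷ r′ ∷ (flat ps′ ++ R)
      mix = prep u (↭-trans (prep v (shifts (flat ps′) (r ∷ r′ ∷ []))) (swap v r ↭-refl))

  -- In an ordered sequence T, the terms not commuting with x cut T into runs of commuting terms.
  module Runs {x : E} (x∉M : x ∉ M) {P : E → Set} (P? : ∀ y → Dec (P y)) (P⇒comm : ∀ {y} → P y → Comm x y) (b : ℕ)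
    (block : ∀ L → All P L → length L ≡ b → ∃[ U ] ∃[ W ] (L ↭ U ++ W × 0 < length U × ∏ U ∈ Z)) where

    record Found (T : List E) : Set where
      field
        U T′     : List E
        perm     : T ↭ U ++ T′
        all-P    : All P U
        nonempty : 0 < length U
        short    : length U ≤ b
        central  : ∏ U ∈ Z
        product  : ∏ T ≡ ∏ U · ∏ T′

    private
      found-↭ : ∀ {T T₁} → T₁ ↭ T → ∏ T₁ ≡ ∏ T → Found T → Found T₁
      found-↭ p eq f = record { Found f ; perm = ↭-trans p (Found.perm f) ; product = trans eq (Found.product f) }

      found-++ : ∀ L {T} → Found T → Found (L ++ T)
      found-++ L {T} f = record { Found f ; T′ = L ++ T′
        ; perm = ↭-trans (++⁺ˡ L perm) (shifts L U)
        ; product = trans (∏-++ L T) (trans (cong (∏ L ·_) product) (trans (sym (·-assoc _ _ _)) (trans (cong (_· ∏ T′) (sym (centre⁻ central (∏ L))))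
            (trans (·-assoc _ _ _) (cong (∏ U ·_) (sym (∏-++ L T′))))))) }
        where open Found f

      move : ∀ cur y T → All (Comm x) cur → Comm x y → ∏ (cur ++ y ∷ T) ≡ ∏ ((y ∷ cur) ++ T)
      move cur y T cs c = trans (cong ∏ (sym (++-assoc cur (y ∷ []) T))) (trans (∏-++ (cur ++ y ∷ []) T) (trans (cong (_· ∏ T)
        (commuting-∏ (commutator-comm x∉M) (Allₚ.++⁺ cs (c ∷ [])) (++-comm cur (y ∷ [])))) (sym (∏-++ (y ∷ cur) T))))

      -- `cur` holds the terms with `P` of the current run, always fewer than `b`. Other terms
      -- commuting with `x` are moved in front of it, as the centraliser of `x` is abelian; a term
      -- not commuting with `x` starts a new run. A run without a block wastes at most `pred b`
      -- terms with `P`.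
      search : ∀ cur T → All P cur → length cur < b → Found (cur ++ T) ⊎ length cur + count P? T ≤ pred b * suc (others x T)
      search cur [] ps lt = inj₂ (≤-trans (≤-reflexive (+-identityʳ _)) (≤-trans (<⇒≤pred lt) (≤-reflexive (sym (*-identityʳ _)))))
      search cur (y ∷ T) ps lt with P? y | comm? x y
      ... | yes p | no nc = ⊥-elim (nc (P⇒comm p))
      ... | no _ | no nc with search [] T [] (≤-<-trans z≤n lt)
      ...   | inj₁ f = inj₁ (found-++ cur (found-++ (y ∷ []) f))
      ...   | inj₂ le = inj₂ (≤-trans (+-mono-≤ (<⇒≤pred lt) le) (≤-reflexive (sym (*-suc (pred b) (suc (others x T))))))
      search cur (y ∷ T) ps lt | no _ | yes c with search cur T ps lt
      ...   | inj₁ f = inj₁ (found-↭ (shift y cur T) (move cur y T (All.map P⇒comm ps) c) (found-++ (y ∷ []) f))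
      ...   | inj₂ le = inj₂ le
      search cur (y ∷ T) ps lt | yes p | yes c with suc (length cur) <? b
      ... | yes lt′ with search (y ∷ cur) T (p ∷ ps) lt′
      ...   | inj₁ f = inj₁ (found-↭ (shift y cur T) (move cur y T (All.map P⇒comm ps) c) f)
      ...   | inj₂ le = inj₂ (≤-trans (≤-reflexive (+-suc (length cur) (count P? T))) le)
      search cur (y ∷ T) ps lt | yes p | yes c | no ge with block (y ∷ cur) (p ∷ ps) (≤-antisym lt (≮⇒≥ ge))
      ... | U , W , perm , ne , central = inj₁ (found-↭ (shift y cur T) (move cur y T (All.map P⇒comm ps) c) record
            { U = U ; T′ = W ++ T ; perm = ↭-trans (++⁺ʳ T perm) (↭-reflexive (++-assoc U W T))
            ; all-P = Allₚ.++⁻ˡ U (All-resp-↭ perm (p ∷ ps)) ; nonempty = ne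
            ; short = ≤-trans (≤-trans (m≤m+n _ _) (≤-reflexive (sym (trans (↭-length perm) (length-++ U))))) lt
            ; central = central
            ; product = trans (∏-++ (y ∷ cur) T) (trans (cong (_· ∏ T) (trans (commuting-∏ (commutator-comm x∉M) (c ∷ All.map P⇒comm ps) perm) (∏-++ U W)))
                (trans (·-assoc _ _ _) (cong (∏ U ·_) (sym (∏-++ W T))))) })

    find-run : ∀ T → 0 < b → pred b * suc (others x T) < count P? T → Found T
    find-run T pos many with search [] T [] pos
    ... | inj₁ f  = f
    ... | inj₂ le = ⊥-elim (<⇒≱ many le)

    record Pool (j : ℕ) (T : List E) : Set where
      field
        blocks : List (List E)
        size   : length blocks ≡ j
        T′     : List E
        perm   : T ↭ concat blocks ++ T′
        all-P  : All (All P) blocks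
        good   : All (λ U → 0 < length U × ∏ U ∈ Z) blocks
        product : ∏ T ≡ ∏ (concat blocks) · ∏ T′

    -- Each extraction costs at most `b` terms with `P` and leaves the number of separating terms
    -- unchanged, because the extracted terms commute with `x`.
    pool : ∀ j T → 0 < b → pred b * suc (others x T) + j * b < count P? T + b → Pool j T
    pool zero T pos many = record { blocks = [] ; size = refl ; T′ = T ; perm = ↭-refl ; all-P = [] ; good = [] ; product = sym (ε-left (∏ T)) }
    pool (suc j) T pos many = record
      { blocks = U ∷ blocks ; size = cong suc size ; T′ = T″
      ; perm = ↭-trans (Found.perm f) (↭-trans (++⁺ˡ U perm) (↭-reflexive (sym (++-assoc U (concat blocks) T″))))
      ; all-P = Found.all-P f ∷ all-P ; good = (Found.nonempty f , Found.central f) ∷ good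
      ; product = trans (Found.product f) (trans (cong (∏ U ·_) product) (trans (sym (·-assoc _ _ _)) (cong (_· ∏ T″) (sym (∏-++ U (concat blocks)))))) }
      where
      o = others x T
      f : Found T
      f = find-run T pos (+-cancelʳ-< b _ _ (≤-<-trans (+-monoʳ-≤ (pred b * suc o) (m≤m+n b (j * b))) many))
      open Found f using (U; T′)
      same : others x T ≡ others x T′
      same = trans (count-↭ (outside? x) (Found.perm f)) (trans (count-++ (outside? x) U T′)
        (cong (_+ others x T′) (count-none (outside? x) (All.map (λ p n → n (P⇒comm p)) (Found.all-P f)))))
      fewer : count P? T ≡ length U + count P? T′
      fewer = trans (count-↭ P? (Found.perm f)) (trans (count-++ P? U T′) (cong (_+ count P? T′) (count-all P? (Found.all-P f))))
      many′ : pred b * suc (others x T′) + j * b < count P? T′ + b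
      many′ = +-cancelˡ-< b _ _ (≤-trans (≤-trans (≤-reflexive (cong suc (trans (cong (λ o → b + (pred b * suc o + j * b)) (sym same)) (l b (pred b * suc o) (j * b)))))
        many) (≤-trans (+-monoˡ-≤ b (≤-trans (≤-reflexive fewer) (+-monoˡ-≤ _ (Found.short f)))) (≤-reflexive (+-assoc b _ b))))
        where
        l : ∀ b p j → b + (p + j) ≡ p + (b + j)
        l = solve-∀
      rec : Pool j T′
      rec = pool j T′ pos many′
      open Pool rec using (blocks; size; perm; all-P; good; product) renaming (T′ to T″)

-- Consequences of minimality for a long sequence

module Bounds (G : FinGroup) (data′ : AffineData G) {S : List (Elt G)} (minimal : MinimalProductOne G S) where

  open Sequences G data′ public

  Long : Set
  Long = 3 * (e * (z * q)) < 4 * length S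

  private
    T₀ : List E
    T₀ = proj₁ (proj₁ (proj₂ minimal))
    T↭S : T₀ ↭ S
    T↭S = proj₁ (proj₂ (proj₁ (proj₂ minimal)))
    ∏T : ∏ T₀ ≡ ε
    ∏T = proj₂ (proj₂ (proj₁ (proj₂ minimal)))

  -- A proper subgroup has at most half of the elements, and by `commuting-bound` the sequence would
  -- be no longer than that.
  short-of-commuting : ∀ {K} → IsSub K → (∀ {x y} → x ∈ K → y ∈ K → Comm x y) → ∀ {g} → g ∉ K → All (_∈ K) S → ¬ Long
  short-of-commuting {K} subK com g∉ S⊆K long = <⇒≱ long (begin
    4 * length S               ≤⟨ *-monoʳ-≤ 4 (commuting-bound minimal subK com S⊆K) ⟩
    4 * # K                    ≤⟨ ≤-slack (2 * # K) (l (# K)) ⟩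
    3 * (2 * # K)              ≤⟨ *-monoʳ-≤ 3 (≤-trans (proper-≤ subK full-sub (λ _ _ → ∈-full) ∈-full g∉) (≤-reflexive #-full)) ⟩
    3 * order                  ≡⟨ cong (3 *_) order-≡ ⟩
    3 * (e * (z * q))          ∎)
    where
    open ≤-Reasoning
    l : ∀ k → 3 * (2 * k) ≡ 4 * k + 2 * k
    l = solve-∀

  module _ {x : E} (x∉M : x ∉ M) where

    C-sub : IsSub (set (comm? x))
    C-sub = record { ε∈ = ∈⁺ (comm? x) comm-ε ; ·∈ = λ p r → ∈⁺ (comm? x) (comm-· (∈⁻ (comm? x) p) (∈⁻ (comm? x) r)) }

    C-comm : ∀ {u v} → u ∈ set (comm? x) → v ∈ set (comm? x) → Comm u v
    C-comm p r = commutator-comm x∉M (∈⁻ (comm? x) p) (∈⁻ (comm? x) r)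

    noncentral : x ∉ Z
    noncentral x∈ = x∉M (Z⊆M x∈)

    outsider : Long → 0 < others x S
    outsider long with others x S in eq
    ... | suc _ = s≤s z≤n
    ... | zero with any? (λ g → ¬? (comm? x g))
    ...   | no none = ⊥-elim (noncentral (centre⁺ λ g → decidable-stable (comm? x g) λ n → none (g , n)))
    ...   | yes (g , nc) = ⊥-elim (short-of-commuting C-sub C-comm {g} (λ p → nc (∈⁻ (comm? x) p)) (all-comm S eq) long)
      where
      all-comm : ∀ L → others x L ≡ 0 → All (_∈ set (comm? x)) L
      all-comm [] _ = []
      all-comm (y ∷ L) eq with comm? x y in c
      ... | yes p = ∈⁺ (comm? x) p ∷ all-comm L eq

    -- `M` has index `e`, so `e` terms contain a segment with product in `M`. That product also
    -- commutes with `x`, which lies outside `M`, and is therefore central.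
    central-block : ∀ L → All (Comm x) L → length L ≡ e → ∃[ U ] ∃[ W ] (L ↭ U ++ W × 0 < length U × ∏ U ∈ Z)
    central-block L cs refl with block-exists M-sub full-sub (λ _ _ → ∈-full) {L} (All.tabulate λ _ → ∈-full)
                                   (≤-reflexive (trans #-full index-e))
    ... | record { pre = pre ; body = body ; post = post ; split = eq ; nonempty = ne ; product = p } =
          body , pre ++ post , ↭-trans (↭-reflexive eq) (shifts pre body) , ne
        , M∩C⊆Z p x∉M (∏-comm (Allₚ.++⁻ˡ body (Allₚ.++⁻ʳ pre (subst (All (Comm x)) eq cs))))
      where
      ∏-comm : ∀ {L} → All (Comm x) L → Comm x (∏ L)
      ∏-comm []       = comm-ε
      ∏-comm (c ∷ cs) = comm-· c (∏-comm cs)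

    module _ {P : E → Set} (P? : ∀ y → Dec (P y)) (P⇒comm : ∀ {y} → P y → Comm x y) (b : ℕ)
      (block : ∀ L → All P L → length L ≡ b → ∃[ U ] ∃[ W ] (L ↭ U ++ W × 0 < length U × ∏ U ∈ Z)) where

      open Runs x∉M P? P⇒comm b block

      -- If z blocks with central products could be moved to the front of `T₀`, some of these
      -- products would multiply to `ε`. Being central, they could be split off without changing the
      -- product of the rest, which is nonempty by `outsider`.
      pool-count : Long → 0 < b → count P? S + b ≤ pred b * suc (others x S) + z * b
      pool-count long pos = ≮⇒≥ λ many → contradict (pool z T₀ pos
        (subst₂ (λ o c → pred b * suc o + z * b < c + b) (sym (count-↭ (outside? x) T↭S)) (sym (count-↭ P? T↭S)) many))
        where
        contradict : ¬ Pool z T₀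
        contradict record { blocks = blocks ; size = size ; T′ = T′ ; perm = perm ; all-P = all-P ; good = good ; product = product }
          with block-exists trivial-sub centre-sub (λ h h∈ → subst (_∈ Z) (sym (∈⁻ (_≟ ε) h∈)) (ε∈ centre-sub)) {map ∏ blocks}
                 (Allₚ.map⁺ (All.map proj₂ good))
                 (≤-reflexive (sym (trans (cong₂ _*_ (trans (length-map ∏ blocks) size) #-trivial) (*-identityʳ z))))
        ... | record { pre = pre ; body = body ; post = post ; split = eq ; nonempty = ne ; product = p }
          with map-split ∏ blocks pre (body ++ post) eq
        ...   | Bp , Bs , refl , refl , eq′ with map-split ∏ Bs body post eq′
        ...     | Bb , Bq , refl , refl , refl = proj₂ (proj₂ minimal) (concat Bb , V , S↭ , U≠[] Bb ne (Allₚ.++⁻ˡ Bb (Allₚ.++⁻ʳ Bp good))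
                  , V≠[] , (concat Bb , ↭-refl , ∏U) , (V , ↭-refl , ∏V))
          where
          V = concat Bp ++ (concat Bq ++ T′)
          concats : concat (Bp ++ Bb ++ Bq) ≡ concat Bp ++ (concat Bb ++ concat Bq)
          concats = trans (sym (concat-++ Bp (Bb ++ Bq))) (cong (concat Bp ++_) (sym (concat-++ Bb Bq)))
          S↭ : S ↭ concat Bb ++ V
          S↭ = ↭-trans (↭-sym T↭S) (↭-trans perm (↭-trans (↭-reflexive (trans (cong (_++ T′) concats)
            (trans (++-assoc (concat Bp) _ T′) (cong (concat Bp ++_) (++-assoc (concat Bb) (concat Bq) T′))))) (shifts (concat Bp) (concat Bb))))
          ∏U : ∏ (concat Bb) ≡ ε
          ∏U = trans (∏-concat Bb) (∈⁻ (_≟ ε) p)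
          ∏V : ∏ V ≡ ε
          ∏V = begin
            ∏ V                                                      ≡⟨ trans (∏-++ (concat Bp) _) (cong (∏ (concat Bp) ·_) (∏-++ (concat Bq) T′)) ⟩
            ∏ (concat Bp) · (∏ (concat Bq) · ∏ T′)                   ≡⟨ word (∏ (concat Bp) ∷ ∏ (concat Bq) ∷ ∏ T′ ∷ []) (v0 • (v1 • v2)) (v0 • (𝟙 • v1) • v2) refl ⟩
            ∏ (concat Bp) · (ε · ∏ (concat Bq)) · ∏ T′               ≡⟨ cong (λ u → ∏ (concat Bp) · (u · ∏ (concat Bq)) · ∏ T′) ∏U ⟨
            ∏ (concat Bp) · (∏ (concat Bb) · ∏ (concat Bq)) · ∏ T′   ≡⟨ cong (_· ∏ T′) (trans (cong (∏ (concat Bp) ·_) (sym (∏-++ (concat Bb) _))) (trans (sym (∏-++ (concat Bp) _)) (cong ∏ (sym concats)))) ⟩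
            ∏ (concat (Bp ++ Bb ++ Bq)) · ∏ T′                       ≡⟨ product ⟨
            ∏ T₀                                                      ≡⟨ ∏T ⟩
            ε                                                        ∎
            where open ≡-Reasoning
          U≠[] : ∀ Bb → 0 < length (map ∏ Bb) → All (λ U → 0 < length U × ∏ U ∈ Z) Bb → NonEmpty G (concat Bb)
          U≠[] ((_ ∷ _) ∷ _) _ _ ()
          U≠[] ([] ∷ _) _ ((() , _) ∷ _)
          others-T′ : others x S ≡ others x T′
          others-T′ = trans (count-↭ (outside? x) (↭-sym T↭S)) (trans (count-↭ (outside? x) perm) (trans (count-++ (outside? x) (concat (Bp ++ Bb ++ Bq)) T′)
            (cong (_+ others x T′) (count-none (outside? x) (All.map (λ p n → n (P⇒comm p)) (Allₚ.concat⁺ all-P))))))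
          V≠[] : NonEmpty G V
          V≠[] eq = <⇒≱ (outsider long) (≤-trans (≤-reflexive others-T′) (≤-trans (count-≤ (outside? x) T′)
            (≤-trans (m≤n+m _ (length (concat Bp) + length (concat Bq))) (≤-reflexive (trans (+-assoc (length (concat Bp)) (length (concat Bq)) (length T′)) (trans
              (cong (length (concat Bp) +_) (sym (length-++ (concat Bq)))) (trans (sym (length-++ (concat Bp))) (cong length eq))))))))

    others+comm : ∀ L → others x L + count (comm? x) L ≡ length L
    others+comm [] = refl
    others+comm (y ∷ L) with comm? x y
    ... | yes _ = trans (+-suc _ _) (cong suc (others+comm L))
    ... | no _  = cong suc (others+comm L)

    -- `pool-count` applied to all terms commuting with `x`, with `b = e` by `central-block`; the
    -- terms not commuting with `x` are then added on both sides.
    pool-bound : Long → 0 < e → length S < others x S * e + e * z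
    pool-bound long pos = +-cancelʳ-≤ e _ _ (≤-trans (s≤s (≤-reflexive (cong (_+ e) (sym (others+comm S)))))
      (≤-trans (s≤s (≤-trans (≤-reflexive (+-assoc (others x S) _ e)) (+-monoʳ-≤ (others x S)
        (pool-count (comm? x) id e central-block long pos)))) (≤-reflexive (l e pos (others x S) z))))
      where
      l : ∀ e → 0 < e → ∀ o z → suc (o + (pred e * suc o + z * e)) ≡ o * e + e * z + e
      l (suc e) _ = l′ e
        where
        l′ : ∀ e o z → suc (o + (e * suc o + z * suc e)) ≡ o * suc e + suc e * z + suc e
        l′ = solve-∀

    involution? : ∀ y → Dec (Comm x y × (y ∉ Z × y · y ∈ Z))
    involution? y = comm? x y ×-dec (¬? (y ∈? Z) ×-dec ((y · y) ∈? Z))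

    -- Two involutions in one run cancel.
    involutions-few : Long → z ≡ 1 → (∀ {u v} → u ∉ Z → v ∉ Z → u · u ∈ Z → v · v ∈ Z → Comm u v → u ≡ v) →
      count involution? S ≤ suc (others x S)
    involutions-few long z≡1 unique = +-cancelʳ-≤ 2 _ _ (≤-trans (pool-count involution? proj₁ 2 cancelling long (s≤s z≤n))
      (≤-reflexive (cong₂ (λ a b → a + b * 2) (*-identityˡ (suc (others x S))) z≡1)))
      where
      cancelling : ∀ L → All (λ y → Comm x y × (y ∉ Z × y · y ∈ Z)) L → length L ≡ 2 → ∃[ U ] ∃[ W ] (L ↭ U ++ W × 0 < length U × ∏ U ∈ Z)
      cancelling (u ∷ v ∷ []) ((cu , u∉ , uu) ∷ (cv , v∉ , vv) ∷ []) refl = u ∷ v ∷ [] , [] , ↭-refl , s≤s z≤n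
        , subst (_∈ Z) (cong (u ·_) (trans (unique u∉ v∉ uu vv (commutator-comm x∉M cu cv)) (sym (ε-right v)))) uu

-- Numerical contradictions: once the variables are shifted by their lower bounds, a weighted sum of the hypotheses reads suc (x + r) ≤ x.

abstract

  abundant-≥3 : ∀ e z q L → 3 ≤ e → 1 ≤ z → (1 + e) ≤ q → (3 * (e * (z * q))) < (4 * L) → (L + z + 1) ≤ (q + (z * q + e * z)) → ⊥
  abundant-≥3 _ _ _ L b0 b1 b2 h0 h1 with m≤n⇒∃[o]m+o≡n b0 | m≤n⇒∃[o]m+o≡n b1 | m≤n⇒∃[o]m+o≡n b2
  ... | e , refl | z , refl | q , refl = ≤-absurd (9 * e + q + 12 * z + 3 * e * e + 3 * e * q + 13 * e * z + 5 * q * z + 3 * e * e * z + 3 * e * q * z) (+-mono-≤ (*-monoʳ-≤ 1 h0) (*-monoʳ-≤ 4 h1)) (identity e z q L)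
      where
      identity : ∀ e z q L → 1 * suc (3 * ((3 + e) * ((1 + z) * (1 + (3 + e) + q)))) + 4 * (L + (1 + z) + 1) ≡ suc (1 * (4 * L) + 4 * ((1 + (3 + e) + q) + ((1 + z) * (1 + (3 + e) + q) + (3 + e) * (1 + z))) + (9 * e + q + 12 * z + 3 * e * e + 3 * e * q + 13 * e * z + 5 * q * z + 3 * e * e * z + 3 * e * q * z))
      identity = solve-∀

  abundant-2-≥4 : ∀ z q L → 4 ≤ z → 3 ≤ q → (3 * (2 * (z * q))) < (4 * L) → (L + z + 1) ≤ (q + (z * q + 2 * z)) → ⊥
  abundant-2-≥4 _ _ L b0 b1 h0 h1 with m≤n⇒∃[o]m+o≡n b0 | m≤n⇒∃[o]m+o≡n b1
  ... | z , refl | q , refl = ≤-absurd (4 * q + 2 * z + 2 * q * z) (+-mono-≤ (*-monoʳ-≤ 1 h0) (*-monoʳ-≤ 4 h1)) (identity z q L)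
      where
      identity : ∀ z q L → 1 * suc (3 * (2 * ((4 + z) * (3 + q)))) + 4 * (L + (4 + z) + 1) ≡ suc (1 * (4 * L) + 4 * ((3 + q) + ((4 + z) * (3 + q) + 2 * (4 + z))) + (4 * q + 2 * z + 2 * q * z))
      identity = solve-∀

  abundant-2-3 : ∀ q L → 4 ≤ q → (3 * (2 * (3 * q))) < (4 * L) → (L + 3 + 1) ≤ (q + (3 * q + 2 * 3)) → ⊥
  abundant-2-3 _ L b0 h0 h1 with m≤n⇒∃[o]m+o≡n b0
  ... | q , refl = ≤-absurd (2 * q) (+-mono-≤ (*-monoʳ-≤ 1 h0) (*-monoʳ-≤ 4 h1)) (identity q L)
      where
      identity : ∀ q L → 1 * suc (3 * (2 * (3 * (4 + q)))) + 4 * (L + 3 + 1) ≡ suc (1 * (4 * L) + 4 * ((4 + q) + (3 * (4 + q) + 2 * 3)) + (2 * q))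
      identity = solve-∀

  pairs-≥4 : ∀ e z q L → 4 ≤ e → 1 ≤ z → (1 + e) ≤ q → (3 * (e * (z * q))) < (4 * L) → (L + z + 3) ≤ (2 * q + (z * q + e * z)) → ⊥
  pairs-≥4 _ _ _ L b0 b1 b2 h0 h1 with m≤n⇒∃[o]m+o≡n b0 | m≤n⇒∃[o]m+o≡n b1 | m≤n⇒∃[o]m+o≡n b2
  ... | e , refl | z , refl | q , refl = ≤-absurd (11 * e + 28 * z + 3 * e * e + 3 * e * q + 19 * e * z + 8 * q * z + 3 * e * e * z + 3 * e * q * z) (+-mono-≤ (*-monoʳ-≤ 1 h0) (*-monoʳ-≤ 4 h1)) (identity e z q L)
      where
      identity : ∀ e z q L → 1 * suc (3 * ((4 + e) * ((1 + z) * (1 + (4 + e) + q)))) + 4 * (L + (1 + z) + 3) ≡ suc (1 * (4 * L) + 4 * (2 * (1 + (4 + e) + q) + ((1 + z) * (1 + (4 + e) + q) + (4 + e) * (1 + z))) + (11 * e + 28 * z + 3 * e * e + 3 * e * q + 19 * e * z + 8 * q * z + 3 * e * e * z + 3 * e * q * z))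
      identity = solve-∀

  pairs-z≥2 : ∀ e z q L → 3 ≤ e → 2 ≤ z → (1 + e) ≤ q → (3 * (e * (z * q))) < (4 * L) → (L + z + 3) ≤ (2 * q + (z * q + e * z)) → ⊥
  pairs-z≥2 _ _ _ L b0 b1 b2 h0 h1 with m≤n⇒∃[o]m+o≡n b0 | m≤n⇒∃[o]m+o≡n b1 | m≤n⇒∃[o]m+o≡n b2
  ... | e , refl | z , refl | q , refl = ≤-absurd (4 + 18 * e + 2 * q + 12 * z + 6 * e * e + 6 * e * q + 13 * e * z + 5 * q * z + 3 * e * e * z + 3 * e * q * z) (+-mono-≤ (*-monoʳ-≤ 1 h0) (*-monoʳ-≤ 4 h1)) (identity e z q L)
      where
      identity : ∀ e z q L → 1 * suc (3 * ((3 + e) * ((2 + z) * (1 + (3 + e) + q)))) + 4 * (L + (2 + z) + 3) ≡ suc (1 * (4 * L) + 4 * (2 * (1 + (3 + e) + q) + ((2 + z) * (1 + (3 + e) + q) + (3 + e) * (2 + z))) + (4 + 18 * e + 2 * q + 12 * z + 6 * e * e + 6 * e * q + 13 * e * z + 5 * q * z + 3 * e * e * z + 3 * e * q * z))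
      identity = solve-∀

  core-few : ∀ e h L → 1 ≤ e → (3 * (e * (1 * (1 + (h + h))))) < (4 * L) → (L) < (h * e) → ⊥
  core-few _ h L b0 h0 h1 with m≤n⇒∃[o]m+o≡n b0
  ... | e , refl = ≤-absurd (7 + 3 * e + 2 * h + 2 * e * h) (+-mono-≤ (*-monoʳ-≤ 1 h0) (*-monoʳ-≤ 4 h1)) (identity e h L)
      where
      identity : ∀ e h L → 1 * suc (3 * ((1 + e) * (1 * (1 + (h + h))))) + 4 * suc (L) ≡ suc (1 * (4 * L) + 4 * (h * (1 + e)) + (7 + 3 * e + 2 * h + 2 * e * h))
      identity = solve-∀

  noncentral-many : ∀ e z q N c → 3 ≤ e → 1 ≤ z → (3 * (e * (z * (1 + q)))) < (4 * (N + c)) → (c) < (z) → (N) < (2 * q) → ⊥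
  noncentral-many _ _ q N c b0 b1 h0 h1 h2 with m≤n⇒∃[o]m+o≡n b0 | m≤n⇒∃[o]m+o≡n b1
  ... | e , refl | z , refl = ≤-absurd (13 + 3 * e + q + 5 * z + 3 * e * q + 3 * e * z + 9 * q * z + 3 * e * q * z) (+-mono-≤ (+-mono-≤ (*-monoʳ-≤ 1 h0) (*-monoʳ-≤ 4 h1)) (*-monoʳ-≤ 4 h2)) (identity e z q N c)
      where
      identity : ∀ e z q N c → 1 * suc (3 * ((3 + e) * ((1 + z) * (1 + q)))) + 4 * suc (c) + 4 * suc (N) ≡ suc (1 * (4 * (N + c)) + 4 * ((1 + z)) + 4 * (2 * q) + (13 + 3 * e + q + 5 * z + 3 * e * q + 3 * e * z + 9 * q * z + 3 * e * q * z))
      identity = solve-∀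

  pool-z≥2 : ∀ e z q o L → 3 ≤ e → 2 ≤ z → (1 + o) ≤ q → (3 * (e * (z * (1 + q)))) < (4 * L) → (L) < (o * e + e * z) → ⊥
  pool-z≥2 _ _ _ o L b0 b1 b2 h0 h1 with m≤n⇒∃[o]m+o≡n b0 | m≤n⇒∃[o]m+o≡n b1 | m≤n⇒∃[o]m+o≡n b2
  ... | e , refl | z , refl | q , refl = ≤-absurd (16 + 4 * e + 6 * o + 18 * q + 6 * z + 2 * e * o + 6 * e * q + 2 * e * z + 9 * o * z + 9 * q * z + 3 * e * o * z + 3 * e * q * z) (+-mono-≤ (*-monoʳ-≤ 1 h0) (*-monoʳ-≤ 4 h1)) (identity e z q o L)
      where
      identity : ∀ e z q o L → 1 * suc (3 * ((3 + e) * ((2 + z) * (1 + (1 + o + q))))) + 4 * suc (L) ≡ suc (1 * (4 * L) + 4 * (o * (3 + e) + (3 + e) * (2 + z)) + (16 + 4 * e + 6 * o + 18 * q + 6 * z + 2 * e * o + 6 * e * q + 2 * e * z + 9 * o * z + 9 * q * z + 3 * e * o * z + 3 * e * q * z))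
      identity = solve-∀

  core-room : ∀ e h o L → 4 ≤ e → 1 ≤ h → (3 * (e * (1 * (1 + (h + h))))) < (4 * L) → (o) < (h + h) → (L) < ((h + h) + (e + o)) → ⊥
  core-room _ _ o L b0 b1 h0 h1 h2 with m≤n⇒∃[o]m+o≡n b0 | m≤n⇒∃[o]m+o≡n b1
  ... | e , refl | h , refl = ≤-absurd (12 + 5 * e + 8 * h + 6 * e * h) (+-mono-≤ (+-mono-≤ (*-monoʳ-≤ 1 h0) (*-monoʳ-≤ 4 h1)) (*-monoʳ-≤ 4 h2)) (identity e h o L)
      where
      identity : ∀ e h o L → 1 * suc (3 * ((4 + e) * (1 * (1 + ((1 + h) + (1 + h)))))) + 4 * suc (o) + 4 * suc (L) ≡ suc (1 * (4 * L) + 4 * ((1 + h) + (1 + h)) + 4 * (((1 + h) + (1 + h)) + ((4 + e) + o)) + (12 + 5 * e + 8 * h + 6 * e * h))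
      identity = solve-∀

  core-noninvolutions : ∀ e h o v L → 4 ≤ e → 1 ≤ h → (3 * (e * (1 * (1 + (h + h))))) < (4 * L) → (o) < (h + h) → (v) < (h) → (L) ≤ (o + (v + (1 + o))) → ⊥
  core-noninvolutions _ _ o v L b0 b1 h0 h1 h2 h3 with m≤n⇒∃[o]m+o≡n b0 | m≤n⇒∃[o]m+o≡n b1
  ... | e , refl | h , refl = ≤-absurd (24 + 9 * e + 4 * h + 6 * e * h) (+-mono-≤ (+-mono-≤ (+-mono-≤ (*-monoʳ-≤ 1 h0) (*-monoʳ-≤ 8 h1)) (*-monoʳ-≤ 4 h2)) (*-monoʳ-≤ 4 h3)) (identity e h o v L)
      where
      identity : ∀ e h o v L → 1 * suc (3 * ((4 + e) * (1 * (1 + ((1 + h) + (1 + h)))))) + 8 * suc (o) + 4 * suc (v) + 4 * (L) ≡ suc (1 * (4 * L) + 8 * ((1 + h) + (1 + h)) + 4 * ((1 + h)) + 4 * (o + (v + (1 + o))) + (24 + 9 * e + 4 * h + 6 * e * h))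
      identity = solve-∀

  three-many : ∀ h L V → 2 ≤ h → (3 * (3 * (1 * (1 + (h + h))))) < (4 * L) → (L) ≤ (3 + V) → (V) < (2 * (h + h)) → ⊥
  three-many _ L V b0 h0 h1 h2 with m≤n⇒∃[o]m+o≡n b0
  ... | h , refl = ≤-absurd (5 + 2 * h) (+-mono-≤ (+-mono-≤ (*-monoʳ-≤ 1 h0) (*-monoʳ-≤ 4 h1)) (*-monoʳ-≤ 4 h2)) (identity h L V)
      where
      identity : ∀ h L V → 1 * suc (3 * (3 * (1 * (1 + ((2 + h) + (2 + h)))))) + 4 * (L) + 4 * suc (V) ≡ suc (1 * (4 * L) + 4 * (3 + V) + 4 * (2 * ((2 + h) + (2 + h))) + (5 + 2 * h))
      identity = solve-∀

  three-room : ∀ h L o → 2 ≤ h → (3 * (3 * (1 * (1 + (h + h))))) < (4 * L) → (o) < (h + 3) → (L) < ((h + h) + (3 + o)) → ⊥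
  three-room _ L o b0 h0 h1 h2 with m≤n⇒∃[o]m+o≡n b0
  ... | h , refl = ≤-absurd (5 + 6 * h) (+-mono-≤ (+-mono-≤ (*-monoʳ-≤ 1 h0) (*-monoʳ-≤ 4 h1)) (*-monoʳ-≤ 4 h2)) (identity h L o)
      where
      identity : ∀ h L o → 1 * suc (3 * (3 * (1 * (1 + ((2 + h) + (2 + h)))))) + 4 * suc (o) + 4 * suc (L) ≡ suc (1 * (4 * L) + 4 * ((2 + h) + 3) + 4 * (((2 + h) + (2 + h)) + (3 + o)) + (5 + 6 * h))
      identity = solve-∀

  three-hosts : ∀ h L r → 2 ≤ h → (3 * (3 * (1 * (1 + (h + h))))) < (4 * L) → (L) ≤ (h + 2 + r) → (r + 1 + 1) ≤ (1 * (1 + (h + h)) + 3 * 1) → ⊥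
  three-hosts _ L r b0 h0 h1 h2 with m≤n⇒∃[o]m+o≡n b0
  ... | h , refl = ≤-absurd (5 + 6 * h) (+-mono-≤ (+-mono-≤ (*-monoʳ-≤ 1 h0) (*-monoʳ-≤ 4 h1)) (*-monoʳ-≤ 4 h2)) (identity h L r)
      where
      identity : ∀ h L r → 1 * suc (3 * (3 * (1 * (1 + ((2 + h) + (2 + h)))))) + 4 * (L) + 4 * (r + 1 + 1) ≡ suc (1 * (4 * L) + 4 * ((2 + h) + 2 + r) + 4 * (1 * (1 + ((2 + h) + (2 + h))) + 3 * 1) + (5 + 6 * h))
      identity = solve-∀

  three-outside : ∀ h L N k → 2 ≤ h → (3 * (3 * (1 * (1 + (h + h))))) < (4 * L) → (L) ≤ (k + N) → (N) < (h + h) → (k) < (5) → ⊥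
  three-outside _ L N k b0 h0 h1 h2 h3 with m≤n⇒∃[o]m+o≡n b0
  ... | h , refl = ≤-absurd (17 + 10 * h) (+-mono-≤ (+-mono-≤ (+-mono-≤ (*-monoʳ-≤ 1 h0) (*-monoʳ-≤ 4 h1)) (*-monoʳ-≤ 4 h2)) (*-monoʳ-≤ 4 h3)) (identity h L N k)
      where
      identity : ∀ h L N k → 1 * suc (3 * (3 * (1 * (1 + ((2 + h) + (2 + h)))))) + 4 * (L) + 4 * suc (N) + 4 * suc (k) ≡ suc (1 * (4 * L) + 4 * (k + N) + 4 * ((2 + h) + (2 + h)) + 4 * (5) + (17 + 10 * h))
      identity = solve-∀

  -- From here on h = 1 + N + d: the number N of terms in `A` falls short of h, and d measures by
  -- how much.
  three-unmatched : ∀ N d L k → (3 * (3 * (1 * (1 + ((1 + N + d) + (1 + N + d)))))) < (4 * L) → (L) ≤ (2 + k + N) → (k) < (2 * (1 + (d + d))) → ⊥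
  three-unmatched N d L k h0 h1 h2 = ≤-absurd (15 + 14 * N + 2 * d) (+-mono-≤ (+-mono-≤ (*-monoʳ-≤ 1 h0) (*-monoʳ-≤ 4 h1)) (*-monoʳ-≤ 4 h2)) (identity N d L k)
      where
      identity : ∀ N d L k → 1 * suc (3 * (3 * (1 * (1 + ((1 + N + d) + (1 + N + d)))))) + 4 * (L) + 4 * suc (k) ≡ suc (1 * (4 * L) + 4 * (2 + k + N) + 4 * (2 * (1 + (d + d))) + (15 + 14 * N + 2 * d))
      identity = solve-∀

  three-pairs : ∀ N d L r → (3 * (3 * (1 * (1 + ((1 + N + d) + (1 + N + d)))))) < (4 * L) → (L) ≤ ((N + 2) + 2 * (1 + (d + d)) + r) → (r + 1 + 1) ≤ (1 * (1 + ((1 + N + d) + (1 + N + d))) + 3 * 1) → (L) ≤ (2 * (1 + ((1 + N + d) + (1 + N + d))) + N) → ⊥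
  three-pairs N d L r h0 h1 h2 h3 = ≤-absurd (1) (+-mono-≤ (+-mono-≤ (+-mono-≤ (*-monoʳ-≤ 1 h0) (*-monoʳ-≤ 1 h1)) (*-monoʳ-≤ 1 h2)) (*-monoʳ-≤ 3 h3)) (identity N d L r)
      where
      identity : ∀ N d L r → 1 * suc (3 * (3 * (1 * (1 + ((1 + N + d) + (1 + N + d)))))) + 1 * (L) + 1 * (r + 1 + 1) + 3 * (L) ≡ suc (1 * (4 * L) + 1 * ((N + 2) + 2 * (1 + (d + d)) + r) + 1 * (1 * (1 + ((1 + N + d) + (1 + N + d))) + 3 * 1) + 3 * (2 * (1 + ((1 + N + d) + (1 + N + d))) + N) + (1))
      identity = solve-∀

  three-class : ∀ N d L o → (3 * (3 * (1 * (1 + ((1 + N + d) + (1 + N + d)))))) < (4 * L) → (o) < (2 + (d + d) + 1 + N) → (L) < (((1 + N + d) + (1 + N + d)) + (3 + o)) → ⊥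
  three-class N d L o h0 h1 h2 = ≤-absurd (3 + 6 * N + 2 * d) (+-mono-≤ (+-mono-≤ (*-monoʳ-≤ 1 h0) (*-monoʳ-≤ 4 h1)) (*-monoʳ-≤ 4 h2)) (identity N d L o)
      where
      identity : ∀ N d L o → 1 * suc (3 * (3 * (1 * (1 + ((1 + N + d) + (1 + N + d)))))) + 4 * suc (o) + 4 * suc (L) ≡ suc (1 * (4 * L) + 4 * (2 + (d + d) + 1 + N) + 4 * (((1 + N + d) + (1 + N + d)) + (3 + o)) + (3 + 6 * N + 2 * d))
      identity = solve-∀

  two-unmatched : ∀ z N t O c L → 2 ≤ z → (3 * (2 * (z * (1 + (N + t))))) < (4 * L) → (L) ≤ (1 + O + (N + c)) → (c) < (z) → (O) < (2 * t) → ⊥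
  two-unmatched _ N t O c L b0 h0 h1 h2 h3 with m≤n⇒∃[o]m+o≡n b0
  ... | z , refl = ≤-absurd (8 + 8 * N + 4 * t + 2 * z + 6 * N * z + 6 * t * z) (+-mono-≤ (+-mono-≤ (+-mono-≤ (*-monoʳ-≤ 1 h0) (*-monoʳ-≤ 4 h1)) (*-monoʳ-≤ 4 h2)) (*-monoʳ-≤ 4 h3)) (identity z N t O c L)
      where
      identity : ∀ z N t O c L → 1 * suc (3 * (2 * ((2 + z) * (1 + (N + t))))) + 4 * (L) + 4 * suc (c) + 4 * suc (O) ≡ suc (1 * (4 * L) + 4 * (1 + O + (N + c)) + 4 * ((2 + z)) + 4 * (2 * t) + (8 + 8 * N + 4 * t + 2 * z + 6 * N * z + 6 * t * z))
      identity = solve-∀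

  two-pairs : ∀ z q L J r → 2 ≤ z → 1 ≤ q → (3 * (2 * (z * (1 + q)))) < (4 * L) → (L) ≤ (J + r) → (J) ≤ (2 * q) → (r + 2) ≤ ((1 + q) + 2 * z) → ⊥
  two-pairs _ _ L J r b0 b1 h0 h1 h2 h3 with m≤n⇒∃[o]m+o≡n b0 | m≤n⇒∃[o]m+o≡n b1
  ... | z , refl | q , refl = ≤-absurd (4 * z + 6 * q * z) (+-mono-≤ (+-mono-≤ (+-mono-≤ (*-monoʳ-≤ 1 h0) (*-monoʳ-≤ 4 h1)) (*-monoʳ-≤ 4 h2)) (*-monoʳ-≤ 4 h3)) (identity z q L J r)
      where
      identity : ∀ z q L J r → 1 * suc (3 * (2 * ((2 + z) * (1 + (1 + q))))) + 4 * (L) + 4 * (J) + 4 * (r + 2) ≡ suc (1 * (4 * L) + 4 * (J + r) + 4 * (2 * (1 + q)) + 4 * ((1 + (1 + q)) + 2 * (2 + z)) + (4 * z + 6 * q * z))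
      identity = solve-∀

  two-class : ∀ z q L o → 2 ≤ z → 1 ≤ q → (3 * (2 * (z * (1 + q)))) < (4 * L) → (o) ≤ (q) → (L) < (o * 2 + 2 * z) → ⊥
  two-class _ _ L o b0 b1 h0 h1 h2 with m≤n⇒∃[o]m+o≡n b0 | m≤n⇒∃[o]m+o≡n b1
  ... | z , refl | q , refl = ≤-absurd (4 + 4 * q + 4 * z + 6 * q * z) (+-mono-≤ (+-mono-≤ (*-monoʳ-≤ 1 h0) (*-monoʳ-≤ 8 h1)) (*-monoʳ-≤ 4 h2)) (identity z q L o)
      where
      identity : ∀ z q L o → 1 * suc (3 * (2 * ((2 + z) * (1 + (1 + q))))) + 8 * (o) + 4 * suc (L) ≡ suc (1 * (4 * L) + 8 * ((1 + q)) + 4 * (o * 2 + 2 * (2 + z)) + (4 + 4 * q + 4 * z + 6 * q * z))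
      identity = solve-∀

  two-two-long : ∀ q L r → (3 * (2 * (2 * q))) < (4 * L) → (L) ≤ (q + r) → (r) ≤ (2 * q) → ⊥
  two-two-long q L r h0 h1 h2 = ≤-absurd (0) (+-mono-≤ (+-mono-≤ (*-monoʳ-≤ 1 h0) (*-monoʳ-≤ 4 h1)) (*-monoʳ-≤ 4 h2)) (identity q L r)
      where
      identity : ∀ q L r → 1 * suc (3 * (2 * (2 * q))) + 4 * (L) + 4 * (r) ≡ suc (1 * (4 * L) + 4 * (q + r) + 4 * (2 * q) + (0))
      identity = solve-∀

  two-two-good : ∀ q r s D W k → (2 * q) < (r) → (r) ≤ (k + s) → (k) < (2 * D) → (s + 2 * W + 1) ≤ (2 * q + 2 * 2) → (1 + D) ≤ (W) → ⊥
  two-two-good q r s D W k h0 h1 h2 h3 h4 = ≤-absurd (0) (+-mono-≤ (+-mono-≤ (+-mono-≤ (+-mono-≤ (*-monoʳ-≤ 1 h0) (*-monoʳ-≤ 1 h1)) (*-monoʳ-≤ 1 h2)) (*-monoʳ-≤ 1 h3)) (*-monoʳ-≤ 2 h4)) (identity q r s D W k)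
      where
      identity : ∀ q r s D W k → 1 * suc (2 * q) + 1 * (r) + 1 * suc (k) + 1 * (s + 2 * W + 1) + 2 * (1 + D) ≡ suc (1 * (r) + 1 * (k + s) + 1 * (2 * D) + 1 * (2 * q + 2 * 2) + 2 * (W) + (0))
      identity = solve-∀

  two-two-outside : ∀ q r → 2 ≤ q → (2 * q) < (r) → (r + 2) ≤ (q + 2 * 2) → ⊥
  two-two-outside _ r b0 h0 h1 with m≤n⇒∃[o]m+o≡n b0
  ... | q , refl = ≤-absurd (q) (+-mono-≤ (*-monoʳ-≤ 1 h0) (*-monoʳ-≤ 1 h1)) (identity q r)
      where
      identity : ∀ q r → 1 * suc (2 * (2 + q)) + 1 * (r + 2) ≡ suc (1 * (r) + 1 * ((2 + q) + 2 * 2) + (q))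
      identity = solve-∀

-- Terms outside M, noncentral terms of M, and central terms

module Cases (G : FinGroup) (data′ : AffineData G) {S : List (Elt G)} (minimal : MinimalProductOne G S) where

  open Bounds G data′ minimal public
  open import Algebra.Solver.CommutativeMonoid (++-commutativeMonoid {A = E}) public using (_⊜_; _⊕_) renaming (solve to permute)

  e<q′ : e < q
  e<q′ with any? (λ y → (y ∈? A) ×-dec ¬? (comm? b y))
  ... | yes (y , y∈ , nc) = e<q y∈ (λ { refl → nc comm-ε })
  ... | no none = ⊥-elim (b∉ (centraliser⁺ λ y y∈ → decidable-stable (comm? b y) λ nc → none (y , y∈ , nc)))

  record Partition : Set where
    field
      Os As Zs : List E
      perm     : S ↭ Os ++ (As ++ Zs)
      Os∉      : All (_∉ M) Os
      As∈      : All (λ a → a ∈ M × a ∉ Z) As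
      Zs∈      : All (_∈ Z) Zs

    lengths : length S ≡ length Os + (length As + length Zs)
    lengths = trans (↭-length perm) (trans (length-++ Os) (cong (length Os +_) (length-++ As)))

  partition : Partition
  partition with separate (_∈? M) S
  ... | Ms , Os , perm , Ms∈ , Os∉ , _ with separate (_∈? Z) Ms
  ...   | Zs , As , perm′ , Zs∈ , As∉ , _ = record
          { Os = Os ; As = As ; Zs = Zs
          ; perm = ↭-trans perm (↭-trans (++⁺ʳ Os perm′) (permute 3 (λ z a o → (z ⊕ a) ⊕ o ⊜ o ⊕ (a ⊕ z)) ↭-refl Zs As Os))
          ; Os∉ = Os∉ ; As∈ = All.zip (Allₚ.++⁻ʳ Zs (All-resp-↭ perm′ Ms∈) , As∉) ; Zs∈ = Zs∈ }

  module _ (long : Long) where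

    open Partition partition

    outside-M : ∃[ x ] ∃[ Os′ ] (Os ≡ x ∷ Os′ × x ∉ M)
    outside-M with Os in eq | Os∉
    ... | x ∷ Os′ | x∉ ∷ _ = x , Os′ , refl , x∉
    ... | [] | _ = ⊥-elim (short-of-commuting M-sub M-comm {b} b∉
        (All-resp-↭ (↭-sym (↭-trans perm (↭-reflexive (cong (_++ (As ++ Zs)) eq)))) (Allₚ.++⁺ (All.map proj₁ As∈) (All.map Z⊆M Zs∈))) long)

    x₀ = proj₁ outside-M
    x₀∉ = proj₂ (proj₂ (proj₂ outside-M))

    -- `pool-count` with blocks that consist of a single central term.
    central-few : length Zs < z
    central-few = ≤-trans (≤-reflexive (+-comm 1 (length Zs))) (≤-trans (+-monoˡ-≤ 1 (≤-trans (≤-reflexive (sym (count-all (_∈? Z) Zs∈)))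
      (≤-trans (m≤n+m _ _) (≤-reflexive (sym (trans (count-↭ (_∈? Z) (↭-trans perm (↭-reflexive (sym (++-assoc Os As Zs))))) (count-++ (_∈? Z) (Os ++ As) Zs)))))))
      (≤-trans (pool-count x₀∉ (_∈? Z) (λ y∈ → sym (centre⁻ y∈ x₀)) 1 single long (s≤s z≤n)) (≤-reflexive (*-identityʳ z))))
      where
      single : ∀ L → All (_∈ Z) L → length L ≡ 1 → ∃[ U ] ∃[ W ] (L ↭ U ++ W × 0 < length U × ∏ U ∈ Z)
      single (y ∷ []) (y∈ ∷ []) refl = y ∷ [] , [] , ↭-refl , s≤s z≤n , subst (_∈ Z) (sym (ε-right y)) y∈

    all-noncentral : z ≡ 1 → All (_∉ Z) S
    all-noncentral z≡1 = All-resp-↭ (↭-sym perm) (Allₚ.++⁺ (All.map (λ n p → n (Z⊆M p)) Os∉) (Allₚ.++⁺ (All.map proj₂ As∈) (none Zs (subst (length Zs <_) z≡1 central-few))))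
      where
      none : ∀ Zs → length Zs < 1 → All (_∉ Z) Zs
      none [] _ = []
      none (_ ∷ _) (s≤s ())

    rest-bound : ∀ {J R s} → S ↭ J ++ R → 0 < length J → Gain J s → q ≤ suc s → length R + z + 1 ≤ z * q + e * z
    rest-bound {R = R} perm J≠[] g q≤ = ≤-trans (≤-reflexive (cong (λ k → length R + k + 1) (sym (trans (cong (z *_) #-trivial) (*-identityʳ z)))))
      (free-bound R spread-∅ (saturated minimal perm J≠[] g q≤))

    abundant-split : q ≤ suc (length As) → ∃[ as ] ∃[ as′ ] ∃[ Os′ ] (As ≡ as ++ as′ × Os ≡ x₀ ∷ Os′ × suc (length as) ≡ q
      × S ↭ (as ++ x₀ ∷ []) ++ (Os′ ++ (as′ ++ Zs)) × Gain (as ++ x₀ ∷ []) (length as))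
    abundant-split many with split-at (pred q) As (pred-mono-≤ many) | outside-M
    ... | as , as′ , eq , len | x , Os′ , eq′ , x∉ = as , as′ , Os′ , eq , eq′
        , trans (cong suc len) (suc-pred q {{>-nonZero 1≤q}})
        , ↭-trans perm (↭-trans (↭-reflexive (cong₂ (λ O B → O ++ (B ++ Zs)) eq′ eq))
            (permute 5 (λ x o a a′ z → (x ⊕ o) ⊕ ((a ⊕ a′) ⊕ z) ⊜ (a ⊕ x) ⊕ (o ⊕ (a′ ⊕ z))) ↭-refl (x ∷ []) Os′ as as′ Zs))
        , subst (Gain (as ++ x ∷ [])) (+-identityʳ (length as)) (HostGain.gain (host-all (host x∉) (Allₚ.++⁻ˡ as (subst (All (λ a → a ∈ M × a ∉ Z)) eq As∈))))

    -- q - 1 noncentral terms of `M` around one term outside `M` realise a whole coset of `A`. This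
    -- costs only q terms, and the remaining ones are product-one free.
    abundant : q ≤ suc (length As) → length S + z + 1 ≤ q + (z * q + e * z)
    abundant many with abundant-split many
    ... | as , as′ , Os′ , eq , eq′ , len , perm′ , g = begin
      length S + z + 1                       ≡⟨ cong (λ k → k + z + 1) (trans (↭-length perm′) (length-++ (as ++ x₀ ∷ []))) ⟩
      length (as ++ x₀ ∷ []) + length R + z + 1   ≡⟨ cong (λ k → k + length R + z + 1) length-J ⟩
      q + length R + z + 1                   ≡⟨ l q (length R) z ⟩
      q + (length R + z + 1)                 ≤⟨ +-monoʳ-≤ q (rest-bound perm′ (subst (0 <_) (sym length-J) 1≤q) g (≤-reflexive (sym len))) ⟩
      q + (z * q + e * z)                    ∎
      where
      open ≤-Reasoning
      R = Os′ ++ (as′ ++ Zs)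
      length-J : length (as ++ x₀ ∷ []) ≡ q
      length-J = trans (length-++ as) (trans (+-comm (length as) 1) len)
      l : ∀ q r z → q + r + z + 1 ≡ q + (r + z + 1)
      l = solve-∀

  gain-triples : ∀ {x} ys xs xs′ → length xs ≡ length ys → length xs′ ≡ length ys →
    All (λ y → ¬ Comm x y) ys → All (λ u → Comm x u × u · u ∉ Z) xs → All (λ u → Comm x u × u ∉ Z) xs′ → x ∉ M →
    Gain (ys ++ (xs ++ xs′)) (length ys + length ys)
  gain-triples [] [] [] _ _ _ _ _ _ = gain-0 []
  gain-triples {x} (y ∷ ys) (u ∷ xs) (u′ ∷ xs′) l l′ (ny ∷ nys) ((cu , uu∉) ∷ cus) ((cu′ , u′∉) ∷ cus′) x∉ =
    subst (Gain _) (cong suc (sym (+-suc (length ys) (length ys))))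
      (gain-↭ (permute 6 (λ y u u′ ys xs xs′ → (y ⊕ (u ⊕ u′)) ⊕ (ys ⊕ (xs ⊕ xs′)) ⊜ (y ⊕ ys) ⊕ ((u ⊕ xs) ⊕ (u′ ⊕ xs′))) ↭-refl (y ∷ []) (u ∷ []) (u′ ∷ []) ys xs xs′)
        (gain-++ (gain-triple (λ c → ny (comm-trans u∉ cu c)) (λ c → ny (comm-trans u′∉ cu′ c)) (commutator-comm x∉ cu cu′) uu∉)
          (gain-triples ys xs xs′ (cong pred l) (cong pred l′) nys cus cus′ x∉)))
    where
    u∉ : u ∉ Z
    u∉ p = uu∉ (·∈ centre-sub p p)

  noninvolution? : ∀ x y → Dec (Comm x y × y · y ∉ Z)
  noninvolution? x y = comm? x y ×-dec ¬? ((y · y) ∈? Z)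

  -- Triples of one term that does not commute with `x` and two terms that do. Each triple gains two
  -- products, and only one of its two commuting terms must have a noncentral square; hence the
  -- differing demands on the three counts.
  core-gain : ∀ V {x} → x ∉ M → All (_∉ Z) V → ∀ h → h ≤ others x V → h ≤ count (noninvolution? x) V → h + h ≤ count (comm? x) V →
    ∃[ J ] ∃[ R ] (V ↭ J ++ R × length J ≡ h + (h + h) × Gain J (h + h) × count (comm? x) V ≡ (h + h) + count (comm? x) R)
  core-gain V {x} x∉ V∉ h ho hn hc with separate (outside? x) V
  ... | ys₀ , core , perm , ys-out , core-in , l₀ with separate (noninvolution? x) core
  ...   | ns , is , perm′ , ns-in , is-out , l₁ = finish
    where
    comm-core : All (Comm x) core
    comm-core = All.map (λ {y} nn → decidable-stable (comm? x y) nn) core-in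
    count-core : count (comm? x) V ≡ length core
    count-core = trans (count-↭ (comm? x) perm) (trans (count-++ (comm? x) ys₀ core) (cong₂ _+_ (count-none (comm? x) ys-out) (count-all (comm? x) comm-core)))
    count-ns : count (noninvolution? x) V ≡ length ns
    count-ns = trans (count-↭ (noninvolution? x) perm) (trans (count-++ (noninvolution? x) ys₀ core)
      (trans (cong (_+ count (noninvolution? x) core) (count-none (noninvolution? x) (All.map (λ n p → n (proj₁ p)) ys-out))) (sym l₁)))
    finish : ∃[ J ] ∃[ R ] (V ↭ J ++ R × length J ≡ h + (h + h) × Gain J (h + h) × count (comm? x) V ≡ (h + h) + count (comm? x) R)
    finish with split-at h ys₀ (subst (h ≤_) (sym l₀) ho) | split-at h ns (subst (h ≤_) count-ns hn)
    ... | ys , ys₁ , refl , ly | xs , ns₁ , refl , lx with split-at h (ns₁ ++ is) (+-cancelˡ-≤ h _ _ (≤-trans hc (≤-reflexive (trans count-core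
            (trans (↭-length perm′) (trans (cong length (++-assoc xs ns₁ is)) (trans (length-++ xs) (cong (_+ length (ns₁ ++ is)) lx))))))))
    ...   | xs′ , rest , eq , lx′ = ys ++ (xs ++ xs′) , ys₁ ++ rest , V↭
          , trans (length-++ ys) (cong₂ _+_ ly (trans (length-++ xs) (cong₂ _+_ lx lx′)))
          , subst (λ k → Gain (ys ++ (xs ++ xs′)) (k + k)) ly (gain-triples ys xs xs′ (trans lx (sym ly)) (trans lx′ (sym ly))
              (Allₚ.++⁻ˡ ys ys-out) (Allₚ.++⁻ˡ xs ns-in) (All.zip (Allₚ.++⁻ˡ xs′ rest-comm , Allₚ.++⁻ˡ xs′ rest∉)) x∉)
          , counted
      where
      core↭ : core ↭ xs ++ (xs′ ++ rest)
      core↭ = ↭-trans perm′ (↭-trans (↭-reflexive (++-assoc xs ns₁ is)) (++⁺ˡ xs (↭-reflexive eq)))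
      V↭ : V ↭ (ys ++ (xs ++ xs′)) ++ (ys₁ ++ rest)
      V↭ = ↭-trans perm (↭-trans (++⁺ˡ (ys ++ ys₁) core↭) (permute 5 (λ y y₁ x x′ r → (y ⊕ y₁) ⊕ (x ⊕ (x′ ⊕ r)) ⊜ (y ⊕ (x ⊕ x′)) ⊕ (y₁ ⊕ r)) ↭-refl ys ys₁ xs xs′ rest))
      rest-comm : All (Comm x) (xs′ ++ rest)
      rest-comm = Allₚ.++⁻ʳ xs (All-resp-↭ core↭ comm-core)
      rest∉ : All (_∉ Z) (xs′ ++ rest)
      rest∉ = Allₚ.++⁻ʳ xs (Allₚ.++⁻ʳ (ys ++ ys₁) (All-resp-↭ (↭-trans perm (++⁺ˡ (ys ++ ys₁) core↭)) V∉))
      counted : count (comm? x) V ≡ (h + h) + count (comm? x) (ys₁ ++ rest)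
      counted = trans count-core (trans (↭-length core↭) (trans (length-++ xs) (trans (cong₂ _+_ lx (trans (length-++ xs′) (cong₂ _+_ lx′
        (sym (trans (count-++ (comm? x) ys₁ rest) (cong₂ _+_ (count-none (comm? x) (Allₚ.++⁻ʳ ys ys-out)) (count-all (comm? x) (Allₚ.++⁻ʳ xs′ rest-comm)))))))) (sym (+-assoc h h _)))))

  -- With trivial centre, the central product supplied by `central-block` is `ε`.
  product-one-core : z ≡ 1 → ∀ {x} → x ∉ M → ∀ {R} → e ≤ count (comm? x) R → 0 < e → ¬ Free R
  product-one-core z≡1 {x} x∉ {R} many pos free with separate (comm? x) R
  ... | cs , ds , perm , cs-in , _ , len with split-at e cs (subst (e ≤_) (sym len) many)
  ...   | es , cs′ , refl , le with central-block x∉ es (Allₚ.++⁻ˡ es cs-in) le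
  ...     | U , W , es↭ , U≠[] , central = free U (W ++ (cs′ ++ ds))
            (↭-trans perm (↭-trans (↭-reflexive (++-assoc es cs′ ds)) (↭-trans (++⁺ʳ (cs′ ++ ds) es↭) (↭-reflexive (++-assoc U W (cs′ ++ ds))))))
            (nonempty-length U≠[]) (U , ↭-refl , Z-trivial central)
    where
    Z-trivial : ∀ {x} → x ∈ Z → x ≡ ε
    Z-trivial {x} x∈ = decidable-stable (x ≟ ε) λ x≢ε → <⇒≱ (distinct-≤ (x ∷ ε ∷ []) ((x≢ε ∷ []) ∷ [] ∷ []) (x∈ ∷ ε∈ centre-sub ∷ [])) (≤-reflexive z≡1)

-- Index at least three, except index three with trivial centre

module Core (G : FinGroup) (data′ : AffineData G) {S : List (Elt G)} (minimal : MinimalProductOne G S) (h : ℕ)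
  (q≡ : Affine.q G data′ ≡ suc (h + h)) (e≥3 : 3 ≤ AffineData.e data′) where

  open Cases G data′ minimal public

  h≥1 : 1 ≤ h
  h≥1 = ≢0⇒1≤ h λ { refl → <⇒≱ e<q′ (≤-trans (≤-reflexive q≡) (≤-trans (s≤s z≤n) e≥3)) }
    where
    ≢0⇒1≤ : ∀ h → h ≢ 0 → 1 ≤ h
    ≢0⇒1≤ zero    ne = ⊥-elim (ne refl)
    ≢0⇒1≤ (suc h) _  = s≤s z≤n

  module _ (long : Long) (z≡1 : z ≡ 1) where

    long′ : 3 * (e * (1 * suc (h + h))) < 4 * length S
    long′ = subst₂ (λ z q → 3 * (e * (z * q)) < 4 * length S) z≡1 q≡ long

    -- If fewer than `h` terms fail to commute with `x`, then `S` is too short by `pool-bound`.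
    -- Otherwise `core-gain` realises a coset of `A`, and `e` terms commuting with `x` are left
    -- over, enough for a product-one subsequence.
    core-absurd : ∀ {x} → x ∉ M → (h + h) + (e + others x S) ≤ length S → h ≤ count (noninvolution? x) S → ⊥
    core-absurd {x} x∉ room hn with h ≤? others x S
    ... | no few = core-few e h (length S) (≤-trans (s≤s z≤n) e≥3) long′ (≤-trans (pool-bound x∉ long (≤-trans (s≤s z≤n) e≥3))
            (≤-trans (≤-reflexive (trans (cong (λ k → others x S * e + e * k) z≡1) (trans (cong (others x S * e +_) (*-identityʳ e)) (+-comm _ e))))
              (*-monoˡ-≤ e (≰⇒> few))))
    ... | yes ho with core-gain S x∉ (all-noncentral long z≡1) h ho hn (+-cancelʳ-≤ (e + others x S) _ _
                        (≤-trans room (≤-trans (≤-reflexive (sym (trans (+-comm (count (comm? x) S) (others x S)) (others+comm x∉ S)))) (+-monoʳ-≤ (count (comm? x) S) (m≤n+m (others x S) e)))))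
    ...   | J , R , perm , len , g , counted = product-one-core z≡1 x∉ {R} (+-cancelˡ-≤ (h + h) _ _ (≤-trans (+-cancelʳ-≤ (others x S) _ _
              (≤-trans (≤-reflexive (+-assoc (h + h) e _)) (≤-trans room (≤-reflexive (sym (trans (+-comm (count (comm? x) S) (others x S)) (others+comm x∉ S))))))) (≤-reflexive counted)))
              (≤-trans (s≤s z≤n) e≥3)
              (saturated minimal perm (subst (0 <_) (sym len) (≤-trans h≥1 (m≤m+n h _))) g (≤-reflexive q≡))

  -- Two ways to secure the noncentral squares that `gain-triple` asks for. In the second, commuting
  -- involutions modulo the centre coincide, and `involutions-few` shows that few of them occur in
  -- `S`.
  NoInvolutions UniqueInvolutions : Set
  NoInvolutions = ∀ x → x ∉ M → x · x ∉ Z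
  UniqueInvolutions = ∀ u v → u ∉ Z → v ∉ Z → u · u ∈ Z → v · v ∈ Z → Comm u v → u ≡ v

  noninvolutions-all : NoInvolutions → ∀ {x} → x ∉ M → ∀ {L} → All (_∉ Z) L → count (comm? x) L ≤ count (noninvolution? x) L
  noninvolutions-all none x∉ [] = z≤n
  noninvolutions-all none {x} x∉ {y ∷ L} (y∉ ∷ L∉) with comm? x y | (y · y) ∈? Z
  ... | no _  | _ = noninvolutions-all none x∉ L∉
  ... | yes c | no _  = s≤s (noninvolutions-all none x∉ L∉)
  ... | yes c | yes p = ⊥-elim (none y (λ y∈M → y∉ (M∩C⊆Z y∈M x∉ c)) p)

  noninvolutions-most : ∀ {x} (x∉ : x ∉ M) {L} → All (_∉ Z) L → count (comm? x) L ≤ count (noninvolution? x) L + count (involution? x∉) L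
  noninvolutions-most x∉ [] = z≤n
  noninvolutions-most {x} x∉ {y ∷ L} (y∉ ∷ L∉) with comm? x y | y ∈? Z | (y · y) ∈? Z
  ... | no _  | _ | _ = noninvolutions-most x∉ L∉
  ... | yes c | yes p | _ = ⊥-elim (y∉ p)
  ... | yes c | no _ | no _  = s≤s (noninvolutions-most x∉ L∉)
  ... | yes c | no _ | yes p = ≤-trans (s≤s (noninvolutions-most x∉ L∉)) (≤-reflexive (sym (+-suc _ _)))

  module _ (cases : 4 ≤ e ⊎ 2 ≤ z) (involutions : NoInvolutions ⊎ UniqueInvolutions) (long : Long) where

    open Partition partition

    private
      q₁ = pred q
      q₁≡ : suc q₁ ≡ q
      q₁≡ = suc-pred q {{>-nonZero 1≤q}}
      q₁≡2h : q₁ ≡ h + h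
      q₁≡2h = cong pred q≡
      Ns = Os ++ As
      S↭Ns : S ↭ Ns ++ Zs
      S↭Ns = ↭-trans perm (↭-reflexive (sym (++-assoc Os As Zs)))
      Ns∉Z : All (_∉ Z) Ns
      Ns∉Z = Allₚ.++⁺ (All.map (λ n p → n (Z⊆M p)) Os∉) (All.map proj₂ As∈)
      long₁ : ∀ {N} → N ≡ length S → 3 * (e * (z * suc q₁)) < 4 * N
      long₁ eq = subst₂ (λ q N → 3 * (e * (z * q)) < 4 * N) (sym q₁≡) (sym eq) long
      many : ¬ length Ns < 2 * q₁
      many few = noncentral-many e z q₁ (length Ns) (length Zs) e≥3 1≤z (long₁ (sym (trans (↭-length S↭Ns) (length-++ Ns)))) (central-few long) few

    from-pairs : ∀ {ps R} → length ps ≡ q₁ → All (λ (x , y) → ¬ Comm x y) ps → Ns ↭ flat ps ++ R → length S + z + 3 ≤ 2 * q + (z * q + e * z)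
    from-pairs {ps} {R} len ncs perm′ = begin
      length S + z + 3                              ≡⟨ cong (λ k → k + z + 3) (trans (↭-length S↭J) (trans (length-++ (flat ps)) (cong (_+ length (R ++ Zs)) (trans (length-flat ps) (cong (2 *_) len))))) ⟩
      2 * q₁ + length (R ++ Zs) + z + 3             ≡⟨ l q₁ (length (R ++ Zs)) z ⟩
      2 * suc q₁ + (length (R ++ Zs) + z + 1)       ≤⟨ +-mono-≤ (≤-reflexive (cong (2 *_) q₁≡)) (rest-bound long S↭J (subst (0 <_) (sym (trans (length-flat ps) (cong (2 *_) len))) 0<J) (gain-flat ncs) (≤-reflexive (trans (sym q₁≡) (cong suc (sym len))))) ⟩
      2 * q + (z * q + e * z)                       ∎
      where
      open ≤-Reasoning
      S↭J : S ↭ flat ps ++ (R ++ Zs)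
      S↭J = ↭-trans S↭Ns (↭-trans (++⁺ʳ Zs perm′) (↭-reflexive (++-assoc (flat ps) R Zs)))
      0<J : 0 < 2 * q₁
      0<J = ≤-trans (subst (1 ≤_) (sym q₁≡2h) (≤-trans h≥1 (m≤m+n h h))) (m≤m+n q₁ _)
      l : ∀ q r z → 2 * q + r + z + 3 ≡ 2 * suc q + (r + z + 1)
      l = solve-∀

    -- Either q - 1 noncommuting pairs realise a coset of `A`, or fewer than q - 1 noncentral terms
    -- fail to commute with some term `x`; the latter case depends on whether `x` lies in `M`.
    index-more : ⊥
    index-more with matching q₁ Ns Ns∉Z (≮⇒≥ many)
    ... | inj₁ (ps , R , len , ncs , perm′) = [ (λ e≥4 → pairs-≥4 e z q (length S) e≥4 1≤z e<q′ long (from-pairs len ncs perm′))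
                                            , (λ z≥2 → pairs-z≥2 e z q (length S) e≥3 z≥2 e<q′ long (from-pairs len ncs perm′)) ]′ cases
    ... | inj₂ (x , L′ , perm′ , few) with x ∈? M
    ...   | yes x∈ with q ≤? suc (length As)
    ...     | yes ab = abundant-≥3 e z q (length S) e≥3 1≤z e<q′ long (abundant long ab)
    -- A noncentral `x` in `M` commutes with no term outside `M`, so there are few such terms. With
    -- few noncentral terms in `M` as well, there are too few noncentral terms altogether.
    ...     | no ¬ab = many (≤-trans (s≤s (≤-reflexive (length-++ Os))) (≤-trans (+-mono-≤ (≤-<-trans Os≤ few) (<⇒≤ (≤-pred (≤-trans (≰⇒> ¬ab) (≤-reflexive (sym q₁≡))))))
                         (≤-reflexive (cong (q₁ +_) (sym (+-identityʳ q₁))))))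
      where
      x∉Z : x ∉ Z
      x∉Z = All.head (All-resp-↭ perm′ Ns∉Z)
      Os≤ : length Os ≤ others x Ns
      Os≤ = ≤-trans (≤-reflexive (sym (count-all (outside? x) (All.map (λ y∉ c → x∉Z (M∩C⊆Z x∈ y∉ (sym c))) Os∉))))
        (≤-trans (m≤m+n _ _) (≤-reflexive (sym (count-++ (outside? x) Os As))))
    index-more | inj₂ (x , L′ , perm′ , few) | no x∉ with 2 ≤? z
    ... | yes z≥2 = pool-z≥2 e z q₁ (others x S) (length S) e≥3 z≥2 few′ (long₁ refl) (pool-bound x∉ long (≤-trans (s≤s z≤n) e≥3))
      where
      same : others x S ≡ others x Ns
      same = trans (count-↭ (outside? x) S↭Ns) (trans (count-++ (outside? x) Ns Zs) (trans (cong (others x Ns +_)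
        (count-none (outside? x) (All.map (λ y∈ n → n (sym (centre⁻ y∈ x))) Zs∈))) (+-identityʳ _)))
      few′ : others x S < q₁
      few′ = subst (_< q₁) (sym same) few
    ... | no z<2 = core-absurd long z≡1 x∉ (≮⇒≥ (λ lt → core-room e h o (length S) e≥4 h≥1 (long′ long z≡1) few″ lt))
                     ([ (λ none → ≤-trans comm≥h (noninvolutions-all none x∉ (all-noncentral long z≡1)))
                      , (λ unique → ≮⇒≥ λ lt → core-noninvolutions e h o (count (noninvolution? x) S) (length S) e≥4 h≥1 (long′ long z≡1) few″ lt
                          (≤-trans (≤-reflexive (sym (others+comm x∉ S))) (+-monoʳ-≤ o (≤-trans (noninvolutions-most x∉ (all-noncentral long z≡1))
                            (+-monoʳ-≤ _ (involutions-few x∉ long z≡1 (λ {u} {v} → unique u v))))))) ]′ involutions)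
      where
      o = others x S
      z≡1 : z ≡ 1
      z≡1 = ≤-antisym (≤-pred (≰⇒> z<2)) 1≤z
      e≥4 : 4 ≤ e
      e≥4 = [ id , (λ z≥2 → ⊥-elim (z<2 z≥2)) ]′ cases
      few″ : o < h + h
      few″ = subst₂ _<_ (sym (trans (count-↭ (outside? x) S↭Ns) (trans (count-++ (outside? x) Ns Zs) (trans (cong (others x Ns +_)
        (count-none (outside? x) (All.map (λ y∈ n → n (sym (centre⁻ y∈ x))) Zs∈))) (+-identityʳ _))))) q₁≡2h few
      comm≥h : h ≤ count (comm? x) S
      comm≥h = +-cancelˡ-≤ o _ _ (≤-trans (+-monoʳ-≤ o (m≤m+n h (h + e))) (≤-trans (≤-reflexive (l o h e)) (≤-trans
        (≮⇒≥ (λ lt → core-room e h o (length S) e≥4 h≥1 (long′ long z≡1) few″ lt)) (≤-reflexive (sym (others+comm x∉ S))))))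
        where
        l : ∀ o h e → o + (h + (h + e)) ≡ (h + h) + (e + o)
        l = solve-∀

-- Index three with trivial centre: inserting terms at three places

module IndexThree (G : FinGroup) (data′ : AffineData G) {S : List (Elt G)} (minimal : MinimalProductOne G S) (h : ℕ)
  (q≡ : Affine.q G data′ ≡ suc (h + h)) (e≡3 : AffineData.e data′ ≡ 3) (z≡1 : Affine.z G data′ ≡ 1) where

  open Core G data′ minimal h q≡ (≤-reflexive (sym e≡3)) public

  h≥2 : 2 ≤ h
  h≥2 = go h (≤-pred (subst₂ _<_ e≡3 q≡ e<q′))
    where
    go : ∀ h → 3 ≤ h + h → 2 ≤ h
    go (suc zero) (s≤s (s≤s ()))
    go (suc (suc h)) _ = s≤s (s≤s z≤n)

  Z-trivial : ∀ {x} → x ∈ Z → x ≡ ε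
  Z-trivial {x} x∈ = decidable-stable (x ≟ ε) λ x≢ε → <⇒≱ (distinct-≤ (x ∷ ε ∷ []) ((x≢ε ∷ []) ∷ [] ∷ []) (x∈ ∷ ε∈ centre-sub ∷ [])) (≤-reflexive z≡1)

  M⊆A : ∀ {m} → m ∈ M → m ∈ A
  M⊆A m∈ with decompose m∈
  ... | a , ζ , a∈ , ζ∈ , refl = subst (_∈ A) (trans (sym (ε-right a)) (cong (a ·_) (sym (Z-trivial ζ∈)))) a∈

  order-3M : order ≡ 3 * # M
  order-3M = trans index-e (cong (_* # M) e≡3)

  module Hosts (none : NoInvolutions) {x x′ : E} (x∉ : x ∉ M) (same : x ⁻ · x′ ∈ M) (nc : ¬ Comm x x′) where

    xx∉M : x · x ∉ M
    xx∉M p = none x x∉ (M∩C⊆Z p x∉ (comm-· refl refl))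

    -- Orderings whose partial products pass through the coset of `x` on the way to that of `x · x`.
    -- The cut marks a place between the two hosts where a further term may be inserted.
    record Split (L : List E) (s : ℕ) : Set where
      field
        X   : BSet order
        v   : E
        v≡  : (x · x) ⁻ · v ∈ M
        X⊆A : ∀ y → y ∈ X → y ∈ A
        cut : ∀ {y} → y ∈ X → ∃[ T₁ ] ∃[ T₂ ] (T₁ ++ T₂ ↭ L × x ⁻ · ∏ T₁ ∈ M × ∏ T₁ · ∏ T₂ ≡ y · v)
        big : suc s ≤ # X ⊎ q ≤ # X

    A-normal-M : ∀ g {m} → m ∈ M → conj g m ∈ M
    A-normal-M g m∈ = A⊆M (conj-A g (M⊆A m∈))

    start : Split (x ∷ x′ ∷ []) 1
    start = record
      { X = set X? ; v = x′ · x
      ; v≡ = subst (_∈ M) (word (x ∷ x′ ∷ []) (v0 ⁱ • (v0 ⁱ • v1) • v0 ⁱ ⁱ) ((v0 • v0) ⁱ • (v1 • v0)) refl) (A-normal-M (x ⁻) same)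
      ; X⊆A = λ y y∈ → [ (λ { refl → ε∈ A-sub }) , (λ { refl → commutator x x′ }) ]′ (∈⁻ X? y∈)
      ; cut = λ y∈ → [ (λ { refl → x′ ∷ [] , x ∷ [] , swap x′ x ↭-refl , subst (λ w → x ⁻ · w ∈ M) (sym (ε-right x′)) same
                            , word (x ∷ x′ ∷ []) ((v1 • 𝟙) • (v0 • 𝟙)) (𝟙 • (v1 • v0)) refl })
                     , (λ { refl → x ∷ [] , x′ ∷ [] , ↭-refl , subst (_∈ M) (word (x ∷ []) 𝟙 (v0 ⁱ • (v0 • 𝟙)) refl) (ε∈ M-sub)
                            , word (x ∷ x′ ∷ []) ((v0 • 𝟙) • (v1 • 𝟙)) (v0 • v1 • (v1 • v0) ⁱ • (v1 • v0)) refl }) ]′ (∈⁻ X? y∈)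
      ; big = inj₁ (distinct-≤ (ε ∷ c ∷ []) (((λ eq → nontrivial-commutator nc (sym eq)) ∷ []) ∷ [] ∷ []) (∈⁺ X? (inj₁ refl) ∷ ∈⁺ X? (inj₂ refl) ∷ [])) }
      where
      c = x · x′ · (x′ · x) ⁻
      X? : ∀ y → Dec (y ≡ ε ⊎ y ≡ c)
      X? y = (y ≟ ε) ⊎-dec (y ≟ c)

    conj-mod : ∀ {g g′ a} → g ⁻ · g′ ∈ M → a ∈ A → conj g′ a ≡ conj g a
    conj-mod {g} {g′} {a} m∈ a∈ = trans (word (g ∷ g′ ∷ a ∷ []) (v1 • v2 • v1 ⁱ) (v0 • (v0 ⁱ • v1 • v2 • (v0 ⁱ • v1) ⁱ) • v0 ⁱ) refl)
      (cong (λ w → g · w · g ⁻) (conj-comm (centraliser⁻ m∈ a a∈)))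

    -- Placed at the front, at the cut or at the end, `a` contributes the factor `a`, `conj x a` or
    -- `conj (x · x) a`. These are distinct because `x` and `x · x` lie outside `M`; hence a gain of
    -- two for one term.
    insert : ∀ {L s a} → Split L s → a ∈ A → a ≢ ε → Split (a ∷ L) (s + 2)
    insert {L} {s} {a} sp a∈ a≢ε = record
      { X = proj₁ prod-set ; v = v ; v≡ = v≡
      ; X⊆A = λ w w∈ → case W-elim w w∈ of λ { (y , d , y∈ , d∈ , refl) → ·∈ A-sub (X⊆A y y∈) (D⊆A d d∈) }
      ; cut = λ {w} w∈ → case W-elim w w∈ of λ { (y , d , y∈ , d∈ , refl) → cut′ y d y∈ (∈⁻ D? d∈) }
      ; big = big-+ big (inj₁ (distinct-≤ (a ∷ conj x a ∷ conj (x · x) a ∷ [])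
          (((λ eq → a≢ε (A∩C a∈ x∉ (comm-conj (sym eq)))) ∷ (λ eq → a≢ε (A∩C a∈ xx∉M (comm-conj (sym eq)))) ∷ [])
           ∷ ((λ eq → a≢ε (A∩C a∈ x∉ (comm-conj (sym (cancelˡ x (cancelʳ (x ⁻) (trans eq (word (x ∷ a ∷ []) (v0 • v0 • v1 • (v0 • v0) ⁱ) (v0 • (v0 • v1 • v0 ⁱ) • v0 ⁱ) refl)))))))) ∷ [])
           ∷ [] ∷ [])
          (∈⁺ D? (inj₁ refl) ∷ ∈⁺ D? (inj₂ (inj₁ refl)) ∷ ∈⁺ D? (inj₂ (inj₂ refl)) ∷ []))) (proj₂ (proj₂ prod-set)) }
      where
      open Split sp
      D? : ∀ d → Dec (d ≡ a ⊎ (d ≡ conj x a ⊎ d ≡ conj (x · x) a))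
      D? d = (d ≟ a) ⊎-dec ((d ≟ conj x a) ⊎-dec (d ≟ conj (x · x) a))
      D⊆A : ∀ d → d ∈ set D? → d ∈ A
      D⊆A d d∈ with ∈⁻ D? d∈
      ... | inj₁ refl = a∈
      ... | inj₂ (inj₁ refl) = conj-A x a∈
      ... | inj₂ (inj₂ refl) = conj-A (x · x) a∈
      prod-set = product-set X⊆A D⊆A (inhabited (big⇒pos big)) (a , ∈⁺ D? (inj₁ refl))
      W-elim = proj₁ (proj₂ prod-set)
      cut′ : ∀ y d → y ∈ X → d ≡ a ⊎ (d ≡ conj x a ⊎ d ≡ conj (x · x) a) →
        ∃[ T₁ ] ∃[ T₂ ] (T₁ ++ T₂ ↭ a ∷ L × x ⁻ · ∏ T₁ ∈ M × ∏ T₁ · ∏ T₂ ≡ y · d · v)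
      cut′ y d y∈ which with cut y∈
      cut′ y d y∈ (inj₁ refl) | T₁ , T₂ , perm , T₁≡ , eq = a ∷ T₁ , T₂ , prep a perm
        , subst (_∈ M) (word (x ∷ a ∷ ∏ T₁ ∷ []) (v0 ⁱ • v1 • v0 ⁱ ⁱ • (v0 ⁱ • v2)) (v0 ⁱ • (v1 • v2)) refl) (·∈ M-sub (A-normal-M (x ⁻) (A⊆M a∈)) T₁≡)
        , trans (·-assoc a (∏ T₁) (∏ T₂)) (trans (cong (a ·_) eq) (trans (sym (·-assoc a y v)) (cong (_· v) (A-comm a∈ (X⊆A y y∈)))))
      cut′ y d y∈ (inj₂ (inj₁ refl)) | T₁ , T₂ , perm , T₁≡ , eq = T₁ ++ a ∷ [] , T₂
        , ↭-trans (permute 3 (λ s t a → (s ⊕ a) ⊕ t ⊜ a ⊕ (s ⊕ t)) ↭-refl T₁ T₂ (a ∷ [])) (prep a perm)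
        , subst (_∈ M) (trans (·-assoc (x ⁻) (∏ T₁) a) (cong (x ⁻ ·_) (sym end))) (·∈ M-sub T₁≡ (A⊆M a∈))
        , trans (cong (_· ∏ T₂) end) (trans (word (∏ T₁ ∷ ∏ T₂ ∷ a ∷ []) (v0 • v2 • v1) (v0 • v2 • v0 ⁱ • (v0 • v1)) refl)
            (trans (cong₂ _·_ (conj-mod T₁≡ a∈) eq) (trans (sym (·-assoc _ y v)) (cong (_· v) (A-comm (conj-A x a∈) (X⊆A y y∈))))))
        where
        end : ∏ (T₁ ++ a ∷ []) ≡ ∏ T₁ · a
        end = trans (∏-++ T₁ (a ∷ [])) (cong (∏ T₁ ·_) (ε-right a))
      cut′ y d y∈ (inj₂ (inj₂ refl)) | T₁ , T₂ , perm , T₁≡ , eq = T₁ , T₂ ++ a ∷ []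
        , ↭-trans (permute 3 (λ s t a → s ⊕ (t ⊕ a) ⊜ a ⊕ (s ⊕ t)) ↭-refl T₁ T₂ (a ∷ [])) (prep a perm)
        , T₁≡
        , trans (cong (∏ T₁ ·_) (trans (∏-++ T₂ (a ∷ [])) (cong (∏ T₂ ·_) (ε-right a)))) (trans (sym (·-assoc _ _ a)) (trans (cong (_· a) eq)
            (trans (word (y ∷ v ∷ a ∷ []) (v0 • v1 • v2) (v0 • (v1 • v2 • v1 ⁱ) • v1) refl) (cong (λ w → y · w · v) (conj-mod v≡ a∈)))))

    insert-all : ∀ {as} → All (λ a → a ∈ M × a ∉ Z) as → Split (as ++ x ∷ x′ ∷ []) (1 + (length as + length as))
    insert-all [] = start
    insert-all {a ∷ as} ((a∈ , a∉) ∷ rest) = subst (Split _) (l (length as)) (insert (insert-all rest) (M⊆A a∈) (λ { refl → a∉ (ε∈ centre-sub) }))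
      where
      l : ∀ n → 1 + (n + n) + 2 ≡ 1 + (suc n + suc n)
      l = solve-∀

    gain-hosts : ∀ {as} → All (λ a → a ∈ M × a ∉ Z) as → Gain (as ++ x ∷ x′ ∷ []) (1 + (length as + length as))
    gain-hosts as∈ = record { X = X ; v = v ; X⊆A = X⊆A ; big = big
      ; reach = λ y∈ → case cut y∈ of λ { (T₁ , T₂ , perm , _ , eq) → T₁ ++ T₂ , perm , trans (∏-++ T₁ T₂) eq } }
      where open Split (insert-all as∈)

  -- With `x` itself these are e = 3 commuting terms, so `central-block` finds a product-one
  -- subsequence of at most three terms.
  Triple : List E → Set
  Triple L = ∃[ x ] ∃[ u ] ∃[ v ] ∃[ R ] (L ↭ x ∷ u ∷ v ∷ R × x ∉ M × Comm x u × Comm x v)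

  Thinned : List E → Set
  Thinned L = ∃[ L′ ] ∃[ L″ ] (L ↭ L′ ++ L″ × AllPairs (λ x y → ¬ Comm x y) L′ × length L ≤ 2 * length L′)

  thin-∷ : ∀ {x L} cs {ds} → L ↭ cs ++ ds → length cs ≤ 1 → All (λ y → ¬ Comm x y) ds → Triple ds ⊎ Thinned ds → Triple (x ∷ L) ⊎ Thinned (x ∷ L)
  thin-∷ {x} cs perm few nds (inj₁ (y , u , v , R , p , y∉ , cu , cv)) = inj₁ (y , u , v , x ∷ cs ++ R
    , ↭-trans (prep x (↭-trans perm (++⁺ˡ cs p))) (permute 4 (λ x c t r → x ⊕ (c ⊕ (t ⊕ r)) ⊜ t ⊕ (x ⊕ (c ⊕ r))) ↭-refl (x ∷ []) cs (y ∷ u ∷ v ∷ []) R) , y∉ , cu , cv)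
  thin-∷ {x} cs perm few nds (inj₂ (L′ , L″ , p , ap , le)) = inj₂ (x ∷ L′ , cs ++ L″
    , prep x (↭-trans perm (↭-trans (++⁺ˡ cs p) (permute 3 (λ c l m → c ⊕ (l ⊕ m) ⊜ l ⊕ (c ⊕ m)) ↭-refl cs L′ L″)))
    , Allₚ.++⁻ˡ L′ (All-resp-↭ p nds) ∷ ap
    , ≤-trans (s≤s (≤-trans (≤-reflexive (trans (↭-length perm) (length-++ cs))) (+-mono-≤ few le))) (≤-reflexive (sym (*-suc 2 (length L′)))))

  private
    shorter : ∀ {x L} cs {ds : List E} → L ↭ cs ++ ds → length ds < length (x ∷ L)
    shorter cs perm = s≤s (≤-trans (m≤n+m _ (length cs)) (≤-reflexive (sym (trans (↭-length perm) (length-++ cs)))))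

  -- Without a triple, the first term commutes with at most one of the others. Dropping that partner
  -- and going on with the rest keeps at least half of the terms.
  thin : ∀ L → Acc _<_ (length L) → All (_∉ M) L → Triple L ⊎ Thinned L
  thin [] _ _ = inj₂ ([] , [] , refl , [] , z≤n)
  thin (x ∷ L) (acc rec) (x∉ ∷ L∉) with separate (comm? x) L
  ... | u ∷ v ∷ cs , ds , perm , cu ∷ cv ∷ _ , _ , _ = inj₁ (x , u , v , cs ++ ds , prep x perm , x∉ , cu , cv)
  ... | [] , ds , perm , _ , nds , _ = thin-∷ [] perm z≤n nds (thin ds (rec (shorter {x} [] perm)) (Allₚ.++⁻ʳ [] (All-resp-↭ perm L∉)))
  ... | c ∷ [] , ds , perm , _ , nds , _ = thin-∷ (c ∷ []) perm (s≤s z≤n) nds (thin ds (rec (shorter {x} (c ∷ []) perm)) (Allₚ.++⁻ʳ (c ∷ []) (All-resp-↭ perm L∉)))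

  -- Outside `M` there are only two cosets, so three of five terms share one. If the first of these
  -- three commutes with both others, they form a triple.
  same-coset-pair : ∀ Os → All (_∉ M) Os → 5 ≤ length Os →
    Triple Os ⊎ ∃[ x ] ∃[ x′ ] ∃[ R ] (Os ↭ x ∷ x′ ∷ R × x ∉ M × x ⁻ · x′ ∈ M × ¬ Comm x x′)
  same-coset-pair (y ∷ Os) (y∉ ∷ Os∉) (s≤s long) with separate (λ u → (y ⁻ · u) ∈? M) Os
  ... | cs , ds , perm , cs∈ , ds∉ , _ = choose cs ds perm cs∈ ds∉
    where
    three : ∀ {a b c R} → y ∷ Os ↭ a ∷ b ∷ c ∷ R → a ∉ M → a ⁻ · b ∈ M → a ⁻ · c ∈ M →
      Triple (y ∷ Os) ⊎ ∃[ x ] ∃[ x′ ] ∃[ R ] (y ∷ Os ↭ x ∷ x′ ∷ R × x ∉ M × x ⁻ · x′ ∈ M × ¬ Comm x x′)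
    three {a} {b} {c} {R} p a∉ ab ac with comm? a b | comm? a c
    ... | no n  | _     = inj₂ (a , b , c ∷ R , p , a∉ , ab , n)
    ... | yes _ | no n  = inj₂ (a , c , b ∷ R , ↭-trans p (prep a (swap b c ↭-refl)) , a∉ , ac , n)
    ... | yes p₁ | yes p₂ = inj₁ (a , b , c , R , p , a∉ , p₁ , p₂)
    meet : ∀ {u v} → u ∉ M → v ∉ M → y ⁻ · u ∉ M → y ⁻ · v ∉ M → u ⁻ · v ∈ M
    meet {u} {v} u∉ v∉ yu yv = decidable-stable ((u ⁻ · v) ∈? M) λ uv → <⇒≱ (*-monoˡ-< (# M) {{>-nonZero (1≤#H M-sub)}} {3} {4} ≤-refl)
      (≤-trans (cosets-≤ M-sub full (ε ∷ y ∷ u ∷ v ∷ [])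
          ((out y∉ ∷ out u∉ ∷ out v∉ ∷ []) ∷ (yu ∷ yv ∷ []) ∷ (uv ∷ []) ∷ [] ∷ []) (All.tabulate (λ _ _ _ → ∈-full))) (≤-reflexive (trans #-full order-3M)))
      where
      out : ∀ {u} → u ∉ M → ε ⁻ · u ∉ M
      out {u} n p = n (subst (_∈ M) (word (u ∷ []) (𝟙 ⁱ • v0) v0 refl) p)
    choose : ∀ cs ds → Os ↭ cs ++ ds → All (λ u → y ⁻ · u ∈ M) cs → All (λ u → y ⁻ · u ∉ M) ds →
      Triple (y ∷ Os) ⊎ ∃[ x ] ∃[ x′ ] ∃[ R ] (y ∷ Os ↭ x ∷ x′ ∷ R × x ∉ M × x ⁻ · x′ ∈ M × ¬ Comm x x′)
    choose (c ∷ c′ ∷ cs) ds perm (p ∷ p′ ∷ _) _ = three (prep y perm) y∉ p p′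
    choose cs (a ∷ b ∷ c ∷ ds) perm _ (na ∷ nb ∷ nc ∷ _) = three (↭-trans (prep y perm)
        (permute 4 (λ y c t d → y ⊕ (c ⊕ (t ⊕ d)) ⊜ t ⊕ (y ⊕ (c ⊕ d))) ↭-refl (y ∷ []) cs (a ∷ b ∷ c ∷ []) ds)) a∉ (meet a∉ b∉′ na nb) (meet a∉ c∉ na nc)
      where
      ds∉M = Allₚ.++⁻ʳ cs (All-resp-↭ perm Os∉)
      a∉ = All.head ds∉M
      b∉′ = All.head (All.tail ds∉M)
      c∉ = All.head (All.tail (All.tail ds∉M))
    choose [] [] perm _ _ = ⊥-elim (<⇒≱ long (≤-trans (≤-reflexive (↭-length perm)) z≤n))
    choose [] (_ ∷ []) perm _ _ = ⊥-elim (<⇒≱ long (≤-trans (≤-reflexive (↭-length perm)) (s≤s z≤n)))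
    choose [] (_ ∷ _ ∷ []) perm _ _ = ⊥-elim (<⇒≱ long (≤-trans (≤-reflexive (↭-length perm)) (s≤s (s≤s z≤n))))
    choose (_ ∷ []) [] perm _ _ = ⊥-elim (<⇒≱ long (≤-trans (≤-reflexive (↭-length perm)) (s≤s z≤n)))
    choose (_ ∷ []) (_ ∷ []) perm _ _ = ⊥-elim (<⇒≱ long (≤-trans (≤-reflexive (↭-length perm)) (s≤s (s≤s z≤n))))
    choose (_ ∷ []) (_ ∷ _ ∷ []) perm _ _ = ⊥-elim (<⇒≱ long (≤-trans (≤-reflexive (↭-length perm)) (s≤s (s≤s (s≤s z≤n)))))

  -- Pairwise noncommuting x, together with their squares, are distinct.
  noncommuting-≤ : NoInvolutions → ∀ {L} → All (_∉ M) L → AllPairs (λ x y → ¬ Comm x y) L → length L ≤ q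
  noncommuting-≤ none {L} L∉ ap = *-cancelˡ-≤ 2 (≤-trans (≤-reflexive (sym (length-squares L)))
    (≤-trans (distinct-≤ {full ∖ M} (squares L) (distinct L L∉ ap) (outside L L∉)) complement))
    where
    squares : List E → List E
    squares []      = []
    squares (x ∷ L) = x ∷ x · x ∷ squares L
    length-squares : ∀ L → length (squares L) ≡ 2 * length L
    length-squares []      = refl
    length-squares (x ∷ L) = trans (cong (2 +_) (length-squares L)) (sym (*-suc 2 (length L)))
    outside : ∀ L → All (_∉ M) L → All (_∈ full ∖ M) (squares L)
    outside [] [] = []
    outside (x ∷ L) (x∉ ∷ L∉) = ∖⁺ {X = full} {M} (∈-full , x∉)
      ∷ ∖⁺ {X = full} {M} (∈-full , λ p → none x x∉ (M∩C⊆Z p x∉ (comm-· refl refl))) ∷ outside L L∉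
    apart : ∀ {x w} L → All (_∉ M) L → All (λ y → ¬ Comm x y) L → w ∉ Z → Comm x w → All (w ≢_) (squares L)
    apart [] _ _ _ _ = []
    apart {x} {w} (y ∷ L) (y∉ ∷ L∉) (n ∷ ns) w∉ c = (λ { refl → n c }) ∷ (λ { refl → n (comm-trans w∉ c (sym (comm-· refl refl))) }) ∷ apart L L∉ ns w∉ c
    distinct : ∀ L → All (_∉ M) L → AllPairs (λ x y → ¬ Comm x y) L → AllPairs _≢_ (squares L)
    distinct [] _ _ = []
    distinct (x ∷ L) (x∉ ∷ L∉) (n ∷ ns) = ((λ eq → x∉ (subst (_∈ M) (cancelˡ x (trans (ε-right x) eq)) (ε∈ M-sub))) ∷ apart L L∉ n (λ p → x∉ (Z⊆M p)) refl)
      ∷ apart L L∉ n (none x x∉) (comm-· refl refl) ∷ distinct L L∉ ns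
    complement : # (full ∖ M) ≤ 2 * q
    complement = +-cancelˡ-≤ (# M) _ _ (≤-trans (disjoint-≤ {X = M} {full ∖ M} {full} (λ i p r → proj₂ (∖⁻ {X = full} {M} r) p) (λ _ _ → ∈-full) (λ _ _ → ∈-full))
      (≤-reflexive (trans #-full (trans order-3M (cong (λ m → # M + 2 * m) (trans #M (trans (cong (_* q) z≡1) (*-identityˡ q))))))))

-- Index three with trivial centre: the contradiction

module IndexThreeBound (G : FinGroup) (data′ : AffineData G) {S : List (Elt G)} (minimal : MinimalProductOne G S) (h : ℕ)
  (q≡ : Affine.q G data′ ≡ suc (h + h)) (e≡3 : AffineData.e data′ ≡ 3) (z≡1 : Affine.z G data′ ≡ 1)
  (none : Core.NoInvolutions G data′ minimal h q≡ (≤-reflexive (sym e≡3))) (long : Bounds.Long G data′ minimal) where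

  open IndexThree G data′ minimal h q≡ e≡3 z≡1
  open Partition partition

  private
    long₃ : 3 * (3 * (1 * suc (h + h))) < 4 * length S
    long₃ = subst (λ e → 3 * (e * (1 * suc (h + h))) < 4 * length S) e≡3 (long′ long z≡1)

    no-Zs : length Zs ≡ 0
    no-Zs = n≤0⇒n≡0 (≤-pred (subst (length Zs <_) z≡1 (central-few long)))

    L≡ : length S ≡ length Os + length As
    L≡ = trans lengths (cong (length Os +_) (trans (cong (length As +_) no-Zs) (+-identityʳ _)))

    few-As : length As < h + h
    few-As = ≰⇒> λ ge → abundant-≥3 e z q (length S) (≤-reflexive (sym e≡3)) 1≤z e<q′ long
      (abundant long (≤-trans (≤-reflexive q≡) (s≤s ge)))

    core₃ : ∀ {x} → x ∉ M → (h + h) + (3 + others x S) ≤ length S → ⊥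
    core₃ {x} x∉ room = core-absurd long z≡1 x∉ (subst (λ e → (h + h) + (e + others x S) ≤ length S) (sym e≡3) room)
      (≤-trans (≤-trans (m≤m+n h (h + 3)) (+-cancelʳ-≤ (others x S) _ _ (≤-trans (≤-reflexive (l h (others x S)))
        (≤-trans room (≤-reflexive (sym (trans (+-comm (count (comm? x) S) (others x S)) (others+comm x∉ S)))))))) (noninvolutions-all none x∉ (all-noncentral long z≡1)))
      where
      l : ∀ h o → h + (h + 3) + o ≡ (h + h) + (3 + o)
      l = solve-∀

    rest₃ : ∀ {J R s} → S ↭ J ++ R → 0 < length J → Gain J s → h + h ≤ s → length R + 1 + 1 ≤ 1 * suc (h + h) + 3 * 1
    rest₃ {R = R} p pos g le = subst₂ (λ z q → length R + z + 1 ≤ z * q + 3 * z) z≡1 q≡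
      (subst (λ e → length R + z + 1 ≤ z * q + e * z) e≡3 (rest-bound long p pos g (≤-trans (≤-reflexive q≡) (s≤s le))))

  in-M-few : ∀ {U V} → S ↭ U ++ V → count (_∈? M) V ≤ length As
  in-M-few {U} {V} p = ≤-trans (m≤n+m _ _) (≤-reflexive (trans (sym (count-++ (_∈? M) U V)) (trans (count-↭ (_∈? M) (↭-trans (↭-sym p) perm))
    (trans (count-++ (_∈? M) Os (As ++ Zs)) (trans (cong₂ _+_ (count-none (_∈? M) Os∉) (count-all (_∈? M) (Allₚ.++⁺ (All.map proj₁ As∈) (All.map Z⊆M Zs∈))))
      (trans (length-++ As) (trans (cong (length As +_) no-Zs) (+-identityʳ _))))))))

  in-or-outside : ∀ {x} → x ∈ M → x ∉ Z → ∀ V → length V ≤ count (_∈? M) V + others x V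
  in-or-outside x∈ x∉ [] = z≤n
  in-or-outside {x} x∈ x∉ (y ∷ V) with y ∈? M | comm? x y
  ... | yes _ | yes _ = s≤s (in-or-outside x∈ x∉ V)
  ... | yes _ | no _  = s≤s (≤-trans (in-or-outside x∈ x∉ V) (+-monoʳ-≤ _ (n≤1+n _)))
  ... | no y∉ | yes c = ⊥-elim (x∉ (M∩C⊆Z x∈ y∉ (sym c)))
  ... | no _  | no _  = ≤-trans (s≤s (in-or-outside x∈ x∉ V)) (≤-reflexive (sym (+-suc _ _)))

  -- The triple contains a product-one `U`, so no part of the remaining terms `V` may realise a
  -- coset of `A`. But `V` is long enough for 2 h noncommuting pairs or for the triples of
  -- `core-gain`, unless fewer than h of its terms fail to commute with some `y` outside `M`; then
  -- `core₃` applies.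
  triple-absurd : ¬ Triple S
  triple-absurd (x , u , v , R₀ , perm₀ , x∉ , cu , cv) with central-block x∉ (x ∷ u ∷ v ∷ []) (refl ∷ cu ∷ cv ∷ []) (sym e≡3)
  ... | U , W , es↭ , U≠[] , central = by-matching (matching (h + h) V V∉ enough)
    where
    V = W ++ R₀
    S↭ : S ↭ U ++ V
    S↭ = ↭-trans perm₀ (↭-trans (++⁺ʳ R₀ es↭) (↭-reflexive (++-assoc U W R₀)))
    U≤3 : length U ≤ 3
    U≤3 = ≤-trans (m≤m+n _ _) (≤-reflexive (sym (trans (↭-length es↭) (length-++ U))))
    L≤ : length S ≤ 3 + length V
    L≤ = ≤-trans (≤-reflexive (trans (↭-length S↭) (length-++ U))) (+-monoˡ-≤ (length V) U≤3)
    V∉ : All (_∉ Z) V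
    V∉ = Allₚ.++⁻ʳ U (All-resp-↭ S↭ (all-noncentral long z≡1))
    saturating : ∀ {J R} → V ↭ J ++ R → 0 < length J → Gain J (h + h) → ⊥
    saturating {J} {R} p pos g = saturated {J = J} {R ++ U} minimal (↭-trans S↭ (↭-trans (++⁺ˡ U p) (permute 3 (λ u j r → u ⊕ (j ⊕ r) ⊜ j ⊕ (r ⊕ u)) ↭-refl U J R)))
      pos g (≤-reflexive q≡) U R (++-comm R U) (nonempty-length U≠[]) (U , ↭-refl , Z-trivial central)
    enough : 2 * (h + h) ≤ length V
    enough = ≮⇒≥ (three-many h (length S) (length V) h≥2 long₃ L≤)
    0<2h : 0 < h + h
    0<2h = ≤-trans h≥1 (m≤m+n h h)
    by-matching : Pairs (h + h) V ⊎ ∃[ x ] ∃[ L′ ] (V ↭ x ∷ L′ × others x V < h + h) → ⊥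
    by-matching (inj₁ (ps , R , len , ncs , p)) = saturating p (subst (0 <_) (sym (trans (length-flat ps) (cong (2 *_) len))) (≤-trans 0<2h (m≤m+n _ _))) (subst (Gain (flat ps)) len (gain-flat ncs))
    by-matching (inj₂ (y , V′ , p , few)) with y ∈? M
    ...   | yes y∈ = <⇒≱ (+-mono-< few-As few) (≤-trans (≤-trans (≤-reflexive (cong ((h + h) +_) (sym (+-identityʳ (h + h))))) enough)
              (≤-trans (in-or-outside y∈ (All.head (All-resp-↭ p V∉)) V) (+-monoˡ-≤ _ (in-M-few {U} S↭))))
    ...   | no y∉ with h ≤? others y V
    ...     | yes ho = by-core (core-gain V y∉ V∉ h ho (≤-trans (≤-trans (m≤m+n h h) comm≥) (noninvolutions-all none y∉ V∉)) comm≥)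
      where
      comm≥ : h + h ≤ count (comm? y) V
      comm≥ = +-cancelˡ-≤ (others y V) _ _ (≤-trans (+-monoˡ-≤ (h + h) (<⇒≤ few)) (≤-trans (≤-trans (≤-reflexive (cong ((h + h) +_) (sym (+-identityʳ (h + h))))) enough)
        (≤-reflexive (sym (others+comm y∉ V)))))
      by-core : ∃[ J ] ∃[ R ] (V ↭ J ++ R × length J ≡ h + (h + h) × Gain J (h + h) × count (comm? y) V ≡ (h + h) + count (comm? y) R) → ⊥
      by-core (J , R , p′ , len , g , _) = saturating p′ (subst (0 <_) (sym len) (≤-trans h≥1 (m≤m+n h _))) g
    by-matching (inj₂ (y , V′ , p , few)) | no y∉ | no ho = core₃ y∉ (≮⇒≥ (three-room h (length S) (others y S) h≥2 long₃ others<))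
      where
      others< : others y S < h + 3
      others< = ≤-trans (s≤s (≤-trans (≤-reflexive (trans (count-↭ (outside? y) S↭) (count-++ (outside? y) U V)))
        (+-monoˡ-≤ _ (≤-trans (count-≤ (outside? y) U) U≤3)))) (≤-trans (≤-reflexive (l (others y V))) (+-monoˡ-≤ 3 (≰⇒> ho)))
        where
        l : ∀ o → suc (3 + o) ≡ suc o + 3
        l = solve-∀

  private
    lift-Triple : ∀ {L R} → S ↭ L ++ R → Triple L → Triple S
    lift-Triple {R = R} p (x , u , v , R₀ , p′ , rest) = x , u , v , R₀ ++ R , ↭-trans p (++⁺ʳ R p′) , rest

  -- In the absence of triples half of these terms are pairwise noncommuting, and `noncommuting-≤`
  -- allows at most q such elements.
  few-Os : length Os ≤ 2 * q
  few-Os with thin Os (<-wellFounded (length Os)) Os∉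
  ... | inj₁ t = ⊥-elim (triple-absurd (lift-Triple perm t))
  ... | inj₂ (L′ , L″ , p , ap , le) = ≤-trans le (*-monoʳ-≤ 2 (noncommuting-≤ none (Allₚ.++⁻ˡ L′ (All-resp-↭ p Os∉)) ap))

  module _ {x x′ : E} {Os′ : List E} (Os↭ : Os ↭ x ∷ x′ ∷ Os′) (x∉ : x ∉ M) (same : x ⁻ · x′ ∈ M) (nc : ¬ Comm x x′) where

    open Hosts none x∉ same nc

    -- The two hosts gain one product and each of the `h` inserted terms gains two, which suffices
    -- for a whole coset with only h + 2 terms.
    many-As : ∀ as as′ → As ≡ as ++ as′ → length as ≡ h → ⊥
    many-As as as′ eq len = three-hosts h (length S) (length (Os′ ++ (as′ ++ Zs))) h≥2 long₃
        (≤-reflexive (trans (↭-length S↭) (trans (length-++ (as ++ x ∷ x′ ∷ [])) (cong (_+ length (Os′ ++ (as′ ++ Zs))) lenJ))))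
        (rest₃ S↭ (subst (0 <_) (sym lenJ) (≤-trans (s≤s z≤n) (m≤n+m 2 h))) (gain-hosts (Allₚ.++⁻ˡ as (subst (All (λ a → a ∈ M × a ∉ Z)) eq As∈)))
          (≤-trans (≤-reflexive (cong₂ _+_ (sym len) (sym len))) (n≤1+n _)))
      where
      lenJ : length (as ++ x ∷ x′ ∷ []) ≡ h + 2
      lenJ = trans (length-++ as) (cong (_+ 2) len)
      S↭ : S ↭ (as ++ x ∷ x′ ∷ []) ++ (Os′ ++ (as′ ++ Zs))
      S↭ = ↭-trans perm (↭-trans (++⁺ Os↭ (++⁺ʳ Zs (↭-reflexive eq)))
        (permute 5 (λ x o a a′ z → (x ⊕ o) ⊕ ((a ⊕ a′) ⊕ z) ⊜ (a ⊕ x) ⊕ (o ⊕ (a′ ⊕ z))) ↭-refl (x ∷ x′ ∷ []) Os′ as as′ Zs))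

    private
      N = length As
      Os≡ : length Os ≡ 2 + length Os′
      Os≡ = ↭-length Os↭
      Os′∉ : All (_∉ M) Os′
      Os′∉ = All.tail (All.tail (All-resp-↭ Os↭ Os∉))
      S↭ : S ↭ (As ++ x ∷ x′ ∷ []) ++ (Os′ ++ Zs)
      S↭ = ↭-trans perm (↭-trans (++⁺ʳ (As ++ Zs) Os↭) (permute 4 (λ x o a z → (x ⊕ o) ⊕ (a ⊕ z) ⊜ (a ⊕ x) ⊕ (o ⊕ z)) ↭-refl (x ∷ x′ ∷ []) Os′ As Zs))

    -- The hosts and the N terms of `A` gain 1 + 2 N. Of the 2 h needed, 1 + 2 d are missing, and
    -- they are sought among noncommuting pairs of the other terms outside `M`.
    module _ (d : ℕ) (h≡ : h ≡ suc N + d) where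

      private
        long₄ : 3 * (3 * (1 * suc ((1 + N + d) + (1 + N + d)))) < 4 * length S
        long₄ = subst (λ h → 3 * (3 * (1 * suc (h + h))) < 4 * length S) h≡ long₃

      by-pairs : Pairs (1 + (d + d)) Os′ → ⊥
      by-pairs (ps , R , len , ncs , p) = three-pairs N d (length S) (length (R ++ Zs)) long₄
            (≤-reflexive (trans (↭-length S↭J) (trans (length-++ J) (cong (_+ length (R ++ Zs)) lenJ))))
            (subst (λ h → length (R ++ Zs) + 1 + 1 ≤ 1 * suc (h + h) + 3 * 1) h≡ (rest₃ S↭J (subst (0 <_) (sym lenJ) (≤-trans (s≤s z≤n) (≤-trans (m≤n+m 2 N) (m≤m+n _ _))))
              (gain-++ (gain-hosts As∈) (gain-flat ncs)) (≤-reflexive (trans (cong (λ h → h + h) h≡) (trans (l N d) (cong (1 + (N + N) +_) (sym len)))))))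
            (≤-trans (≤-reflexive L≡) (+-monoˡ-≤ N (≤-trans few-Os (≤-reflexive (cong (2 *_) (trans q≡ (cong (λ h → suc (h + h)) h≡)))))))
        where
        J = (As ++ x ∷ x′ ∷ []) ++ flat ps
        S↭J : S ↭ J ++ (R ++ Zs)
        S↭J = ↭-trans S↭ (↭-trans (++⁺ˡ (As ++ x ∷ x′ ∷ []) (++⁺ʳ Zs p)) (permute 4 (λ a f r z → a ⊕ ((f ⊕ r) ⊕ z) ⊜ (a ⊕ f) ⊕ (r ⊕ z)) ↭-refl (As ++ x ∷ x′ ∷ []) (flat ps) R Zs))
        lenJ : length J ≡ (N + 2) + 2 * (1 + (d + d))
        lenJ = trans (length-++ (As ++ x ∷ x′ ∷ [])) (cong₂ _+_ (length-++ As) (trans (length-flat ps) (cong (2 *_) len)))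
        l : ∀ N d → (1 + N + d) + (1 + N + d) ≡ 1 + (N + N) + (1 + (d + d))
        l = solve-∀

      by-class : ∃[ y ] ∃[ L′ ] (Os′ ↭ y ∷ L′ × others y Os′ < 1 + (d + d)) → ⊥
      by-class (y , L′ , p , lt) = core₃ {y} (All.head (All-resp-↭ p Os′∉)) (≮⇒≥ λ room →
            three-class N d (length S) (others y S) long₄ others< (subst (λ h → length S < (h + h) + (3 + others y S)) h≡ room))
        where
        others< : others y S < 2 + (d + d) + 1 + N
        others< = ≤-trans (s≤s (≤-reflexive (trans (count-↭ (outside? y) S↭) (trans (count-++ (outside? y) (As ++ x ∷ x′ ∷ []) (Os′ ++ Zs))
          (cong (others y (As ++ x ∷ x′ ∷ []) +_) (count-++ (outside? y) Os′ Zs))))))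
          (≤-trans (s≤s (+-mono-≤ (≤-trans (count-≤ (outside? y) (As ++ x ∷ x′ ∷ [])) (≤-reflexive (length-++ As))) (+-mono-≤ (≤-pred lt) (≤-trans (count-≤ (outside? y) Zs) (≤-reflexive no-Zs)))))
            (≤-reflexive (l N (d + d))))
          where
          l : ∀ N D → suc (N + 2 + (D + 0)) ≡ 2 + D + 1 + N
          l = solve-∀

      few-As-absurd : ⊥
      few-As-absurd = [ by-pairs , by-class ]′ (matching (1 + (d + d)) Os′ (All.map (λ n p → n (Z⊆M p)) Os′∉)
        (≮⇒≥ (three-unmatched N d (length S) (length Os′) long₄ (≤-reflexive (trans L≡ (cong (_+ N) Os≡))))))

    hosts-absurd : ⊥
    hosts-absurd with h ≤? length As
    ... | yes many = let (as , as′ , eq , len) = split-at h As many in many-As as as′ eq len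
    ... | no few   = let (d , eq) = m≤n⇒∃[o]m+o≡n (≰⇒> few) in few-As-absurd d (sym eq)

  index-three : ⊥
  index-three = [ (λ t → triple-absurd (lift-Triple perm t)) , (λ (x , x′ , Os′ , Os↭ , x∉ , same , nc) → hosts-absurd Os↭ x∉ same nc) ]′
    (same-coset-pair Os Os∉ (≮⇒≥ (three-outside h (length S) (length As) (length Os) h≥2 long₃ (≤-reflexive L≡) few-As)))

-- Index two

module IndexTwo (G : FinGroup) (data′ : AffineData G) {S : List (Elt G)} (minimal : MinimalProductOne G S)
  (e≡2 : AffineData.e data′ ≡ 2) where

  open Cases G data′ minimal public

  private
    order-2M : order ≡ 2 * # M
    order-2M = trans index-e (cong (_* # M) e≡2)

  remove-pairs : ∀ {P : E → Set} {R : E → E → Set} {xs} → Any P xs → AllPairs R xs → ∃[ x ] ∃[ ys ] (P x × xs ↭ x ∷ ys × AllPairs R ys)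
  remove-pairs {xs = x ∷ xs} (here p) (_ ∷ ap) = x , xs , p , ↭-refl , ap
  remove-pairs {xs = x ∷ xs} (there i) (a ∷ ap) with remove-pairs i ap
  ... | y , ys , p , perm , ap′ = y , x ∷ ys , p , ↭-trans (prep x perm) (swap x y ↭-refl) , All.tail (All-resp-↭ perm a) ∷ ap′

  record Collected (R : List E) : Set where
    field
      items : List (List E)
      rest  : List E
      perm  : R ↭ concat items ++ rest
      good  : All (λ U → 0 < length U × length U ≤ 2 × ∏ U ∈ Z) items
      rest∉ : All (_∉ M) rest
      apart : AllPairs (λ x y → ¬ Comm x y) rest

  same-coset : ∀ {x y} → x ∉ M → y ∉ M → x · y ∈ M
  same-coset {x} {y} x∉ y∉ = decidable-stable ((x · y) ∈? M) λ n → <⇒≱ (*-monoˡ-< (# M) {{>-nonZero (1≤#H M-sub)}} {2} {3} ≤-refl)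
    (≤-trans (cosets-≤ M-sub full (ε ∷ x ⁻ ∷ y ∷ [])
        (((λ p → x∉ (subst (_∈ M) (word (x ∷ []) ((𝟙 ⁱ • v0 ⁱ) ⁱ) v0 refl) (⁻∈ M-sub p))) ∷ (λ p → y∉ (subst (_∈ M) (word (y ∷ []) (𝟙 ⁱ • v0) v0 refl) p)) ∷ [])
         ∷ ((λ p → n (subst (_∈ M) (word (x ∷ y ∷ []) (v0 ⁱ ⁱ • v1) (v0 • v1) refl) p)) ∷ []) ∷ [] ∷ []) (All.tabulate (λ _ _ _ → ∈-full))) (≤-reflexive (trans #-full order-2M)))

  collect : ∀ R → All (λ y → y ∈ Z ⊎ y ∉ M) R → Collected R
  collect [] [] = record { items = [] ; rest = [] ; perm = refl ; good = [] ; rest∉ = [] ; apart = [] }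
  collect (y ∷ R) (which ∷ ws) = add which (collect R ws)
    where
    add : y ∈ Z ⊎ y ∉ M → Collected R → Collected (y ∷ R)
    add (inj₁ y∈) c = record { Collected c ; items = (y ∷ []) ∷ items ; perm = prep y perm
                             ; good = (s≤s z≤n , s≤s z≤n , subst (_∈ Z) (sym (ε-right y)) y∈) ∷ good }
      where open Collected c
    add (inj₂ y∉) c with Any.any? (comm? y) (Collected.rest c)
    ... | no none = record { Collected c ; rest = y ∷ rest ; perm = ↭-trans (prep y perm) (↭-sym (shift y (concat items) rest))
                           ; rest∉ = y∉ ∷ rest∉ ; apart = Allₚ.¬Any⇒All¬ rest none ∷ apart }
      where open Collected c
    ... | yes found = record { items = (y ∷ y′ ∷ []) ∷ items ; rest = rest′
            ; perm = prep y (↭-trans perm (↭-trans (++⁺ˡ (concat items) rest↭) (shift y′ (concat items) rest′)))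
            ; good = (s≤s z≤n , s≤s (s≤s z≤n) , subst (λ w → y · w ∈ Z) (sym (ε-right y′)) (M∩C⊆Z (same-coset y∉ (All.head y′∉)) y∉ (comm-· refl c′))) ∷ good
            ; rest∉ = All.tail y′∉ ; apart = proj₂ (proj₂ (proj₂ (proj₂ removed))) }
      where
      open Collected c
      removed = remove-pairs found apart
      y′ = proj₁ removed
      rest′ = proj₁ (proj₂ removed)
      c′ = proj₁ (proj₂ (proj₂ removed))
      rest↭ : rest ↭ y′ ∷ rest′
      rest↭ = proj₁ (proj₂ (proj₂ (proj₂ removed)))
      y′∉ : All (_∉ M) (y′ ∷ rest′)
      y′∉ = All-resp-↭ rest↭ rest∉

  -- Commuting pairs multiply into Z; pairwise noncommuting terms lie in distinct cosets of Z.
  outside-bound : ∀ R → All (λ y → y ∈ Z ⊎ y ∉ M) R → Free R → length R + 2 ≤ q + 2 * z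
  outside-bound R ws free = begin
    length R + 2                             ≡⟨ cong (_+ 2) (trans (↭-length perm) (length-++ (concat items))) ⟩
    length (concat items) + length rest + 2  ≤⟨ +-monoˡ-≤ 2 (+-mono-≤ (item-length items good) rest≤q) ⟩
    2 * length items + q + 2                 ≡⟨ l (length items) q ⟩
    q + 2 * suc (length items)               ≤⟨ +-monoʳ-≤ q (*-monoʳ-≤ 2 items<z) ⟩
    q + 2 * z                                ∎
    where
    open ≤-Reasoning
    open Collected (collect R ws)
    l : ∀ i q → 2 * i + q + 2 ≡ q + 2 * suc i
    l = solve-∀
    item-length : ∀ items → All (λ U → 0 < length U × length U ≤ 2 × ∏ U ∈ Z) items → length (concat items) ≤ 2 * length items
    item-length [] [] = z≤n
    item-length (U ∷ items) ((_ , le , _) ∷ g) = ≤-trans (≤-reflexive (length-++ U)) (≤-trans (+-mono-≤ le (item-length items g)) (≤-reflexive (sym (*-suc 2 (length items)))))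
    complement : # (full ∖ M) ≤ # M
    complement = +-cancelˡ-≤ (# M) _ _ (≤-trans (disjoint-≤ {X = M} {full ∖ M} {full} (λ i p r → proj₂ (∖⁻ {X = full} {M} r) p) (λ _ _ → ∈-full) (λ _ _ → ∈-full))
      (≤-reflexive (trans #-full (trans order-2M (cong (# M +_) (+-identityʳ (# M)))))))
    rest≤q : length rest ≤ q
    rest≤q = *-cancelʳ-≤ (length rest) q z {{>-nonZero 1≤z}} (≤-trans (cosets-≤ centre-sub (full ∖ M) rest
        (AllPairs.map (λ {x} {y} n p → n (subst (Comm x) (word (x ∷ y ∷ []) (v0 • (v0 ⁱ • v1)) v1 refl) (comm-· refl (sym (centre⁻ p x))))) apart)
        (All.map (λ {x} x∉ h h∈ → ∖⁺ {X = full} {M} (∈-full , λ p → x∉ (cancelʳ∈ M-sub (Z⊆M h∈) p))) rest∉))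
      (≤-trans complement (≤-reflexive (trans #M (*-comm z q)))))
    items<z : length items < z
    items<z = ≰⇒> λ z≤ → contradict (block-exists trivial-sub centre-sub (λ h h∈ → subst (_∈ Z) (sym (∈⁻ (_≟ ε) h∈)) (ε∈ centre-sub)) {map ∏ items}
      (Allₚ.map⁺ (All.map (λ p → proj₂ (proj₂ p)) good)) (≤-trans z≤ (≤-reflexive (sym (trans (cong₂ _*_ (length-map ∏ items) #-trivial) (*-identityʳ _))))))
      where
      contradict : ¬ Block trivial-sub (map ∏ items)
      contradict record { pre = pre ; body = body ; post = post ; split = eq ; nonempty = ne ; product = p } =
        let (Bp , Bs , eq₁ , _ , eq₂) = map-split ∏ items pre (body ++ post) eq
            (Bb , Bq , eq₃ , eq₄ , _) = map-split ∏ Bs body post eq₂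
            items≡ : items ≡ Bp ++ (Bb ++ Bq)
            items≡ = trans eq₁ (cong (Bp ++_) eq₃)
        in free (concat Bb) (concat Bp ++ (concat Bq ++ rest))
             (↭-trans perm (↭-trans (↭-reflexive (cong (_++ rest) (trans (cong concat items≡) (trans (sym (concat-++ Bp (Bb ++ Bq))) (cong (concat Bp ++_) (sym (concat-++ Bb Bq)))))))
               (permute 4 (λ p b r s → (p ⊕ (b ⊕ r)) ⊕ s ⊜ b ⊕ (p ⊕ (r ⊕ s))) ↭-refl (concat Bp) (concat Bb) (concat Bq) rest)))
             (U≠[] Bb (subst (λ b → 0 < length b) (sym eq₄) ne) (Allₚ.++⁻ˡ Bb (Allₚ.++⁻ʳ Bp (subst (All (λ U → 0 < length U × length U ≤ 2 × ∏ U ∈ Z)) items≡ good))))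
             (concat Bb , ↭-refl , trans (∏-concat Bb) (trans (cong ∏ eq₄) (∈⁻ (_≟ ε) p)))
        where
        U≠[] : ∀ Bb → 0 < length (map ∏ Bb) → All (λ U → 0 < length U × length U ≤ 2 × ∏ U ∈ Z) Bb → NonEmpty G (concat Bb)
        U≠[] ((_ ∷ _) ∷ _) _ _ ()
        U≠[] ([] ∷ _) _ ((() , _) ∷ _)

  module _ (z≥2 : 2 ≤ z) (q≥3 : 3 ≤ q) (long : Long) where

    open Partition partition

    private
      long₂ : 3 * (2 * (z * q)) < 4 * length S
      long₂ = subst (λ e → 3 * (e * (z * q)) < 4 * length S) e≡2 long
      Os′ = proj₁ (proj₂ (outside-M long))
      x₁ = x₀ long
      x₁∉ : x₁ ∉ M
      x₁∉ = x₀∉ long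
      Os≡ : Os ≡ x₁ ∷ Os′
      Os≡ = proj₁ (proj₂ (proj₂ (outside-M long)))

    module _ (N t q₁ : ℕ) (N≡ : N ≡ length As) (q₁≡ : q₁ ≡ N + suc t) (q≡ : q ≡ suc q₁) where

      private
        long₃ : 3 * (2 * (z * suc q₁)) < 4 * length S
        long₃ = subst (λ q → 3 * (2 * (z * q)) < 4 * length S) q≡ long₂
        Os′∉ : All (_∉ M) Os′
        Os′∉ = All.tail (subst (All (_∉ M)) Os≡ Os∉)
        L≡ : length S ≡ 1 + length Os′ + (N + length Zs)
        L≡ = trans lengths (cong₂ _+_ (cong length Os≡) (cong (_+ length Zs) (sym N≡)))
        q₁≥1 : 1 ≤ q₁
        q₁≥1 = ≤-trans (s≤s z≤n) (≤-pred (subst (3 ≤_) q≡ q≥3))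

        Hosted : Set
        Hosted = ∃[ J ] ∃[ R ] (x₁ ∷ As ↭ J ++ R × Gain J N × length J ≤ 2 * N × All (_∉ M) R)

        hosted : ∀ As → All (λ a → a ∈ M × a ∉ Z) As → ∃[ J ] ∃[ R ] (x₁ ∷ As ↭ J ++ R × Gain J (length As) × length J ≤ 2 * length As × All (_∉ M) R)
        -- With nothing to host, `x₁` is returned to the remaining terms, so that `J` never exceeds
        -- twice its gain.
        hosted [] _ = [] , x₁ ∷ [] , ↭-refl , gain-0 [] , z≤n , x₁∉ ∷ []
        hosted As@(a ∷ as) As∈ = As ++ x₁ ∷ [] , [] , ↭-trans (++-comm (x₁ ∷ []) As) (↭-reflexive (sym (++-identityʳ _)))
          , subst (Gain (As ++ x₁ ∷ [])) (+-identityʳ (length As)) (HostGain.gain (host-all (host x₁∉) As∈))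
          , ≤-trans (≤-reflexive (length-++ As)) (≤-trans (+-monoʳ-≤ (length As) (s≤s z≤n)) (≤-reflexive (cong (length As +_) (sym (+-identityʳ (length As)))))) , []

        -- The hosted part uses up all noncentral terms of `M`. The rest consists of central terms
        -- and terms outside `M`, for which `outside-bound` is sharper than `free-bound`.
        by-pairs : Hosted → Pairs (suc t) Os′ → ⊥
        by-pairs (J , R , J↭ , g , J≤ , R∉) (ps , R′ , len , ncs , p) = two-pairs z q₁ (length S) (length (J ++ flat ps)) (length rest) z≥2 q₁≥1 long₃
            (≤-reflexive (trans (↭-length S↭) (length-++ (J ++ flat ps))))
            (≤-trans (≤-reflexive (length-++ J)) (≤-trans (+-mono-≤ J≤ (≤-reflexive (trans (length-flat ps) (cong (2 *_) len)))) (≤-reflexive (trans (sym (*-distribˡ-+ 2 N (suc t))) (cong (2 *_) (sym q₁≡))))))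
            (subst (λ q → length rest + 2 ≤ q + 2 * z) q≡ (outside-bound rest (Allₚ.++⁺ (All.map inj₂ R∉) (Allₚ.++⁺ (All.map inj₂ (Allₚ.++⁻ʳ (flat ps) (All-resp-↭ p Os′∉))) (All.map inj₁ Zs∈)))
              (saturated minimal S↭ (≤-trans (subst (0 <_) (sym (trans (length-flat ps) (cong (2 *_) len))) (s≤s z≤n)) (≤-trans (m≤n+m _ (length J)) (≤-reflexive (sym (length-++ J)))))
                (gain-++ g (gain-flat ncs)) (≤-reflexive (trans q≡ (cong suc (trans q₁≡ (cong (N +_) (sym len)))))))))
          where
          rest = R ++ (R′ ++ Zs)
          S↭ : S ↭ (J ++ flat ps) ++ rest
          S↭ = ↭-trans perm (↭-trans (↭-reflexive (cong (_++ (As ++ Zs)) Os≡)) (↭-trans (permute 4 (λ x o a z → (x ⊕ o) ⊕ (a ⊕ z) ⊜ (x ⊕ a) ⊕ (o ⊕ z)) ↭-refl (x₁ ∷ []) Os′ As Zs)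
            (↭-trans (++⁺ J↭ (++⁺ʳ Zs p)) (permute 5 (λ j r f r′ z → (j ⊕ r) ⊕ ((f ⊕ r′) ⊕ z) ⊜ (j ⊕ f) ⊕ (r ⊕ (r′ ⊕ z))) ↭-refl J R (flat ps) R′ Zs))))

        by-class : ∃[ x ] ∃[ L′ ] (Os′ ↭ x ∷ L′ × others x Os′ < suc t) → ⊥
        by-class (x , L′ , p , few) = two-class z q₁ (length S) (others x S) z≥2 q₁≥1 long₃ o≤
          (subst (λ e → length S < others x S * e + e * z) e≡2 (pool-bound x∉ long (subst (0 <_) (sym e≡2) (s≤s z≤n))))
          where
          x∉ : x ∉ M
          x∉ = All.head (All-resp-↭ p Os′∉)
          o≤ : others x S ≤ q₁
          o≤ = ≤-trans (≤-reflexive (trans (count-↭ (outside? x) perm) (trans (count-++ (outside? x) Os (As ++ Zs)) (cong₂ _+_ (cong (others x) Os≡) (trans (count-++ (outside? x) As Zs)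
              (cong (others x As +_) (count-none (outside? x) (All.map (λ y∈ n → n (sym (centre⁻ y∈ x))) Zs∈))))))))
            (≤-trans (+-mono-≤ (≤-trans (count-++-≤ x₁ Os′) few) (≤-trans (≤-reflexive (+-identityʳ _)) (count-≤ (outside? x) As))) (≤-reflexive (trans (+-comm (suc t) (length As)) (trans (cong (_+ suc t) (sym N≡)) (sym q₁≡)))))
            where
            count-++-≤ : ∀ y L → others x (y ∷ L) ≤ suc (others x L)
            count-++-≤ y L with comm? x y
            ... | yes _ = n≤1+n _
            ... | no _  = ≤-refl

      few-As-absurd : ⊥
      few-As-absurd = [ by-pairs hosted′ , by-class ]′ (matching (suc t) Os′ (All.map (λ n p → n (Z⊆M p)) Os′∉)
          (≮⇒≥ λ lt → two-unmatched z N (suc t) (length Os′) (length Zs) (length S) z≥2 (subst (λ q → 3 * (2 * (z * suc q)) < 4 * length S) q₁≡ long₃) (≤-reflexive L≡) (central-few long) lt))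
        where
        hosted′ : Hosted
        hosted′ = subst (λ N → ∃[ J ] ∃[ R ] (x₁ ∷ As ↭ J ++ R × Gain J N × length J ≤ 2 * N × All (_∉ M) R)) (sym N≡) (hosted As As∈)

    M-free : ∀ {R} Bs L → R ↭ Bs ++ L → All (_∈ M) L → # M ≤ length L → ¬ Free R
    M-free Bs L R↭ L⊆M big free with block-exists trivial-sub M-sub (λ h h∈ → subst (_∈ M) (sym (∈⁻ (_≟ ε) h∈)) (ε∈ M-sub)) {L} L⊆M
        (≤-trans big (≤-reflexive (sym (trans (cong (length L *_) #-trivial) (*-identityʳ _)))))
    ... | record { pre = pre ; body = body ; post = post ; split = refl ; nonempty = ne ; product = p } =
          free body (Bs ++ (pre ++ post)) (↭-trans R↭ (permute 4 (λ c p b r → c ⊕ (p ⊕ (b ⊕ r)) ⊜ b ⊕ (c ⊕ (p ⊕ r))) ↭-refl Bs pre body post))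
            (nonempty-length ne) (body , ↭-refl , ∈⁻ (_≟ ε) p)

    module _ (z≡2 : z ≡ 2) {R : List E} (free : Free R) (R-long : 2 * q < length R) where

      -- For e = z = 2, `free-bound` allows at most 2 q + 1 terms. A length above 2 q leaves no
      -- slack, and a block with fewer than `2 * # D` terms would break the bound.
      good-block : ∀ {body R′ D} → R ↭ body ++ R′ → 0 < length body → (∀ d → d ∈ D → d ∈ A) → (∀ {d} → d ∈ D → Reach body d) → length body < 2 * # D → ⊥
      good-block {body} {R′} {D} R↭ ne D⊆A reachD short =
        let (W , spread , large) = spread-∷ {pre = []} {post = R′} spread-∅ (free-↭ R↭ free) ne D⊆A reachD in
        two-two-good q (length R) (length R′) (# D) (# W) (length body) R-long (≤-reflexive (trans (↭-length R↭) (length-++ body))) short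
          (subst (λ z → length R′ + z * # W + 1 ≤ z * q + 2 * z) z≡2 (subst (λ e → length R′ + z * # W + 1 ≤ z * q + e * z) e≡2 (free-bound R′ spread (free-↭ R↭ free))))
          (≤-trans (≤-reflexive (cong (_+ # D) (sym #-trivial))) large)

      -- Moving the first term `y` to the end conjugates the product by `y ⁻`. This changes it,
      -- since `y` commutes with no nontrivial element of `A`; so at most three terms yield two
      -- products.
      turned-block : ∀ {y L R′} → R ↭ (y ∷ L) ++ R′ → y ∉ M → ∏ (y ∷ L) ∈ A → length L ≤ 2 → ⊥
      turned-block {y} {L} {R′} R↭ y∉ a∈ short = good-block {D = set D?} R↭ (s≤s z≤n) D⊆A reachD
          (≤-trans (s≤s (s≤s short)) (*-monoʳ-≤ 2 (distinct-≤ (a ∷ conj (y ⁻) a ∷ []) ((distinct ∷ []) ∷ [] ∷ []) (∈⁺ D? (inj₁ refl) ∷ ∈⁺ D? (inj₂ refl) ∷ []))))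
        where
        a = ∏ (y ∷ L)
        D? : ∀ d → Dec (d ≡ a ⊎ d ≡ conj (y ⁻) a)
        D? d = (d ≟ a) ⊎-dec (d ≟ conj (y ⁻) a)
        D⊆A : ∀ d → d ∈ set D? → d ∈ A
        D⊆A d d∈ = [ (λ { refl → a∈ }) , (λ { refl → conj-A (y ⁻) a∈ }) ]′ (∈⁻ D? d∈)
        reachD : ∀ {d} → d ∈ set D? → Reach (y ∷ L) d
        reachD d∈ = [ (λ { refl → y ∷ L , ↭-refl , refl })
                    , (λ { refl → L ++ y ∷ [] , ++-comm L (y ∷ []) , trans (∏-++ L (y ∷ [])) (word (y ∷ ∏ L ∷ []) (v1 • (v0 • 𝟙)) (v0 ⁱ • (v0 • v1) • v0 ⁱ ⁱ) refl) }) ]′ (∈⁻ D? d∈)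
        a≢ε : a ≢ ε
        a≢ε eq = free (y ∷ L) R′ R↭ (λ ()) (y ∷ L , ↭-refl , eq)
        distinct : a ≢ conj (y ⁻) a
        distinct eq = a≢ε (A∩C a∈ y∉ (sym (subst (Comm a) (word (y ∷ []) (v0 ⁱ ⁱ) v0 refl) (comm-⁻ (sym (comm-conj (sym eq)))))))

      third-in-A : ∀ {u m} → u ∈ M → m ∈ M → u ∉ A → m ∉ A → u · m ∈ A
      third-in-A {u} {m} u∈ m∈ u∉ m∉ = decidable-stable ((u · m) ∈? A) λ n → <⇒≱ (*-monoˡ-< q {{>-nonZero 1≤q}} {2} {3} ≤-refl)
        (≤-trans (cosets-≤ A-sub M (ε ∷ u ⁻ ∷ m ∷ [])
            (((λ p → u∉ (subst (_∈ A) (word (u ∷ []) ((𝟙 ⁱ • v0 ⁱ) ⁱ) v0 refl) (⁻∈ A-sub p))) ∷ (λ p → m∉ (subst (_∈ A) (word (m ∷ []) (𝟙 ⁱ • v0) v0 refl) p)) ∷ [])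
             ∷ ((λ p → n (subst (_∈ A) (word (u ∷ m ∷ []) (v0 ⁱ ⁱ • v1) (v0 • v1) refl) p)) ∷ []) ∷ [] ∷ [])
            ((λ h h∈ → subst (_∈ M) (sym (ε-left h)) (A⊆M h∈)) ∷ (λ h h∈ → ·∈ M-sub (⁻∈ M-sub u∈) (A⊆M h∈)) ∷ (λ h h∈ → ·∈ M-sub m∈ (A⊆M h∈)) ∷ []))
          (≤-reflexive (trans #M (cong (_* q) z≡2))))

      -- `A` has index two in `M`. Given `y` and `y′` outside `M` and `m` in `M`, one of `y · y′`,
      -- `m` and `y · y′ · m` lies in `A` and provides a block with more products than the bound
      -- permits. The remaining cases have almost all terms in `M`, or none.
      two-two : ∀ O L → R ↭ O ++ L → All (_∉ M) O → All (_∈ M) L → ⊥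
      two-two [] L R↭ _ L∈ = M-free [] L R↭ L∈ (≤-trans (≤-reflexive (trans #M (cong (_* q) z≡2))) (≤-trans (<⇒≤ R-long) (≤-reflexive (↭-length R↭)))) free
      two-two (y ∷ []) L R↭ _ L∈ = M-free (y ∷ []) L R↭ L∈ (≤-trans (≤-reflexive (trans #M (cong (_* q) z≡2))) (≤-pred (≤-trans R-long (≤-reflexive (↭-length R↭))))) free
      two-two O@(_ ∷ _ ∷ _) [] R↭ O∉ _ = two-two-outside q (length R) (≤-trans (n≤1+n 2) q≥3) R-long
        (subst (λ z → length R + 2 ≤ q + 2 * z) z≡2 (outside-bound R (All-resp-↭ (↭-sym (↭-trans R↭ (↭-reflexive (++-identityʳ O)))) (All.map inj₂ O∉)) free))
      two-two (y ∷ y′ ∷ O) (m ∷ L) R↭ (y∉ ∷ y′∉ ∷ _) (m∈ ∷ _) with (y · y′) ∈? A | m ∈? A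
      ... | yes p | _ = turned-block {y} {y′ ∷ []} R↭ y∉ (subst (λ w → y · w ∈ A) (sym (ε-right y′)) p) (s≤s z≤n)
      ... | no _ | yes p = good-block {m ∷ []} {y ∷ y′ ∷ O ++ L} {set (_≟ m)} (↭-trans R↭ (shift m (y ∷ y′ ∷ O) L)) (s≤s z≤n)
                             (λ d d∈ → subst (_∈ A) (sym (∈⁻ (_≟ m) d∈)) p) (λ d∈ → m ∷ [] , ↭-refl , trans (ε-right m) (sym (∈⁻ (_≟ m) d∈)))
                             (*-monoʳ-≤ 2 (1≤# {X = set (_≟ m)} (∈⁺ (_≟ m) refl)))
      ... | no n | no n′ = turned-block {y} {y′ ∷ m ∷ []} {O ++ L} (↭-trans R↭ (permute 4 (λ y o m l → (y ⊕ o) ⊕ (m ⊕ l) ⊜ (y ⊕ m) ⊕ (o ⊕ l)) ↭-refl (y ∷ y′ ∷ []) O (m ∷ []) L)) y∉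
            (subst (_∈ A) (word (y ∷ y′ ∷ m ∷ []) (v0 • v1 • v2) (v0 • (v1 • (v2 • 𝟙))) refl) (third-in-A (same-coset y∉ y′∉) m∈ n n′)) ≤-refl

    -- The estimate of `abundant` suffices for z ≥ 4, and for z = 3 except at q = 3; for z = 2 it
    -- has to be improved by `two-two`.
    abundant-absurd : (z ≡ 3 → q ≢ 3) → q ≤ suc (length As) → ⊥
    abundant-absurd not-3-3 many = [ (λ z≥4 → abundant-2-≥4 z q (length S) z≥4 q≥3 long₂ bound) , small ]′ (split z z≥2)
      where
      bound : length S + z + 1 ≤ q + (z * q + 2 * z)
      bound = subst (λ e → length S + z + 1 ≤ q + (z * q + e * z)) e≡2 (abundant long many)
      split : ∀ z → 2 ≤ z → 4 ≤ z ⊎ (z ≡ 3 ⊎ z ≡ 2)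
      split (suc zero) (s≤s ())
      split (suc (suc zero)) _ = inj₂ (inj₂ refl)
      split (suc (suc (suc zero))) _ = inj₂ (inj₁ refl)
      split (suc (suc (suc (suc z)))) _ = inj₁ (s≤s (s≤s (s≤s (s≤s z≤n))))
      small : z ≡ 3 ⊎ z ≡ 2 → ⊥
      small (inj₁ z≡3) = abundant-2-3 q (length S) (≤∧≢⇒< q≥3 (λ eq → not-3-3 z≡3 (sym eq)))
        (subst (λ z → 3 * (2 * (z * q)) < 4 * length S) z≡3 long₂) (subst (λ z → length S + z + 1 ≤ q + (z * q + 2 * z)) z≡3 bound)
      small (inj₂ z≡2) = let (as , as′ , O , As≡ , Os≡′ , len , S↭ , g) = abundant-split long many in
        two-two z≡2 {O ++ (as′ ++ Zs)} (saturated minimal S↭ (≤-trans (s≤s z≤n) (≤-trans (m≤n+m 1 (length as)) (≤-reflexive (sym (length-++ as))))) g (≤-reflexive (sym len)))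
          (≰⇒> λ le → two-two-long q (length S) (length (O ++ (as′ ++ Zs))) (subst (λ z → 3 * (2 * (z * q)) < 4 * length S) z≡2 long₂)
            (≤-reflexive (trans (↭-length S↭) (trans (length-++ (as ++ x₁ ∷ [])) (cong (_+ length (O ++ (as′ ++ Zs))) (trans (length-++ as) (trans (+-comm (length as) 1) len)))))) le)
          O (as′ ++ Zs) ↭-refl (All.tail (subst (All (_∉ M)) Os≡′ Os∉)) (Allₚ.++⁺ (Allₚ.++⁻ʳ as (All.map proj₁ (subst (All (λ a → a ∈ M × a ∉ Z)) As≡ As∈))) (All.map Z⊆M Zs∈))

    index-two : (z ≡ 3 → q ≢ 3) → ⊥
    index-two not-3-3 with q ≤? suc (length As)
    ... | yes many = abundant-absurd not-3-3 many
    ... | no few = let (t , eq) = m≤n⇒∃[o]m+o≡n (≰⇒> few) in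
          few-As-absurd (length As) t (length As + suc t) refl refl (trans (sym eq) (cong suc (sym (+-suc (length As) t))))

-- For e = 2 the condition z ≥ 2 keeps out the dihedral groups of order 2 q, for which the bound
-- fails. In the other alternative, involutions modulo the centre are either absent outside `M` or
-- unique within each centraliser.
affine-bound : ∀ {G} (data′ : AffineData G) → let open Affine G data′ in
  ∀ h → q ≡ suc (h + h) →
  (e ≡ 2 × 2 ≤ z × (z ≡ 3 → q ≢ 3)) ⊎
  (3 ≤ e × ((∀ x → x ∉ M → x · x ∉ Z) ⊎
            (4 ≤ e × (∀ u v → u ∉ Z → v ∉ Z → u · u ∈ Z → v · v ∈ Z → Comm u v → u ≡ v)))) →
  ∀ {S} → MinimalProductOne G S → 4 * length S ≤ 3 * FinGroup.order G
affine-bound {G} data′ h q≡ kind {S} minimal = ≮⇒≥ λ lt → absurd kind (subst (λ n → 3 * n < 4 * length S) order-≡ lt)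
  where
  open Cases G data′ minimal
  absurd : _ → Long → ⊥
  absurd (inj₁ (e≡2 , z≥2 , not-3-3)) long = IndexTwo.index-two G data′ minimal e≡2 z≥2 (subst (λ e → suc e ≤ q) e≡2 e<q′) long not-3-3
  absurd (inj₂ (e≥3 , inv)) long with 4 ≤? e | 2 ≤? z
  ... | yes e≥4 | _ = Core.index-more G data′ minimal h q≡ e≥3 (inj₁ e≥4) ([ inj₁ , (λ p → inj₂ (proj₂ p)) ]′ inv) long
  ... | no _ | yes z≥2 = Core.index-more G data′ minimal h q≡ e≥3 (inj₂ z≥2) ([ inj₁ , (λ p → inj₂ (proj₂ p)) ]′ inv) long
  ... | no e≱4 | no z≱2 = IndexThreeBound.index-three G data′ minimal h q≡ (≤-antisym (≤-pred (≰⇒> e≱4)) e≥3) (≤-antisym (≤-pred (≰⇒> z≱2)) 1≤z)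
          ([ id , (λ p → ⊥-elim (e≱4 (proj₁ p))) ]′ inv) long

-- Subgroups generated by one or two elements

module Generation (G : FinGroup) where

  open Centralisers G public
  open Shapes G public

  private
    order-≤ : ∀ {a N} → HasOrder a N → N ≤ order
    order-≤ {a} {N} o = ≤-trans (≤-reflexive (sym #-full)) (≤-trans (injection-≤ {n = N} {X = full} {Y = full {order}} (λ i → a ^ toℕ i) (λ _ _ → ∈-full)
      (λ i j _ _ eq → toℕ-injective (HasOrder.injective o _ _ (toℕ<n i) (toℕ<n j) eq))) (≤-reflexive #-full))

    -- The order of an element is at most that of the group, so exponents below `order` reach every
    -- power; the bound makes membership decidable.
    power? : ∀ a g → Dec (∃[ i ] a ^ toℕ {order} i ≡ g)
    power? a g = any? (λ i → a ^ toℕ i ≟ g)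

  abstract
    ⟨_⟩ : E → BSet order
    ⟨ a ⟩ = set (power? a)

    ⟨⟩⁺ : ∀ {a} k → a ^ k ∈ ⟨ a ⟩
    ⟨⟩⁺ {a} k with has-order a
    ... | N , o = ∈⁺ (power? a) (fromℕ< small , trans (cong (a ^_) (toℕ-fromℕ< small)) (sym (^-% {{N≢0}} k)))
      where
      open HasOrder o
      N≢0 : NonZero N
      N≢0 = >-nonZero positive
      small : (k % N) {{N≢0}} < order
      small = ≤-trans (m%n<n k N {{N≢0}}) (order-≤ o)

    ⟨⟩⁻ : ∀ {a g} → g ∈ ⟨ a ⟩ → ∃[ k ] a ^ k ≡ g
    ⟨⟩⁻ {a} g∈ = let (i , eq) = ∈⁻ (power? a) g∈ in toℕ i , eq

  ⟨⟩-sub : ∀ a → IsSub ⟨ a ⟩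
  ⟨⟩-sub a = record { ε∈ = ⟨⟩⁺ 0 ; ·∈ = λ x∈ y∈ → case ⟨⟩⁻ x∈ of λ { (i , refl) → case ⟨⟩⁻ y∈ of λ { (j , refl) → subst (_∈ ⟨ a ⟩) (^-+ a i j) (⟨⟩⁺ (i + j)) } } }

  gen∈⟨⟩ : ∀ a → a ∈ ⟨ a ⟩
  gen∈⟨⟩ a = subst (_∈ ⟨ a ⟩) (^-1 a) (⟨⟩⁺ 1)

  #⟨⟩ : ∀ {a N} → HasOrder a N → # ⟨ a ⟩ ≡ N
  #⟨⟩ {a} {N} o = ≤-antisym
      (≤-trans (≤-trans (≤-reflexive (sym (*-identityˡ _))) (double-count ⟨ a ⟩ full (λ g i → ⌊ a ^ toℕ {N} i ≟ g ⌋) 1 1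
          (λ g g∈ → case ⟨⟩⁻ g∈ of λ { (k , refl) → 1≤# {i = fromℕ< (m%n<n k N {{N≢0}})} (∧⁺ {X = full} {λ i → ⌊ a ^ toℕ i ≟ a ^ k ⌋} ∈-full
              (∈⁺ (λ i → a ^ toℕ i ≟ a ^ k) (trans (cong (a ^_) (toℕ-fromℕ< (m%n<n k N {{N≢0}}))) (sym (^-% {{N≢0}} k))))) })
          (λ i _ → #≤1 λ g g′ p p′ → trans (sym (∈⁻ (λ g → a ^ toℕ i ≟ g) (mem (_∈_.holds (proj₂ (∧⁻ {X = ⟨ a ⟩} {λ g → ⌊ a ^ toℕ i ≟ g ⌋} p))))))
                                          (∈⁻ (λ g → a ^ toℕ i ≟ g) (mem (_∈_.holds (proj₂ (∧⁻ {X = ⟨ a ⟩} {λ g → ⌊ a ^ toℕ i ≟ g ⌋} p′))))))))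
        (≤-reflexive (trans (*-identityˡ _) #-full)))
      (≤-trans (≤-reflexive (sym #-full)) (injection-≤ {n = N} {X = full} (λ i → a ^ toℕ i) (λ i _ → ⟨⟩⁺ (toℕ i))
        (λ i j _ _ eq → toℕ-injective (injective _ _ (toℕ<n i) (toℕ<n j) eq))))
    where
    open HasOrder o
    N≢0 : NonZero N
    N≢0 = >-nonZero positive

  prime-order : ∀ {c q} → Prime q → c ^ q ≡ ε → c ≢ ε → HasOrder c q
  prime-order {c} {q} pr kills c≢ε with has-order c
  ... | N , o with prime⇒irreducible pr (HasOrder.divides′ o q kills)
  ...   | inj₁ refl = ⊥-elim (c≢ε (trans (sym (^-1 c)) (HasOrder.kills o)))
  ...   | inj₂ refl = o

  -- By Bézout, `x` is a power of `x ^ k` divided by a power of `x ^ q`.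
  prime-root : ∀ {H x q k} → IsSub H → Prime q → x ^ q ∈ H → ¬ q ∣ k → x ^ k ∈ H → x ∈ H
  prime-root {H} {x} {q} {k} sub pr xq∈ q∤k xk∈ with prime-coprime pr q∤k
  ... | u , v , eq = cancelʳ∈ sub (^∈ sub xq∈ v) (subst (_∈ H) (trans (sym (^-* x k u)) (trans (cong (x ^_) eq) (cong (x ·_) (^-* x q v)))) (^∈ sub xk∈ u))

  prime-generates : ∀ {c q} → Prime q → c ^ q ≡ ε → ∀ {d} → d ∈ ⟨ c ⟩ → d ≢ ε → c ∈ ⟨ d ⟩
  prime-generates {c} {q} pr kills {d} d∈ d≢ε with ⟨⟩⁻ d∈
  ... | k , refl = prime-root {k = k} (⟨⟩-sub (c ^ k)) pr (subst (_∈ ⟨ c ^ k ⟩) (sym kills) (⟨⟩⁺ 0))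
        (λ { (divides m refl) → d≢ε (trans (cong (c ^_) (*-comm m q)) (trans (^-* c q m) (trans (cong (_^ m) kills) (ε-^ m)))) }) (gen∈⟨⟩ (c ^ k))

  ⟨⟩-⊆ : ∀ {a H} → IsSub H → a ∈ H → ∀ g → g ∈ ⟨ a ⟩ → g ∈ H
  ⟨⟩-⊆ sub a∈ g g∈ = case ⟨⟩⁻ g∈ of λ { (k , refl) → ^∈ sub a∈ k }

  -- P need not be decidable, so the subgroup exists only under double negation.
  subgroup : (P : E → Set) → P ε → (∀ {x y} → P x → P y → P (x · y)) →
    ((H : BSet order) → IsSub H → (∀ {x} → P x → x ∈ H) → (∀ {x} → x ∈ H → P x) → ⊥) → ⊥
  subgroup P Pε P· k = decide-all P λ P? → k (set P?)
    (record { ε∈ = ∈⁺ P? Pε ; ·∈ = λ x∈ y∈ → ∈⁺ P? (P· (∈⁻ P? x∈) (∈⁻ P? y∈)) }) (∈⁺ P?) (∈⁻ P?)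

  Product : E → E → E → Set
  Product a b g = ∃[ i ] ∃[ j ] a ^ i · b ^ j ≡ g

  Normalises : E → E → Set
  Normalises b a = conj b a ∈ ⟨ a ⟩

  normalises-^ : ∀ {a b} → Normalises b a → ∀ j k → conj (b ^ j) (a ^ k) ∈ ⟨ a ⟩
  normalises-^ {a} nb zero k = subst (_∈ ⟨ a ⟩) (word (a ^ k ∷ []) v0 (𝟙 • v0 • 𝟙 ⁱ) refl) (⟨⟩⁺ k)
  normalises-^ {a} {b} nb (suc j) k with ⟨⟩⁻ (normalises-^ nb j k)
  ... | l , eq = subst (_∈ ⟨ a ⟩) (trans (sym (conj-^ b a l)) (trans (cong (conj b) eq)
        (word (b ∷ b ^ j ∷ a ^ k ∷ []) (v0 • (v1 • v2 • v1 ⁱ) • v0 ⁱ) (v0 • v1 • v2 • (v0 • v1) ⁱ) refl))) (^∈ (⟨⟩-sub a) nb l)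

  product-· : ∀ {a b} → Normalises b a → ∀ {x y} → Product a b x → Product a b y → Product a b (x · y)
  product-· {a} {b} nb (i , j , refl) (k , l , refl) with ⟨⟩⁻ (normalises-^ nb j k)
  ... | m , eq = i + m , j + l , (begin
      a ^ (i + m) · b ^ (j + l)                         ≡⟨ cong₂ _·_ (^-+ a i m) (^-+ b j l) ⟩
      a ^ i · a ^ m · (b ^ j · b ^ l)                   ≡⟨ cong (λ w → a ^ i · w · (b ^ j · b ^ l)) eq ⟩
      a ^ i · (b ^ j · a ^ k · (b ^ j) ⁻) · (b ^ j · b ^ l)  ≡⟨ word (a ^ i ∷ b ^ j ∷ a ^ k ∷ b ^ l ∷ []) (v0 • (v1 • v2 • v1 ⁱ) • (v1 • v3)) (v0 • v1 • (v2 • v3)) refl ⟩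
      a ^ i · b ^ j · (a ^ k · b ^ l)                   ∎)
    where open ≡-Reasoning

  product-ε : ∀ {a b} → Product a b ε
  product-ε = 0 , 0 , ε-left ε

  product-left : ∀ {a b} → Product a b a
  product-left {a} = 1 , 0 , trans (ε-right _) (^-1 a)

  product-right : ∀ {a b} → Product a b b
  product-right {b = b} = 0 , 1 , trans (ε-left _) (^-1 b)

  -- Since `b` normalises the powers of `a`, the products `a ^ i · b ^ j` form a subgroup. Either it
  -- is everything, or the hypothesis on proper subgroups applies to it.
  generated : ∀ {a b} → Normalises b a → ((∀ g → Product a b g) → ⊥) →
    (∀ {H} → IsSub H → a ∈ H → b ∈ H → (∀ {x} → x ∈ H → Product a b x) → ∀ {g} → g ∉ H → ⊥) → ⊥
  generated {a} {b} nb whole part = subgroup (Product a b) product-ε (product-· nb) λ H sub P⇒ ⇒P →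
    case any? (λ g → ¬? (g ∈? H)) of λ
      { (yes (g , g∉)) → part sub (P⇒ product-left) (P⇒ product-right) ⇒P g∉
      ; (no none) → whole λ g → ⇒P (decidable-stable (g ∈? H) λ g∉ → none (g , g∉)) }

  cosets-cover : ∀ {H} L → (∀ g → Any (λ x → x ⁻ · g ∈ H) L) → order ≤ length L * # H
  cosets-cover {H} L h = ≤-trans (≤-reflexive (sym #-full)) (go full L (λ g _ → h g))
    where
    go : ∀ X L → (∀ g → g ∈ X → Any (λ x → x ⁻ · g ∈ H) L) → # X ≤ length L * # H
    go X [] h = #≤0 λ x x∈ → case h x x∈ of λ ()
    go X (y ∷ L) h = ≤-trans (cover-≤ {X = yH} {X ∖ yH} {X} λ x x∈ → case x ∈? yH of λ
        { (yes p) → inj₁ p ; (no n) → inj₂ (∖⁺ {X = X} {yH} (x∈ , n)) })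
      (+-mono-≤ (injection-≤ (y ⁻ ·_) (λ x x∈ → ∈⁻ yH? x∈) (λ i j _ _ → cancelˡ (y ⁻)))
        (go (X ∖ yH) L λ x x∈ → let (xX , x∉) = ∖⁻ {X = X} {yH} x∈ in case h x xX of λ
          { (here p) → ⊥-elim (x∉ (∈⁺ yH? p)) ; (there i) → i }))
      where
      yH? : ∀ g → Dec (y ⁻ · g ∈ H)
      yH? g = (y ⁻ · g) ∈? H
      yH : BSet order
      yH = set yH?

-- Class equations

abstract

  -- In these class inequalities n is the order of the group; c, N and s are the sizes of a
  -- centraliser, of its normaliser and of its noncentral part; U, V and W count the elements whose
  -- conjugates meet that noncentral part.
  half-class : ∀ c n U N s z → 1 ≤ c → (2 * U) < (n) → (s * n) ≤ (N * U) → (N) ≤ (c) → (c) ≤ (s + z) → (2 * z) ≤ (c) → ⊥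
  half-class _ n U N s z b0 h0 h1 h2 h3 h4 with m≤n⇒∃[o]m+o≡n b0
  ... | c , refl = ≤-absurd (c) (+-mono-≤ (+-mono-≤ (+-mono-≤ (+-mono-≤ (*-monoʳ-≤ ((1 + c)) h0) (*-monoʳ-≤ 2 h1)) (*-monoʳ-≤ (2 * U) h2)) (*-monoʳ-≤ (2 * n) h3)) (*-monoʳ-≤ n h4)) (identity c n U N s z)
      where
      identity : ∀ c n U N s z → ((1 + c)) * suc (2 * U) + 2 * (s * n) + (2 * U) * (N) + (2 * n) * ((1 + c)) + n * (2 * z) ≡ suc (((1 + c)) * (n) + 2 * (N * U) + (2 * U) * ((1 + c)) + (2 * n) * (s + z) + n * ((1 + c)) + (c))
      identity = solve-∀

  third-class : ∀ c n U N s → 3 ≤ c → (3 * U) < (n) → (s * n) ≤ (N * U) → (N) ≤ (2 * c) → (c) ≤ (s + 1) → (3) ≤ (c) → ⊥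
  third-class _ n U N s b0 h0 h1 h2 h3 h4 with m≤n⇒∃[o]m+o≡n b0
  ... | c , refl = ≤-absurd (5 + 2 * c) (+-mono-≤ (+-mono-≤ (+-mono-≤ (+-mono-≤ (*-monoʳ-≤ (2 * (3 + c)) h0) (*-monoʳ-≤ 3 h1)) (*-monoʳ-≤ (3 * U) h2)) (*-monoʳ-≤ (3 * n) h3)) (*-monoʳ-≤ n h4)) (identity c n U N s)
      where
      identity : ∀ c n U N s → (2 * (3 + c)) * suc (3 * U) + 3 * (s * n) + (3 * U) * (N) + (3 * n) * ((3 + c)) + n * (3) ≡ suc ((2 * (3 + c)) * (n) + 3 * (N * U) + (3 * U) * (2 * (3 + c)) + (3 * n) * (s + 1) + n * ((3 + c)) + (5 + 2 * c))
      identity = solve-∀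

  two-thirds-class : ∀ c n U N s → 3 ≤ c → (3 * U) < (2 * n) → (s * n) ≤ (N * U) → (N) ≤ (c) → (c) ≤ (s + 1) → (3) ≤ (c) → ⊥
  two-thirds-class _ n U N s b0 h0 h1 h2 h3 h4 with m≤n⇒∃[o]m+o≡n b0
  ... | c , refl = ≤-absurd (2 + c) (+-mono-≤ (+-mono-≤ (+-mono-≤ (+-mono-≤ (*-monoʳ-≤ ((3 + c)) h0) (*-monoʳ-≤ 3 h1)) (*-monoʳ-≤ (3 * U) h2)) (*-monoʳ-≤ (3 * n) h3)) (*-monoʳ-≤ n h4)) (identity c n U N s)
      where
      identity : ∀ c n U N s → ((3 + c)) * suc (3 * U) + 3 * (s * n) + (3 * U) * (N) + (3 * n) * ((3 + c)) + n * (3) ≡ suc (((3 + c)) * (2 * n) + 3 * (N * U) + (3 * U) * ((3 + c)) + (3 * n) * (s + 1) + n * ((3 + c)) + (2 + c))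
      identity = solve-∀

  another-class : ∀ c z n U N s → 1 ≤ c → 1 ≤ z → (n) ≤ (z + U) → (c) ≤ (N) → (N * U) ≤ (s * n) → (s + z) ≤ (c) → (2 * c) ≤ (n) → ⊥
  another-class _ _ n U N s b0 b1 h0 h1 h2 h3 h4 with m≤n⇒∃[o]m+o≡n b0 | m≤n⇒∃[o]m+o≡n b1
  ... | c , refl | z , refl = ≤-absurd (c + z + c * z) (+-mono-≤ (+-mono-≤ (+-mono-≤ (+-mono-≤ (*-monoʳ-≤ ((1 + c)) h0) (*-monoʳ-≤ U h1)) (*-monoʳ-≤ 1 h2)) (*-monoʳ-≤ n h3)) (*-monoʳ-≤ ((1 + z)) h4)) (identity c z n U N s)
      where
      identity : ∀ c z n U N s → ((1 + c)) * (n) + U * ((1 + c)) + 1 * (N * U) + n * (s + (1 + z)) + ((1 + z)) * (2 * (1 + c)) ≡ suc (((1 + c)) * ((1 + z) + U) + U * (N) + 1 * (s * n) + n * ((1 + c)) + ((1 + z)) * (n) + (c + z + c * z))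
      identity = solve-∀

  two-halves : ∀ z n U V → 1 ≤ z → (n) ≤ (2 * U) → (n) ≤ (2 * V) → (z + (U + V)) ≤ (n) → ⊥
  two-halves _ n U V b0 h0 h1 h2 with m≤n⇒∃[o]m+o≡n b0
  ... | z , refl = ≤-absurd (1 + 2 * z) (+-mono-≤ (+-mono-≤ (*-monoʳ-≤ 1 h0) (*-monoʳ-≤ 1 h1)) (*-monoʳ-≤ 2 h2)) (identity z n U V)
      where
      identity : ∀ z n U V → 1 * (n) + 1 * (n) + 2 * ((1 + z) + (U + V)) ≡ suc (1 * (2 * U) + 1 * (2 * V) + 2 * (n) + (1 + 2 * z))
      identity = solve-∀

  two-thirds-third : ∀ n U V → (2 * n) ≤ (3 * U) → (n) ≤ (3 * V) → (1 + (U + V)) ≤ (n) → ⊥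
  two-thirds-third n U V h0 h1 h2 = ≤-absurd (2) (+-mono-≤ (+-mono-≤ (*-monoʳ-≤ 1 h0) (*-monoʳ-≤ 1 h1)) (*-monoʳ-≤ 3 h2)) (identity n U V)
      where
      identity : ∀ n U V → 1 * (2 * n) + 1 * (n) + 3 * (1 + (U + V)) ≡ suc (1 * (3 * U) + 1 * (3 * V) + 3 * (n) + (2))
      identity = solve-∀

  three-classes : ∀ n U V W → (n) ≤ (2 * U) → (n) ≤ (3 * V) → (n) ≤ (3 * W) → (1 + (U + (V + W))) ≤ (n) → ⊥
  three-classes n U V W h0 h1 h2 h3 = ≤-absurd (5 + n) (+-mono-≤ (+-mono-≤ (+-mono-≤ (*-monoʳ-≤ 3 h0) (*-monoʳ-≤ 2 h1)) (*-monoʳ-≤ 2 h2)) (*-monoʳ-≤ 6 h3)) (identity n U V W)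
      where
      identity : ∀ n U V W → 3 * (n) + 2 * (n) + 2 * (n) + 6 * (1 + (U + (V + W))) ≡ suc (3 * (2 * U) + 2 * (3 * V) + 2 * (3 * W) + 6 * (n) + (5 + n))
      identity = solve-∀

  at-most-half : ∀ n U N s → (n) < (2 * U) → (2) ≤ (N) → (N * U) ≤ (s * n) → (s + 1) ≤ (2) → ⊥
  at-most-half n U N s h0 h1 h2 h3 = ≤-absurd (0) (+-mono-≤ (+-mono-≤ (+-mono-≤ (*-monoʳ-≤ 1 h0) (*-monoʳ-≤ U h1)) (*-monoʳ-≤ 1 h2)) (*-monoʳ-≤ n h3)) (identity n U N s)
      where
      identity : ∀ n U N s → 1 * suc (n) + U * (2) + 1 * (N * U) + n * (s + 1) ≡ suc (1 * (2 * U) + U * (N) + 1 * (s * n) + n * (2) + (0))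
      identity = solve-∀

  two-classes : ∀ c n U V N s → 1 ≤ c → (n) ≤ (1 + (U + V)) → (2 * U) ≤ (n) → (2 * c) ≤ (N) → (N * V) ≤ (s * n) → (s + 1) ≤ (c) → (2 * c) ≤ (N) → (2 * N) ≤ (n) → ⊥
  two-classes _ n U V N s b0 h0 h1 h2 h3 h4 h5 h6 with m≤n⇒∃[o]m+o≡n b0
  ... | c , refl = ≤-absurd (1 + 2 * c) (+-mono-≤ (+-mono-≤ (+-mono-≤ (+-mono-≤ (+-mono-≤ (+-mono-≤ (*-monoʳ-≤ (2 * (1 + c)) h0) (*-monoʳ-≤ ((1 + c)) h1)) (*-monoʳ-≤ V h2)) (*-monoʳ-≤ 1 h3)) (*-monoʳ-≤ n h4)) (*-monoʳ-≤ 2 h5)) (*-monoʳ-≤ 1 h6)) (identity c n U V N s)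
      where
      identity : ∀ c n U V N s → (2 * (1 + c)) * (n) + ((1 + c)) * (2 * U) + V * (2 * (1 + c)) + 1 * (N * V) + n * (s + 1) + 2 * (2 * (1 + c)) + 1 * (2 * N) ≡ suc ((2 * (1 + c)) * (1 + (U + V)) + ((1 + c)) * (n) + V * (N) + 1 * (s * n) + n * ((1 + c)) + 2 * (N) + 1 * (n) + (1 + 2 * c))
      identity = solve-∀

  -- With p = 1 + r, eliminating v and k gives L ≤ p (p + 1) / 2, which is at most 3 p² / 4 once p ≥
  -- 2.
  square-order : ∀ r L v k → 1 ≤ r → (3 * ((1 + r) * (1 + r))) < (4 * L) → (L) ≤ (v + (1 + r) * k) → (v + k) ≤ (1 + r) → (L) ≤ (v * (2 + r)) → ⊥
  square-order _ L v k b0 h0 h1 h2 h3 with m≤n⇒∃[o]m+o≡n b0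
  ... | r , refl = ≤-absurd (3 + 10 * r + 8 * r * r + 2 * r * r * r) (+-mono-≤ (+-mono-≤ (+-mono-≤ (*-monoʳ-≤ (2 * (1 + (1 + r))) h0) (*-monoʳ-≤ (4 * (2 + (1 + r))) h1)) (*-monoʳ-≤ (4 * ((1 + (1 + r)) * (2 + (1 + r)))) h2)) (*-monoʳ-≤ (4 * (1 + r)) h3)) (identity r L v k)
      where
      identity : ∀ r L v k → (2 * (1 + (1 + r))) * suc (3 * ((1 + (1 + r)) * (1 + (1 + r)))) + (4 * (2 + (1 + r))) * (L) + (4 * ((1 + (1 + r)) * (2 + (1 + r)))) * (v + k) + (4 * (1 + r)) * (L) ≡ suc ((2 * (1 + (1 + r))) * (4 * L) + (4 * (2 + (1 + r))) * (v + (1 + (1 + r)) * k) + (4 * ((1 + (1 + r)) * (2 + (1 + r)))) * (1 + (1 + r)) + (4 * (1 + r)) * (v * (2 + (1 + r))) + (3 + 10 * r + 8 * r * r + 2 * r * r * r))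
      identity = solve-∀

-- Groups all of whose proper subgroups are cyclic or odd dihedral

module Critical (G : FinGroup)
  (proper : ∀ {H} → Subgroups.IsSub G H → ∀ {g} → g ∉ H → DN (Shapes.Cyc G H ⊎ Shapes.ODih G H)) where

  open Generation G public

  Z : BSet order
  Z = centre

  C : E → BSet order
  C x = set (comm? x)

  C⁺ : ∀ {x y} → Comm x y → y ∈ C x
  C⁺ {x} = ∈⁺ (comm? x)

  C⁻ : ∀ {x y} → y ∈ C x → Comm x y
  C⁻ {x} = ∈⁻ (comm? x)

  C-sub : ∀ x → IsSub (C x)
  C-sub x = record { ε∈ = C⁺ comm-ε ; ·∈ = λ p r → C⁺ (comm-· (C⁻ p) (C⁻ r)) }

  Z-ε : ∀ {x} → x ∉ Z → x ≢ ε
  Z-ε x∉ refl = x∉ (ε∈ centre-sub)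

  noncommuting-witness : ∀ {x} → x ∉ Z → ∃[ g ] g ∉ C x
  noncommuting-witness {x} x∉ with any? (λ g → ¬? (comm? x g))
  ... | yes (g , n) = g , λ p → n (C⁻ p)
  ... | no none = ⊥-elim (x∉ (centre⁺ λ y → decidable-stable (comm? x y) λ n → none (y , n)))

  -- The centraliser is proper and has `x` as a nontrivial central element, so by `central⇒Cyc` it
  -- is cyclic even if it is odd dihedral.
  C-cyclic : ∀ {x} → x ∉ Z → DN (Cyc (C x))
  C-cyclic {x} x∉ k = proper (C-sub x) (proj₂ (noncommuting-witness x∉)) λ
    { (inj₁ cyc) → k cyc ; (inj₂ dih) → k (central⇒Cyc (C-sub x) dih (C⁺ refl) (Z-ε x∉) C⁻) }

  comm-trans : ∀ {x y w} → y ∉ Z → Comm x y → Comm y w → Comm x w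
  comm-trans {x} {y} {w} y∉ c c′ = decidable-stable (comm? x w) λ n → C-cyclic y∉ λ cyc → n (Cyc.commutes cyc (C⁺ (sym c)) (C⁺ c′))

  -- Otherwise `x` and `y` lie in a proper subgroup of exponent `p` in which `y` is central. It
  -- would be cyclic by either alternative, and a cyclic group of exponent `p` is generated by `y`
  -- already.
  rank-two : ∀ {p x y} → Prime p → x ^ p ≡ ε → y ^ p ≡ ε → Comm x y → y ≢ ε → x ∉ ⟨ y ⟩ → DN (∀ g → Product y x g)
  rank-two {p} {x} {y} pr xp yp c y≢ε x∉ k = generated (subst (_∈ ⟨ y ⟩) (sym (conj-comm c)) (gen∈⟨⟩ y)) k λ {H} sub y∈ x∈ ⇒P g∉ →
    proper sub g∉ λ
      { (inj₁ cyc) → impossible y∈ x∈ ⇒P cyc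
      ; (inj₂ dih) → impossible y∈ x∈ ⇒P (central⇒Cyc sub dih y∈ y≢ε λ w∈ → case ⇒P w∈ of λ { (i , j , refl) → comm-· (comm-^ refl i) (comm-^ (sym c) j) }) }

    where
    exponent : ∀ {g} → Product y x g → g ^ p ≡ ε
    exponent (i , j , refl) = trans (^-· (comm-^^ (sym c) i j) p)
      (trans (cong₂ _·_ (trans (^-swap y i p) (trans (cong (_^ i) yp) (ε-^ i))) (trans (^-swap x j p) (trans (cong (_^ j) xp) (ε-^ j)))) (ε-left ε))
    impossible : ∀ {H} → y ∈ H → x ∈ H → (∀ {g} → g ∈ H → Product y x g) → ¬ Cyc H
    impossible y∈ x∈ ⇒P cyc =
      let (k , y≡) = Cyc.power cyc y∈
          (l , x≡) = Cyc.power cyc x∈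
      in x∉ (subst (_∈ ⟨ y ⟩) x≡ (^∈ (⟨⟩-sub y) (prime-generates pr (exponent (⇒P (Cyc.gen∈ cyc))) (subst (_∈ ⟨ Cyc.gen cyc ⟩) y≡ (⟨⟩⁺ k)) y≢ε) l))

  conj-conj : ∀ g h x → conj g (conj h x) ≡ conj (g · h) x
  conj-conj g h x = word (g ∷ h ∷ x ∷ []) (v0 • (v1 • v2 • v1 ⁱ) • v0 ⁱ) (v0 • v1 • v2 • (v0 • v1) ⁱ) refl

  conj-Comm : ∀ g {x y} → Comm x y → Comm (conj g x) (conj g y)
  conj-Comm g {x} {y} c = trans (word (g ∷ x ∷ y ∷ []) (v0 • v1 • v0 ⁱ • (v0 • v2 • v0 ⁱ)) (v0 • (v1 • v2) • v0 ⁱ) refl)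
    (trans (cong (conj g) c) (word (g ∷ x ∷ y ∷ []) (v0 • (v2 • v1) • v0 ⁱ) (v0 • v2 • v0 ⁱ • (v0 • v1 • v0 ⁱ)) refl))

  conj-noncentral : ∀ g {x} → x ∉ Z → conj g x ∉ Z
  conj-noncentral g {x} x∉ p = x∉ (subst (_∈ Z) (trans (sym (conj-comm (sym (centre⁻ p (g ⁻))))) (word (g ∷ x ∷ []) (v0 ⁱ • (v0 • v1 • v0 ⁱ) • v0 ⁱ ⁱ) v1 refl)) p)

  -- Commuting is an equivalence relation on noncentral elements. For noncentral `x`, therefore,
  -- `N x` is the normaliser of the centraliser `C x`, and `U x` is the union of the conjugates of
  -- `C x` without the centre.
  N U C* : E → BSet order
  N x = set (λ g → comm? (conj g x) x)
  U x = set (λ y → ¬? (y ∈? Z) ×-dec any? (λ g → comm? (conj g y) x))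
  C* x = C x ∖ Z

  N⁺ : ∀ {x g} → Comm (conj g x) x → g ∈ N x
  N⁺ {x} = ∈⁺ (λ g → comm? (conj g x) x)

  N⁻ : ∀ {x g} → g ∈ N x → Comm (conj g x) x
  N⁻ {x} = ∈⁻ (λ g → comm? (conj g x) x)

  U⁺ : ∀ {x y} → y ∉ Z → ∀ g → Comm (conj g y) x → y ∈ U x
  U⁺ {x} y∉ g c = ∈⁺ (λ y → ¬? (y ∈? Z) ×-dec any? (λ g → comm? (conj g y) x)) (y∉ , g , c)

  U⁻ : ∀ {x y} → y ∈ U x → y ∉ Z × ∃[ g ] Comm (conj g y) x
  U⁻ {x} = ∈⁻ (λ y → ¬? (y ∈? Z) ×-dec any? (λ g → comm? (conj g y) x))

  U-disjoint : ∀ {x y} → y ∉ Z → y ∉ U x → ∀ w → w ∈ U x → w ∉ U y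
  U-disjoint {x} {y} y∉ y∉U w wx wy with U⁻ wx | U⁻ wy
  ... | w∉ , g , c | _ , g′ , c′ = y∉U (U⁺ y∉ (g · g′ ⁻) (comm-trans (conj-noncentral g w∉)
        (sym (subst (λ v → Comm v (conj (g · g′ ⁻) y)) (word (g ∷ g′ ∷ w ∷ []) (v0 • v1 ⁱ • (v1 • v2 • v1 ⁱ) • (v0 • v1 ⁱ) ⁱ) (v0 • v2 • v0 ⁱ) refl) (conj-Comm (g · g′ ⁻) c′))) c))

  module _ {x : E} (x∉ : x ∉ Z) where

    N-sub : IsSub (N x)
    N-sub = record { ε∈ = N⁺ (subst (λ w → Comm w x) (word (x ∷ []) v0 (𝟙 • v0 • 𝟙 ⁱ) refl) refl)
      ; ·∈ = λ {g} {h} p r → N⁺ (subst (λ w → Comm w x) (conj-conj g h x) (comm-trans (conj-noncentral g x∉) (conj-Comm g (N⁻ r)) (N⁻ p))) }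

    C⊆N : ∀ g → g ∈ C x → g ∈ N x
    C⊆N g g∈ = N⁺ (subst (λ w → Comm w x) (sym (conj-comm (sym (C⁻ g∈)))) refl)

    Z⊆C : ∀ g → g ∈ Z → g ∈ C x
    Z⊆C g g∈ = C⁺ (sym (centre⁻ g∈ x))

    C≤ : # (C x) ≤ # (C* x) + # Z
    C≤ = cover-≤ {X = C* x} {Z} λ i i∈ → case i ∈? Z of λ { (yes p) → inj₂ p ; (no n) → inj₁ (∖⁺ {X = C x} {Z} (i∈ , n)) }

    ≤C : # (C* x) + # Z ≤ # (C x)
    ≤C = disjoint-≤ {X = C* x} {Z} (λ i p → proj₂ (∖⁻ {X = C x} {Z} p)) (λ i p → proj₁ (∖⁻ {X = C x} {Z} p)) Z⊆C

    2Z≤C : 2 * # Z ≤ # (C x)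
    2Z≤C = proper-≤ centre-sub (C-sub x) Z⊆C (C⁺ refl) x∉

    2C≤n : 2 * # (C x) ≤ order
    2C≤n = ≤-trans (proper-≤ (C-sub x) full-sub (λ _ _ → ∈-full) ∈-full (proj₂ (noncommuting-witness x∉))) (≤-reflexive #-full)

    private
      R? : ∀ g y → Dec (Comm (conj g y) x)
      R? g y = comm? (conj g y) x

      there-back : ∀ g w → conj g (conj (g ⁻) w) ≡ w
      there-back g w = word (g ∷ w ∷ []) (v0 • (v0 ⁱ • v1 • v0 ⁱ ⁱ) • v0 ⁱ) v1 refl

    -- Counts the pairs of `g` and `y` with `conj g y` in `C* x`: each `g` admits `# (C* x)`
    -- elements `y`, and for each `y` in `U x` the suitable `g` form a coset of `N x`. Together with
    -- `class-upper` this is an equation.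
    class-lower : # (C* x) * order ≤ # (N x) * # (U x)
    class-lower = subst (λ n → # (C* x) * n ≤ # (N x) * # (U x)) #-full (double-count full (U x) (λ g y → ⌊ R? g y ⌋) (# (C* x)) (# (N x))
      (λ g _ → injection-≤ {X = C* x} (conj (g ⁻)) (λ w w∈ → let (wC , w∉) = ∖⁻ {X = C x} {Z} w∈ ; c = subst (λ v → Comm v x) (sym (there-back g w)) (sym (C⁻ wC)) in
          ∧⁺ {X = U x} {λ y → ⌊ R? g y ⌋} (U⁺ (conj-noncentral (g ⁻) w∉) g c) (∈⁺ (R? g) c))
        (λ i j _ _ eq → trans (sym (there-back g i)) (trans (cong (conj g) eq) (there-back g j))))
      (λ y y∈ → let (y∉ , g₀ , c₀) = U⁻ y∈ in injection-≤ {Y = N x} (_· g₀ ⁻)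
        (λ g g∈ → N⁺ (comm-trans (conj-noncentral g y∉)
          (sym (subst (λ w → Comm w (conj (g · g₀ ⁻) x)) (word (g ∷ g₀ ∷ y ∷ []) (v0 • v1 ⁱ • (v1 • v2 • v1 ⁱ) • (v0 • v1 ⁱ) ⁱ) (v0 • v2 • v0 ⁱ) refl) (conj-Comm (g · g₀ ⁻) c₀)))
          (∈⁻ (λ g → R? g y) (proj₂ (∧⁻ {X = full} {λ g → ⌊ R? g y ⌋} g∈)))))
        (λ i j _ _ → cancelʳ (g₀ ⁻))))

    class-upper : # (N x) * # (U x) ≤ # (C* x) * order
    class-upper = subst (λ n → # (N x) * # (U x) ≤ # (C* x) * n) #-full (double-count (U x) full (λ y g → ⌊ R? g y ⌋) (# (N x)) (# (C* x))
      (λ y y∈ → let (y∉ , g₀ , c₀) = U⁻ y∈ in injection-≤ {X = N x} (_· g₀)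
        (λ k k∈ → ∧⁺ {X = full} {λ g → ⌊ R? g y ⌋} ∈-full (∈⁺ (λ g → R? g y) (subst (λ w → Comm w x) (conj-conj k g₀ y)
          (comm-trans (conj-noncentral k x∉) (conj-Comm k c₀) (N⁻ k∈))))) (λ i j _ _ → cancelʳ g₀))
      (λ g _ → injection-≤ {Y = C* x} (conj g) (λ y y∈ → let (yU , r) = ∧⁻ {X = U x} {λ y → ⌊ R? g y ⌋} y∈ in
          ∖⁺ {X = C x} {Z} (C⁺ (sym (∈⁻ (R? g) r)) , conj-noncentral g (proj₁ (U⁻ yU))))
        (λ i j _ _ eq → cancelˡ g (cancelʳ (g ⁻) eq))))

  record SelfNormalising (x : E) : Set where
    field N≤C : # (N x) ≤ # (C x)

  -- What is kept when the normaliser of `C x` is odd dihedral with `C x` as its group of rotations;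
  -- `t` is one of its reflections.
  record Dihedral (x : E) : Set where
    field
      trivial-centre : ∀ {ζ} → ζ ∈ Z → ζ ≡ ε
      half  : ℕ
      odd   : ∀ {w} → Comm x w → w ^ suc (half + half) ≡ ε
      3≤C   : 3 ≤ # (C x)
      t     : E
      t≢ε   : t ≢ ε
      t²    : t · t ≡ ε
      N≤    : # (N x) ≤ 2 * # (C x)
      ≤N    : 2 * # (C x) ≤ # (N x)
      2N≤n  : 2 * # (N x) ≤ order

  odd-involution : ∀ {w} h → w ^ suc (h + h) ≡ ε → w · w ≡ ε → w ≡ ε
  odd-involution {w} h odd sq = trans (sym (ε-right w)) (trans (cong (w ·_) (sym (trans (^-+ w h h)
    (trans (sym (^-· refl h)) (trans (cong (_^ h) sq) (ε-^ h)))))) odd)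

  normaliser-shape : ∀ {x} → x ∉ Z → ∀ {g} → g ∉ N x → DN (SelfNormalising x ⊎ Dihedral x)
  normaliser-shape {x} x∉ {g₀} g₀∉ k = proper (N-sub x∉) g₀∉ λ
      { (inj₁ cyc) → k (inj₁ record { N≤C = #-mono λ g g∈ → C⁺ (Cyc.commutes cyc x∈N g∈) })
      ; (inj₂ dih) → case any? (λ g → (g ∈? N x) ×-dec ¬? (comm? x g)) of λ
          { (no none) → k (inj₁ record { N≤C = #-mono λ g g∈ → C⁺ (decidable-stable (comm? x g) λ n → none (g , g∈ , n)) })
          ; (yes (g , g∈ , nc)) → k (inj₂ (dihedral dih g∈ nc)) } }
    where
    sub = N-sub x∉
    x∈N : x ∈ N x
    x∈N = C⊆N x∉ x (C⁺ refl)
    dihedral : ODih (N x) → ∀ {g} → g ∈ N x → ¬ Comm x g → Dihedral x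
    dihedral D {g} g∈ nc = record
      { trivial-centre = λ {ζ} ζ∈ → central-trivial ζ∈
      ; half = half ; odd = λ c → odd (C⊆N x∉ _ (C⁺ c)) (C⊆rot (C⁺ c))
      ; 3≤C = ≤-trans (≤-reflexive (cong (3 *_) (sym #-trivial))) (cosets-≤ trivial-sub (C x) (ε ∷ x ∷ x ⁻ ∷ [])
          (((λ p → Z-ε x∉ (trans (word (x ∷ []) v0 (𝟙 ⁱ • v0) refl) (∈⁻ (_≟ ε) p))) ∷ (λ p → Z-ε x∉ (trans (word (x ∷ []) v0 ((𝟙 ⁱ • v0 ⁱ) ⁱ) refl) (trans (cong _⁻ (∈⁻ (_≟ ε) p)) ε⁻))) ∷ [])
           ∷ ((λ p → x²≢ε (trans (word (x ∷ []) (v0 • v0) ((v0 ⁱ • v0 ⁱ) ⁱ) refl) (trans (cong _⁻ (∈⁻ (_≟ ε) p)) ε⁻))) ∷ []) ∷ [] ∷ [])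
          (closed (ε∈ (C-sub x)) ∷ closed (C⁺ refl) ∷ closed (⁻∈ (C-sub x) (C⁺ refl)) ∷ []))
      ; t = g ; t≢ε = λ { refl → nc comm-ε } ; t² = flip g∈ g∉rot
      ; N≤ = ≤-trans (cover-≤ {X = C x} {gC} λ n n∈ → split n n∈) (+-monoʳ-≤ (# (C x)) (≤-trans gC≤ (≤-reflexive (sym (+-identityʳ _)))))
      ; ≤N = ≤-trans (+-monoʳ-≤ (# (C x)) (≤-trans (≤-reflexive (+-identityʳ _)) (#-translate (C x) g)))
          (disjoint-≤ {X = C x} {gC} (λ i i∈ i∈′ → ⊥-elim (nc (C⁻ (cancelʳ-C i i∈ (∈⁻ gC? i∈′))))) (C⊆N x∉)
            (λ i i∈ → subst (_∈ N x) (word (g ∷ i ∷ []) (v0 • (v0 ⁱ • v1)) v1 refl) (·∈ sub g∈ (C⊆N x∉ _ (∈⁻ gC? i∈)))))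
      ; 2N≤n = ≤-trans (proper-≤ sub full-sub (λ _ _ → ∈-full) ∈-full g₀∉) (≤-reflexive #-full) }
      where
      open ODih D
      closed : ∀ {w} → w ∈ C x → ∀ h → h ∈ trivial → w · h ∈ C x
      closed w∈ h h∈ = ·∈ (C-sub x) w∈ (subst (_∈ C x) (sym (∈⁻ (_≟ ε) h∈)) (ε∈ (C-sub x)))
      flip-conj : ∀ {r s} → r ∈ N x → s ∈ N x → r ∈ rot → s ∉ rot → Comm s r → r ≡ ε
      flip-conj {r} {s} r∈ s∈ rr s∉ c = odd-involution half (odd r∈ rr) (begin
        r · r                 ≡⟨ word (r ∷ s ∷ []) (v0 • v0) (v0 • (v1 • v1 ⁱ) • v0) refl ⟩
        r · (s · s ⁻) · r     ≡⟨ cong (λ w → r · (s · w) · r) (sym (cancelˡ s (trans (flip s∈ s∉) (sym (⁻-right s))))) ⟩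
        r · (s · s) · r       ≡⟨ word (r ∷ s ∷ []) (v0 • (v1 • v1) • v0) (v0 • v1 • (v1 • v0)) refl ⟩
        r · s · (s · r)       ≡⟨ cong (_· (s · r)) (sym c) ⟩
        s · r · (s · r)       ≡⟨ flip (·∈ sub s∈ r∈) (sr s∈ r∈ s∉ rr) ⟩
        ε                     ∎)
        where open ≡-Reasoning
      conj∉ : ∀ {s} → s ∈ N x → s ∉ rot → conj g s ∉ rot
      conj∉ {s} s∈ s∉ p with g ∈? rot
      ... | yes gr = rs g∈ s∈ gr s∉ (subst (_∈ rot) (word (g ∷ s ∷ []) (v0 • v1 • v0 ⁱ • v0) (v0 • v1) refl) (rr (conj∈ sub g∈ s∈) g∈ p gr))
      ... | no g∉  = rs (conj∈ sub g∈ s∈) g∈ p g∉ (subst (_∈ rot) (word (g ∷ s ∷ []) (v0 • v1) (v0 • v1 • v0 ⁱ • v0) refl) (ss g∈ s∈ g∉ s∉))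
      -- If `x` were a reflection, so would be `conj g x`. The two commute, so their product is a
      -- rotation with trivial square; odd order forces `conj g x ≡ x`, against `nc`.
      x∈rot : x ∈ rot
      x∈rot = decidable-stable (x ∈? rot) λ x∉rot → nc (sym (comm-conj (same (conj∉ x∈N x∉rot) x∉rot)))
        where
        same : conj g x ∉ rot → x ∉ rot → conj g x ≡ x
        same n n′ = cancelʳ x (trans (odd-involution half (odd (·∈ sub y∈ x∈N) (ss y∈ x∈N n n′))
            (trans (word (y ∷ x ∷ []) (v0 • v1 • (v0 • v1)) (v0 • (v1 • v0) • v1) refl) (trans (cong (λ w → y · w · x) (sym (N⁻ g∈)))
              (trans (word (y ∷ x ∷ []) (v0 • (v0 • v1) • v1) (v0 • v0 • (v1 • v1)) refl) (trans (cong₂ _·_ (flip y∈ n) (flip x∈N n′)) (ε-left ε))))))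
            (sym (flip x∈N n′)))
          where
          y = conj g x
          y∈ = conj∈ sub g∈ x∈N
      g∉rot : g ∉ rot
      g∉rot gr = nc (comm x∈N g∈ x∈rot gr)
      x²≢ε : x · x ≢ ε
      x²≢ε sq = Z-ε x∉ (odd-involution half (odd x∈N x∈rot) sq)
      C⊆rot : ∀ {w} → w ∈ C x → w ∈ rot
      C⊆rot {w} w∈ = decidable-stable (w ∈? rot) λ w∉ → Z-ε x∉ (flip-conj x∈N (C⊆N x∉ w w∈) x∈rot w∉ (sym (C⁻ w∈)))
      rot⊆C : ∀ {w} → w ∈ N x → w ∈ rot → w ∈ C x
      rot⊆C w∈ wr = C⁺ (comm x∈N w∈ x∈rot wr)
      central-trivial : ∀ {ζ} → ζ ∈ Z → ζ ≡ ε
      central-trivial {ζ} ζ∈ = flip-conj (C⊆N x∉ ζ (Z⊆C x∉ ζ ζ∈)) g∈ (C⊆rot (Z⊆C x∉ ζ ζ∈)) g∉rot (sym (centre⁻ ζ∈ g))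
      gC? : ∀ n → Dec (g ⁻ · n ∈ C x)
      gC? n = (g ⁻ · n) ∈? C x
      gC : BSet order
      gC = set gC?
      gC≤ : # gC ≤ # (C x)
      gC≤ = injection-≤ (g ⁻ ·_) (λ n n∈ → ∈⁻ gC? n∈) (λ i j _ _ → cancelˡ (g ⁻))
      split : ∀ n → n ∈ N x → n ∈ C x ⊎ n ∈ gC
      split n n∈ with n ∈? rot
      ... | yes r = inj₁ (rot⊆C n∈ r)
      ... | no n∉ = inj₂ (∈⁺ gC? (subst (λ w → w · n ∈ C x) (cancelˡ g (trans (flip g∈ g∉rot) (sym (⁻-right g)))) (rot⊆C (·∈ sub g∈ n∈) (ss g∈ n∈ g∉rot n∉))))
      cancelʳ-C : ∀ i → i ∈ C x → g ⁻ · i ∈ C x → g ∈ C x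
      cancelʳ-C i i∈ p = subst (_∈ C x) (word (g ∷ []) (v0 ⁱ ⁱ) v0 refl) (⁻∈ (C-sub x) (cancelʳ∈ (C-sub x) i∈ p))

-- Existence of a self-centralising normal cyclic subgroup

module ClassCounting (G : FinGroup)
  (proper : ∀ {H} → Subgroups.IsSub G H → ∀ {g} → g ∉ H → DN (Shapes.Cyc G H ⊎ Shapes.ODih G H)) where

  open Critical G proper public

  private
    1≤C : ∀ x → 1 ≤ # (C x)
    1≤C x = 1≤#H (C-sub x)

    1≤Z : 1 ≤ # Z
    1≤Z = 1≤#H centre-sub

    self-half : ∀ {x} (x∉ : x ∉ Z) → SelfNormalising x → order ≤ 2 * # (U x)
    self-half {x} x∉ s = ≮⇒≥ λ lt → half-class (# (C x)) order (# (U x)) (# (N x)) (# (C* x)) (# Z) (1≤C x) lt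
      (class-lower x∉) (SelfNormalising.N≤C s) (C≤ x∉) (2Z≤C x∉)

    dihedral-third : ∀ {x} (x∉ : x ∉ Z) → # Z ≡ 1 → Dihedral x → order ≤ 3 * # (U x)
    dihedral-third {x} x∉ z≡1 d = ≮⇒≥ λ lt → third-class (# (C x)) order (# (U x)) (# (N x)) (# (C* x)) (Dihedral.3≤C d) lt
      (class-lower x∉) (Dihedral.N≤ d) (subst (λ z → # (C x) ≤ # (C* x) + z) z≡1 (C≤ x∉)) (Dihedral.3≤C d)

    Z-U : ∀ {x} i → i ∈ Z → i ∉ U x
    Z-U i i∈ p = proj₁ (U⁻ p) i∈

    disjoint-sum : ∀ {x y} → y ∉ Z → y ∉ U x → # Z + (# (U x) + # (U y)) ≤ order
    disjoint-sum {x} {y} y∉ y∉U = ≤-trans (+-monoʳ-≤ (# Z) (≤-reflexive (sym (#-disjoint (U x) (U y) (U-disjoint y∉ y∉U)))))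
      (≤-trans (disjoint-≤ {X = Z} {U x ∪ U y} {full} (λ i i∈ p → [ Z-U i i∈ , Z-U i i∈ ]′ (∪⁻ {X = U x} {U y} p)) (λ _ _ → ∈-full) (λ _ _ → ∈-full)) (≤-reflexive #-full))

  -- Otherwise the classes of the centralisers would overfill the group.
  normal-centraliser : ∀ {x} → x ∉ Z → DN (∃[ y ] (y ∉ Z × ∀ g → g ∈ N y))
  normal-centraliser {x} x∉ k = em (∃[ y ] (y ∉ Z × Dihedral y)) λ { (yes (y , y∉ , d)) → some-dihedral y∉ d ; (no none) → no-dihedral none }
    where
    outside-N : ∀ {y} → y ∉ Z → ∃[ g ] g ∉ N y
    outside-N {y} y∉ with any? (λ g → ¬? (g ∈? N y))
    ... | yes p = p
    ... | no none = ⊥-elim (k (y , y∉ , λ g → decidable-stable (g ∈? N y) λ n → none (g , n)))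
    shape : ∀ {y} → y ∉ Z → DN (SelfNormalising y ⊎ Dihedral y)
    shape y∉ = normaliser-shape y∉ (proj₂ (outside-N y∉))

    -- Each `U` has at least half of the elements, yet one of them cannot exhaust the noncentral
    -- elements. A second one, disjoint from the first, and the centre are then too much.
    no-dihedral : ¬ (∃[ y ] (y ∉ Z × Dihedral y)) → ⊥
    no-dihedral none = self x∉ λ s → another s λ { (y , y∉ , y∉U) → self y∉ λ s′ →
        two-halves (# Z) order (# (U x)) (# (U y)) 1≤Z (self-half x∉ s) (self-half y∉ s′) (disjoint-sum y∉ y∉U) }
      where
      self : ∀ {y} → y ∉ Z → DN (SelfNormalising y)
      self y∉ k = shape y∉ λ { (inj₁ s) → k s ; (inj₂ d) → none (_ , y∉ , d) }
      another : SelfNormalising x → DN (∃[ y ] (y ∉ Z × y ∉ U x))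
      another s k = another-class (# (C x)) (# Z) order (# (U x)) (# (N x)) (# (C* x)) (1≤C x) 1≤Z
        (≤-trans (≤-reflexive (sym #-full)) (cover-≤ {X = Z} {U x} {full} λ i _ → case i ∈? Z of λ
          { (yes p) → inj₁ p ; (no n) → inj₂ (decidable-stable (i ∈? U x) λ n′ → k (i , n , n′)) }))
        (#-mono (C⊆N x∉)) (class-upper x∉) (≤C x∉) (2C≤n x∉)

    -- The involution `t` cannot itself be of dihedral kind, where centralisers have odd exponent.
    -- If its centraliser has more than two elements, `U t` has two thirds of the group and `U y` a
    -- third, which leaves no place for `ε`.
    some-dihedral : ∀ {y} → y ∉ Z → Dihedral y → ⊥
    some-dihedral {y} y∉ d = shape t∉ λ { (inj₂ d′) → t≢ε (odd-involution (Dihedral.half d′) (Dihedral.odd d′ refl) t²)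
        ; (inj₁ s) → case 3 ≤? # (C t) of λ
            { (yes 3≤) → two-thirds-third order (# (U t)) (# (U y)) (≮⇒≥ λ lt → two-thirds-class (# (C t)) order (# (U t)) (# (N t)) (# (C* t)) 3≤ lt
                  (class-lower t∉) (SelfNormalising.N≤C s) (subst (λ z → # (C t) ≤ # (C* t) + z) z≡1 (C≤ t∉)) 3≤)
                third (subst (λ z → z + (# (U t) + # (U y)) ≤ order) z≡1 (disjoint-sum y∉ y∉U))
            ; (no 3≰) → small s (≤-pred (≰⇒> 3≰)) } }
      where
      open Dihedral d
      z≡1 : # Z ≡ 1
      z≡1 = ≤-antisym (#≤1 λ i j p p′ → trans (trivial-centre p) (sym (trivial-centre p′))) 1≤Z
      t∉ : t ∉ Z
      t∉ p = t≢ε (trivial-centre p)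
      third : order ≤ 3 * # (U y)
      third = dihedral-third y∉ z≡1 d
      y∉U : y ∉ U t
      y∉U p with U⁻ p
      ... | _ , g , c = t≢ε (trans (word (g ∷ t ∷ []) v1 (v0 • (v0 ⁱ • v1 • v0 ⁱ ⁱ) • v0 ⁱ) refl) (trans (cong (conj g) t′≡ε) (word (g ∷ []) (v0 • 𝟙 • v0 ⁱ) 𝟙 refl)))
        where
        t′ = conj (g ⁻) t
        t′≡ε : t′ ≡ ε
        t′≡ε = odd-involution half (odd (subst (λ w → Comm w t′) (word (g ∷ y ∷ []) (v0 ⁱ • (v0 • v1 • v0 ⁱ) • v0 ⁱ ⁱ) v1 refl) (conj-Comm (g ⁻) c)))
          (trans (word (g ∷ t ∷ []) (v0 ⁱ • v1 • v0 ⁱ ⁱ • (v0 ⁱ • v1 • v0 ⁱ ⁱ)) (v0 ⁱ • (v1 • v1) • v0 ⁱ ⁱ) refl) (trans (cong (conj (g ⁻)) t²) (word (g ∷ []) (v0 ⁱ • 𝟙 • v0 ⁱ ⁱ) 𝟙 refl)))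
      small : SelfNormalising t → # (C t) ≤ 2 → ⊥
      small s C≤2 = case any? (λ w → ¬? (w ∈? Z) ×-dec (¬? (w ∈? U t) ×-dec ¬? (w ∈? U y))) of λ
        { (yes (w , w∉ , w∉t , w∉y)) → shape w∉ λ sh → three-classes order (# (U t)) (# (U y)) (# (U w)) (self-half t∉ s) third
            ([ (λ s′ → ≤-trans (self-half w∉ s′) (*-monoˡ-≤ (# (U w)) (n≤1+n 2))) , dihedral-third w∉ z≡1 ]′ sh) (sum₃ w∉ w∉t w∉y)
        -- Only the classes of `t` and `y` exist. Let n be the order of the group and c that of
        -- `C y`: then `U t` has at most n / 2 elements and `U y` at most n / 2 - n / (2 c). As n ≥
        -- 4 c, the identity alone cannot fill the gap.
        ; (no none) → two-classes (# (C y)) order (# (U t)) (# (U y)) (# (N y)) (# (C* y)) (1≤C y)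
            (≤-trans (≤-reflexive (sym #-full)) (≤-trans (cover-≤ {X = Z} {U t ∪ U y} {full} λ i _ → covered none i)
              (+-mono-≤ (≤-reflexive z≡1) (≤-trans (m≤m+n _ _) (≤-reflexive (#-∪-∩ (U t) (U y)))))))
            (≮⇒≥ λ lt → at-most-half order (# (U t)) (# (N t)) (# (C* t)) lt (≤-trans (≤-trans (*-monoʳ-≤ 2 1≤Z) (2Z≤C t∉)) (#-mono (C⊆N t∉))) (class-upper t∉)
              (≤-trans (subst (λ z → # (C* t) + z ≤ # (C t)) z≡1 (≤C t∉)) C≤2))
            ≤N (class-upper y∉) (subst (λ z → # (C* y) + z ≤ # (C y)) z≡1 (≤C y∉)) ≤N 2N≤n }
        where
        covered : ¬ (∃[ w ] (w ∉ Z × w ∉ U t × w ∉ U y)) → ∀ i → i ∈ Z ⊎ i ∈ U t ∪ U y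
        covered none i with i ∈? Z | i ∈? U t | i ∈? U y
        ... | yes p | _ | _ = inj₁ p
        ... | no _ | yes p | _ = inj₂ (∪⁺ {X = U t} {U y} (inj₁ p))
        ... | no _ | no _ | yes p = inj₂ (∪⁺ {X = U t} {U y} (inj₂ p))
        ... | no a | no b | no c = ⊥-elim (none (i , a , b , c))
        sum₃ : ∀ {w} → w ∉ Z → w ∉ U t → w ∉ U y → 1 + (# (U t) + (# (U y) + # (U w))) ≤ order
        sum₃ {w} w∉ w∉t w∉y = ≤-trans (≤-reflexive (cong₂ _+_ (sym z≡1) (trans (cong (# (U t) +_) (sym (#-disjoint (U y) (U w) (U-disjoint w∉ w∉y))))
            (sym (#-disjoint (U t) (U y ∪ U w) (λ i p r → [ U-disjoint y∉ y∉U i p , U-disjoint w∉ w∉t i p ]′ (∪⁻ {X = U y} {U w} r)))))))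
          (≤-trans (disjoint-≤ {X = Z} {U t ∪ (U y ∪ U w)} {full} (λ i i∈ p → [ Z-U i i∈ , (λ r → [ Z-U i i∈ , Z-U i i∈ ]′ (∪⁻ {X = U y} {U w} r)) ]′ (∪⁻ {X = U t} {U y ∪ U w} p)) (λ _ _ → ∈-full) (λ _ _ → ∈-full)) (≤-reflexive #-full))

  record NormalCyclic : Set where
    field
      a      : E
      a∉     : a ∉ Z
      cent   : ∀ {g} → Comm g a → g ∈ ⟨ a ⟩
      normal : ∀ g → conj g a ∈ ⟨ a ⟩

  normal-cyclic : ∀ {x} → x ∉ Z → DN NormalCyclic
  normal-cyclic x∉ k = normal-centraliser x∉ λ { (y , y∉ , all) → C-cyclic y∉ λ cyc →
    let open Cyc cyc
        (i , y≡) = power (C⁺ refl)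
        a∉ : gen ∉ Z
        a∉ p = y∉ (subst (_∈ Z) y≡ (^∈ centre-sub p i))
        in-C : ∀ {g} → Comm g gen → g ∈ ⟨ gen ⟩
        in-C {g} c = case power (C⁺ (comm-trans a∉ (C⁻ gen∈) (sym c))) of λ { (j , refl) → ⟨⟩⁺ j }
    in k record { a = gen ; a∉ = a∉ ; cent = in-C
                ; normal = λ g → in-C (comm-trans y∉ (comm-trans (conj-noncentral g y∉) (conj-Comm g (sym (C⁻ gen∈))) (N⁻ (all g))) (C⁻ gen∈)) } }

-- Extending the normal cyclic subgroup by an element of prime order

module Extension (G : FinGroup)
  (proper : ∀ {H} → Subgroups.IsSub G H → ∀ {g} → g ∉ H → DN (Shapes.Cyc G H ⊎ Shapes.ODih G H))
  (not-dihedral : ∀ k → ¬ IsoDihedral G (suc (k + k)))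
  (normal-cyclic′ : ClassCounting.NormalCyclic G proper) where

  open ClassCounting G proper public
  open NormalCyclic normal-cyclic′ public

  even-power : ∀ {w} → w · w ≡ ε → ∀ j → w ^ (j + j) ≡ ε
  even-power {w} sq j = trans (^-+ w j j) (trans (sym (^-· refl j)) (trans (cong (_^ j) sq) (ε-^ j)))

  odd-power : ∀ {w} → w · w ≡ ε → ∀ j → w ^ suc (j + j) ≡ w
  odd-power {w} sq j = trans (cong (w ·_) (even-power sq j)) (ε-right w)

  conj-ε : ∀ {g w} → conj g w ≡ ε → w ≡ ε
  conj-ε {g} {w} eq = trans (word (g ∷ w ∷ []) v1 (v0 ⁱ • (v0 • v1 • v0 ⁱ) • v0) refl) (trans (cong (λ v → g ⁻ · v · g) eq) (word (g ∷ []) (v0 ⁱ • 𝟙 • v0) 𝟙 refl))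

  -- The cyclic group generated by `w` has no nontrivial element besides `w`.
  involution-fixed : ∀ {g w} → w · w ≡ ε → conj g w ∈ ⟨ w ⟩ → Comm g w
  involution-fixed {g} {w} sq p with ⟨⟩⁻ p
  ... | k , eq with parity k
  ...   | j , inj₂ refl = comm-conj (trans (sym eq) (odd-power sq j))
  ...   | j , inj₁ refl = subst (Comm g) (sym (conj-ε (trans (sym eq) (even-power sq j)))) comm-ε

  ⟨a⟩-comm : ∀ {x y} → x ∈ ⟨ a ⟩ → y ∈ ⟨ a ⟩ → Comm x y
  ⟨a⟩-comm x∈ y∈ with ⟨⟩⁻ x∈ | ⟨⟩⁻ y∈
  ... | i , refl | j , refl = comm-^^ refl i j

  ⟨a⟩-conj : ∀ g {x} → x ∈ ⟨ a ⟩ → conj g x ∈ ⟨ a ⟩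
  ⟨a⟩-conj g x∈ with ⟨⟩⁻ x∈
  ... | k , refl = subst (_∈ ⟨ a ⟩) (sym (conj-^ g a k)) (^∈ (⟨⟩-sub a) (normal g) k)

  a²≢ε : a · a ≢ ε
  a²≢ε sq = a∉ (centre⁺ λ g → sym (involution-fixed sq (normal g)))

  -- By `rank-two` the whole group would be generated by two commuting elements, whereas `a` is not
  -- central.
  rank-two-absurd : ∀ {p x y} → Prime p → x ^ p ≡ ε → y ^ p ≡ ε → Comm x y → y ≢ ε → x ∉ ⟨ y ⟩ → ⊥
  rank-two-absurd {x = x} {y} pr xp yp c y≢ε x∉ = rank-two pr xp yp c y≢ε x∉ λ gen → a∉ (centre⁺ λ g → commuting (gen a) (gen g))
    where
    commuting : ∀ {u v} → Product y x u → Product y x v → Comm u v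
    commuting (i , j , refl) (k , l , refl) = comm-· (sym (comm-· (comm-^^ refl k i) (comm-^^ (sym c) k j))) (sym (comm-· (comm-^^ c l i) (comm-^^ refl l j)))

  ^2 : ∀ {x} → x · x ≡ ε → x ^ 2 ≡ ε
  ^2 {x} sq = trans (^-2 x) sq

  -- If `a` has odd order, the group is one of the excluded dihedral groups. If its order is
  -- `k + k`, the involution `a ^ k` commutes with `b`, and the two contradict `rank-two-absurd`.
  dihedral-absurd : ∀ {b} → b ∉ ⟨ a ⟩ → b · b ≡ ε → conj b a ≡ a ⁻ → (∀ g → Product a b g) → ⊥
  dihedral-absurd {b} b∉ b² inverts gen with has-order a
  ... | N , o with parity N
  ...   | k , inj₂ refl = not-dihedral k (dihedral-iso o b² inverts (λ i eq → b∉ (subst (_∈ ⟨ a ⟩) eq (⟨⟩⁺ i))) cover)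
    where
    cover : ∀ g → (∃[ i ] a ^ i ≡ g) ⊎ (∃[ i ] a ^ i · b ≡ g)
    cover g with gen g
    ... | i , j , refl with parity j
    ...   | l , inj₁ refl = inj₁ (i , sym (trans (cong (a ^ i ·_) (even-power b² l)) (ε-right _)))
    ...   | l , inj₂ refl = inj₂ (i , cong (a ^ i ·_) (sym (odd-power b² l)))
  ...   | k , inj₁ refl = rank-two-absurd prime[2] (^2 b²) (^2 y²)
            (comm-conj (trans (conj-^ b a k) (trans (cong (_^ k) inverts) (trans (⁻-^ a k) (sym (cancelˡ (a ^ k) (trans y² (sym (⁻-right _)))))))))
            y≢ε (λ p → b∉ (⟨⟩-⊆ (⟨⟩-sub a) (⟨⟩⁺ k) b p))
    where
    open HasOrder o
    y² : a ^ k · a ^ k ≡ ε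
    y² = trans (sym (^-+ a k k)) kills
    0<k : ∀ k → 0 < k + k → 0 < k
    0<k (suc k) _ = s≤s z≤n
    y≢ε : a ^ k ≢ ε
    y≢ε eq = <⇒≱ (≤-trans (s≤s (m≤m+n k 0)) (≤-trans (≤-reflexive (trans (cong suc (+-identityʳ k)) (+-comm 1 k))) (+-monoʳ-≤ k (0<k k positive))))
                 (∣⇒≤ {{>-nonZero (0<k k positive)}} (divides′ k eq))

  normalises-power : ∀ b k → Normalises b (a ^ k)
  normalises-power b k with ⟨⟩⁻ (normal b)
  ... | r , eq = subst (_∈ ⟨ a ^ k ⟩) (trans (^-swap a k r) (trans (cong (_^ k) eq) (sym (conj-^ b a k)))) (⟨⟩⁺ r)

  module Prime-index {b : E} (b∉ : b ∉ ⟨ a ⟩) {p : ℕ} (pr : Prime p) (bp∈ : b ^ p ∈ ⟨ a ⟩) (gen : ∀ g → Product a b g) where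

    t : ℕ
    t = proj₁ (⟨⟩⁻ bp∈)

    a^t : a ^ t ≡ b ^ p
    a^t = proj₂ (⟨⟩⁻ bp∈)

    -- The commutator of `b` and `a`. Conjugation by `b` multiplies `a ^ i` by `c ^ i`, so the order
    -- of `c` governs the action of `b`.
    c : E
    c = conj b a · a ⁻

    c∈ : c ∈ ⟨ a ⟩
    c∈ = ·∈ (⟨⟩-sub a) (normal b) (⁻∈ (⟨⟩-sub a) (gen∈⟨⟩ a))

    conj-a : conj b a ≡ c · a
    conj-a = word (conj b a ∷ a ∷ []) v0 (v0 • v1 ⁱ • v1) refl

    not-comm : ¬ Comm b a
    not-comm cm = b∉ (cent cm)

    c≢ε : c ≢ ε
    c≢ε eq = not-comm (comm-conj (trans conj-a (trans (cong (_· a) eq) (ε-left a))))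

    c~a : Comm c a
    c~a = ⟨a⟩-comm c∈ (gen∈⟨⟩ a)

    bracket : ∀ i → conj b (a ^ i) ≡ c ^ i · a ^ i
    bracket i = trans (conj-^ b a i) (trans (cong (_^ i) conj-a) (^-· c~a i))

    bracket-comm : ∀ i → Comm b (a ^ i) → c ^ i ≡ ε
    bracket-comm i cm = cancelʳ (a ^ i) (trans (sym (bracket i)) (trans (conj-comm cm) (sym (ε-left _))))

    k : ℕ
    k = proj₁ (has-order c)

    order-c : HasOrder c k
    order-c = proj₂ (has-order c)

    -- `b` commutes with its own power `b ^ p`, which is `a ^ t`.
    k∣t : k ∣ t
    k∣t = HasOrder.divides′ order-c t (bracket-comm t (subst (Comm b) (sym a^t) (comm-^ refl p)))

    2≤k : 2 ≤ k
    2≤k = go k (HasOrder.positive order-c) (HasOrder.kills order-c)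
      where
      go : ∀ k → 0 < k → c ^ k ≡ ε → 2 ≤ k
      go (suc zero) _ eq = ⊥-elim (c≢ε (trans (sym (^-1 c)) eq))
      go (suc (suc k)) _ _ = s≤s (s≤s z≤n)

    b^j∈ : ∀ {j} → b ^ j ∈ ⟨ a ⟩ → p ∣ j
    b^j∈ {j} q∈ = decidable-stable (p ∣? j) λ p∤j → b∉ (prime-root {k = j} (⟨⟩-sub a) pr bp∈ p∤j q∈)

    comm-gen : ∀ {x} → Comm x a → Comm x b → ∀ g → Comm x g
    comm-gen ca cb g with gen g
    ... | i , j , refl = comm-· (comm-^ ca i) (comm-^ cb j)

    module _ {q : ℕ} (prq : Prime q) (q∣k : q ∣ k) (cq≢ε : c ^ q ≢ ε) where

      private
        nc : ¬ Comm (a ^ q) b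
        nc cm = cq≢ε (bracket-comm q (sym cm))

        -- If `a ^ q` and `b` gave everything, the exponent of `b` in an expression for `a` would be
        -- a multiple of `p`, and that power of `b` a power of `a ^ t` with `q` dividing `t`. So `a`
        -- would be a power of `a ^ q`, and `c` one of `c ^ q`, although `q` divides the order of
        -- `c`.
        whole : ¬ (∀ g → Product (a ^ q) b g)
        whole gen′ = let (i , j , eq) = gen′ a in
          whole′ i j eq (b^j∈ {j} (cancelˡ∈ (⟨⟩-sub a) (^∈ (⟨⟩-sub a) (⟨⟩⁺ q) i) (subst (_∈ ⟨ a ⟩) (sym eq) (gen∈⟨⟩ a)))) (∣-trans q∣k k∣t)
          where
          whole′ : ∀ i j → (a ^ q) ^ i · b ^ j ≡ a → p ∣ j → q ∣ t → ⊥
          whole′ i _ eq (divides m refl) (divides t′ t≡) = <⇒≱ k′<k (∣⇒≤ {{>-nonZero 0<k′}} (HasOrder.divides′ order-c k′ (begin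
              c ^ k′                      ≡⟨ cong (_^ k′) c≡ ⟩
              (c ^ (q * s)) ^ k′          ≡⟨ ^-* c (q * s) k′ ⟨
              c ^ (q * s * k′)            ≡⟨ cong (c ^_) (l q s k′) ⟩
              c ^ (k′ * q * s)            ≡⟨ cong (λ w → c ^ (w * s)) k≡ ⟨
              c ^ (k * s)                 ≡⟨ HasOrder.^-∣ order-c (m∣m*n s) ⟩
              ε                           ∎)))
            where
            open ≡-Reasoning
            s = i + t′ * m
            k′ = _∣_.quotient q∣k
            k≡ = _∣_.equality q∣k
            l : ∀ q s k → q * s * k ≡ k * q * s
            l = solve-∀
            l₂ : ∀ q i t m → q * i + t * q * m ≡ q * (i + t * m)
            l₂ = solve-∀
            a≡ : a ^ (q * s) ≡ a
            a≡ = begin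
              a ^ (q * s)                          ≡⟨ cong (a ^_) (l₂ q i t′ m) ⟨
              a ^ (q * i + t′ * q * m)             ≡⟨ ^-+ a (q * i) (t′ * q * m) ⟩
              a ^ (q * i) · a ^ (t′ * q * m)       ≡⟨ cong₂ _·_ (^-* a q i) (trans (cong (λ w → a ^ (w * m)) (sym t≡)) (trans (^-* a t m) (trans (cong (_^ m) a^t) (trans (sym (^-* b p m)) (cong (b ^_) (*-comm p m)))))) ⟩
              (a ^ q) ^ i · b ^ (m * p)            ≡⟨ eq ⟩
              a                                    ∎
            c≡ : c ≡ c ^ (q * s)
            c≡ = cancelʳ a (trans (sym conj-a) (trans (cong (conj b) (sym a≡)) (trans (bracket (q * s)) (cong (c ^ (q * s) ·_) a≡))))
            0<k′ : 0 < k′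
            0<k′ = pos k′ (subst (0 <_) k≡ (HasOrder.positive order-c))
              where
              pos : ∀ k′ → 0 < k′ * q → 0 < k′
              pos (suc _) _ = s≤s z≤n
            k′<k : k′ < k
            k′<k = subst (k′ <_) (sym k≡) (m<m*n k′ q {{>-nonZero 0<k′}} (prime-≥2 prq))

        inverted : b · b ≡ ε → conj b (a ^ q) ≡ (a ^ q) ⁻ → ⊥
        inverted b² inv with conj b a · a ≟ ε
        ... | yes d≡ε = dihedral-absurd b∉ b² (cancelʳ a (trans d≡ε (sym (⁻-left a)))) gen
        ... | no d≢ε = rank-two-absurd prime[2] (^2 b²) (^2 d²) b~d d≢ε (λ r → b∉ (⟨⟩-⊆ (⟨⟩-sub a) d∈ b r))
          where
          -- `b` fixes `d`, so `d` is a power of `a` whose exponent is divisible by `k` and hence by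
          -- `q`. As a power of `a ^ q` it is inverted by `b` as well, so its square is trivial.
          d = conj b a · a
          d∈ : d ∈ ⟨ a ⟩
          d∈ = ·∈ (⟨⟩-sub a) (normal b) (gen∈⟨⟩ a)
          b⁻ : b ⁻ ≡ b
          b⁻ = sym (cancelˡ b (trans b² (sym (⁻-right b))))
          b~d : Comm b d
          b~d = comm-conj (begin
            conj b (conj b a · a)                     ≡⟨ word (b ∷ a ∷ []) (v0 • (v0 • v1 • v0 ⁱ • v1) • v0 ⁱ) (v0 • v0 • v1 • (v0 • v0) ⁱ • (v0 • v1 • v0 ⁱ)) refl ⟩
            b · b · a · (b · b) ⁻ · conj b a          ≡⟨ cong (λ w → w · a · w ⁻ · conj b a) b² ⟩
            ε · a · ε ⁻ · conj b a                    ≡⟨ word (a ∷ conj b a ∷ []) (𝟙 • v0 • 𝟙 ⁱ • v1) (v0 • v1) refl ⟩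
            a · conj b a                              ≡⟨ ⟨a⟩-comm (gen∈⟨⟩ a) (normal b) ⟩
            conj b a · a                              ∎)
            where open ≡-Reasoning
          d² : d · d ≡ ε
          d² = let (s , a^s) = ⟨⟩⁻ d∈ in squared s a^s (∣-trans q∣k (HasOrder.divides′ order-c s (bracket-comm s (subst (Comm b) (sym a^s) b~d))))
           where
           squared : ∀ s → a ^ s ≡ d → q ∣ s → d · d ≡ ε
           squared s a^s (divides m s≡) = trans (cong (d ·_) (trans (sym (conj-comm b~d)) d-inverted)) (⁻-right d)
            where
            d≡ : (a ^ q) ^ m ≡ d
            d≡ = trans (sym (^-* a q m)) (trans (cong (a ^_) (trans (*-comm q m) (sym s≡))) a^s)
            d-inverted : conj b d ≡ d ⁻
            d-inverted = trans (cong (conj b) (sym d≡)) (trans (conj-^ b (a ^ q) m) (trans (cong (_^ m) inv) (trans (⁻-^ (a ^ q) m) (cong _⁻ d≡))))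

      -- `a ^ q` and `b` generate a proper subgroup, nonabelian as `c ^ q` is not trivial, hence odd
      -- dihedral: `b` is an involution inverting `a ^ q`. By `inverted` this contradicts either
      -- `dihedral-absurd` or `rank-two-absurd`.
      composite-absurd : ⊥
      composite-absurd = generated (normalises-power b q) whole λ {H} sub aq∈ b∈ _ g∉ → proper sub g∉ λ
        { (inj₁ cyc) → nc (Cyc.commutes cyc aq∈ b∈)
        ; (inj₂ dih) → let (b² , inv , _) = noncommuting⇒inverts sub dih aq∈ b∈ nc (λ sq → nc (sym (involution-fixed sq (normalises-power b q)))) in inverted b² inv }

    conj-c : conj b c ∈ ⟨ c ⟩
    conj-c with ⟨⟩⁻ c∈
    ... | u , eq = subst (_∈ ⟨ c ⟩) (trans (cong (c ^ u ·_) (sym eq)) (trans (sym (bracket u)) (cong (conj b) eq))) (·∈ (⟨⟩-sub c) (⟨⟩⁺ u) (gen∈⟨⟩ c))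

    bp~c : Comm (b ^ p) c
    bp~c = ⟨a⟩-comm bp∈ c∈

    -- b has no fixed point on ⟨ c ⟩, so its orbits there have p elements.
    orbit-< : ¬ Comm b c → p < # ⟨ c ⟩
    orbit-< nc = ≤-<-trans (≤-trans (≤-reflexive (sym #-full)) (injection-≤ {n = p} {X = full} {Y = ⟨ c ⟩ ∖ trivial} (λ i → conj (b ^ toℕ i) c)
        (λ i _ → ∖⁺ {X = ⟨ c ⟩} {trivial} (subst (λ w → conj (b ^ toℕ i) w ∈ ⟨ c ⟩) (^-1 c) (normalises-^ conj-c (toℕ i) 1) , λ e → c≢ε (conj-ε (∈⁻ (_≟ ε) e))))
        (λ i j _ _ eq → toℕ-injective ([ (λ le → same le (toℕ<n j) eq) , (λ le → sym (same le (toℕ<n i) (sym eq))) ]′ (≤-total (toℕ i) (toℕ j))))))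
      (#-mono-< {X = ⟨ c ⟩ ∖ trivial} {⟨ c ⟩} {ε} (λ i r → proj₁ (∖⁻ {X = ⟨ c ⟩} {trivial} r)) (⟨⟩⁺ 0) (λ r → proj₂ (∖⁻ {X = ⟨ c ⟩} {trivial} r) (ε∈ trivial-sub)))
      where
      same : ∀ {i j} → i ≤ j → j < p → conj (b ^ i) c ≡ conj (b ^ j) c → i ≡ j
      same {i} le j<p eq with m≤n⇒∃[o]m+o≡n le
      ... | zero , refl = sym (+-identityʳ i)
      ... | suc d , refl = ⊥-elim (nc (sym (C⁻ (prime-root {k = suc d} (C-sub c) pr (C⁺ (sym bp~c)) (λ dv → <⇒≱ (≤-<-trans (m≤n+m (suc d) i) j<p) (∣⇒≤ dv))
            (C⁺ (sym (comm-conj (cancelˡ (b ^ i) (cancelʳ ((b ^ i) ⁻) (trans (trans (conj-conj (b ^ i) (b ^ suc d) c) (cong (λ w → conj w c) (sym (^-+ b i (suc d))))) (sym eq)))))))))))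

-- The commutator of a and b has order p

triangle : ℕ → ℕ
triangle zero    = 0
triangle (suc n) = n + triangle n

-- The n-th value is n (n - 1) / 2; for odd n it is a multiple of n, which makes the correction term
-- of `twisted-power` vanish for odd primes.
triangle-odd : ∀ h → triangle (suc (h + h)) ≡ suc (h + h) * h
triangle-odd zero = refl
triangle-odd (suc h) = trans (cong (λ n → triangle (suc (suc n))) (+-suc h h)) (trans (cong (λ n → suc (suc (h + h)) + (suc (h + h) + n)) (triangle-odd h)) (l h))
  where
  l : ∀ h → suc (suc (h + h)) + (suc (h + h) + suc (h + h) * h) ≡ suc (suc h + suc h) * suc h
  l = solve-∀

module PrimeIndexCases (G : FinGroup)
  (proper : ∀ {H} → Subgroups.IsSub G H → ∀ {g} → g ∉ H → DN (Shapes.Cyc G H ⊎ Shapes.ODih G H))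
  (not-dihedral : ∀ k → ¬ IsoDihedral G (suc (k + k)))
  (normal-cyclic′ : ClassCounting.NormalCyclic G proper) where

  open Extension G proper not-dihedral normal-cyclic′ public

  -- The collection formula in nilpotency class two: each `y` that passes a `b` leaves a factor `w`,
  -- and n (n - 1) / 2 such passages occur.
  twisted-power : ∀ {b y w} → y · b ≡ b · y · w → Comm w b → Comm w y → ∀ n → (b · y) ^ n ≡ b ^ n · y ^ n · w ^ triangle n
  twisted-power {b} {y} {w} yb wb wy zero = word [] 𝟙 (𝟙 • 𝟙 • 𝟙) refl
  twisted-power {b} {y} {w} yb wb wy (suc n) = begin
    b · y · (b · y) ^ n                                   ≡⟨ cong (b · y ·_) (twisted-power yb wb wy n) ⟩
    b · y · (b ^ n · y ^ n · w ^ triangle n)              ≡⟨ word (b ∷ y ∷ b ^ n ∷ y ^ n ∷ w ^ triangle n ∷ []) (v0 • v1 • (v2 • v3 • v4)) (v0 • (v1 • v2) • v3 • v4) refl ⟩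
    b · (y · b ^ n) · y ^ n · w ^ triangle n              ≡⟨ cong (λ v → b · v · y ^ n · w ^ triangle n) (pass n) ⟩
    b · (b ^ n · y · w ^ n) · y ^ n · w ^ triangle n      ≡⟨ word (b ∷ b ^ n ∷ y ∷ w ^ n ∷ y ^ n ∷ w ^ triangle n ∷ []) (v0 • (v1 • v2 • v3) • v4 • v5) (v0 • v1 • (v2 • (v3 • v4)) • v5) refl ⟩
    b · b ^ n · (y · (w ^ n · y ^ n)) · w ^ triangle n    ≡⟨ cong (λ v → b · b ^ n · (y · v) · w ^ triangle n) (comm-^^ wy n n) ⟩
    b · b ^ n · (y · (y ^ n · w ^ n)) · w ^ triangle n    ≡⟨ word (b ∷ b ^ n ∷ y ∷ y ^ n ∷ w ^ n ∷ w ^ triangle n ∷ []) (v0 • v1 • (v2 • (v3 • v4)) • v5) (v0 • v1 • (v2 • v3) • (v4 • v5)) refl ⟩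
    b · b ^ n · (y · y ^ n) · (w ^ n · w ^ triangle n)    ≡⟨ cong (b · b ^ n · (y · y ^ n) ·_) (^-+ w n (triangle n)) ⟨
    b ^ suc n · y ^ suc n · w ^ triangle (suc n)          ∎
    where
    open ≡-Reasoning
    pass : ∀ n → y · b ^ n ≡ b ^ n · y · w ^ n
    pass zero = word (y ∷ []) (v0 • 𝟙) (𝟙 • v0 • 𝟙) refl
    pass (suc n) = begin
      y · (b · b ^ n)               ≡⟨ word (y ∷ b ∷ b ^ n ∷ []) (v0 • (v1 • v2)) (v0 • v1 • v2) refl ⟩
      y · b · b ^ n                 ≡⟨ cong (_· b ^ n) yb ⟩
      b · y · w · b ^ n             ≡⟨ word (b ∷ y ∷ w ∷ b ^ n ∷ []) (v0 • v1 • v2 • v3) (v0 • v1 • (v2 • v3)) refl ⟩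
      b · y · (w · b ^ n)           ≡⟨ cong (b · y ·_) (comm-^ wb n) ⟩
      b · y · (b ^ n · w)           ≡⟨ word (b ∷ y ∷ w ∷ b ^ n ∷ []) (v0 • v1 • (v3 • v2)) (v0 • (v1 • v3) • v2) refl ⟩
      b · (y · b ^ n) · w           ≡⟨ cong (λ v → b · v · w) (pass n) ⟩
      b · (b ^ n · y · w ^ n) · w   ≡⟨ word (b ∷ y ∷ w ∷ b ^ n ∷ w ^ n ∷ []) (v0 • (v3 • v1 • v4) • v2) (v0 • v3 • v1 • (v4 • v2)) refl ⟩
      b · b ^ n · y · (w ^ n · w)   ≡⟨ cong (b · b ^ n · y ·_) (comm-^ refl n) ⟨
      b · b ^ n · y · (w · w ^ n)   ∎

  -- `c` plays the part of -1, and `x` and `y` those of i and j.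
  Quaternion : E → E → E → Set
  Quaternion x y c = x · x ≡ c × y · y ≡ c × c · c ≡ ε × c ≢ ε × conj y x ≡ c · x × (∀ g → Product x y g)

  module _ (no-quaternion : ∀ {x y c} → ¬ Quaternion x y c)
           {b : E} (b∉ : b ∉ ⟨ a ⟩) {p : ℕ} (pr : Prime p) (bp∈ : b ^ p ∈ ⟨ a ⟩) (gen : ∀ g → Product a b g) where

    open Prime-index b∉ pr bp∈ gen

    module _ (k≡p : k ≡ p) where

      private
        order-p : HasOrder c p
        order-p = subst (HasOrder c) k≡p order-c
        cp : c ^ p ≡ ε
        cp = HasOrder.kills order-p
        b~c : Comm b c
        -- `⟨ c ⟩` has `p` elements, one too few for an orbit of length `p` that avoids `ε`.
        b~c = decidable-stable (comm? b c) λ nc → <⇒≱ (orbit-< nc) (≤-reflexive (#⟨⟩ order-p))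
        m : ℕ
        m = _∣_.quotient k∣t
        t≡ : t ≡ m * p
        t≡ = trans (_∣_.equality k∣t) (cong (m *_) k≡p)
        -- `a ^ m` is a p-th root of `b ^ p`; dividing `b` by it leaves only the collection term as
        -- p-th power.
        y = (a ^ m) ⁻
        w = c ^ m
        y∈ : y ∈ ⟨ a ⟩
        y∈ = ⁻∈ (⟨⟩-sub a) (⟨⟩⁺ m)
        B = b · y
        B∉ : B ∉ ⟨ a ⟩
        B∉ r = b∉ (cancelʳ∈ (⟨⟩-sub a) y∈ r)
        w~b : Comm w b
        w~b = sym (comm-^ b~c m)
        w~⟨a⟩ : ∀ {x} → x ∈ ⟨ a ⟩ → Comm w x
        w~⟨a⟩ = ⟨a⟩-comm (^∈ (⟨⟩-sub a) c∈ m)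
        twist : y · b ≡ b · y · w
        twist = cancelˡ (a ^ m) (begin
          a ^ m · ((a ^ m) ⁻ · b)              ≡⟨ word (a ^ m ∷ b ∷ []) (v0 • (v0 ⁱ • v1)) v1 refl ⟩
          b                                    ≡⟨ word (w ∷ b ∷ []) v1 (v0 ⁱ • (v0 • v1)) refl ⟩
          w ⁻ · (w · b)                        ≡⟨ cong (w ⁻ ·_) w~b ⟩
          w ⁻ · (b · w)                        ≡⟨ word (w ∷ b ∷ a ^ m ∷ []) (v0 ⁱ • (v1 • v0)) (v0 ⁱ • (v1 • v2 • v1 ⁱ) • v1 • v2 ⁱ • v0) refl ⟩
          w ⁻ · conj b (a ^ m) · b · y · w     ≡⟨ cong (λ v → w ⁻ · v · b · y · w) (bracket m) ⟩
          w ⁻ · (w · a ^ m) · b · y · w        ≡⟨ word (w ∷ b ∷ a ^ m ∷ []) (v0 ⁱ • (v0 • v2) • v1 • v2 ⁱ • v0) (v2 • (v1 • v2 ⁱ • v0)) refl ⟩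
          a ^ m · (b · y · w)                  ∎)
          where open ≡-Reasoning
        B^p : B ^ p ≡ w ^ triangle p
        B^p = trans (twisted-power twist w~b (w~⟨a⟩ y∈) p) (trans (cong (_· w ^ triangle p) (trans (cong₂ _·_ (trans (sym a^t) (trans (cong (a ^_) t≡) (^-* a m p))) (⁻-^ (a ^ m) p)) (⁻-right _))) (ε-left _))
        B~c : Comm B c
        B~c = sym (comm-· (sym b~c) (⟨a⟩-comm c∈ y∈))
        B∉⟨c⟩ : ∀ {B} → B ∉ ⟨ a ⟩ → B ∉ ⟨ c ⟩
        B∉⟨c⟩ n r = n (⟨⟩-⊆ (⟨⟩-sub a) c∈ _ r)

        odd-case : ∀ h → p ≡ suc (h + h) → ⊥
        odd-case h p≡ = rank-two-absurd pr (trans B^p (trans (cong (w ^_) (trans (cong triangle p≡) (trans (triangle-odd h) (cong (_* h) (sym p≡)))))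
          (trans (^-* w p h) (trans (cong (_^ h) (trans (^-swap c m p) (trans (cong (_^ m) cp) (ε-^ m)))) (ε-^ h))))) cp B~c c≢ε (B∉⟨c⟩ B∉)

        module _ (p≡2 : p ≡ 2) where
          c² : c · c ≡ ε
          c² = trans (sym (^-2 c)) (trans (cong (c ^_) (sym p≡2)) cp)
          B² : B · B ≡ w
          B² = trans (sym (^-2 B)) (trans (cong (B ^_) (sym p≡2)) (trans B^p (trans (cong (λ n → w ^ triangle n) p≡2) (^-1 w))))
          conj-B : ∀ i → conj B (a ^ i) ≡ c ^ i · a ^ i
          conj-B i = trans (sym (conj-conj b y (a ^ i))) (trans (cong (conj b) (conj-comm (⟨a⟩-comm y∈ (⟨⟩⁺ i)))) (bracket i))
          -- `c` is an even power of `a`, so some `x = a ^ v` also squares to `c`. For even `v`, `B`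
          -- and `x` commute and `B · x` is an involution independent of `c`; for odd `v`, they
          -- satisfy the quaternion relations.
          square-case : B · B ≡ c → ⊥
          square-case BB = let (u , a^u) = ⟨⟩⁻ c∈ in
            root u a^u (HasOrder.divides′ order-p u (cancelʳ (a ^ u) (trans (sym (conj-B u)) (trans (cong (conj B) a^u) (trans (conj-comm B~c) (trans (sym a^u) (sym (ε-left _))))))))
           where
           root : ∀ u → a ^ u ≡ c → p ∣ u → ⊥
           root u a^u (divides v u≡) = finish (parity v)
            where
            x = a ^ v
            xx : x · x ≡ c
            xx = trans (sym (^-+ a v v)) (trans (cong (a ^_) (trans (l v) (trans (cong (v *_) (sym p≡2)) (sym u≡)))) a^u)
              where
              l : ∀ v → v + v ≡ v * 2
              l = solve-∀
            finish : ∃[ j ] (v ≡ j + j ⊎ v ≡ suc (j + j)) → ⊥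
            finish (j , inj₁ v≡) = rank-two-absurd prime[2] (^2 (begin
                B · x · (B · x)     ≡⟨ word (B ∷ x ∷ []) (v0 • v1 • (v0 • v1)) (v0 • (v1 • v0) • v1) refl ⟩
                B · (x · B) · x     ≡⟨ cong (λ z → B · z · x) (sym B~x) ⟩
                B · (B · x) · x     ≡⟨ word (B ∷ x ∷ []) (v0 • (v0 • v1) • v1) (v0 • v0 • (v1 • v1)) refl ⟩
                B · B · (x · x)     ≡⟨ cong₂ _·_ BB xx ⟩
                c · c               ≡⟨ c² ⟩
                ε                   ∎)) (^2 c²) (sym (comm-· (sym B~c) (⟨a⟩-comm c∈ (⟨⟩⁺ v)))) c≢ε (B∉⟨c⟩ λ r → B∉ (cancelʳ∈ (⟨⟩-sub a) (⟨⟩⁺ v) r))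
              where
              open ≡-Reasoning
              B~x : Comm B x
              B~x = comm-conj (trans (conj-B v) (trans (cong (_· x) (trans (cong (c ^_) v≡) (even-power c² j))) (ε-left x)))
            finish (j , inj₂ v≡) = generated normalises (λ gen′ → no-quaternion (xx , BB , c² , c≢ε , conj-x , gen′)) λ sub x∈ B∈ _ g∉ → proper sub g∉ λ
                { (inj₁ cyc) → nc (Cyc.commutes cyc x∈ B∈)
                ; (inj₂ dih) → c≢ε (trans (sym BB) (proj₁ (noncommuting⇒inverts sub dih x∈ B∈ nc (λ sq → c≢ε (trans (sym xx) sq))))) }
              where
              conj-x : conj B x ≡ c · x
              conj-x = trans (conj-B v) (cong (_· x) (trans (cong (c ^_) v≡) (odd-power c² j)))
              normalises : Normalises B x
              normalises = subst (_∈ ⟨ x ⟩) (trans (cong (_· x) xx) (sym conj-x)) (·∈ (⟨⟩-sub x) (·∈ (⟨⟩-sub x) (gen∈⟨⟩ x) (gen∈⟨⟩ x)) (gen∈⟨⟩ x))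
              nc : ¬ Comm x B
              nc cm = c≢ε (cancelʳ x (trans (sym conj-x) (trans (conj-comm (sym cm)) (sym (ε-left x)))))
          even-case : ∃[ j ] (m ≡ j + j ⊎ m ≡ suc (j + j)) → ⊥
          even-case (j , inj₁ m≡) = rank-two-absurd prime[2] (^2 (trans B² (trans (cong (c ^_) m≡) (even-power c² j)))) (^2 c²) B~c c≢ε (B∉⟨c⟩ B∉)
          even-case (j , inj₂ m≡) = square-case (trans B² (trans (cong (c ^_) m≡) (odd-power c² j)))

      same-prime-absurd : ⊥
      same-prime-absurd with parity p
      ... | h , inj₂ p≡ = odd-case h p≡
      ... | h , inj₁ p≡ = even-case (sym (prime-∣-prime prime[2] pr (divides h (trans p≡ (l h))))) (parity m)
        where
        l : ∀ h → h + h ≡ h * 2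
        l = solve-∀

-- Commutators and index in a group generated by two elements

module Commutators (G : FinGroup) where

  open Generation G public

  module _ {A : BSet order} (sub : IsSub A) (A-normal : ∀ g {x} → x ∈ A → conj g x ∈ A) where

    private
      Mod : E → E → Set
      Mod x y = x · y · (y · x) ⁻ ∈ A

      mod-sym : ∀ {x y} → Mod x y → Mod y x
      mod-sym {x} {y} p = subst (_∈ A) (word (x ∷ y ∷ []) ((v0 • v1 • (v1 • v0) ⁱ) ⁱ) (v1 • v0 • (v0 • v1) ⁱ) refl) (⁻∈ sub p)

      mod-· : ∀ {x y w} → Mod x y → Mod x w → Mod x (y · w)
      mod-· {x} {y} {w} p r = subst (_∈ A) (word (x ∷ y ∷ w ∷ []) (v0 • v1 • (v1 • v0) ⁱ • (v1 • (v0 • v2 • (v2 • v0) ⁱ) • v1 ⁱ)) (v0 • (v1 • v2) • (v1 • v2 • v0) ⁱ) refl)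
        (·∈ sub p (A-normal y r))

      mod-^ : ∀ {x y} → Mod x y → ∀ k → Mod x (y ^ k)
      mod-^ {x} p zero    = subst (_∈ A) (word (x ∷ []) 𝟙 (v0 • 𝟙 • (𝟙 • v0) ⁱ) refl) (ε∈ sub)
      mod-^ {x} p (suc k) = mod-· p (mod-^ p k)

      mod-refl : ∀ x → Mod x x
      mod-refl x = subst (_∈ A) (sym (⁻-right (x · x))) (ε∈ sub)

    -- Modulo the normal subgroup `A` the generators commute, so all products of their powers do.
    commutators-in : ∀ {a b} → b · a · (a · b) ⁻ ∈ A → ∀ {x y} → Product a b x → Product a b y → x · y · (y · x) ⁻ ∈ A
    commutators-in {a} {b} ba (i , j , refl) (k , l , refl) = mod-· (mod-sym (mod-· (mod-sym (powers (mod-refl a) i k)) (mod-sym (powers ba j k))))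
        (mod-sym (mod-· (mod-sym (powers (mod-sym ba) i l)) (mod-sym (powers (mod-refl b) j l))))
      where
      powers : ∀ {x y} → Mod x y → ∀ i k → Mod (x ^ i) (y ^ k)
      powers p i k = mod-sym (mod-^ (mod-sym (mod-^ p k)) i)

  cyclic-index : ∀ {M} → IsSub M → ∀ b e → (∀ i → 0 < i → i < e → b ^ i ∉ M) → (∀ g → ∃[ j ] (j < e × (b ^ j) ⁻ · g ∈ M)) → order ≡ e * # M
  cyclic-index {M} sub b e apart cover = ≤-antisym
      (≤-trans (cosets-cover powers λ g → let (j , j<e , p) = cover g in Anyₚ.applyUpTo⁺ (b ^_) p j<e) (≤-reflexive (cong (_* # M) length-powers)))
      (≤-trans (≤-reflexive (cong (_* # M) (sym length-powers))) (≤-trans (cosets-≤ sub full powers (AllPairsₚ.applyUpTo⁺₁ (b ^_) e apart′) (All.tabulate (λ _ _ _ → ∈-full))) (≤-reflexive #-full)))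
    where
    powers = applyUpTo (b ^_) e
    length-powers : length powers ≡ e
    length-powers = length-applyUpTo (b ^_) e
    apart′ : ∀ {i j} → i < j → j < e → (b ^ i) ⁻ · b ^ j ∉ M
    apart′ {i} i<j j<e p with m≤n⇒∃[o]m+o≡n i<j
    ... | d , refl = apart (suc d) (s≤s z≤n) (≤-<-trans (m≤n+m (suc d) i) (subst (_< e) (sym (+-suc i d)) j<e))
          (subst (_∈ M) (trans (cong ((b ^ i) ⁻ ·_) (trans (cong (b ^_) (sym (+-suc i d))) (^-+ b i (suc d)))) (word (b ^ i ∷ b ^ suc d ∷ []) (v0 ⁱ • (v0 • v1)) v1 refl)) p)

-- The commutator of a and b has prime order different from p

module AffineExtension (G : FinGroup)
  (proper : ∀ {H} → Subgroups.IsSub G H → ∀ {g} → g ∉ H → DN (Shapes.Cyc G H ⊎ Shapes.ODih G H))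
  (not-dihedral : ∀ k → ¬ IsoDihedral G (suc (k + k)))
  (normal-cyclic′ : ClassCounting.NormalCyclic G proper)
  {S : List (Elt G)} (minimal : MinimalProductOne G S) (long : 3 * FinGroup.order G < 4 * length S) where

  open PrimeIndexCases G proper not-dihedral normal-cyclic′ public
  open Commutators G using (commutators-in; cyclic-index) public

  -- Four powers of `ζ` cannot be distinct among three central elements, so one of the first three
  -- is trivial. Exponent 6, a common multiple of 1, 2 and 3, is enough because `not-3-3` compares
  -- it with 9.
  sixth-power : ∀ {ζ} → ζ ∈ centre → # centre ≡ 3 → ζ ^ 6 ≡ ε
  sixth-power {ζ} ζ∈Z z≡3 with ζ ^ 1 ≟ ε | ζ ^ 2 ≟ ε | ζ ^ 3 ≟ ε
  ... | yes z₁ | _ | _ = trans (^-* ζ 1 6) (trans (cong (_^ 6) z₁) (ε-^ 6))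
  ... | no _ | yes z₂ | _ = trans (^-* ζ 2 3) (trans (cong (_^ 3) z₂) (ε-^ 3))
  ... | no _ | no _ | yes z₃ = trans (^-* ζ 3 2) (trans (cong (_^ 2) z₃) (ε-^ 2))
  ... | no n₁ | no n₂ | no n₃ = ⊥-elim (<⇒≱ (distinct-≤ (ζ ^ 0 ∷ ζ ^ 1 ∷ ζ ^ 2 ∷ ζ ^ 3 ∷ [])
        (((λ eq → n₁ (sym eq)) ∷ (λ eq → n₂ (sym eq)) ∷ (λ eq → n₃ (sym eq)) ∷ [])
        ∷ ((λ eq → n₁ (^-diff ζ 1 1 (sym eq))) ∷ (λ eq → n₂ (^-diff ζ 1 2 (sym eq))) ∷ [])
        ∷ ((λ eq → n₁ (^-diff ζ 2 1 (sym eq))) ∷ []) ∷ [] ∷ [])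
        (^∈ centre-sub ζ∈Z 0 ∷ ^∈ centre-sub ζ∈Z 1 ∷ ^∈ centre-sub ζ∈Z 2 ∷ ^∈ centre-sub ζ∈Z 3 ∷ [])) (≤-reflexive z≡3))

  module _ {b : E} (b∉ : b ∉ ⟨ a ⟩) {p : ℕ} (pr : Prime p) (bp∈ : b ^ p ∈ ⟨ a ⟩) (gen : ∀ g → Product a b g) where

    open Prime-index b∉ pr bp∈ gen

    module _ (prk : Prime k) (k≢p : k ≢ p) where

      private
        ck : c ^ k ≡ ε
        ck = HasOrder.kills order-c

        -- If `b` fixed `c`, conjugation by `b ^ p` would multiply `a` by `c ^ p`. But `b ^ p` is a
        -- power of `a`, so `c ^ p` would be trivial and the prime `k` would divide `p`.
        nc : ¬ Comm b c
        nc cm = k≢p (prime-∣-prime prk pr (HasOrder.divides′ order-c p (cancelʳ a (trans (sym (conj-power p)) (trans (conj-comm (⟨a⟩-comm bp∈ (gen∈⟨⟩ a))) (sym (ε-left a)))))))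
          where
          conj-power : ∀ i → conj (b ^ i) a ≡ c ^ i · a
          conj-power zero = word (a ∷ []) (𝟙 • v0 • 𝟙 ⁱ) (𝟙 • v0) refl
          conj-power (suc i) = trans (sym (conj-conj b (b ^ i) a)) (trans (cong (conj b) (conj-power i))
            (trans (word (b ∷ c ^ i ∷ a ∷ []) (v0 • (v1 • v2) • v0 ⁱ) (v0 • v1 • v0 ⁱ • (v0 • v2 • v0 ⁱ)) refl)
              (trans (cong₂ _·_ (conj-comm (comm-^ cm i)) conj-a) (trans (sym (·-assoc _ c a)) (cong (_· a) (sym (comm-^ refl i)))))))

        C-b^j : ∀ {j} → Comm (b ^ j) c → p ∣ j
        C-b^j {j} cm = decidable-stable (p ∣? j) λ p∤j → nc (sym (C⁻ (prime-root {k = j} (C-sub c) pr (C⁺ (sym bp~c)) p∤j (C⁺ (sym cm)))))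

        ⟨c⟩⊆⟨a⟩ : ∀ {x} → x ∈ ⟨ c ⟩ → x ∈ ⟨ a ⟩
        ⟨c⟩⊆⟨a⟩ = ⟨⟩-⊆ (⟨⟩-sub a) c∈ _

        b^j-in : ∀ {j} → p ∣ j → b ^ j ∈ ⟨ a ⟩
        b^j-in (divides m refl) = subst (_∈ ⟨ a ⟩) (trans (sym (^-* b p m)) (cong (b ^_) (*-comm p m))) (^∈ (⟨⟩-sub a) bp∈ m)

        cent-c : ∀ {m} → Comm m c → m ∈ ⟨ a ⟩
        cent-c {m} cm with gen m
        ... | i , j , refl = ·∈ (⟨⟩-sub a) (⟨⟩⁺ i) (b^j-in (C-b^j {j} (sym (subst (Comm c) (word (a ^ i ∷ b ^ j ∷ []) (v0 ⁱ • (v0 • v1)) v1 refl)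
              (comm-· (comm-⁻ (⟨a⟩-comm c∈ (⟨⟩⁺ i))) (sym cm))))))

        M-in : ∀ {m} → m ∈ centraliser ⟨ c ⟩ → m ∈ ⟨ a ⟩
        M-in m∈ = cent-c (centraliser⁻ m∈ c (gen∈⟨⟩ c))

        in-M : ∀ {m} → m ∈ ⟨ a ⟩ → m ∈ centraliser ⟨ c ⟩
        in-M m∈ = centraliser⁺ λ y y∈ → ⟨a⟩-comm m∈ (⟨c⟩⊆⟨a⟩ y∈)

        ⟨c⟩-normal : ∀ g {x} → x ∈ ⟨ c ⟩ → conj g x ∈ ⟨ c ⟩
        ⟨c⟩-normal g {x} x∈ with gen g | ⟨⟩⁻ x∈
        ... | i , j , refl | l , refl = subst (_∈ ⟨ c ⟩) (trans (sym (conj-comm (⟨a⟩-comm (⟨⟩⁺ i) (⟨c⟩⊆⟨a⟩ (normalises-^ conj-c j l))))) (conj-conj (a ^ i) (b ^ j) (c ^ l))) (normalises-^ conj-c j l)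

        -- The b-fixed part of a: solve [b, c ^ j] = c.
        d = conj b c · c ⁻
        d∈ : d ∈ ⟨ c ⟩
        d∈ = ·∈ (⟨⟩-sub c) conj-c (⁻∈ (⟨⟩-sub c) (gen∈⟨⟩ c))
        d≢ε : d ≢ ε
        d≢ε eq = nc (comm-conj (trans (word (conj b c ∷ c ∷ []) v0 (v0 • v1 ⁱ • v1) refl) (trans (cong (_· c) eq) (ε-left c))))
        j₀ : ℕ
        j₀ = proj₁ (⟨⟩⁻ (prime-generates prk ck d∈ d≢ε))
        d^j₀ : d ^ j₀ ≡ c
        d^j₀ = proj₂ (⟨⟩⁻ (prime-generates prk ck d∈ d≢ε))
        s = c ^ j₀
        ζ = s ⁻ · a
        conj-s : conj b s ≡ c · s
        conj-s = trans (conj-^ b c j₀) (trans (cong (_^ j₀) (word (conj b c ∷ c ∷ []) v0 (v0 • v1 ⁱ • v1) refl)) (trans (^-· (⟨a⟩-comm (⟨c⟩⊆⟨a⟩ d∈) c∈) j₀) (cong (_· s) d^j₀)))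
        s∈ : s ∈ ⟨ a ⟩
        s∈ = ^∈ (⟨⟩-sub a) c∈ j₀
        ζ∈Z : ζ ∈ centre
        ζ∈Z = centre⁺ (comm-gen (⟨a⟩-comm (·∈ (⟨⟩-sub a) (⁻∈ (⟨⟩-sub a) s∈) (gen∈⟨⟩ a)) (gen∈⟨⟩ a)) (sym (comm-conj (begin
            conj b (s ⁻ · a)             ≡⟨ word (b ∷ s ∷ a ∷ []) (v0 • (v1 ⁱ • v2) • v0 ⁱ) ((v0 • v1 • v0 ⁱ) ⁱ • (v0 • v2 • v0 ⁱ)) refl ⟩
            (conj b s) ⁻ · conj b a      ≡⟨ cong₂ (λ u v → u ⁻ · v) conj-s conj-a ⟩
            (c · s) ⁻ · (c · a)          ≡⟨ word (c ∷ s ∷ a ∷ []) ((v0 • v1) ⁱ • (v0 • v2)) (v1 ⁱ • v2) refl ⟩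
            s ⁻ · a                      ∎))))
          where open ≡-Reasoning
        a≡ : a ≡ s · ζ
        a≡ = word (s ∷ a ∷ []) v1 (v0 • (v0 ⁱ • v1)) refl
        a^ : ∀ i → a ^ i ≡ s ^ i · ζ ^ i
        a^ i = trans (cong (_^ i) a≡) (^-· (sym (centre⁻ ζ∈Z s)) i)

        b^-cover : ∀ g → ∃[ j ] (j < p × (b ^ j) ⁻ · g ∈ centraliser ⟨ c ⟩)
        b^-cover g with gen g
        ... | i , j , refl = r , m%n<n j p {{p≢0}} , in-M (subst (_∈ ⟨ a ⟩) (sym rewritten) (·∈ (⟨⟩-sub a) (⟨a⟩-conj ((b ^ r) ⁻) (⟨⟩⁺ i)) (b^j-in (divides (_/_ j p {{p≢0}}) refl))))
          where
          p≢0 : NonZero p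
          p≢0 = >-nonZero (≤-trans (s≤s z≤n) (prime-≥2 pr))
          r = _%_ j p {{p≢0}}
          rewritten : (b ^ r) ⁻ · (a ^ i · b ^ j) ≡ conj ((b ^ r) ⁻) (a ^ i) · b ^ (_/_ j p {{p≢0}} * p)
          rewritten = trans (cong (λ w → (b ^ r) ⁻ · (a ^ i · w)) (trans (cong (b ^_) (m≡m%n+[m/n]*n j p {{p≢0}})) (^-+ b r _)))
            (word (b ^ r ∷ a ^ i ∷ b ^ (_/_ j p {{p≢0}} * p) ∷ []) (v0 ⁱ • (v1 • (v0 • v2))) (v0 ⁱ • v1 • v0 ⁱ ⁱ • v2) refl)

      affine-data : AffineData G
      affine-data = record
        { A = ⟨ c ⟩ ; A-sub = ⟨⟩-sub c
        ; A-gen = λ {x} x∈ x≢ε {y} y∈ → let (l , c≡) = ⟨⟩⁻ (prime-generates prk ck x∈ x≢ε) ; (m , y≡) = ⟨⟩⁻ y∈ in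
            l * m , trans (^-* x l m) (trans (cong (_^ m) c≡) y≡)
        ; commutator = λ x y → commutators-in (⟨⟩-sub c) ⟨c⟩-normal (subst (_∈ ⟨ c ⟩) (word (b ∷ a ∷ []) (v0 • v1 • v0 ⁱ • v1 ⁱ) (v0 • v1 • (v1 • v0) ⁱ) refl) (gen∈⟨⟩ c)) (gen x) (gen y)
        ; b = b ; b∉ = λ q → nc (centraliser⁻ q c (gen∈⟨⟩ c))
        ; decompose = λ m∈ → let (i , eq) = ⟨⟩⁻ (M-in m∈) in s ^ i , ζ ^ i , ^∈ (⟨⟩-sub c) (⟨⟩⁺ j₀) i , ^∈ centre-sub ζ∈Z i , trans (sym eq) (a^ i)
        ; e = p
        ; index-e = cyclic-index (centraliser-sub ⟨ c ⟩) b p (λ i 0<i i<p q → <⇒≱ i<p (∣⇒≤ {{>-nonZero 0<i}} (b^j∈ {i} (M-in q)))) b^-cover }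

      private
        module Aff = Affine G affine-data

        q≡k : Aff.q ≡ k
        q≡k = #⟨⟩ order-c

        x^p∈ : ∀ x → x ^ p ∈ ⟨ a ⟩
        x^p∈ x with gen x
        ... | i , j , refl = subst (_∈ ⟨ a ⟩) (word (x′ ^ p ∷ b ^ (j * p) ∷ []) (v0 • v1 ⁱ • v1) v0 refl) (·∈ (⟨⟩-sub a) (push p) (b^j-in (divides j refl)))
          where
          x′ = a ^ i · b ^ j
          push : ∀ n → x′ ^ n · (b ^ (j * n)) ⁻ ∈ ⟨ a ⟩
          push zero = subst (_∈ ⟨ a ⟩) (sym (trans (cong (λ n → ε · (b ^ n) ⁻) (*-zeroʳ j)) (word [] (𝟙 • 𝟙 ⁱ) 𝟙 refl))) (⟨⟩⁺ 0)
          push (suc n) = subst (_∈ ⟨ a ⟩) (trans (word (a ^ i ∷ b ^ j ∷ x′ ^ n ∷ b ^ (j * n) ∷ []) (v0 • (v1 • (v2 • v3 ⁱ) • v1 ⁱ)) (v0 • v1 • v2 • (v1 • v3) ⁱ) refl)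
              (cong (λ w → x′ · x′ ^ n · w ⁻) (trans (sym (^-+ b j (j * n))) (cong (b ^_) (sym (*-suc j n))))))
            (·∈ (⟨⟩-sub a) (⟨⟩⁺ i) (⟨a⟩-conj (b ^ j) (push n)))

        -- Both `x ^ p` and `x · x` lie in `⟨ a ⟩`, and `p` does not divide 2, so `x` would lie
        -- there too.
        no-involutions : 3 ≤ p → ∀ x → x ∉ Aff.M → x · x ∉ Aff.Z
        no-involutions p≥3 x x∉ xx = x∉ (in-M (prime-root {k = 2} (⟨⟩-sub a) pr (x^p∈ x) (λ dv → <⇒≱ p≥3 (∣⇒≤ dv)) (subst (_∈ ⟨ a ⟩) (sym (^-2 x)) (M-in (Aff.Z⊆M xx)))))

        -- `b · b` is central. If the centre is trivial, `b` is an involution, and then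
        -- `conj b a · a` is central too: `b` would invert `a`.
        index-two-centre : p ≡ 2 → 2 ≤ Aff.z
        index-two-centre p≡2 = ≰⇒> λ z≤1 → let b² = trivial-Z z≤1 (b·b-central p≡2) in
          dihedral-absurd b∉ b² (cancelʳ a (trans (trivial-Z z≤1 (d-central b²)) (sym (⁻-left a)))) gen
          where
          trivial-Z : Aff.z ≤ 1 → ∀ {x} → x ∈ centre → x ≡ ε
          trivial-Z z≤1 {x} x∈ = decidable-stable (x ≟ ε) λ ne → <⇒≱ (distinct-≤ (x ∷ ε ∷ []) ((ne ∷ []) ∷ [] ∷ []) (x∈ ∷ ε∈ centre-sub ∷ [])) z≤1
          b·b-central : p ≡ 2 → b · b ∈ centre
          b·b-central p≡2 = centre⁺ (comm-gen (⟨a⟩-comm (subst (_∈ ⟨ a ⟩) (trans (cong (b ^_) p≡2) (^-2 b)) bp∈) (gen∈⟨⟩ a)) (sym (comm-· refl refl)))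
          d-central : b · b ≡ ε → conj b a · a ∈ centre
          d-central b² = centre⁺ (comm-gen (⟨a⟩-comm (·∈ (⟨⟩-sub a) (normal b) (gen∈⟨⟩ a)) (gen∈⟨⟩ a)) (sym (comm-conj (begin
            conj b (conj b a · a)                     ≡⟨ word (b ∷ a ∷ []) (v0 • (v0 • v1 • v0 ⁱ • v1) • v0 ⁱ) (v0 • v0 • v1 • (v0 • v0) ⁱ • (v0 • v1 • v0 ⁱ)) refl ⟩
            b · b · a · (b · b) ⁻ · conj b a          ≡⟨ cong (λ w → w · a · w ⁻ · conj b a) b² ⟩
            ε · a · ε ⁻ · conj b a                    ≡⟨ word (a ∷ conj b a ∷ []) (𝟙 • v0 • 𝟙 ⁱ • v1) (v0 • v1) refl ⟩
            a · conj b a                              ≡⟨ ⟨a⟩-comm (gen∈⟨⟩ a) (normal b) ⟩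
            conj b a · a                              ∎))))
            where open ≡-Reasoning

        -- If z = q = 3 then a ^ 6 = ε, although M = ⟨ a ⟩ has nine elements.
        not-3-3 : Aff.z ≡ 3 → Aff.q ≢ 3
        not-3-3 z≡3 q≡3 = <⇒≱ {6} {9} (s≤s (s≤s (s≤s (s≤s (s≤s (s≤s (s≤s z≤n))))))) (≤-trans (≤-reflexive (sym (trans Aff.#M (cong₂ _*_ z≡3 q≡3))))
            (≤-trans (#-mono (λ m m∈ → M-in m∈)) (≤-trans (≤-reflexive (#⟨⟩ (proj₂ (has-order a)))) (∣⇒≤ (HasOrder.divides′ (proj₂ (has-order a)) 6 a⁶)))))
          where
          c³ : c ^ 3 ≡ ε
          c³ = trans (cong (c ^_) (sym (trans (sym q≡k) q≡3))) ck
          a⁶ : a ^ 6 ≡ ε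
          a⁶ = trans (a^ 6) (trans (cong₂ _·_ (trans (^-swap c j₀ 6) (trans (cong (_^ j₀) (trans (^-* c 3 2) (trans (cong (_^ 2) c³) (ε-^ 2)))) (ε-^ j₀))) (sixth-power ζ∈Z z≡3)) (ε-left ε))

      affine-absurd : ⊥
      affine-absurd = odd-order (parity k)
        where
        odd-order : ∃[ h ] (k ≡ h + h ⊎ k ≡ suc (h + h)) → ⊥
        odd-order (h , inj₁ k≡) = nc (involution-fixed (trans (sym (^-2 c)) (trans (cong (c ^_) (prime-∣-prime prime[2] prk (divides h (trans k≡ (l h))))) ck)) conj-c)
          where
          l : ∀ h → h + h ≡ h * 2
          l = solve-∀
        odd-order (h , inj₂ k≡) = <⇒≱ long (affine-bound affine-data h (trans q≡k k≡) kind minimal)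
          where
          kind = [ (λ p≥3 → inj₂ (p≥3 , inj₁ (no-involutions p≥3)))
                 , (λ p≡2 → inj₁ (p≡2 , index-two-centre p≡2 , not-3-3)) ]′ (small p (prime-≥2 pr))
            where
            small : ∀ p → 2 ≤ p → 3 ≤ p ⊎ p ≡ 2
            small (suc (suc zero)) _ = inj₂ refl
            small (suc (suc (suc p))) _ = inj₁ (s≤s (s≤s (s≤s z≤n)))
            small (suc zero) (s≤s ())

-- The nonabelian case

module NonabelianBound (G : FinGroup)
  (proper : ∀ {H} → Subgroups.IsSub G H → ∀ {g} → g ∉ H → DN (Shapes.Cyc G H ⊎ Shapes.ODih G H))
  (not-dihedral : ∀ k → ¬ IsoDihedral G (suc (k + k)))
  (normal-cyclic′ : ClassCounting.NormalCyclic G proper)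
  {S : List (Elt G)} (minimal : MinimalProductOne G S) (long : 3 * FinGroup.order G < 4 * length S)
  (no-quaternion : ∀ {x y c} → ¬ PrimeIndexCases.Quaternion G proper not-dihedral normal-cyclic′ x y c) where

  open AffineExtension G proper not-dihedral normal-cyclic′ minimal long

  -- The order of the commutator of `b` and `a` is composite, equal to `p`, or another prime; each
  -- case has been excluded.
  cyclic-quotient-absurd : ∀ {b p} → b ∉ ⟨ a ⟩ → Prime p → b ^ p ∈ ⟨ a ⟩ → ¬ (∀ g → Product a b g)
  cyclic-quotient-absurd {b} {p} b∉ pr bp∈ gen = case prime? k of λ
      { (yes prk) → case k ≟ℕ p of λ { (yes eq) → same-prime-absurd no-quaternion b∉ pr bp∈ gen eq ; (no ne) → affine-absurd b∉ pr bp∈ gen prk ne }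
      ; (no ¬prk) → let (q , prq , q∣k) = prime-divisor k 2≤k in composite-absurd prq q∣k (λ cq → ¬prk (subst Prime (sym (is-prime prq (HasOrder.divides′ order-c q cq))) prq)) }
    where
    open Prime-index b∉ pr bp∈ gen
    is-prime : ∀ {q} → Prime q → k ∣ q → k ≡ q
    is-prime prq k∣q = [ (λ k≡1 → ⊥-elim (<⇒≱ 2≤k (≤-reflexive k≡1))) , id ]′ (prime⇒irreducible prq k∣q)

  -- `a` and `b` lie in a proper subgroup by `cyclic-quotient-absurd`. They do not commute, so it is
  -- odd dihedral, and `a` is a rotation because its square is not trivial.
  inverts : ∀ {b p} → b ∉ ⟨ a ⟩ → Prime p → b ^ p ∈ ⟨ a ⟩ → DN (b · b ≡ ε × conj b a ≡ a ⁻ × ∃[ j ] a ^ suc (j + j) ≡ ε)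
  inverts {b} b∉ pr bp∈ k = generated (normal b) (cyclic-quotient-absurd b∉ pr bp∈) λ sub a∈ b∈ _ g∉ → proper sub g∉ λ
    { (inj₁ cyc) → b∉ (cent (Cyc.commutes cyc b∈ a∈))
    ; (inj₂ dih) → k (noncommuting⇒inverts sub dih a∈ b∈ (λ c → b∉ (cent (sym c))) a²≢ε) }

  private
    both-invert : ∀ {f g} → conj f a ≡ a ⁻ → conj g a ≡ a ⁻ → f · g ∈ ⟨ a ⟩
    both-invert {f} {g} ff gg = cent (comm-conj (trans (sym (conj-conj f g a)) (trans (cong (conj f) gg)
      (trans (word (f ∷ a ∷ []) (v0 • v1 ⁱ • v0 ⁱ) ((v0 • v1 • v0 ⁱ) ⁱ) refl) (trans (cong _⁻ ff) (word (a ∷ []) (v0 ⁱ ⁱ) v0 refl))))))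

  module _ {b : E} (b∉ : b ∉ ⟨ a ⟩) (b² : b · b ≡ ε) (b-inverts : conj b a ≡ a ⁻) {h : ℕ} (odd : a ^ suc (h + h) ≡ ε) where

    odd⇒≢ : ∀ {x} → x ∈ ⟨ a ⟩ → x · x ≡ ε → x ≡ ε
    odd⇒≢ {x} x∈ sq with ⟨⟩⁻ x∈
    ... | k , refl = odd-involution h (trans (^-swap a k (suc (h + h))) (trans (cong (_^ k) odd) (ε-^ k))) sq

    module _ {f : E} (f²∉ : f · f ∉ ⟨ a ⟩) (f⁴ : f · f · (f · f) ≡ ε) (f²-inverts : conj (f · f) a ≡ a ⁻) where

      private
        ν = proj₁ (has-order a)
        order-a = proj₂ (has-order a)
        2≤N : 2 ≤ ν
        2≤N = go ν (HasOrder.positive order-a) (HasOrder.kills order-a)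
          where
          go : ∀ ν → 0 < ν → a ^ ν ≡ ε → 2 ≤ ν
          go (suc zero) _ eq = ⊥-elim (Z-ε a∉ (trans (sym (^-1 a)) eq))
          go (suc (suc ν)) _ _ = s≤s (s≤s z≤n)
        q = proj₁ (prime-divisor ν 2≤N)
        prq : Prime q
        prq = proj₁ (proj₂ (prime-divisor ν 2≤N))
        q∣N : q ∣ ν
        q∣N = proj₂ (proj₂ (prime-divisor ν 2≤N))
        m = _∣_.quotient q∣N
        N≡ : ν ≡ m * q
        N≡ = _∣_.equality q∣N
        c = a ^ m
        c∈ : c ∈ ⟨ a ⟩
        c∈ = ⟨⟩⁺ m
        cq : c ^ q ≡ ε
        cq = trans (sym (^-* a m q)) (trans (cong (a ^_) (sym N≡)) (HasOrder.kills order-a))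
        c≢ε : c ≢ ε
        c≢ε eq = <⇒≱ (subst (m <_) (sym N≡) (m<m*n m q {{>-nonZero 0<m}} (prime-≥2 prq))) (∣⇒≤ {{>-nonZero 0<m}} (HasOrder.divides′ order-a m eq))
          where
          pos : ∀ m → 0 < m * q → 0 < m
          pos (suc _) _ = s≤s z≤n
          0<m : 0 < m
          0<m = pos m (subst (0 <_) N≡ (HasOrder.positive order-a))
        invert-⟨a⟩ : ∀ {x} → x ∈ ⟨ a ⟩ → conj (f · f) x ≡ x ⁻
        invert-⟨a⟩ x∈ with ⟨⟩⁻ x∈
        ... | i , refl = trans (conj-^ (f · f) a i) (trans (cong (_^ i) f²-inverts) (⁻-^ a i))
        f²-fixed : ∀ {x} → x ∈ ⟨ a ⟩ → Comm (f · f) x → x ≡ ε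
        f²-fixed {x} x∈ cm = odd⇒≢ x∈ (trans (cong (x ·_) (trans (sym (conj-comm cm)) (invert-⟨a⟩ x∈))) (⁻-right x))
        nc : ¬ Comm c f
        nc cm = c≢ε (f²-fixed c∈ (sym (comm-· cm cm)))
        f^4 : f ^ 4 ≡ ε
        f^4 = trans (word (f ∷ []) (v0 • (v0 • (v0 • (v0 • 𝟙)))) (v0 • v0 • (v0 • v0)) refl) f⁴

        module Whole (gen : ∀ g → Product c f g) where

          reduce-4 : ∀ j → ∃[ r ] (r < 4 × f ^ j ≡ f ^ r)
          reduce-4 j = j % 4 , m%n<n j 4 , trans (cong (f ^_) (m≡m%n+[m/n]*n j 4)) (trans (^-+ f (j % 4) (j / 4 * 4)) (trans (cong (f ^ (j % 4) ·_)
            (trans (cong (f ^_) (*-comm (j / 4) 4)) (trans (^-* f 4 (j / 4)) (trans (cong (_^ (j / 4)) f^4) (ε-^ (j / 4)))))) (ε-right _)))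

          no-f : ∀ r → 0 < r → r < 4 → ¬ Comm (f ^ r) c
          no-f 1 _ _ cm = nc (sym (subst (λ w → Comm w c) (^-1 f) cm))
          no-f 2 _ _ cm = c≢ε (f²-fixed c∈ (subst (λ w → Comm w c) (^-2 f) cm))
          no-f 3 _ _ cm = nc (subst (Comm c) (trans (sym (⁻-unique (trans (sym (^-+ f 3 1)) f^4))) (^-1 f)) (comm-⁻ (sym cm)))
            where
            ⁻-unique : ∀ {x y} → x · y ≡ ε → y ≡ x ⁻
            ⁻-unique {x} eq = cancelˡ x (trans eq (sym (⁻-right x)))
          no-f (suc (suc (suc (suc r)))) _ (s≤s (s≤s (s≤s (s≤s ()))))

          M-in : ∀ {g} → Comm g c → g ∈ ⟨ c ⟩
          M-in {g} cm with gen g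
          ... | i , j , refl with reduce-4 j
          ...   | zero , _ , eq = subst (_∈ ⟨ c ⟩) (sym (trans (cong (c ^ i ·_) eq) (ε-right _))) (⟨⟩⁺ i)
          ...   | suc r , r<4 , eq = ⊥-elim (no-f (suc r) (s≤s z≤n) r<4 (subst (λ w → Comm w c) eq (sym (subst (Comm c) (word (c ^ i ∷ f ^ j ∷ []) (v0 ⁱ • (v0 • v1)) v1 refl)
                  (comm-· (comm-⁻ (comm-^ refl i)) (sym cm))))))

          ⟨c⟩-comm : ∀ {x y} → x ∈ ⟨ c ⟩ → y ∈ ⟨ c ⟩ → Comm x y
          ⟨c⟩-comm x∈ y∈ = ⟨a⟩-comm (⟨⟩-⊆ (⟨⟩-sub a) c∈ _ x∈) (⟨⟩-⊆ (⟨⟩-sub a) c∈ _ y∈)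

          ⟨c⟩-normal : ∀ g {x} → x ∈ ⟨ c ⟩ → conj g x ∈ ⟨ c ⟩
          ⟨c⟩-normal g x∈ with ⟨⟩⁻ x∈
          ... | l , refl = subst (_∈ ⟨ c ⟩) (sym (conj-^ g c l)) (^∈ (⟨⟩-sub c) (normalises-power g m) l)

          trivial-Z : ∀ {x} → x ∈ centre → x ≡ ε
          trivial-Z {x} x∈ = f²-fixed (⟨⟩-⊆ (⟨⟩-sub a) c∈ x (M-in (centre⁻ x∈ c))) (sym (centre⁻ x∈ (f · f)))

          affine-data₄ : AffineData G
          affine-data₄ = record
            { A = ⟨ c ⟩ ; A-sub = ⟨⟩-sub c
            ; A-gen = λ {x} x∈ x≢ε {y} y∈ → let (l , c≡) = ⟨⟩⁻ (prime-generates prq cq x∈ x≢ε) ; (m , y≡) = ⟨⟩⁻ y∈ in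
                l * m , trans (^-* x l m) (trans (cong (_^ m) c≡) y≡)
            ; commutator = λ x y → commutators-in (⟨⟩-sub c) ⟨c⟩-normal (subst (_∈ ⟨ c ⟩) (word (f ∷ c ∷ []) (v0 • v1 • v0 ⁱ • v1 ⁱ) (v0 • v1 • (v1 • v0) ⁱ) refl)
                (·∈ (⟨⟩-sub c) (normalises-power f m) (⁻∈ (⟨⟩-sub c) (gen∈⟨⟩ c)))) (gen x) (gen y)
            ; b = f ; b∉ = λ r → nc (sym (centraliser⁻ r c (gen∈⟨⟩ c)))
            ; decompose = λ {m} m∈ → m , ε , M-in (centraliser⁻ m∈ c (gen∈⟨⟩ c)) , ε∈ centre-sub , sym (ε-right m)
            ; e = 4
            ; index-e = cyclic-index (centraliser-sub ⟨ c ⟩) f 4 (λ i 0<i i<4 r → no-f i 0<i i<4 (centraliser⁻ r c (gen∈⟨⟩ c))) cover }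
            where
            cover : ∀ g → ∃[ j ] (j < 4 × (f ^ j) ⁻ · g ∈ centraliser ⟨ c ⟩)
            cover g with gen g
            ... | i , j , refl = let (r , r<4 , eq) = reduce-4 j in r , r<4 , centraliser⁺ λ y y∈ →
                  ⟨c⟩-comm (subst (_∈ ⟨ c ⟩) (trans (word (f ^ r ∷ c ^ i ∷ []) (v0 ⁱ • v1 • v0 ⁱ ⁱ) (v0 ⁱ • (v1 • v0)) refl) (cong (λ w → (f ^ r) ⁻ · (c ^ i · w)) (sym eq))) (⟨c⟩-normal ((f ^ r) ⁻) (⟨⟩⁺ i))) y∈

          unique-involutions : ∀ u v → u ∉ centre → v ∉ centre → u · u ∈ centre → v · v ∈ centre → Comm u v → u ≡ v
          unique-involutions u v u∉ v∉ uu vv cm = decidable-stable (u ≟ v) λ u≢v → rank-two-absurd prime[2] (^2 (trivial-Z uu)) (^2 (trivial-Z vv)) cm (Z-ε v∉) (not-power u≢v)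
            where
            not-power : u ≢ v → u ∉ ⟨ v ⟩
            not-power u≢v r with ⟨⟩⁻ r
            ... | k , eq with parity k
            ...   | j , inj₁ refl = Z-ε u∉ (trans (sym eq) (even-power (trivial-Z vv) j))
            ...   | j , inj₂ refl = u≢v (trans (sym eq) (odd-power (trivial-Z vv) j))

          absurd : ∃[ h ] (q ≡ h + h ⊎ q ≡ suc (h + h)) → ⊥
          absurd (h , inj₁ q≡) = c≢ε (odd⇒≢ c∈ (trans (sym (^-2 c)) (trans (cong (c ^_) (prime-∣-prime prime[2] prq (divides h (trans q≡ (l h))))) cq)))
            where
            l : ∀ h → h + h ≡ h * 2
            l = solve-∀
          absurd (h , inj₂ q≡) = <⇒≱ long (affine-bound affine-data₄ h (trans (#⟨⟩ (prime-order prq cq c≢ε)) q≡)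
            (inj₂ (s≤s (s≤s (s≤s z≤n)) , inj₂ (≤-refl , unique-involutions))) minimal)

      -- `c` has prime order and `f` order four, and they do not commute. A proper subgroup
      -- containing both would be odd dihedral with `f` as a reflection, impossible as `f · f` is
      -- nontrivial. So they generate the group, which is affine with e = 4 and trivial centre.
      order-four-absurd : ⊥
      order-four-absurd = generated (normalises-power f m) (λ gen → Whole.absurd gen (parity q)) λ sub c∈ f∈ _ g∉ → proper sub g∉ λ
        { (inj₁ cyc) → nc (Cyc.commutes cyc c∈ f∈)
        ; (inj₂ dih) → f²∉ (subst (_∈ ⟨ a ⟩) (sym (proj₁ (noncommuting⇒inverts sub dih c∈ f∈ nc (λ sq → c≢ε (odd⇒≢ (⟨⟩⁺ m) sq))))) (⟨⟩⁺ 0)) }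

    private
      -- The union of `⟨ a ⟩` and its coset by `b`; the second condition can be written `b · g`
      -- because `b` is an involution.
      L? : ∀ g → Dec (g ∈ ⟨ a ⟩ ⊎ b · g ∈ ⟨ a ⟩)
      L? g = (g ∈? ⟨ a ⟩) ⊎-dec ((b · g) ∈? ⟨ a ⟩)

      b⁻ : b ⁻ ≡ b
      b⁻ = sym (cancelˡ b (trans b² (sym (⁻-right b))))

      L-sub : IsSub (set L?)
      L-sub = record { ε∈ = ∈⁺ L? (inj₁ (⟨⟩⁺ 0)) ; ·∈ = λ x∈ y∈ → ∈⁺ L? (mult (∈⁻ L? x∈) (∈⁻ L? y∈)) }
        where
        conj-in : ∀ {x} → x ∈ ⟨ a ⟩ → b · x · b ∈ ⟨ a ⟩
        conj-in {x} x∈ = subst (λ w → b · x · w ∈ ⟨ a ⟩) b⁻ (⟨a⟩-conj b x∈)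
        mult : ∀ {x y} → x ∈ ⟨ a ⟩ ⊎ b · x ∈ ⟨ a ⟩ → y ∈ ⟨ a ⟩ ⊎ b · y ∈ ⟨ a ⟩ → x · y ∈ ⟨ a ⟩ ⊎ b · (x · y) ∈ ⟨ a ⟩
        mult {x} {y} (inj₁ p) (inj₁ r) = inj₁ (·∈ (⟨⟩-sub a) p r)
        mult {x} {y} (inj₂ p) (inj₁ r) = inj₂ (subst (_∈ ⟨ a ⟩) (·-assoc b x y) (·∈ (⟨⟩-sub a) p r))
        mult {x} {y} (inj₁ p) (inj₂ r) = inj₂ (subst (_∈ ⟨ a ⟩) (trans (word (b ∷ x ∷ y ∷ []) (v0 • v1 • v0 • (v0 • v2)) (v0 • v1 • (v0 • v0) • v2) refl)
          (trans (cong (λ w → b · x · w · y) b²) (word (b ∷ x ∷ y ∷ []) (v0 • v1 • 𝟙 • v2) (v0 • (v1 • v2)) refl))) (·∈ (⟨⟩-sub a) (conj-in p) r))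
        mult {x} {y} (inj₂ p) (inj₂ r) = inj₁ (subst (_∈ ⟨ a ⟩) (trans (word (b ∷ x ∷ y ∷ []) (v0 • (v0 • v1) • v0 • (v0 • v2)) (v0 • v0 • v1 • (v0 • v0) • v2) refl)
          (trans (cong (λ w → w · x · w · y) b²) (word (x ∷ y ∷ []) (𝟙 • v0 • 𝟙 • v1) (v0 • v1) refl))) (·∈ (⟨⟩-sub a) (conj-in p) r))

      L-proper : ∃[ g ] g ∉ set L?
      L-proper with any? (λ g → ¬? (g ∈? set L?))
      ... | yes p = p
      ... | no none = ⊥-elim (dihedral-absurd b∉ b² b-inverts λ g → product g (∈⁻ L? (decidable-stable (g ∈? set L?) λ n → none (g , n))))
        where
        product : ∀ g → g ∈ ⟨ a ⟩ ⊎ b · g ∈ ⟨ a ⟩ → Product a b g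
        product g (inj₁ r) = let (i , eq) = ⟨⟩⁻ r in i , 0 , trans (ε-right _) eq
        product g (inj₂ r) = let (i , eq) = ⟨⟩⁻ (subst (λ w → b · (b · g) · w ∈ ⟨ a ⟩) b⁻ (⟨a⟩-conj b r)) in i , 1 ,
          trans (cong₂ _·_ eq (^-1 b)) (trans (word (b ∷ g ∷ []) (v0 • (v0 • v1) • v0 • v0) (v0 • v0 • v1 • (v0 • v0)) refl) (trans (cong (λ w → w · g · w) b²) (word (g ∷ []) (𝟙 • v0 • 𝟙) v0 refl)))

    -- The elements inverting `a` form a single coset of `⟨ a ⟩`. An `f` outside `L` with a prime
    -- power in `L` therefore has that power in the coset of `b`; then `f · f` itself must be an
    -- involution inverting `a`, and `order-four-absurd` applies.
    inverting-absurd : ⊥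
    inverting-absurd = let (g , g∉) = L-proper ; (k , ℓ , prℓ , f∉ , fℓ∈) = prime-power-into L-sub g∉ in go prℓ f∉ (∈⁻ L? fℓ∈)
      where
      go : ∀ {f ℓ} → Prime ℓ → f ∉ set L? → f ^ ℓ ∈ ⟨ a ⟩ ⊎ b · f ^ ℓ ∈ ⟨ a ⟩ → ⊥
      go {f} {ℓ} prℓ f∉L which = [ (λ r → not-prime prℓ r) , (λ r → in-bM r (fℓ∉ r)) ]′ which
        where
        f∉ : f ∉ ⟨ a ⟩
        f∉ r = f∉L (∈⁺ L? (inj₁ r))
        not-prime : ∀ {p} → Prime p → f ^ p ∈ ⟨ a ⟩ → ⊥
        not-prime prp r = inverts f∉ prp r λ { (_ , inv , _) → f∉L (∈⁺ L? (inj₂ (both-invert b-inverts inv))) }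
        g′ = f ^ ℓ
        fℓ∉ : b · g′ ∈ ⟨ a ⟩ → g′ ∉ ⟨ a ⟩
        fℓ∉ r n = b∉ (cancelʳ∈ (⟨⟩-sub a) n r)
        in-bM : b · g′ ∈ ⟨ a ⟩ → g′ ∉ ⟨ a ⟩ → ⊥
        in-bM r n = inverts n prime[2] g′²∈ λ { (g′² , _ , _) →
            inverts f²∉ prℓ (subst (_∈ ⟨ a ⟩) (sym (trans (^-· refl ℓ) g′²)) (⟨⟩⁺ 0)) λ { (f⁴ , inv , _) → order-four-absurd f²∉ f⁴ inv } }
          where
          f²∉ : f · f ∉ ⟨ a ⟩
          f²∉ s = not-prime prime[2] (subst (_∈ ⟨ a ⟩) (sym (^-2 f)) s)
          g′²∈ : g′ ^ 2 ∈ ⟨ a ⟩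
          g′²∈ = subst (_∈ ⟨ a ⟩) (trans (word (b ∷ g′ ∷ []) (v0 • (v0 • v1) • v0 ⁱ • (v0 • v1)) (v0 • v0 • (v1 • v1)) refl) (trans (cong (_· (g′ · g′)) b²) (trans (ε-left _) (sym (^-2 g′)))))
            (·∈ (⟨⟩-sub a) (⟨a⟩-conj b r) r)

  nonabelian-absurd : ⊥
  nonabelian-absurd with any? (λ g → ¬? (g ∈? ⟨ a ⟩))
  ... | no none = a∉ (centre⁺ λ g → ⟨a⟩-comm (gen∈⟨⟩ a) (decidable-stable (g ∈? ⟨ a ⟩) λ n → none (g , n)))
  ... | yes (g , g∉) = let (k , p , pr , b∉ , bp∈) = prime-power-into (⟨⟩-sub a) g∉ in
        inverts b∉ pr bp∈ λ { (b² , inv , h , odd) → inverting-absurd b∉ b² inv {h} odd }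

-- The quaternion group of order eight

module QuaternionBound (G : FinGroup) {S : List (Elt G)} (minimal : MinimalProductOne G S) (long : 3 * FinGroup.order G < 4 * length S) where

  open Commutators G

  module _ {x y c : E} (xx : x · x ≡ c) (yy : y · y ≡ c) (cc : c · c ≡ ε) (c≢ε : c ≢ ε) (conj-x : conj y x ≡ c · x) (gen : ∀ g → Product x y g) where

    private
      H? : ∀ g → Dec (g ≡ ε ⊎ g ≡ c)
      H? g = (g ≟ ε) ⊎-dec (g ≟ c)

      H : BSet order
      H = set H?

      c-central : ∀ g → Comm c g
      c-central g with gen g
      ... | i , j , refl = comm-· (comm-^ (subst (λ w → Comm w x) xx (sym (comm-· refl refl))) i) (comm-^ (subst (λ w → Comm w y) yy (sym (comm-· refl refl))) j)

      H-central : ∀ {h} → h ∈ H → ∀ g → Comm h g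
      H-central h∈ g = [ (λ { refl → sym comm-ε }) , (λ { refl → c-central g }) ]′ (∈⁻ H? h∈)

      c∈ : c ∈ H
      c∈ = ∈⁺ H? (inj₂ refl)

      H-sub : IsSub H
      H-sub = record { ε∈ = ∈⁺ H? (inj₁ refl) ; ·∈ = λ p r → ∈⁺ H? (mult (∈⁻ H? p) (∈⁻ H? r)) }
        where
        mult : ∀ {g h} → g ≡ ε ⊎ g ≡ c → h ≡ ε ⊎ h ≡ c → g · h ≡ ε ⊎ g · h ≡ c
        mult (inj₁ refl) (inj₁ refl) = inj₁ (ε-left ε)
        mult (inj₁ refl) (inj₂ refl) = inj₂ (ε-left c)
        mult (inj₂ refl) (inj₁ refl) = inj₂ (ε-right c)
        mult (inj₂ refl) (inj₂ refl) = inj₁ cc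

      H-normal : ∀ g {h} → h ∈ H → conj g h ∈ H
      H-normal g h∈ = subst (_∈ H) (sym (conj-comm (sym (H-central h∈ g)))) h∈

      commutator : ∀ u v → u · v · (v · u) ⁻ ∈ H
      commutator u v = commutators-in H-sub H-normal (subst (_∈ H) (sym (trans (word (y ∷ x ∷ []) (v0 • v1 • (v1 • v0) ⁱ) (v0 • v1 • v0 ⁱ • v1 ⁱ) refl)
        (trans (cong (_· x ⁻) conj-x) (word (c ∷ x ∷ []) (v0 • v1 • v1 ⁱ) v0 refl)))) c∈) (gen u) (gen v)

      open ModuloCommutators H-sub commutator using (∏-↭-mod)

      square : ∀ g → g · g ∈ H
      square g with gen g
      ... | i , j , refl = subst (_∈ H) (begin
          k · (u · u · (v · v))           ≡⟨ H-central k∈ _ ⟩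
          u · u · (v · v) · k             ≡⟨ word (u ∷ v ∷ k ∷ []) (v0 • v0 • (v1 • v1) • v2) (v0 • (v0 • (v1 • v1) • v2)) refl ⟩
          u · (u · (v · v) · k)           ≡⟨ cong (u ·_) (sym (H-central k∈ (u · (v · v)))) ⟩
          u · (k · (u · (v · v)))         ≡⟨ word (u ∷ v ∷ []) (v0 • (v1 • v0 • (v0 • v1) ⁱ • (v0 • (v1 • v1)))) (v0 • v1 • (v0 • v1)) refl ⟩
          u · v · (u · v)                 ∎) (·∈ H-sub k∈ (·∈ H-sub (powers xx i) (powers yy j)))
        where
        open ≡-Reasoning
        u = x ^ i
        v = y ^ j
        k = v · u · (u · v) ⁻
        k∈ : k ∈ H
        k∈ = commutator v u
        powers : ∀ {w} → w · w ≡ c → ∀ i → w ^ i · w ^ i ∈ H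
        powers {w} ww i = subst (_∈ H) (trans (cong (_^ i) (sym ww)) (^-· refl i)) (^∈ H-sub c∈ i)

      reduce-power : ∀ {w} → w · w ≡ c → ∀ i → ∃[ r ] ∃[ h ] ((r ≡ 0 ⊎ r ≡ 1) × h ∈ H × w ^ i ≡ w ^ r · h)
      reduce-power {w} ww i with parity i
      ... | l , inj₁ refl = 0 , c ^ l , inj₁ refl , ^∈ H-sub c∈ l , trans (^-+ w l l) (trans (sym (^-· refl l)) (trans (cong (_^ l) ww) (sym (ε-left _))))
      ... | l , inj₂ refl = 1 , c ^ l , inj₂ refl , ^∈ H-sub c∈ l , trans (cong (w ·_) (trans (^-+ w l l) (trans (sym (^-· refl l)) (cong (_^ l) ww)))) (cong (_· c ^ l) (sym (^-1 w)))

      order-≤ : order ≤ 4 * # H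
      order-≤ = cosets-cover (x ^ 0 · y ^ 0 ∷ x ^ 1 · y ^ 0 ∷ x ^ 0 · y ^ 1 ∷ x ^ 1 · y ^ 1 ∷ []) λ g → cover g (gen g)
        where
        member : ∀ {g h u v} → h ∈ H → g ≡ u · v · h → (u · v) ⁻ · g ∈ H
        member {u = u} {v} h∈ refl = subst (_∈ H) (word (u · v ∷ _ ∷ []) v1 (v0 ⁱ • (v0 • v1)) refl) h∈
        cover : ∀ g → Product x y g → Any (λ w → w ⁻ · g ∈ H) (x ^ 0 · y ^ 0 ∷ x ^ 1 · y ^ 0 ∷ x ^ 0 · y ^ 1 ∷ x ^ 1 · y ^ 1 ∷ [])
        cover g (i , j , refl) = let (r , h , r≡ , h∈ , eq) = reduce-power xx i ; (s , k , s≡ , k∈ , eq′) = reduce-power yy j in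
            choose r s h k r≡ s≡ (·∈ H-sub h∈ k∈) (trans (cong₂ _·_ eq eq′) (trans (word (x ^ r ∷ h ∷ y ^ s ∷ k ∷ []) (v0 • v1 • (v2 • v3)) (v0 • (v1 • v2) • v3) refl)
              (trans (cong (λ w → x ^ r · w · k) (H-central h∈ (y ^ s))) (word (x ^ r ∷ h ∷ y ^ s ∷ k ∷ []) (v0 • (v2 • v1) • v3) (v0 • v2 • (v1 • v3)) refl))))
          where
          choose : ∀ r s h k → r ≡ 0 ⊎ r ≡ 1 → s ≡ 0 ⊎ s ≡ 1 → h · k ∈ H → x ^ i · y ^ j ≡ x ^ r · y ^ s · (h · k) →
            Any (λ w → w ⁻ · (x ^ i · y ^ j) ∈ H) (x ^ 0 · y ^ 0 ∷ x ^ 1 · y ^ 0 ∷ x ^ 0 · y ^ 1 ∷ x ^ 1 · y ^ 1 ∷ [])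
          choose _ _ h k (inj₁ refl) (inj₁ refl) hk eq = here (member hk eq)
          choose _ _ h k (inj₂ refl) (inj₁ refl) hk eq = there (here (member hk eq))
          choose _ _ h k (inj₁ refl) (inj₂ refl) hk eq = there (there (here (member hk eq)))
          choose _ _ h k (inj₂ refl) (inj₂ refl) hk eq = there (there (there (here (member hk eq))))

      8≤order : 8 ≤ order
      8≤order = ≤-trans (*-monoʳ-≤ 2 4≤) (≤-trans (proper-≤ (⟨⟩-sub x) full-sub (λ _ _ → ∈-full) {y} ∈-full y∉) (≤-reflexive #-full))
        where
        y∉ : y ∉ ⟨ x ⟩
        y∉ p with ⟨⟩⁻ p
        ... | k , refl = c≢ε (cancelʳ x (trans (sym conj-x) (trans (conj-comm (sym (comm-^ refl k))) (sym (ε-left x)))))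
        x≢ε : x ≢ ε
        x≢ε refl = c≢ε (trans (sym xx) (ε-left ε))
        x≢c : x ≢ c
        x≢c refl = c≢ε (trans (sym xx) cc)
        c⟨x⟩ : c ∈ ⟨ x ⟩
        c⟨x⟩ = subst (_∈ ⟨ x ⟩) xx (·∈ (⟨⟩-sub x) (gen∈⟨⟩ x) (gen∈⟨⟩ x))
        4≤ : 4 ≤ # ⟨ x ⟩
        4≤ = distinct-≤ (ε ∷ x ∷ c ∷ c · x ∷ [])
          (((λ eq → x≢ε (sym eq)) ∷ (λ eq → c≢ε (sym eq)) ∷ (λ eq → x≢c (cancelˡ c (trans (sym eq) (sym cc)))) ∷ [])
           ∷ (x≢c ∷ (λ eq → c≢ε (cancelʳ x (trans (sym eq) (sym (ε-left x))))) ∷ [])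
           ∷ ((λ eq → x≢ε (cancelˡ c (trans (sym eq) (sym (ε-right c))))) ∷ []) ∷ [] ∷ [])
          (⟨⟩⁺ 0 ∷ gen∈⟨⟩ x ∷ c⟨x⟩ ∷ ·∈ (⟨⟩-sub x) c⟨x⟩ (gen∈⟨⟩ x) ∷ [])

      five-cosets : ∀ L → AllPairs (Apart H) L → length L ≤ 4
      five-cosets L ap = *-cancelʳ-≤ (length L) 4 (# H) {{>-nonZero (1≤#H H-sub)}}
        (≤-trans (cosets-≤ H-sub full L ap (All.tabulate (λ _ _ _ → ∈-full))) (≤-trans (≤-reflexive #-full) order-≤))

      HBlock : ℕ → List E → Set
      HBlock n R = ∃[ U ] ∃[ W ] (R ↭ U ++ W × 0 < length U × length U ≤ n × ∏ U ∈ H)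

      -- Squares lie in `H`, so two terms in the same coset of `H` multiply into `H`.
      find-pair : ∀ R → HBlock 2 R ⊎ AllPairs (Apart H) (ε ∷ R)
      find-pair [] = inj₂ ([] ∷ [])
      find-pair (r ∷ R) with find-pair R
      ... | inj₁ (U , W , p , ne , le , m) = inj₁ (U , r ∷ W , ↭-trans (prep r p) (↭-sym (shift r U W)) , ne , le , m)
      ... | inj₂ (out ∷ ap) with r ∈? H
      ...   | yes r∈ = inj₁ (r ∷ [] , R , ↭-refl , s≤s z≤n , s≤s z≤n , subst (_∈ H) (sym (ε-right r)) r∈)
      ...   | no r∉ with Any.any? (λ s → (r ⁻ · s) ∈? H) R
      ...     | no none = inj₂ (((λ p → r∉ (subst (_∈ H) (word (r ∷ []) (𝟙 ⁱ • v0) v0 refl) p)) ∷ out) ∷ Allₚ.¬Any⇒All¬ R none ∷ ap)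
      ...     | yes found with extract found
      ...       | s , R′ , p , R↭ = inj₁ (r ∷ s ∷ [] , R′ , prep r R↭ , s≤s z≤n , ≤-refl
                , subst (_∈ H) (word (r ∷ s ∷ []) (v0 • v0 • (v0 ⁱ • v1)) (v0 • (v1 • 𝟙)) refl) (·∈ H-sub (square r) p))

      tiny-block : ∀ R → 4 ≤ length R → HBlock 2 R
      tiny-block R long with find-pair R
      ... | inj₁ b = b
      ... | inj₂ ap = ⊥-elim (<⇒≱ (s≤s long) (five-cosets (ε ∷ R) ap))

      small-block : ∀ R → 3 ≤ length R → HBlock 3 R
      small-block (_ ∷ []) (s≤s ())
      small-block (_ ∷ _ ∷ []) (s≤s (s≤s ()))
      small-block R@(r ∷ s ∷ w ∷ R′) _ with find-pair (r ∷ s ∷ w ∷ R′)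
      ... | inj₁ (U , W , p , ne , le , m) = U , W , p , ne , m≤n⇒m≤1+n le , m
      -- The quotient by `H` is a Klein four group, in which the product of the three nontrivial
      -- elements is trivial.
      ... | inj₂ ((r₀ ∷ s₀ ∷ w₀ ∷ _) ∷ (rs ∷ rw ∷ _) ∷ (sw ∷ _) ∷ _) = r ∷ s ∷ w ∷ [] , R′ , ↭-refl , s≤s z≤n , ≤-refl
            , subst (_∈ H) (trans (word (w ∷ r · s ∷ []) (v0 • v0 • (v0 ⁱ • v1)) (v0 • v1) refl) w~) (·∈ H-sub (square w) in-H)
        where
        in-H : w ⁻ · (r · s) ∈ H
        in-H = decidable-stable ((w ⁻ · (r · s)) ∈? H) λ n → <⇒≱ ≤-refl (five-cosets (ε ∷ r ∷ s ∷ w ∷ r · s ∷ [])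
          ((r₀ ∷ s₀ ∷ w₀ ∷ (λ p → rs (subst (_∈ H) (word (r ∷ s ∷ []) ((v0 • v0) ⁱ • (𝟙 ⁱ • (v0 • v1))) (v0 ⁱ • v1) refl) (·∈ H-sub (⁻∈ H-sub (square r)) p))) ∷ [])
           ∷ (rs ∷ rw ∷ (λ p → s₀ (subst (_∈ H) (word (r ∷ s ∷ []) (v0 ⁱ • (v0 • v1)) (𝟙 ⁱ • v1) refl) p)) ∷ [])
           ∷ (sw ∷ (λ p → r₀ (subst (_∈ H) (word (r ∷ s ∷ []) (v1 • (v1 ⁱ • (v0 • v1)) • v1 ⁱ) (𝟙 ⁱ • v0) refl) (H-normal s p))) ∷ [])
           ∷ (n ∷ []) ∷ [] ∷ []))
        w~ : w · (r · s) ≡ ∏ (r ∷ s ∷ w ∷ [])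
        w~ = trans (word (w ∷ r · s ∷ []) (v0 • v1) (v0 • (v0 • (v0 ⁱ • v1))) refl) (trans (cong (w ·_) (sym (H-central in-H w)))
          (word (w ∷ r ∷ s ∷ []) (v0 • (v0 ⁱ • (v1 • v2) • v0)) (v1 • (v2 • (v0 • 𝟙))) refl))

      -- Two disjoint blocks with product c cancel.
      not-free : ∀ R → 5 ≤ length R → ¬ Free R
      not-free R long free =
        let (U , W , p , ne , le , m) = tiny-block R (≤-trans (n≤1+n 4) long)
            (U′ , W′ , p′ , ne′ , _ , m′) = small-block W (+-cancelˡ-≤ 2 3 (length W) (≤-trans long (≤-trans (≤-reflexive (trans (↭-length p) (length-++ U))) (+-monoˡ-≤ (length W) le))))
        in combine U U′ W W′ p p′ ne ne′ (∈⁻ H? m) (∈⁻ H? m′)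
        where
        combine : ∀ U U′ W W′ → R ↭ U ++ W → W ↭ U′ ++ W′ → 0 < length U → 0 < length U′ → ∏ U ≡ ε ⊎ ∏ U ≡ c → ∏ U′ ≡ ε ⊎ ∏ U′ ≡ c → ⊥
        combine U U′ W W′ p p′ ne ne′ (inj₁ e₁) _ = free U W p (nonempty-length ne) (U , ↭-refl , e₁)
        combine U U′ W W′ p p′ ne ne′ (inj₂ _) (inj₁ e₂) = free U′ (U ++ W′) (↭-trans p (↭-trans (++⁺ˡ U p′) (shifts U U′))) (nonempty-length ne′) (U′ , ↭-refl , e₂)
        combine U U′ W W′ p p′ ne ne′ (inj₂ e₁) (inj₂ e₂) = free (U ++ U′) W′ (↭-trans p (↭-trans (++⁺ˡ U p′) (↭-reflexive (sym (++-assoc U U′ W′)))))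
          (nonempty-length (≤-trans ne (≤-trans (m≤m+n _ _) (≤-reflexive (sym (length-++ U)))))) (U ++ U′ , ↭-refl , trans (∏-++ U U′) (trans (cong₂ _·_ e₁ e₂) cc))

      7≤ : 7 ≤ length S
      7≤ = ≰⇒> λ le → <⇒≱ long (≤-trans (*-monoʳ-≤ 4 le) (*-monoʳ-≤ 3 8≤order))

      T₀ = proj₁ (proj₁ (proj₂ minimal))
      T₀↭ : T₀ ↭ S
      T₀↭ = proj₁ (proj₂ (proj₁ (proj₂ minimal)))
      ∏T₀ : ∏ T₀ ≡ ε
      ∏T₀ = proj₂ (proj₂ (proj₁ (proj₂ minimal)))

      -- `u · v` and `v · u` differ by `c`, so the pair alone realises a whole coset of `H`. The
      -- other terms, at least five, would then be product-one free.
      with-pair : ∀ {u v R} → S ↭ u ∷ v ∷ R → ¬ Comm u v → ⊥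
      with-pair {u} {v} {R} S↭ nc = not-free R (+-cancelˡ-≤ 2 5 (length R) (≤-trans 7≤ (≤-reflexive (↭-length S↭)))) λ U W R↭ U≠[] (U′ , U′↭ , U′ε) →
          let S↭U : S ↭ U ++ (u ∷ v ∷ W)
              S↭U = ↭-trans S↭ (↭-trans (prep u (prep v R↭)) (shifts (u ∷ v ∷ []) U))
              V∈ : ∏ (u ∷ v ∷ W) ∈ H
              V∈ = subst (_∈ H) (trans (cong₂ (λ p r → (p · r ⁻) ⁻) ∏T₀ (trans (∏-++ U′ (u ∷ v ∷ W)) (cong (_· ∏ (u ∷ v ∷ W)) U′ε)))
                     (word (∏ (u ∷ v ∷ W) ∷ []) ((𝟙 • (𝟙 • v0) ⁱ) ⁱ) v0 refl)) (⁻∈ H-sub (∏-↭-mod (↭-trans T₀↭ (↭-trans S↭U (++⁺ʳ (u ∷ v ∷ W) (↭-sym U′↭))))))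
          in proj₂ (proj₂ minimal) (U , u ∷ v ∷ W , S↭U , U≠[] , (λ ()) , (U′ , U′↭ , U′ε) , arrange W (∈⁻ H? V∈))
        where
        vu≡c : v · u · (u · v) ⁻ ≡ c
        vu≡c = [ (λ eq → ⊥-elim (nc (sym (cancelʳ ((u · v) ⁻) (trans eq (sym (⁻-right (u · v)))))))) , id ]′ (∈⁻ H? (commutator v u))
        arrange : ∀ W → ∏ (u ∷ v ∷ W) ≡ ε ⊎ ∏ (u ∷ v ∷ W) ≡ c → ProductOne G (u ∷ v ∷ W)
        arrange W (inj₁ eq) = u ∷ v ∷ W , ↭-refl , eq
        arrange W (inj₂ eq) = v ∷ u ∷ W , swap v u ↭-refl , trans (word (u ∷ v ∷ ∏ W ∷ []) (v1 • (v0 • v2)) (v1 • v0 • (v0 • v1) ⁱ • (v0 • (v1 • v2))) refl) (trans (cong₂ _·_ vu≡c eq) cc)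

      all-commute : (∀ {u v} → Any (u ≡_) S → Any (v ≡_) S → Comm u v) → ⊥
      all-commute com = go S refl
        where
        go : ∀ S′ → S ≡ S′ → ⊥
        go [] refl = <⇒≱ 7≤ z≤n
        go (s ∷ R) refl = not-free R (≤-trans (n≤1+n 5) (≤-pred 7≤)) λ U W R↭ U≠[] (U′ , U′↭ , U′ε) →
          let S↭U : S ↭ U′ ++ (s ∷ W)
              S↭U = ↭-trans (prep s R↭) (↭-trans (↭-sym (shift s U W)) (++⁺ʳ (s ∷ W) (↭-sym U′↭)))
          in proj₂ (proj₂ minimal) (U , s ∷ W , ↭-trans S↭U (++⁺ʳ (s ∷ W) U′↭) , U≠[] , (λ ()) , (U′ , U′↭ , U′ε)
               , (s ∷ W , ↭-refl , trans (sym (ε-left _)) (trans (cong (_· ∏ (s ∷ W)) (sym U′ε)) (trans (sym (∏-++ U′ (s ∷ W)))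
                   (trans (sym (commuting-∏ com (All.tabulate id) S↭U)) (trans (commuting-∏ com (All.tabulate id) (↭-sym T₀↭)) ∏T₀))))))

    quaternion-absurd : ⊥
    quaternion-absurd with Any.any? (λ u → Any.any? (λ v → ¬? (comm? u v)) S) S
    ... | no none = all-commute λ {u} {v} u∈ v∈ → decidable-stable (comm? u v) λ n → none (Any.map (λ { refl → Any.map (λ { refl → n }) v∈ }) u∈)
    ... | yes found with extract found
    ...   | u , R , f , S↭ = pick (Any-resp-↭ S↭ f)
      where
      pick : Any (λ v → ¬ Comm u v) (u ∷ R) → ⊥
      pick (here n) = n refl
      pick (there i) = let (v , R′ , n , R↭) = extract i in with-pair (↭-trans S↭ (prep u R↭)) n

-- The abelian case

indicator-yes : ∀ {n} {X : BSet n} {i} → i ∈ X → indicator (X i) ≡ 1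
indicator-yes {X = X} {i} (mem t) with X i
... | true = refl

indicator-no : ∀ {n} {X : BSet n} {i} → i ∉ X → indicator (X i) ≡ 0
indicator-no {X = X} {i} n with X i | (λ t → n (mem t))
... | true  | n′ = ⊥-elim (n′ tt)
... | false | _  = refl

count-mono : ∀ {A : Set} {P Q : A → Set} (P? : ∀ x → Dec (P x)) (Q? : ∀ x → Dec (Q x)) → (∀ {x} → P x → Q x) → ∀ xs → count P? xs ≤ count Q? xs
count-mono P? Q? f [] = z≤n
count-mono P? Q? f (x ∷ xs) with P? x | Q? x
... | no _  | yes _ = m≤n⇒m≤1+n (count-mono P? Q? f xs)
... | no _  | no _  = count-mono P? Q? f xs
... | yes _ | yes _ = s≤s (count-mono P? Q? f xs)
... | yes p | no ¬q = ⊥-elim (¬q (f p))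

maximum : ∀ {n} (f : Fin n → ℕ) → Fin n → ∃[ i ] (∀ j → f j ≤ f i)
maximum {suc zero} f _ = zero , λ { zero → ≤-refl }
maximum {suc (suc n)} f _ with maximum (f ∘ suc) zero
... | i , max with ≤-total (f zero) (f (suc i))
...   | inj₁ le = suc i , λ { zero → le ; (suc j) → max j }
...   | inj₂ ge = zero , λ { zero → ≤-refl ; (suc j) → ≤-trans (max j) ge }

module ElementaryBound (G : FinGroup) {S : List (Elt G)} (minimal : MinimalProductOne G S) (long : 3 * FinGroup.order G < 4 * length S)
  (abelian : ∀ x y → Group.Comm G x y) where

  open Commutators G

  private
    T₀ = proj₁ (proj₁ (proj₂ minimal))
    T₀↭ : T₀ ↭ S
    T₀↭ = proj₁ (proj₂ (proj₁ (proj₂ minimal)))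
    ∏T₀ : ∏ T₀ ≡ ε
    ∏T₀ = proj₂ (proj₂ (proj₁ (proj₂ minimal)))

    ∏-↭ : ∀ {L L′} → L ↭ L′ → ∏ L ≡ ∏ L′
    ∏-↭ {L} = commuting-∏ {Q = λ _ → E} (λ {x} {y} _ _ → abelian x y) (All.tabulate {xs = L} (λ {x} _ → x))

    ∏S : ∏ S ≡ ε
    ∏S = trans (∏-↭ (↭-sym T₀↭)) ∏T₀

    ∏-split : ∀ {U V} → S ↭ U ++ V → ∏ U ≡ ε → ∏ V ≡ ε
    ∏-split {U} {V} p u = trans (sym (ε-left _)) (trans (cong (_· ∏ V) (sym u)) (trans (sym (∏-++ U V)) (trans (∏-↭ (↭-sym p)) ∏S)))

    no-split : ∀ U V → S ↭ U ++ V → 0 < length U → 0 < length V → ∏ U ≢ ε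
    no-split U V p neU neV u = proj₂ (proj₂ minimal) (U , V , p , nonempty-length neU , nonempty-length neV , (U , ↭-refl , u) , (V , ↭-refl , ∏-split {U} {V} p u))

  GoodIn : BSet order → List E → Set
  GoodIn H U = 0 < length U × ∏ U ∈ H

  -- More than `# H` blocks would leave at least `# H` after setting one aside, and some of their
  -- products would multiply to `ε`. The block set aside keeps the complement nonempty.
  blocks-bound : ∀ {H} → IsSub H → ∀ Is → S ↭ concat Is → All (GoodIn H) Is → length Is ≤ # H
  blocks-bound sub [] _ _ = z≤n
  blocks-bound {H} sub (I ∷ Is) S↭ ((I≠[] , _) ∷ good) = ≰⇒> λ le → contradict (block-exists trivial-sub sub (λ h h∈ → subst (_∈ H) (sym (∈⁻ (_≟ ε) h∈)) (ε∈ sub)) {map ∏ Is}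
      (Allₚ.map⁺ (All.map proj₂ good)) (≤-trans le (≤-reflexive (sym (trans (cong₂ _*_ (length-map ∏ Is) #-trivial) (*-identityʳ _))))))
    where
    contradict : ¬ Block trivial-sub (map ∏ Is)
    contradict record { pre = pre ; body = body ; post = post ; split = eq ; nonempty = ne ; product = p } =
      let (Bp , Bs , eq₁ , _ , eq₂) = map-split ∏ Is pre (body ++ post) eq
          (Bb , Bq , eq₃ , eq₄ , _) = map-split ∏ Bs body post eq₂
          Is≡ : Is ≡ Bp ++ (Bb ++ Bq)
          Is≡ = trans eq₁ (cong (Bp ++_) eq₃)
      in no-split (concat Bb) (I ++ (concat Bp ++ concat Bq))
           (↭-trans S↭ (↭-trans (↭-reflexive (cong (I ++_) (trans (cong concat Is≡) (trans (sym (concat-++ Bp (Bb ++ Bq))) (cong (concat Bp ++_) (sym (concat-++ Bb Bq)))))))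
             (↭-trans (++⁺ˡ I (shifts (concat Bp) (concat Bb))) (shifts I (concat Bb)))))
           (U≠[] Bb (subst (λ b → 0 < length b) (sym eq₄) ne) (Allₚ.++⁻ˡ Bb (Allₚ.++⁻ʳ Bp (subst (All (GoodIn H)) Is≡ good))))
           (≤-trans I≠[] (≤-trans (m≤m+n _ _) (≤-reflexive (sym (length-++ I)))))
           (trans (∏-concat Bb) (trans (cong ∏ eq₄) (∈⁻ (_≟ ε) p)))
      where
      U≠[] : ∀ Bb → 0 < length (map ∏ Bb) → All (GoodIn H) Bb → 0 < length (concat Bb)
      U≠[] ((_ ∷ _) ∷ _) _ _ = s≤s z≤n
      U≠[] ([] ∷ _) _ ((() , _) ∷ _)

  module _ {p : ℕ} (pr : Prime p) {x y : E} (xp : x ^ p ≡ ε) (yp : y ^ p ≡ ε) (y≢ε : y ≢ ε) (x∉ : x ∉ ⟨ y ⟩) (gen : ∀ g → Product y x g) where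

    private
      p≢0 : NonZero p
      p≢0 = >-nonZero (≤-trans (s≤s z≤n) (prime-≥2 pr))

      order-p² : order ≡ p * p
      order-p² = trans (cyclic-index (⟨⟩-sub y) x p
          (λ i 0<i i<p r → x∉ (prime-root {k = i} (⟨⟩-sub y) pr (subst (_∈ ⟨ y ⟩) (sym xp) (⟨⟩⁺ 0)) (λ dv → <⇒≱ i<p (∣⇒≤ {{>-nonZero 0<i}} dv)) r)) cover)
        (cong (p *_) (#⟨⟩ (prime-order pr yp y≢ε)))
        where
        cover : ∀ g → ∃[ j ] (j < p × (x ^ j) ⁻ · g ∈ ⟨ y ⟩)
        cover g with gen g
        ... | i , j , refl = r , m%n<n j p {{p≢0}} , subst (_∈ ⟨ y ⟩) (sym (trans (cong (λ w → (x ^ r) ⁻ · (y ^ i · w)) x^j)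
              (trans (cong ((x ^ r) ⁻ ·_) (abelian _ _)) (word (x ^ r ∷ y ^ i ∷ []) (v0 ⁱ • (v0 • v1)) v1 refl)))) (⟨⟩⁺ i)
          where
          r = _%_ j p {{p≢0}}
          x^j : x ^ j ≡ x ^ r
          x^j = HasOrder.^-% (prime-order pr xp (λ { refl → x∉ (⟨⟩⁺ 0) })) {{p≢0}} j

      exponent : ∀ g → g ^ p ≡ ε
      exponent g with gen g
      ... | i , j , refl = trans (^-· (abelian _ _) p) (trans (cong₂ _·_ (trans (^-swap y i p) (trans (cong (_^ i) yp) (ε-^ i))) (trans (^-swap x j p) (trans (cong (_^ j) xp) (ε-^ j)))) (ε-left ε))

      #line : ∀ {h} → h ≢ ε → # ⟨ h ⟩ ≡ p
      #line {h} h≢ε = #⟨⟩ (prime-order pr (exponent h) h≢ε)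

      r = pred p
      p≡ : p ≡ suc r
      p≡ = sym (suc-pred p {{p≢0}})

      long-p : 3 * (p * p) < 4 * length S
      long-p = subst (λ n → 3 * n < 4 * length S) order-p² long

      2≤L : 2 ≤ length S
      2≤L = ≰⇒> λ le → <⇒≱ long-p (≤-trans (*-monoʳ-≤ 4 le) (≤-trans (≤-slack {4} {12} 8 refl) (*-monoʳ-≤ 3 (*-mono-≤ (prime-≥2 pr) (prime-≥2 pr)))))

      no-ε : All (_≢ ε) S
      no-ε = Allₚ.¬Any⇒All¬ S λ has → let (s , R , s≡ε , S↭) = extract has in
        no-split (s ∷ []) R S↭ (s≤s z≤n) (≤-pred (≤-trans 2≤L (≤-reflexive (↭-length S↭)))) (trans (ε-right s) s≡ε)

      -- A line, that is a subgroup of order `p`, is represented by each of its p - 1 generators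
      -- `h`; counting all of them avoids a choice of representatives.
      On? : ∀ h s → Dec (h ≢ ε × s ∈ ⟨ h ⟩)
      On? h s = ¬? (h ≟ ε) ×-dec (s ∈? ⟨ h ⟩)

      total : ∀ L → All (_≢ ε) L → length L * r ≤ sum (λ h → count (On? h) L)
      total [] [] = z≤n
      total (s ∷ L) (s≢ε ∷ ne) = ≤-trans (+-mono-≤ lines (total L ne)) (≤-reflexive (sym (∑-distrib-+ (λ h → indicator ⌊ On? h s ⌋) (λ h → count (On? h) L))))
        where
        lines : r ≤ sum (λ h → indicator ⌊ On? h s ⌋)
        lines = ≤-trans (+-cancelˡ-≤ 1 _ _ (≤-trans (≤-reflexive (trans (sym p≡) (sym (#line s≢ε)))) (≤-trans (cover-≤ {X = trivial} {⟨ s ⟩ ∖ trivial} {⟨ s ⟩} (λ h h∈ → case h ∈? trivial of λ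
              { (yes q) → inj₁ q ; (no q) → inj₂ (∖⁺ {X = ⟨ s ⟩} {trivial} (h∈ , q)) })) (≤-reflexive (cong (_+ # (⟨ s ⟩ ∖ trivial)) #-trivial)))))
          (≤-trans (#-mono {X = ⟨ s ⟩ ∖ trivial} {set (λ h → On? h s)} (λ h h∈ → let (h∈s , h∉) = ∖⁻ {X = ⟨ s ⟩} {trivial} h∈ ; h≢ε = λ eq → h∉ (∈⁺ (_≟ ε) eq) in
              ∈⁺ (λ h → On? h s) (h≢ε , prime-generates pr (exponent s) h∈s h≢ε))) (≤-reflexive (#-sum (set (λ h → On? h s)))))

      -- Averaging: each term lies on the line of `h` for p - 1 of the p² - 1 nontrivial `h`, so
      -- some line carries at least the fraction 1 / (p + 1) of `S`.
      rich-line : ∃[ h ] (length S ≤ count (On? h) S * suc p)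
      rich-line with any? (λ h → length S ≤? count (On? h) S * suc p)
      ... | yes q = q
      ... | no none = ⊥-elim (<⇒≱ (s≤s (≤-refl {length S * # Y})) (≤-trans (+-monoˡ-≤ (length S * # Y) 1≤Y) upper))
        where
        Y? : ∀ h → Dec (h ≢ ε)
        Y? h = ¬? (h ≟ ε)
        Y : BSet order
        Y = set Y?
        #Y : suc (# Y) ≡ p * p
        #Y = trans (cong (_+ # Y) (sym #-trivial)) (trans (sym (#-disjoint trivial Y (λ i q q′ → ∈⁻ Y? q′ (∈⁻ (_≟ ε) q))))
          (trans (≤-antisym (#≤n _) (≤-trans (≤-reflexive (sym #-full)) (#-mono {X = full} {trivial ∪ Y} λ i _ → ∪⁺ {X = trivial} {Y} (case i ≟ ε of λ
            { (yes q) → inj₁ (∈⁺ (_≟ ε) q) ; (no q) → inj₂ (∈⁺ Y? q) })))) order-p²))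
        1≤Y : 1 ≤ # Y
        1≤Y = 1≤# {i = y} (∈⁺ Y? y≢ε)
        pointwise : ∀ h → indicator (Y h) + suc p * count (On? h) S ≤ length S * indicator (Y h)
        pointwise h = case h ≟ ε of λ
          { (yes refl) → ≤-trans (≤-reflexive (trans (cong (_+ suc p * count (On? ε) S) (indicator-no {X = Y} {ε} (λ q → ∈⁻ Y? q refl)))
              (trans (cong (suc p *_) (count-none (On? ε) (All.tabulate {xs = S} (λ _ q → proj₁ q refl)))) (*-zeroʳ (suc p))))) z≤n
          ; (no ne) → ≤-trans (+-mono-≤ (≤-reflexive (indicator-yes {X = Y} (∈⁺ Y? ne))) (≤-reflexive (*-comm (suc p) (count (On? h) S))))
              (≤-trans (≰⇒> λ le → none (h , le)) (≤-reflexive (sym (trans (cong (length S *_) (indicator-yes {X = Y} (∈⁺ Y? ne))) (*-identityʳ _))))) }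
        upper : # Y + length S * # Y ≤ length S * # Y
        upper = ≤-trans (+-monoʳ-≤ (# Y) lower) (≤-trans (≤-reflexive (trans (cong₂ _+_ (#-sum Y) (sym (sum-scale (suc p) (λ h → count (On? h) S))))
            (sym (∑-distrib-+ (indicator ∘ Y) (λ h → suc p * count (On? h) S)))))
          (≤-trans (sum-mono pointwise) (≤-reflexive (trans (sum-scale (length S) (indicator ∘ Y)) (cong (length S *_) (sym (#-sum Y)))))))
          where
          lower : length S * # Y ≤ suc p * sum (λ h → count (On? h) S)
          lower = ≤-trans (≤-reflexive (trans (cong (length S *_) (cong pred (trans #Y (cong (λ p → p * p) p≡)))) (trans (l (length S) r) (cong (λ p → suc p * (length S * r)) (sym p≡))))) (*-monoʳ-≤ (suc p) (total S no-ε))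
            where
            l : ∀ L r → L * (r + r * suc r) ≡ suc (suc r) * (L * r)
            l = solve-∀

      module _ {h : E} (h≢ε : h ≢ ε) where

        H = ⟨ h ⟩

        gather : ∀ R → Acc _<_ (length R) → ∃[ Is ] ∃[ R′ ] (R ↭ concat Is ++ R′ × All (GoodIn H) Is × length R ≤ p * length Is + length R′ × length R′ < p)
        gather R (acc rec) with p ≤? length R
        ... | no small = [] , R , ↭-refl , [] , ≤-reflexive (cong (_+ length R) (sym (*-zeroʳ p))) , ≰⇒> small
        ... | yes big = extend (block-exists (⟨⟩-sub h) full-sub (λ _ _ → ∈-full) {R} (All.tabulate λ _ → ∈-full)
                (≤-trans (≤-reflexive (trans #-full order-p²)) (≤-trans (*-monoˡ-≤ p big) (≤-reflexive (cong (length R *_) (sym (#line h≢ε)))))))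
          where
          extend : Block (⟨⟩-sub h) R → ∃[ Is ] ∃[ R′ ] (R ↭ concat Is ++ R′ × All (GoodIn H) Is × length R ≤ p * length Is + length R′ × length R′ < p)
          extend b = let (Is , R′ , perm , good , le , lt) = gather (pre ++ post) (rec shorter) in
              body ∷ Is , R′ , ↭-trans (↭-reflexive split) (↭-trans (shifts pre body) (↭-trans (++⁺ˡ body perm) (↭-reflexive (sym (++-assoc body (concat Is) R′)))))
            , (nonempty , product) ∷ good
            , ≤-trans (≤-reflexive lengths) (≤-trans (+-mono-≤ body≤p le) (≤-reflexive (trans (sym (+-assoc p (p * length Is) (length R′))) (cong (_+ length R′) (sym (*-suc p (length Is))))))) , lt
            where
            open Block b
            lengths : length R ≡ length body + length (pre ++ post)
            lengths = trans (cong length split) (trans (↭-length (shifts pre body {post})) (length-++ body))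
            shorter : length (pre ++ post) < length R
            shorter = ≤-trans (+-monoˡ-≤ (length (pre ++ post)) nonempty) (≤-reflexive (sym lengths))
            body≤p : length body ≤ p
            body≤p = *-cancelʳ-≤ (length body) p p {{p≢0}} (≤-trans (≤-reflexive (cong (length body *_) (sym (#line h≢ε))))
              (≤-trans (block-length (⟨⟩-sub h) full-sub (λ _ _ → ∈-full) {R} (All.tabulate λ _ → ∈-full) b) (≤-reflexive (trans #-full order-p²))))

        singletons : List E → List (List E)
        singletons = map (_∷ [])

        concat-singletons : ∀ L → concat (singletons L) ≡ L
        concat-singletons []      = refl
        concat-singletons (x ∷ L) = cong (x ∷_) (concat-singletons L)

        -- Terms on the line are blocks by themselves and the others are packed into blocks of at
        -- most `p` terms. There are at most `p` blocks in all, so many terms on the line make `S`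
        -- short, while `rich` forces many of them.
        line-absurd : length S ≤ count (_∈? H) S * suc p → ⊥
        line-absurd rich = let (Hs , Rs , S↭ , Hs∈ , _ , lenH) = separate (_∈? H) S
                               (Is , R′ , Rs↭ , good , le , lt) = gather Rs (<-wellFounded (length Rs)) in
            finish Hs Rs S↭ Hs∈ lenH Is R′ Rs↭ good le lt
          where
          finish : ∀ Hs Rs → S ↭ Hs ++ Rs → All (_∈ H) Hs → length Hs ≡ count (_∈? H) S → ∀ Is R′ → Rs ↭ concat Is ++ R′ → All (GoodIn H) Is →
            length Rs ≤ p * length Is + length R′ → length R′ < p → ⊥
          finish Hs Rs S↭ Hs∈ lenH Is R′ Rs↭ good le lt = by-rest R′ refl
            where
            Base = singletons Hs ++ Is
            base-good : All (GoodIn H) Base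
            base-good = Allₚ.++⁺ (Allₚ.map⁺ (All.map (λ {s} s∈ → s≤s z≤n , subst (_∈ H) (sym (ε-right s)) s∈) Hs∈)) good
            S↭Base : S ↭ concat Base ++ R′
            S↭Base = ↭-trans S↭ (↭-trans (++⁺ˡ Hs Rs↭) (↭-reflexive (trans (sym (++-assoc Hs (concat Is) R′)) (cong (_++ R′) (trans (cong (_++ concat Is) (sym (concat-singletons Hs))) (concat-++ (singletons Hs) Is))))))
            length-Base : length Base ≡ length Hs + length Is
            length-Base = trans (length-++ (singletons Hs)) (cong (_+ length Is) (length-map (_∷ []) Hs))
            R′∈ : ∏ R′ ∈ H
            R′∈ = cancelˡ∈ (⟨⟩-sub h) (subst (_∈ H) (sym (∏-concat Base)) (∏∈ (⟨⟩-sub h) (Allₚ.map⁺ (All.map proj₂ base-good))))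
              (subst (_∈ H) (trans (sym (trans (∏-↭ (↭-sym S↭Base)) ∏S)) (∏-++ (concat Base) R′)) (ε∈ (⟨⟩-sub h)))
            L≤ : length S ≤ length Hs + (p * length Is + length R′)
            L≤ = ≤-trans (≤-reflexive (trans (↭-length S↭) (length-++ Hs))) (+-monoʳ-≤ (length Hs) le)
            conclude : ∀ k → length S ≤ length Hs + p * k → length Hs + k ≤ p → ⊥
            conclude k L≤ fits = square-order r (length S) (length Hs) k (≤-pred (subst (2 ≤_) p≡ (prime-≥2 pr)))
              (subst (λ p → 3 * (p * p) < 4 * length S) p≡ long-p) (subst (λ p → length S ≤ length Hs + p * k) p≡ L≤) (subst (length Hs + k ≤_) p≡ fits)
              (≤-trans rich (≤-reflexive (cong₂ _*_ (sym lenH) (cong suc p≡))))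
            by-rest : ∀ R″ → R″ ≡ R′ → ⊥
            by-rest [] refl = conclude (length Is) (≤-trans L≤ (≤-reflexive (cong (length Hs +_) (+-identityʳ _))))
              (≤-trans (≤-reflexive (sym length-Base)) (≤-trans (blocks-bound (⟨⟩-sub h) Base (↭-trans S↭Base (↭-reflexive (++-identityʳ _))) base-good) (≤-reflexive (#line h≢ε))))
            -- The leftover terms form one more block: their product lies in `H` because those of
            -- `S` and of all other blocks do.
            by-rest (z ∷ R″) refl = conclude (suc (length Is)) (≤-trans L≤ (+-monoʳ-≤ (length Hs) (≤-trans (+-monoʳ-≤ (p * length Is) (<⇒≤ lt)) (≤-reflexive (trans (+-comm _ p) (sym (*-suc p (length Is))))))))
              (≤-trans (≤-reflexive (trans (+-suc (length Hs) (length Is)) (cong suc (sym length-Base)))) (≤-trans (blocks-bound (⟨⟩-sub h) (R′ ∷ Base) (↭-trans S↭Base (++-comm (concat Base) R′)) ((s≤s z≤n , R′∈) ∷ base-good)) (≤-reflexive (#line h≢ε))))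

    elementary-absurd : ⊥
    elementary-absurd = let (h , rich) = rich-line in on-line h rich
      where
      weaken : ∀ h L → count (On? h) L ≤ count (_∈? ⟨ h ⟩) L
      weaken h L = count-mono (On? h) (_∈? ⟨ h ⟩) proj₂ L
      on-line : ∀ h → length S ≤ count (On? h) S * suc p → ⊥
      on-line h rich = case h ≟ ε of λ
        { (yes h≡ε) → <⇒≱ 2≤L (≤-trans rich (≤-trans (≤-reflexive (cong (_* suc p) (count-none (On? h) (All.tabulate {xs = S} (λ _ q → proj₁ q h≡ε))))) z≤n))
        ; (no h≢ε) → line-absurd h≢ε (≤-trans rich (*-monoˡ-≤ (suc p) (weaken h S))) }

module AbelianBound (G : FinGroup)
  (proper : ∀ {H} → Subgroups.IsSub G H → ∀ {g} → g ∉ H → DN (Shapes.Cyc G H ⊎ Shapes.ODih G H))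
  (not-cyclic : ¬ IsCyclic G) (abelian : ∀ x y → Group.Comm G x y)
  {S : List (Elt G)} (minimal : MinimalProductOne G S) (long : 3 * FinGroup.order G < 4 * length S) where

  open Critical G proper
  open ElementaryBound G minimal long abelian using (elementary-absurd)

  private
    a : E
    a = proj₁ (maximum (λ g → # ⟨ g ⟩) ε)

    maximal : ∀ {g} → g ∉ ⟨ a ⟩ → a ∉ ⟨ g ⟩
    maximal {g} g∉ a∈ = <⇒≱ (#-mono-< (⟨⟩-⊆ (⟨⟩-sub g) a∈) (gen∈⟨⟩ g) g∉) (proj₂ (maximum (λ g → # ⟨ g ⟩) ε) g)

  module _ {b : E} (b∉ : b ∉ ⟨ a ⟩) {p : ℕ} (pr : Prime p) where

    -- From `t * u ≡ 1 + p * v` the element `root` satisfies `root ^ p ≡ a` and lies outside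
    -- `⟨ a ⟩`, against the maximality of `⟨ a ⟩`.
    root-coprime : ∀ {t} → a ^ t ≡ b ^ p → ¬ p ∣ t → ⊥
    root-coprime {t} a^t p∤t = let (u , v , eq) = prime-coprime pr p∤t in go u v eq
      where
      go : ∀ u v → t * u ≡ 1 + p * v → ⊥
      go u v eq = maximal root∉ (subst (_∈ ⟨ root ⟩) root^p (⟨⟩⁺ p))
        where
        root = b ^ u · (a ^ v) ⁻
        root^p : root ^ p ≡ a
        root^p = begin
          root ^ p                             ≡⟨ ^-· (abelian _ _) p ⟩
          (b ^ u) ^ p · ((a ^ v) ⁻) ^ p        ≡⟨ cong₂ _·_ (^-swap b u p) (⁻-^ (a ^ v) p) ⟩
          (b ^ p) ^ u · ((a ^ v) ^ p) ⁻        ≡⟨ cong₂ (λ w w′ → w ^ u · w′ ⁻) (sym a^t) (trans (^-swap a v p) (sym (^-* a p v))) ⟩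
          (a ^ t) ^ u · (a ^ (p * v)) ⁻        ≡⟨ cong (_· (a ^ (p * v)) ⁻) (trans (sym (^-* a t u)) (cong (a ^_) eq)) ⟩
          a · a ^ (p * v) · (a ^ (p * v)) ⁻    ≡⟨ word (a ∷ a ^ (p * v) ∷ []) (v0 • v1 • v1 ⁱ) v0 refl ⟩
          a                                    ∎
          where open ≡-Reasoning
        p∤u : ¬ p ∣ u
        p∤u (divides m refl) = <⇒≱ (prime-≥2 pr) (∣⇒≤ (∣m+n∣m⇒∣n {p} {p * v} {1} (subst (p ∣_) (trans eq (+-comm 1 (p * v))) (∣-trans (divides m refl) (n∣m*n t))) (m∣m*n v)))
        root∉ : root ∉ ⟨ a ⟩
        root∉ r = b∉ (prime-root {k = u} (⟨⟩-sub a) pr (subst (_∈ ⟨ a ⟩) a^t (⟨⟩⁺ t)) p∤u (cancelʳ∈ (⟨⟩-sub a) (⁻∈ (⟨⟩-sub a) (⟨⟩⁺ v)) r))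

    -- If `p` does not divide the order of `a`, then `a · b` generates a larger cyclic subgroup.
    -- Otherwise a power of `a` has order `p` and is independent of `b`, so the group is elementary
    -- abelian of rank two.
    killed : b ^ p ≡ ε → ⊥
    killed bp = let (ν , o) = has-order a in case p ∣? ν of λ { (no p∤ν) → coprime o (prime-coprime pr p∤ν) ; (yes p∣ν) → divisible o p∣ν }
      where
      coprime : ∀ {ν} → HasOrder a ν → ∃[ u ] ∃[ v ] ν * u ≡ 1 + p * v → ⊥
      coprime {ν} o (u , v , eq) = maximal (λ r → b∉ (cancelˡ∈ (⟨⟩-sub a) (gen∈⟨⟩ a) r)) (subst (_∈ ⟨ a · b ⟩) (sym a≡) (⁻∈ (⟨⟩-sub (a · b)) (^∈ (⟨⟩-sub (a · b)) (⟨⟩⁺ p) v)))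
        where
        ab^p : (a · b) ^ p ≡ a ^ p
        ab^p = trans (^-· (abelian a b) p) (trans (cong (a ^ p ·_) bp) (ε-right _))
        a≡ : a ≡ (((a · b) ^ p) ^ v) ⁻
        a≡ = cancelʳ ((a ^ p) ^ v) (trans (trans (cong (a ·_) (sym (^-* a p v))) (trans (cong (a ^_) (sym eq)) (HasOrder.^-∣ o (m∣m*n u))))
          (sym (trans (cong (λ w → (w ^ v) ⁻ · (a ^ p) ^ v) ab^p) (⁻-left _))))
      divisible : ∀ {ν} → HasOrder a ν → p ∣ ν → ⊥
      divisible {ν} o (divides m ν≡) = rank-two pr bp yp (abelian b y) y≢ε b∉y (elementary-absurd pr bp yp y≢ε b∉y)
        where
        y = a ^ m
        yp : y ^ p ≡ ε
        yp = trans (sym (^-* a m p)) (trans (cong (a ^_) (sym ν≡)) (HasOrder.kills o))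
        pos : ∀ m → 0 < m * p → 0 < m
        pos (suc _) _ = s≤s z≤n
        0<m : 0 < m
        0<m = pos m (subst (0 <_) ν≡ (HasOrder.positive o))
        y≢ε : y ≢ ε
        y≢ε eq = <⇒≱ (subst (m <_) (sym ν≡) (m<m*n m p {{>-nonZero 0<m}} (prime-≥2 pr))) (∣⇒≤ {{>-nonZero 0<m}} (HasOrder.divides′ o m eq))
        b∉y : b ∉ ⟨ y ⟩
        b∉y r = b∉ (⟨⟩-⊆ (⟨⟩-sub a) (⟨⟩⁺ m) b r)

  abelian-absurd : ⊥
  abelian-absurd with any? (λ g → ¬? (g ∈? ⟨ a ⟩))
  ... | no none = not-cyclic (a , λ g → ⟨⟩⁻ (decidable-stable (g ∈? ⟨ a ⟩) λ n → none (g , n)))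
  ... | yes (g , g∉) = let (k , p , pr , b∉ , bp∈) = prime-power-into (⟨⟩-sub a) g∉ in go b∉ pr bp∈
    where
    go : ∀ {b p} → b ∉ ⟨ a ⟩ → Prime p → b ^ p ∈ ⟨ a ⟩ → ⊥
    go {b} {p} b∉ pr bp∈ = let (t , a^t) = ⟨⟩⁻ bp∈ in case p ∣? t of λ
        { (no p∤t) → root-coprime b∉ pr {t} a^t p∤t ; (yes p∣t) → shift-root t a^t p∣t }
      where
      -- Dividing `b` by `a ^ m`, a p-th root of `b ^ p`, reduces to the case of trivial p-th power.
      shift-root : ∀ t → a ^ t ≡ b ^ p → p ∣ t → ⊥
      shift-root t a^t (divides m refl) = killed {b · (a ^ m) ⁻} (λ r → b∉ (cancelʳ∈ (⟨⟩-sub a) (⁻∈ (⟨⟩-sub a) (⟨⟩⁺ m)) r)) pr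
        (trans (^-· (abelian _ _) p) (trans (cong₂ _·_ (trans (sym a^t) (^-* a m p)) (⁻-^ (a ^ m) p)) (⁻-right _)))

-- Induction on the order of the group

bound : ∀ n → (∀ {m} → m < n → ∀ G → FinGroup.order G ≡ m → ¬ IsCyclic G → (∀ k → ¬ IsoDihedral G (suc (k + k))) →
    ∀ S → MinimalProductOne G S → 4 * length S ≤ 3 * FinGroup.order G) →
  ∀ G → FinGroup.order G ≡ n → ¬ IsCyclic G → (∀ k → ¬ IsoDihedral G (suc (k + k))) →
  ∀ S → MinimalProductOne G S → 4 * length S ≤ 3 * FinGroup.order G
bound n smaller G refl not-cyclic not-dihedral S minimal = ≮⇒≥ absurd
  where
  open Generation G

  -- If `H` were of neither kind, the induction hypothesis would bound the sequence that `descend`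
  -- produces over `H`, and the ratio of length to order carries the bound back to `S`.
  proper : 3 * order < 4 * length S → ∀ {H} → IsSub H → ∀ {g} → g ∉ H → DN (Cyc H ⊎ ODih H)
  proper long {H} sub {g} g∉ k = <⇒≱ long (*-cancelʳ-≤ (4 * length S) (3 * order) (# H) {{>-nonZero (1≤#H sub)}} (begin
      4 * length S * # H            ≡⟨ *-assoc 4 (length S) (# H) ⟩
      4 * (length S * # H)          ≤⟨ *-monoʳ-≤ 4 (proj₂ (proj₂ down)) ⟩
      4 * (length S′ * order)       ≡⟨ *-assoc 4 (length S′) order ⟨
      4 * length S′ * order         ≤⟨ *-monoˡ-≤ order below ⟩
      3 * # H * order               ≡⟨ exchange (# H) order ⟩
      3 * order * # H               ∎))
    where
    open ≤-Reasoning
    open Relabelling G sub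
    exchange : ∀ h n → 3 * h * n ≡ 3 * n * h
    exchange = solve-∀
    down = descend minimal
    S′ = proj₁ down
    below : 4 * length S′ ≤ 3 * # H
    below = smaller (≤-trans (#-mono-< {X = H} {full} (λ _ _ → ∈-full) ∈-full g∉) (≤-reflexive #-full)) relabel refl
      (λ cyc → k (inj₁ (Cyc-intro sub cyc))) (λ j dih → k (inj₂ (ODih-intro sub j dih))) S′ (proj₁ (proj₂ down))

  absurd : ¬ 3 * order < 4 * length S
  absurd long with any? (λ x → ¬? (x ∈? centre))
  ... | no none = AbelianBound.abelian-absurd G (proper long) not-cyclic (λ x y → centre⁻ (decidable-stable (x ∈? centre) λ n → none (x , n)) y) minimal long
  ... | yes (x , x∉) = ClassCounting.normal-cyclic G (proper long) x∉ λ nc → NonabelianBound.nonabelian-absurd G (proper long) not-dihedral nc minimal long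
        λ (xx , yy , cc , c≢ε , conj-x , gen) → QuaternionBound.quaternion-absurd G minimal long xx yy cc c≢ε conj-x gen

theorem7p2 : (G : FinGroup) → ¬ IsCyclic G →
    (∀ (k : ℕ) → ¬ IsoDihedral G (suc (k + k))) →
    ∀ S → MinimalProductOne G S →
    4 * length S ≤ 3 * FinGroup.order G
theorem7p2 G = <-rec _ bound (FinGroup.order G) G refl
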